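{- Let $n\ge 2$. If $S$ is an admissible subset of $\{r,b,g,o,y,s\}$ with $|S|=4$, then \[|J(T_n(S))|=\prod_{j=0}^{n-1}\frac{(3j+1)!}{(n+j)!}=\prod_{1\le i\le j\le k\le n-1}\frac{i+j+k+1}{i+j+k-1}.\]
   Context: Let $T_n$ be the set of triples $(c_1,c_2,c_3)$ of nonnegative integers with $c_1+c_2+c_3\le n-2$. To the colors $r,g,y,b,o,s$ associate $v_r=(1,0,0)$, $v_g=(0,1,0)$, $v_y=(0,0,1)$, $v_b=(-1,1,0)$, $v_o=(-1,0,1)$, $v_s=(0,1,-1)$. For a set $S$ of colors, $T_n(S)$ is the poset on $T_n$ whose order is the reflexive–transitive closure of $p<p+v_x$ for $x\in S$ and $p,p+v_x\in T_n$. A set $S$ of colors is admissible if: $\{r,b\}\subseteq S\Rightarrow g\in S$; $\{o,s\}\subseteq S\Rightarrow b\in S$; $\{s,y\}\subseteq S\Rightarrow g\in S$; $\{r,o\}\subseteq S\Rightarrow y\in S$. $J(P)$ is the set of order ideals (down-closed subsets, including $\emptyset$) of $P$. -}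

module Defs where

open import Data.Nat using (ℕ; zero; suc; _+_; _*_; _∸_; _≤_; _!)
open import Data.Nat.ListAction using (sum; product)
open import Data.Bool using (Bool; true; false; if_then_else_)
open import Data.Product using (Σ; _×_; _,_)
open import Data.List using (List; []; _∷_; map; upTo; length)
open import Data.List.Relation.Unary.All using (All)
open import Data.List.Relation.Unary.Any using (Any)
open import Data.List.Relation.Unary.AllPairs using (AllPairs)
open import Relation.Binary.PropositionalEquality using (_≡_)
open import Relation.Binary.Construct.Closure.ReflexiveTransitive using (Star)
open import Relation.Nullary using (¬_)

data Color : Set where
  r g y b o s : Color

allColors : List Color
allColors = r ∷ g ∷ y ∷ b ∷ o ∷ s ∷ []

ColorSet : Set
ColorSet = Color → Bool

size : ColorSet → ℕ
size S = sum (map (λ x → if S x then 1 else 0) allColors)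

_∈C_ : Color → ColorSet → Set
x ∈C S = S x ≡ true

Admissible : ColorSet → Set
Admissible S =
    (r ∈C S → b ∈C S → g ∈C S)
  × (o ∈C S → s ∈C S → b ∈C S)
  × (s ∈C S → y ∈C S → g ∈C S)
  × (r ∈C S → o ∈C S → y ∈C S)

Triple : Set
Triple = ℕ × ℕ × ℕ

InT : ℕ → Triple → Set
InT n (c₁ , c₂ , c₃) = c₁ + c₂ + c₃ ≤ n ∸ 2

Pt : ℕ → Set
Pt n = Σ Triple (InT n)

-- Move x p q  ⇔  q = p + v_x  (componentwise, in ℤ³)
Move : Color → Triple → Triple → Set
Move r (a , b' , c) (a' , b'' , c') = (a' ≡ suc a) × (b'' ≡ b') × (c' ≡ c)
Move g (a , b' , c) (a' , b'' , c') = (a' ≡ a) × (b'' ≡ suc b') × (c' ≡ c)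
Move y (a , b' , c) (a' , b'' , c') = (a' ≡ a) × (b'' ≡ b') × (c' ≡ suc c)
Move b (a , b' , c) (a' , b'' , c') = (a ≡ suc a') × (b'' ≡ suc b') × (c' ≡ c)
Move o (a , b' , c) (a' , b'' , c') = (a ≡ suc a') × (b'' ≡ b') × (c' ≡ suc c)
Move s (a , b' , c) (a' , b'' , c') = (a' ≡ a) × (b'' ≡ suc b') × (c ≡ suc c')

Cover : (n : ℕ) → ColorSet → Pt n → Pt n → Set
Cover n S (p , _) (q , _) = Σ Color (λ x → x ∈C S × Move x p q)

Le : (n : ℕ) → ColorSet → Pt n → Pt n → Set
Le n S = Star (Cover n S)

SubsetT : ℕ → Set
SubsetT n = Pt n → Bool

IsIdeal : (n : ℕ) → ColorSet → SubsetT n → Set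
IsIdeal n S I = (p q : Pt n) → Le n S p q → I q ≡ true → I p ≡ true

SameSubset : (n : ℕ) → SubsetT n → SubsetT n → Set
SameSubset n I J = (p : Pt n) → I p ≡ J p

NumIdeals : ℕ → ColorSet → ℕ → Set
NumIdeals n S N =
  Σ (List (SubsetT n)) λ L →
      (length L ≡ N)
    × All (IsIdeal n S) L
    × AllPairs (λ I J → ¬ (SameSubset n I J)) L
    × ((I : SubsetT n) → IsIdeal n S I → Any (λ J → SameSubset n J I) L)

-- the list [a, a+1, ..., b]  (empty if b < a)
range : ℕ → ℕ → List ℕ
range lo hi = map (lo +_) (upTo (suc hi ∸ lo))

prodFT : ℕ → ℕ → (ℕ → ℕ) → ℕ
prodFT lo hi f = product (map f (range lo hi))

numA : ℕ → ℕ
numA n = prodFT 0 (n ∸ 1) (λ j → (3 * j + 1) !)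

denA : ℕ → ℕ
denA n = prodFT 0 (n ∸ 1) (λ j → (n + j) !)

prodIJK : ℕ → (ℕ → ℕ) → ℕ
prodIJK n f = prodFT 1 (n ∸ 1) (λ i → prodFT i (n ∸ 1) (λ j → prodFT j (n ∸ 1) (λ k → f (i + j + k))))

numB : ℕ → ℕ
numB n = prodIJK n (λ m → m + 1)

denB : ℕ → ℕ
denB n = prodIJK n (λ m → m ∸ 1)

{-# OPTIONS --safe #-}
module Submission where

-- An order ideal is recorded by its heights in the direction of the colour g.  Permuting the
-- barycentric coordinates (c₀, c₁, c₂, c₃), where c₀ = n - 2 - c₁ - c₂ - c₃, reduces the admissible
-- sets to {g,y,b,o} and {r,g,y,b}.  With m = n - 1, both counts X satisfy X(0) = 1 and
--   X(m) (2m+1)! (2m)! = X(m-1) (3m+1)! m!,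
-- and so do the two products.
--
-- For {g,y,b,o} the heights form a monotone triangle with bottom row 0, …, m.  The number of
-- monotone triangles with bottom row k is W V (k), where V is a Vandermonde determinant and
-- W = ∏_{s<t} (1 + E_s E_t - E_s) in the shifts E (Fischer's operator formula).  Symmetric functions
-- of the differences annihilate V, whence α(v, x) = ± α(x + n, v) for α = W V.  Together with two
-- dualities of the poset this forces the coefficients of A(w) (1 - w)^(2m+1) in degrees m+1, …, 2m
-- to vanish, where A is the generating function of the triangles by the number of entries m on the
-- last diagonal; the ratio A(1) / A(0) follows by pairing with a suitable polynomial.
--
-- For {r,g,y,b} the number of arrays with given first row e is (P₁ ∧ P₂ ∧ ⋯)(e), where P_j lists the
-- coefficients of p^j, p = u (1 + u).  Summing over increasing e is a Pfaffian-like functional Φ: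
-- Φ(q ∧ f ∧ G) = ⟨q, f⟩ Φ(G) if q is orthogonal to the factors of G and their number is even.  An
-- explicit combination q of P₀, …, P_M with this orthogonality (a terminating hypergeometric sum that vanishes by the
-- Wilf–Zeilberger method) gives Φ(P₀ ∧ ⋯ ∧ P_M) in terms of Φ(P₀ ∧ ⋯ ∧ P_{M-1}).

open import Data.Nat.Base as ℕ using (ℕ; zero; suc; z≤n; s≤s)
import Data.Nat.Properties as ℕP
import Data.Integer.Properties as ℤP
open import Data.Nat.Tactic.RingSolver using () renaming (solve-∀ to solveℕ)
open import Data.Integer.Tactic.RingSolver using (solve-∀)
open import Data.Product using (Σ; _,_; proj₁; proj₂; _×_)
open import Data.Sum.Base using (_⊎_; inj₁; inj₂; [_,_]′)
open import Data.Unit.Base using (⊤; tt)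
open import Function.Base using (_∘_; id)
open import Relation.Binary.PropositionalEquality hiding ([_]; J)
open import Relation.Nullary.Decidable using (does; yes; no)
open import Relation.Nullary.Negation using (¬_; contradiction)

module ShiftOperators where
  open import Algebra.Bundles using (CommutativeRing)
  open import Data.Integer.Base using (ℤ; +_; 0ℤ; 1ℤ; -1ℤ; _+_; _*_; _-_; -_)
  open import Data.Fin.Base using (Fin; zero; suc)
  open import Data.Vec.Base using (Vec; _∷_)
  open import Level using (0ℓ)

  private variable n m : ℕ

  Fn : ℕ → Set
  Fn n = Vec ℤ n → ℤ

  infixl 6 _⊕_
  infixl 7 _⊗_
  infix 4 _≈_

  data Op (n : ℕ) : Set where
    E : Fin n → Op n
    con : ℤ → Op n
    _⊕_ _⊗_ : Op n → Op n → Op n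

  bump : Fin n → Vec ℤ n → Vec ℤ n
  bump zero (x ∷ v) = (x + 1ℤ) ∷ v
  bump (suc i) (x ∷ v) = x ∷ bump i v

  act : Op n → Fn n → Fn n
  act (E i) f v = f (bump i v)
  act (con c) f v = c * f v
  act (p ⊕ q) f v = act p f v + act q f v
  act (p ⊗ q) f v = act p (act q f) v

  record _≈_ {n} (p q : Op n) : Set where
    constructor mk
    field at : ∀ f v → act p f v ≡ act q f v
  open _≈_

  act-cong : ∀ (p : Op n) {f g : Fn n} → (∀ v → f v ≡ g v) → ∀ v → act p f v ≡ act p g v
  act-cong (E i) e v = e _
  act-cong (con c) e v = cong (c *_) (e v)
  act-cong (p ⊕ q) e v = cong₂ _+_ (act-cong p e v) (act-cong q e v)
  act-cong (p ⊗ q) e v = act-cong p (act-cong q e) v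

  +-interchange : ∀ a b c d → (a + b) + (c + d) ≡ (a + c) + (b + d)
  +-interchange = solve-∀

  act-+ : ∀ (p : Op n) (f g : Fn n) v → act p (λ u → f u + g u) v ≡ act p f v + act p g v
  act-+ (E i) f g v = refl
  act-+ (con c) f g v = ℤP.*-distribˡ-+ c (f v) (g v)
  act-+ (p ⊕ q) f g v = trans (cong₂ _+_ (act-+ p f g v) (act-+ q f g v)) (+-interchange (act p f v) (act p g v) (act q f v) (act q g v))
  act-+ (p ⊗ q) f g v = trans (act-cong p (act-+ q f g) v) (act-+ p (act q f) (act q g) v)

  act-* : ∀ (p : Op n) c (f : Fn n) v → act p (λ u → c * f u) v ≡ c * act p f v
  act-* (E i) c f v = refl
  act-* (con d) c f v = lem d c (f v)
    where lem : ∀ d c x → d * (c * x) ≡ c * (d * x)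
          lem = solve-∀
  act-* (p ⊕ q) c f v = trans (cong₂ _+_ (act-* p c f v) (act-* q c f v)) (sym (ℤP.*-distribˡ-+ c _ _))
  act-* (p ⊗ q) c f v = trans (act-cong p (act-* q c f) v) (act-* p c (act q f) v)

  act-neg : ∀ (p : Op n) (f : Fn n) v → act p (λ u → - f u) v ≡ - act p f v
  act-neg p f v = trans (act-cong p (λ u → sym (ℤP.-1*i≡-i (f u))) v) (trans (act-* p -1ℤ f v) (ℤP.-1*i≡-i _))

  act-minus : ∀ (p : Op n) (f g : Fn n) v → act p (λ u → f u - g u) v ≡ act p f v - act p g v
  act-minus p f g v = trans (act-+ p f (λ u → - g u) v) (cong (_+_ (act p f v)) (act-neg p g v))

  bump-comm : ∀ (i j : Fin n) v → bump i (bump j v) ≡ bump j (bump i v)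
  bump-comm zero zero (x ∷ v) = refl
  bump-comm zero (suc j) (x ∷ v) = refl
  bump-comm (suc i) zero (x ∷ v) = refl
  bump-comm (suc i) (suc j) (x ∷ v) = cong (x ∷_) (bump-comm i j v)

  act-E : ∀ (p : Op n) i (f : Fn n) v → act p (λ u → f (bump i u)) v ≡ act p f (bump i v)
  act-E (E j) i f v = cong f (bump-comm i j v)
  act-E (con c) i f v = refl
  act-E (p ⊕ q) i f v = cong₂ _+_ (act-E p i f v) (act-E q i f v)
  act-E (p ⊗ q) i f v = trans (act-cong p (act-E q i f) v) (act-E p i (act q f) v)

  ⊗-comm-act : ∀ (p q : Op n) f v → act p (act q f) v ≡ act q (act p f) v
  ⊗-comm-act p (E i) f v = act-E p i f v
  ⊗-comm-act p (con c) f v = act-* p c f v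
  ⊗-comm-act p (q ⊕ q') f v = trans (act-+ p (act q f) (act q' f) v) (cong₂ _+_ (⊗-comm-act p q f v) (⊗-comm-act p q' f v))
  ⊗-comm-act p (q ⊗ q') f v = trans (⊗-comm-act p q (act q' f) v) (act-cong q (⊗-comm-act p q' f) v)

  ≈-refl : {p : Op n} → p ≈ p
  ≈-refl = mk λ f v → refl

  ≈-sym : {p q : Op n} → p ≈ q → q ≈ p
  ≈-sym e = mk λ f v → sym (at e f v)

  ≈-trans : {p q r : Op n} → p ≈ q → q ≈ r → p ≈ r
  ≈-trans e e' = mk λ f v → trans (at e f v) (at e' f v)

  ⊝_ : Op n → Op n
  ⊝ p = con -1ℤ ⊗ p

  OpRing : ℕ → CommutativeRing 0ℓ 0ℓ
  OpRing n = record
    { Carrier = Op n ; _≈_ = _≈_ ; _+_ = _⊕_ ; _*_ = _⊗_ ; -_ = ⊝_ ; 0# = con 0ℤ ; 1# = con 1ℤ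
    ; isCommutativeRing = record
      { isRing = record
        { +-isAbelianGroup = record
          { isGroup = record
            { isMonoid = record
              { isSemigroup = record
                { isMagma = record { isEquivalence = record { refl = ≈-refl ; sym = ≈-sym ; trans = ≈-trans }
                                   ; ∙-cong = λ e e' → mk λ f v → cong₂ _+_ (at e f v) (at e' f v) }
                ; assoc = λ p q r → mk λ f v → ℤP.+-assoc (act p f v) (act q f v) (act r f v) }
              ; identity = (λ p → mk λ f v → ℤP.+-identityˡ (act p f v)) , (λ p → mk λ f v → ℤP.+-identityʳ (act p f v)) }
            ; inverse = (λ p → mk λ f v → inv1 (act p f v) (f v)) , (λ p → mk λ f v → inv2 (act p f v) (f v))
            ; ⁻¹-cong = λ e → mk λ f v → cong (-1ℤ *_) (at e f v) }
          ; comm = λ p q → mk λ f v → ℤP.+-comm (act p f v) (act q f v) }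
        ; *-cong = λ {p} {q} {r} {t} e e' → mk λ f v → trans (at e (act r f) v) (act-cong q (at e' f) v)
        ; *-assoc = λ p q r → mk λ _ _ → refl
        ; *-identity = (λ p → mk λ f v → ℤP.*-identityˡ (act p f v)) , (λ p → mk λ f v → act-cong p (λ u → ℤP.*-identityˡ (f u)) v)
        ; distrib = (λ p q r → mk λ f v → act-+ p (act q f) (act r f) v) , (λ p q r → mk λ _ _ → refl) }
      ; *-comm = λ p q → mk λ f v → ⊗-comm-act p q f v } }
    where
      inv1 : ∀ a x → -1ℤ * a + a ≡ 0ℤ * x
      inv1 = solve-∀
      inv2 : ∀ a x → a + -1ℤ * a ≡ 0ℤ * x
      inv2 = solve-∀

  module R {n} = CommutativeRing (OpRing n)

module OperatorProducts where
  open ShiftOperators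
  open import Data.Integer.Base using (ℤ; +_; 0ℤ; 1ℤ; -1ℤ; _+_; _*_; _-_; -_)
  open import Data.Fin.Base using (Fin; zero; suc; inject₁; fromℕ)
  open import Data.Vec.Base using (Vec; _∷_)
  open _≈_

  private variable n m k : ℕ

  ≡⇒≈ : {p q : Op n} → p ≡ q → p ≈ q
  ≡⇒≈ refl = ≈-refl

  comm⊗ : ∀ (p q : Op n) → p ⊗ q ≈ q ⊗ p
  comm⊗ = R.*-comm

  assoc⊗ : ∀ (p q c : Op n) → (p ⊗ q) ⊗ c ≈ p ⊗ (q ⊗ c)
  assoc⊗ = R.*-assoc

  cong⊗ : {p q c d : Op n} → p ≈ q → c ≈ d → p ⊗ c ≈ q ⊗ d
  cong⊗ = R.*-cong

  swap⊗ : ∀ (p q c : Op n) → p ⊗ (q ⊗ c) ≈ q ⊗ (p ⊗ c)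
  swap⊗ p q c = ≈-trans (≈-sym (assoc⊗ p q c)) (≈-trans (cong⊗ (comm⊗ p q) ≈-refl) (assoc⊗ q p c))

  interchange⊗ : ∀ (p q c d : Op n) → (p ⊗ q) ⊗ (c ⊗ d) ≈ (p ⊗ c) ⊗ (q ⊗ d)
  interchange⊗ p q c d = ≈-trans (assoc⊗ p q _) (≈-trans (cong⊗ ≈-refl (swap⊗ q c d)) (≈-sym (assoc⊗ p c _)))

  prodF : ∀ n → (Fin n → Op m) → Op m
  prodF zero g = con 1ℤ
  prodF (suc n) g = g zero ⊗ prodF n (g ∘ suc)

  prodF-cong : ∀ n {g h : Fin n → Op m} → (∀ i → g i ≈ h i) → prodF n g ≈ prodF n h
  prodF-cong zero e = ≈-refl
  prodF-cong (suc n) e = cong⊗ (e zero) (prodF-cong n (e ∘ suc))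

  prodF-last : ∀ n (g : Fin (suc n) → Op m) → prodF (suc n) g ≈ prodF n (g ∘ inject₁) ⊗ g (fromℕ n)
  prodF-last zero g = comm⊗ _ _
  prodF-last (suc n) g = ≈-trans (cong⊗ ≈-refl (prodF-last n (g ∘ suc))) (≈-sym (assoc⊗ _ _ _))

  τ : Fin (suc n) → Fin (suc (suc n)) → Fin (suc (suc n))
  τ zero zero = suc zero
  τ zero (suc zero) = zero
  τ zero (suc (suc i)) = suc (suc i)
  τ {suc n} (suc k) zero = zero
  τ {suc n} (suc k) (suc i) = suc (τ k i)

  prodF-τ : ∀ n (k : Fin (suc n)) (g : Fin (suc (suc n)) → Op m) → prodF (suc (suc n)) (g ∘ τ k) ≈ prodF (suc (suc n)) g
  prodF-τ n zero g = swap⊗ _ _ _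
  prodF-τ (suc n) (suc k) g = cong⊗ ≈-refl (prodF-τ n k (g ∘ suc))

  ren : (Fin m → Fin n) → Op m → Op n
  ren ρ (E i) = E (ρ i)
  ren ρ (con c) = con c
  ren ρ (p ⊕ q) = ren ρ p ⊕ ren ρ q
  ren ρ (p ⊗ q) = ren ρ p ⊗ ren ρ q

  ren-∘ : (ρ : Fin n → Fin k) (σ : Fin m → Fin n) (p : Op m) → ren ρ (ren σ p) ≡ ren (ρ ∘ σ) p
  ren-∘ ρ σ (E i) = refl
  ren-∘ ρ σ (con c) = refl
  ren-∘ ρ σ (p ⊕ q) = cong₂ _⊕_ (ren-∘ ρ σ p) (ren-∘ ρ σ q)
  ren-∘ ρ σ (p ⊗ q) = cong₂ _⊗_ (ren-∘ ρ σ p) (ren-∘ ρ σ q)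

  ren-prodF : (ρ : Fin m → Fin k) → ∀ n (g : Fin n → Op m) → ren ρ (prodF n g) ≡ prodF n (ren ρ ∘ g)
  ren-prodF ρ zero g = refl
  ren-prodF ρ (suc n) g = cong (ren ρ (g zero) ⊗_) (ren-prodF ρ n (g ∘ suc))

  act-ren : (ρ : Fin m → Fin n) (T : Vec ℤ n → Vec ℤ m) → (∀ i u → T (bump (ρ i) u) ≡ bump i (T u)) →
    ∀ p f u → act p f (T u) ≡ act (ren ρ p) (f ∘ T) u
  act-ren ρ T h (E i) f u = sym (cong f (h i u))
  act-ren ρ T h (con c) f u = refl
  act-ren ρ T h (p ⊕ q) f u = cong₂ _+_ (act-ren ρ T h p f u) (act-ren ρ T h q f u)
  act-ren ρ T h (p ⊗ q) f u = trans (act-ren ρ T h p (act q f) u) (act-cong (ren ρ p) (act-ren ρ T h q f) u)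

  lift : Op n → Op (suc n)
  lift = ren suc

  act-lift : ∀ (p : Op n) f x v → act (lift p) f (x ∷ v) ≡ act p (λ u → f (x ∷ u)) v
  act-lift (E i) f x v = refl
  act-lift (con c) f x v = refl
  act-lift (p ⊕ q) f x v = cong₂ _+_ (act-lift p f x v) (act-lift q f x v)
  act-lift (p ⊗ q) f x v = trans (act-lift p (act (lift q) f) x v) (act-cong p (act-lift q f x) v)

  lift-cong : {p q : Op n} → p ≈ q → lift p ≈ lift q
  lift-cong {p = p} {q} e = mk λ { f (x ∷ v) → trans (act-lift p f x v) (trans (at e _ v) (sym (act-lift q f x v))) }

  Δ : Fin n → Op n
  Δ i = E i ⊕ con -1ℤ

  w : Fin n → Fin n → Op n
  w i j = con 1ℤ ⊕ E i ⊗ Δ j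

  Wg : ∀ n → (Fin n → Fin m) → Op m
  Wg zero σ = con 1ℤ
  Wg (suc n) σ = prodF n (λ j → w (σ zero) (σ (suc j))) ⊗ Wg n (σ ∘ suc)

  W : ∀ n → Op n
  W n = Wg n id

  PP : ∀ n → Op (suc n)
  PP n = prodF n (λ j → w zero (suc j))

  ren-Wg : (ρ : Fin m → Fin k) → ∀ n (σ : Fin n → Fin m) → ren ρ (Wg n σ) ≡ Wg n (ρ ∘ σ)
  ren-Wg ρ zero σ = refl
  ren-Wg ρ (suc n) σ = cong₂ _⊗_ (ren-prodF ρ n _) (ren-Wg ρ n (σ ∘ suc))

  W-suc : ∀ n → W (suc n) ≡ PP n ⊗ lift (W n)
  W-suc n = cong (PP n ⊗_) (sym (ren-Wg suc n id))

  Wg-ext : ∀ n {σ σ' : Fin n → Fin m} → (∀ i → σ i ≡ σ' i) → Wg n σ ≈ Wg n σ'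
  Wg-ext zero e = ≈-refl
  Wg-ext (suc n) e = cong⊗ (prodF-cong n λ j → ≡⇒≈ (cong₂ w (e zero) (e (suc j)))) (Wg-ext n (e ∘ suc))

  Wg-last : ∀ n (σ : Fin (suc n) → Fin m) →
    Wg (suc n) σ ≈ prodF n (λ j → w (σ (inject₁ j)) (σ (fromℕ n))) ⊗ Wg n (σ ∘ inject₁)
  Wg-last zero σ = ≈-refl
  Wg-last (suc n) σ = ≈-trans (cong⊗ (prodF-last n (λ j → w (σ zero) (σ (suc j)))) (Wg-last n (σ ∘ suc)))
    (≈-trans (cong⊗ (comm⊗ _ _) ≈-refl) (interchange⊗ _ _ _ _))

  ins : Fin (suc n) → ℤ → ℤ → Vec ℤ n → Vec ℤ (suc (suc n))
  ins zero a b v = a ∷ b ∷ v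
  ins (suc i) a b (x ∷ v) = x ∷ ins i a b v

  sw : ∀ {n} {X : Set} → Fin (suc n) → Vec X (suc (suc n)) → Vec X (suc (suc n))
  sw zero (x ∷ y ∷ v) = y ∷ x ∷ v
  sw {n = suc n} (suc k) (x ∷ v) = x ∷ sw k v

  sw-ins : (i : Fin (suc n)) → ∀ a b v → sw i (ins i a b v) ≡ ins i b a v
  sw-ins zero a b v = refl
  sw-ins (suc i) a b (x ∷ v) = cong (x ∷_) (sw-ins i a b v)

  sw-bump : (k : Fin (suc n)) → ∀ i u → sw k (bump (τ k i) u) ≡ bump i (sw k u)
  sw-bump zero zero (x ∷ y ∷ v) = refl
  sw-bump zero (suc zero) (x ∷ y ∷ v) = refl
  sw-bump zero (suc (suc i)) (x ∷ y ∷ v) = refl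
  sw-bump {suc n} (suc k) zero (x ∷ v) = refl
  sw-bump {suc n} (suc k) (suc i) (x ∷ v) = cong (x ∷_) (sw-bump k i v)

  lo hi : Fin (suc n) → Fin (suc (suc n))
  lo zero = zero
  lo {suc n} (suc i) = suc (lo i)
  hi zero = suc zero
  hi {suc n} (suc i) = suc (hi i)

  bump-lo : (i : Fin (suc n)) → ∀ a b v → bump (lo i) (ins i a b v) ≡ ins i (a + 1ℤ) b v
  bump-lo zero a b v = refl
  bump-lo (suc i) a b (x ∷ v) = cong (x ∷_) (bump-lo i a b v)

  bump-hi : (i : Fin (suc n)) → ∀ a b v → bump (hi i) (ins i a b v) ≡ ins i a (b + 1ℤ) v
  bump-hi zero a b v = refl
  bump-hi (suc i) a b (x ∷ v) = cong (x ∷_) (bump-hi i a b v)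

  τ-lo : (i : Fin (suc n)) → τ i (lo i) ≡ hi i
  τ-lo zero = refl
  τ-lo {suc n} (suc i) = cong suc (τ-lo i)

  τ-hi : (i : Fin (suc n)) → τ i (hi i) ≡ lo i
  τ-hi zero = refl
  τ-hi {suc n} (suc i) = cong suc (τ-hi i)

  W-factor : ∀ n (i : Fin (suc n)) → Σ (Op (suc (suc n))) λ U →
    (W (suc (suc n)) ≈ w (lo i) (hi i) ⊗ U) × (ren (τ i) U ≈ U)
  W-factor n zero = A ⊗ (B ⊗ C) , assoc⊗ _ _ _ , ≈-trans (cong⊗ (≡⇒≈ rA) (cong⊗ (≡⇒≈ rB) (≡⇒≈ rC))) (swap⊗ B A C)
    where
      A B C : Op (suc (suc n))
      A = prodF n (λ j → w zero (suc (suc j)))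
      B = prodF n (λ j → w (suc zero) (suc (suc j)))
      C = Wg n (λ j → suc (suc j))
      rA : ren (τ zero) A ≡ B
      rA = ren-prodF (τ zero) n _
      rB : ren (τ zero) B ≡ A
      rB = ren-prodF (τ zero) n _
      rC : ren (τ zero) C ≡ C
      rC = ren-Wg (τ zero) n _
  W-factor (suc n) (suc i) with W-factor n i
  ... | U , e , s = PP (suc (suc n)) ⊗ lift U ,
        ≈-trans (≡⇒≈ (W-suc (suc (suc n)))) (≈-trans (cong⊗ ≈-refl (lift-cong e)) (swap⊗ _ _ _)) ,
        cong⊗ (≈-trans (≡⇒≈ (ren-prodF (τ (suc i)) (suc (suc n)) (λ j → w zero (suc j)))) (prodF-τ n i (λ j → w zero (suc j))))
          (≈-trans (≡⇒≈ (trans (ren-∘ (τ (suc i)) suc U) (sym (ren-∘ suc (τ i) U)))) (lift-cong s))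

  Alt : ∀ {n} {X : Set} → (Vec X (suc (suc n)) → ℤ) → Set
  Alt {n} G = ∀ (i : Fin (suc n)) u → G (sw i u) ≡ - G u

  x≡-x⇒x≡0 : ∀ x → x ≡ - x → x ≡ 0ℤ
  x≡-x⇒x≡0 (+ zero) e = refl

  W-tie : (G : Fn (suc (suc n))) → Alt G → ∀ i a v → let H = act (W (suc (suc n))) G in
    H (ins i a a v) + H (ins i (a + 1ℤ) (a + 1ℤ) v) ≡ H (ins i a (a + 1ℤ) v)
  W-tie {n} G alt i a v = trans (expand (H (ins i a a v)) _ _) (trans (cong (_+ H (ins i a (a + 1ℤ) v)) zero') (ℤP.+-identityˡ _))
    where
      H : Fn (suc (suc n))
      H = act (W (suc (suc n))) G
      U = proj₁ (W-factor n i)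
      Y : Op (suc (suc n))
      Y = w (hi i) (lo i) ⊗ (w (lo i) (hi i) ⊗ U)
      sym-w : ren (τ i) Y ≈ Y
      sym-w = ≈-trans (cong⊗ (≡⇒≈ (cong₂ w (τ-hi i) (τ-lo i))) (cong⊗ (≡⇒≈ (cong₂ w (τ-lo i) (τ-hi i))) (proj₂ (proj₂ (W-factor n i)))))
                (swap⊗ _ _ _)
      anti : ∀ u → act Y G (sw i u) ≡ - act Y G u
      anti u = trans (act-ren (τ i) (sw i) (sw-bump i) Y G u) (trans (at sym-w _ u) (trans (act-cong Y (alt i) u) (act-neg Y G u)))
      vanish : act (w (hi i) (lo i)) H (ins i a a v) ≡ 0ℤ
      vanish = trans (act-cong (w (hi i) (lo i)) (at (proj₁ (proj₂ (W-factor n i))) G) _)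
        (x≡-x⇒x≡0 _ (trans (sym (cong (act Y G) (sw-ins i a a v))) (anti (ins i a a v))))
      zero' : H (ins i a a v) + (H (ins i (a + 1ℤ) (a + 1ℤ) v) - H (ins i a (a + 1ℤ) v)) ≡ 0ℤ
      zero' = trans (cong₂ _+_ (sym (ℤP.*-identityˡ (H (ins i a a v))))
                       (cong₂ _+_ (sym (cong H (trans (cong (bump (lo i)) (bump-hi i a a v)) (bump-lo i a (a + 1ℤ) v))))
                         (trans (sym (ℤP.-1*i≡-i _)) (cong (λ z → -1ℤ * H z) (sym (bump-hi i a a v))))))
                    vanish
      expand : ∀ x y z → x + y ≡ x + (y - z) + z
      expand = solve-∀

module Wedge where
  open ShiftOperators
  open OperatorProducts
  open import Data.Integer.Base using (ℤ; +_; -[1+_]; 0ℤ; 1ℤ; -1ℤ; _+_; _*_; _-_; -_)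
  open import Data.Fin.Base using (Fin; zero; suc)
  open import Data.Vec.Base using (Vec; []; _∷_)
  open _≈_

  private variable
    n m k : ℕ
    X : Set

  δ : (ℤ → ℤ) → ℤ → ℤ
  δ f x = f (x + 1ℤ) - f x

  -- ∑_{0 ≤ i < x} f i, continued to negative x so that the difference is f everywhere
  sumℤ : (ℤ → ℤ) → ℤ → ℤ
  sumℤ f (+ zero) = 0ℤ
  sumℤ f (+ suc n) = sumℤ f (+ n) + f (+ n)
  sumℤ f -[1+ zero ] = - f -[1+ zero ]
  sumℤ f -[1+ suc n ] = sumℤ f -[1+ n ] - f -[1+ suc n ]

  δ-sumℤ : ∀ f x → δ (sumℤ f) x ≡ f x
  δ-sumℤ f (+ n) rewrite ℕP.+-comm n 1 = lem (sumℤ f (+ n)) (f (+ n))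
    where lem : ∀ a c → a + c - a ≡ c
          lem = solve-∀
  δ-sumℤ f -[1+ zero ] = lem (f -[1+ zero ])
    where lem : ∀ a → 0ℤ - - a ≡ a
          lem = solve-∀
  δ-sumℤ f -[1+ suc n ] = lem (sumℤ f -[1+ n ]) (f -[1+ suc n ])
    where lem : ∀ a c → a - (a - c) ≡ c
          lem = solve-∀

  bin : ℕ → ℤ → ℤ
  bin zero x = 1ℤ
  bin (suc j) = sumℤ (bin j)

  δ-bin : ∀ j x → δ (bin (suc j)) x ≡ bin j x
  δ-bin j = δ-sumℤ (bin j)

  wd : (X → ℤ) → (Vec X n → ℤ) → Vec X (suc n) → ℤ
  wd {n = zero} f G (x ∷ []) = f x * G []
  wd {n = suc n} f G (x ∷ v) = f x * G v - wd f (λ u → G (x ∷ u)) v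

  wd-cong : {f g : X → ℤ} {F G : Vec X n → ℤ} → (∀ x → f x ≡ g x) → (∀ v → F v ≡ G v) → ∀ v → wd f F v ≡ wd g G v
  wd-cong {n = zero} e e' (x ∷ []) = cong₂ _*_ (e x) (e' [])
  wd-cong {n = suc n} e e' (x ∷ v) = cong₂ _-_ (cong₂ _*_ (e x) (e' v)) (wd-cong e (λ u → e' (x ∷ u)) v)

  wd-congʳ : ∀ (f : X → ℤ) {F G : Vec X n → ℤ} → (∀ v → F v ≡ G v) → ∀ v → wd f F v ≡ wd f G v
  wd-congʳ f = wd-cong (λ x → refl {x = f x})

  wd-+ : ∀ (f : X → ℤ) (F G : Vec X n → ℤ) v → wd f (λ u → F u + G u) v ≡ wd f F v + wd f G v
  wd-+ {n = zero} f F G (x ∷ []) = ℤP.*-distribˡ-+ (f x) _ _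
  wd-+ {n = suc n} f F G (x ∷ v) rewrite wd-+ f (λ u → F (x ∷ u)) (λ u → G (x ∷ u)) v =
    lem (f x) (F v) (G v) (wd f (λ u → F (x ∷ u)) v) (wd f (λ u → G (x ∷ u)) v)
    where lem : ∀ a c d s t → a * (c + d) - (s + t) ≡ (a * c - s) + (a * d - t)
          lem = solve-∀

  wd-* : ∀ (f : X → ℤ) c (F : Vec X n → ℤ) v → wd f (λ u → c * F u) v ≡ c * wd f F v
  wd-* {n = zero} f c F (x ∷ []) = lem (f x) c (F [])
    where lem : ∀ a c d → a * (c * d) ≡ c * (a * d)
          lem = solve-∀
  wd-* {n = suc n} f c F (x ∷ v) rewrite wd-* f c (λ u → F (x ∷ u)) v = lem (f x) c (F v) (wd f (λ u → F (x ∷ u)) v)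
    where lem : ∀ a c d s → a * (c * d) - c * s ≡ c * (a * d - s)
          lem = solve-∀

  wd-neg : ∀ (f : X → ℤ) (F : Vec X n → ℤ) v → wd f (λ u → - F u) v ≡ - wd f F v
  wd-neg f F v = trans (wd-congʳ f (λ u → sym (ℤP.-1*i≡-i (F u))) v) (trans (wd-* f -1ℤ F v) (ℤP.-1*i≡-i (wd f F v)))

  wd-0 : ∀ (f : X → ℤ) {F : Vec X n → ℤ} → (∀ v → F v ≡ 0ℤ) → ∀ v → wd f F v ≡ 0ℤ
  wd-0 f e v = trans (wd-congʳ f e v) (trans (wd-* f 0ℤ (λ _ → 0ℤ) v) (ℤP.*-zeroˡ (wd f (λ _ → 0ℤ) v)))

  wd-0ˡ : ∀ {f : X → ℤ} (F : Vec X n → ℤ) → (∀ x → f x ≡ 0ℤ) → ∀ v → wd f F v ≡ 0ℤ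
  wd-0ˡ {n = zero} F e (x ∷ []) rewrite e x = ℤP.*-zeroˡ (F [])
  wd-0ˡ {n = suc n} F e (x ∷ v) rewrite e x | wd-0ˡ (λ u → F (x ∷ u)) e v | ℤP.*-zeroˡ (F v) = refl

  AltF : ∀ n → (Vec X n → ℤ) → Set
  AltF zero G = ⊤
  AltF (suc zero) G = ⊤
  AltF (suc (suc n)) G = Alt G

  AltF-tail : ∀ n (G : Vec X (suc n) → ℤ) → AltF (suc n) G → ∀ x → AltF n (λ u → G (x ∷ u))
  AltF-tail zero G a x = tt
  AltF-tail (suc zero) G a x = tt
  AltF-tail (suc (suc n)) G a x i u = a (suc i) (x ∷ u)

  wd-alt : ∀ n f (G : Vec X (suc n) → ℤ) → AltF (suc n) G → Alt (wd f G)
  wd-alt zero f G a zero (x ∷ y ∷ []) = lem (f x) (G (y ∷ [])) (f y) (G (x ∷ []))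
    where lem : ∀ a c d e → d * e - a * c ≡ - (a * c - d * e)
          lem = solve-∀
  wd-alt (suc n) f G a zero (x ∷ y ∷ v) rewrite wd-congʳ f (λ u → a zero (x ∷ y ∷ u)) v | wd-neg f (λ u → G (x ∷ y ∷ u)) v =
    lem (f x) (G (y ∷ v)) (f y) (G (x ∷ v)) (wd f (λ u → G (x ∷ y ∷ u)) v)
    where lem : ∀ a c d e s → d * e - (a * c - - s) ≡ - (a * c - (d * e - s))
          lem = solve-∀
  wd-alt (suc n) f G a (suc i) (x ∷ v) rewrite a i v | wd-alt n f (λ u → G (x ∷ u)) (AltF-tail (suc n) G a x) i v =
    lem (f x) (G v) (wd f (λ u → G (x ∷ u)) v)
    where lem : ∀ a c s → a * - c - - s ≡ - (a * c - s)
          lem = solve-∀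

  wd-wd : ∀ (f : X → ℤ) (F : Vec X n → ℤ) v → wd f (wd f F) v ≡ 0ℤ
  wd-wd {n = zero} f F (x ∷ y ∷ []) = lem (f x) (f y) (F [])
    where lem : ∀ a c d → a * (c * d) - c * (a * d) ≡ 0ℤ
          lem = solve-∀
  wd-wd {n = suc n} f F (x ∷ v) = trans (cong (λ z → f x * wd f F v - z) inner) (lem (f x * wd f F v))
    where
      lem : ∀ a → a - (a + - 0ℤ) ≡ 0ℤ
      lem = solve-∀
      inner : wd f (λ u → f x * F u - wd f (λ u' → F (x ∷ u')) u) v ≡ f x * wd f F v + - 0ℤ
      inner = trans (wd-+ f _ _ v) (cong₂ _+_ (wd-* f (f x) F v)
                (trans (wd-neg f (wd f (λ u' → F (x ∷ u'))) v) (cong -_ (wd-wd f (λ u' → F (x ∷ u')) v))))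

  GW : ℕ → ∀ n → Fn n
  GW a zero v = 1ℤ
  GW a (suc n) = wd (bin a) (GW (suc a) n)

  V : ∀ n → Fn n
  V = GW 0

  GW-alt : ∀ a n → AltF n (GW a n)
  GW-alt a zero = tt
  GW-alt a (suc zero) = tt
  GW-alt a (suc (suc n)) = wd-alt n (bin a) (GW (suc a) (suc n)) (GW-alt (suc a) (suc n))

  -- the elementary symmetric polynomials of the differences
  elg : ∀ n → (Fin n → Fin m) → ℕ → Op m
  elg zero σ zero = con 1ℤ
  elg zero σ (suc r) = con 0ℤ
  elg (suc n) σ zero = elg n (σ ∘ suc) zero
  elg (suc n) σ (suc r) = elg n (σ ∘ suc) (suc r) ⊕ Δ (σ zero) ⊗ elg n (σ ∘ suc) r

  el : ∀ n → ℕ → Op n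
  el n = elg n id

  ren-elg : (ρ : Fin m → Fin k) → ∀ n (σ : Fin n → Fin m) r → ren ρ (elg n σ r) ≡ elg n (ρ ∘ σ) r
  ren-elg ρ zero σ zero = refl
  ren-elg ρ zero σ (suc r) = refl
  ren-elg ρ (suc n) σ zero = ren-elg ρ n (σ ∘ suc) zero
  ren-elg ρ (suc n) σ (suc r) = cong₂ _⊕_ (ren-elg ρ n (σ ∘ suc) (suc r)) (cong (Δ (ρ (σ zero)) ⊗_) (ren-elg ρ n (σ ∘ suc) r))

  act-el-suc : ∀ n r (f : Fn (suc n)) x v → act (elg n suc r) f (x ∷ v) ≡ act (el n r) (λ u → f (x ∷ u)) v
  act-el-suc n r f x v = trans (cong (λ p → act p f (x ∷ v)) (sym (ren-elg suc n id r))) (act-lift (el n r) f x v)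

  el-zero : ∀ n (σ : Fin n → Fin m) f v → act (elg n σ zero) f v ≡ f v
  el-zero zero σ f v = ℤP.*-identityˡ _
  el-zero (suc n) σ f v = el-zero n (σ ∘ suc) f v

  el-step : ∀ n r (f : Fn (suc n)) x v → act (el (suc n) (suc r)) f (x ∷ v) ≡
    act (el n (suc r)) (λ u → f (x ∷ u)) v + (act (el n r) (λ u → f ((x + 1ℤ) ∷ u)) v - act (el n r) (λ u → f (x ∷ u)) v)
  el-step n r f x v = cong₂ _+_ (act-el-suc n (suc r) f x v)
    (cong₂ _+_ (act-el-suc n r f (x + 1ℤ) v) (trans (ℤP.-1*i≡-i _) (cong -_ (act-el-suc n r f x v))))

  el-wd : ∀ n r f (G : Fn n) u → act (el (suc n) (suc r)) (wd f G) u ≡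
    wd f (act (el n (suc r)) G) u + wd (δ f) (act (el n r) G) u
  el-wd zero zero f G (x ∷ []) = lem (f x) (f (x + 1ℤ)) (G [])
    where lem : ∀ a c g → 0ℤ * (a * g) + (1ℤ * (c * g) + -1ℤ * (1ℤ * (a * g))) ≡ a * (0ℤ * g) + (c - a) * (1ℤ * g)
          lem = solve-∀
  el-wd zero (suc r) f G (x ∷ []) = lem (f x) (f (x + 1ℤ)) (G [])
    where lem : ∀ a c g → 0ℤ * (a * g) + (0ℤ * (c * g) + -1ℤ * (0ℤ * (a * g))) ≡ a * (0ℤ * g) + (c - a) * (0ℤ * g)
          lem = solve-∀
  el-wd (suc n) r f G (x ∷ v) = trans (el-step (suc n) r (wd f G) x v)
    (trans (cong₂ _+_ (trans (split (suc r) x) (cong (λ z → f x * X1 - z) (el-wd n r f (Gx x) v)))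
                      (cong₂ _-_ (split r (x + 1ℤ)) (split r x)))
    (trans (main r)
      (sym (cong₂ (λ s t → f x * X1 - s + (δ f x * X0 - t))
         (trans (wd-congʳ f (λ u → el-step n r G x u) v)
           (trans (wd-+ f _ _ v) (cong (_+_ (wd f (act (el n (suc r)) (Gx x)) v)) (trans (wd-+ f _ _ v)
              (cong (_+_ (wd f (act (el n r) (Gx (x + 1ℤ))) v)) (wd-neg f _ v))))))
         (refl {x = wd (δ f) (λ u → act (el (suc n) r) G (x ∷ u)) v})))))
    where
      Gx : ℤ → Fn n
      Gx x u = G (x ∷ u)
      X1 X0 : ℤ
      X1 = act (el (suc n) (suc r)) G v
      X0 = act (el (suc n) r) G v
      split : ∀ r y → act (el (suc n) r) (λ u → wd f G (y ∷ u)) v ≡ f y * act (el (suc n) r) G v - act (el (suc n) r) (wd f (Gx y)) v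
      split r y = trans (act-minus (el (suc n) r) (λ u → f y * G u) (wd f (Gx y)) v) (cong (_- act (el (suc n) r) (wd f (Gx y)) v) (act-* (el (suc n) r) (f y) G v))
      lem0 : ∀ a c X1 X0 p q Y Z s → s ≡ q → a * X1 - (p + q) + ((c * X0 - Y) - (a * X0 - Z)) ≡ a * X1 - (p + (Y - Z)) + ((c - a) * X0 - s)
      lem0 a c X1 X0 p q Y Z .q refl = go a c X1 X0 p q Y Z
        where go : ∀ a c X1 X0 p q Y Z → a * X1 - (p + q) + ((c * X0 - Y) - (a * X0 - Z)) ≡ a * X1 - (p + (Y - Z)) + ((c - a) * X0 - q)
              go = solve-∀
      lem1 : ∀ a c X1 X0 p q Y Y' Z Z' → a * X1 - (p + q) + ((c * X0 - (Y + Y')) - (a * X0 - (Z + Z'))) ≡ a * X1 - (p + (Y - Z)) + ((c - a) * X0 - (q + (Y' - Z')))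
      lem1 = solve-∀
      main : ∀ r → f x * act (el (suc n) (suc r)) G v - (wd f (act (el n (suc r)) (Gx x)) v + wd (δ f) (act (el n r) (Gx x)) v)
        + ((f (x + 1ℤ) * act (el (suc n) r) G v - act (el (suc n) r) (wd f (Gx (x + 1ℤ))) v) - (f x * act (el (suc n) r) G v - act (el (suc n) r) (wd f (Gx x)) v))
        ≡ f x * act (el (suc n) (suc r)) G v - (wd f (act (el n (suc r)) (Gx x)) v + (wd f (act (el n r) (Gx (x + 1ℤ))) v - wd f (act (el n r) (Gx x)) v))
        + (δ f x * act (el (suc n) r) G v - wd (δ f) (λ u → act (el (suc n) r) G (x ∷ u)) v)
      main zero = trans (cong₂ (λ s t → f x * act (el (suc n) 1) G v - (wd f (act (el n 1) (Gx x)) v + wd (δ f) (act (el n 0) (Gx x)) v) + ((f (x + 1ℤ) * act (el (suc n) 0) G v - s) - (f x * act (el (suc n) 0) G v - t)))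
                     (trans (el-zero (suc n) id _ v) (sym (wd-congʳ f (el-zero n id _) v)))
                     (trans (el-zero (suc n) id _ v) (sym (wd-congʳ f (el-zero n id _) v))))
                   (lem0 (f x) (f (x + 1ℤ)) (act (el (suc n) 1) G v) (act (el (suc n) 0) G v) (wd f (act (el n 1) (Gx x)) v) _ (wd f (act (el n 0) (Gx (x + 1ℤ))) v) (wd f (act (el n 0) (Gx x)) v) _ (wd-congʳ (δ f) (λ u → trans (el-zero n suc G (x ∷ u)) (sym (el-zero n id (Gx x) u))) v))
      main (suc r) = trans (cong₂ (λ s t → f x * act (el (suc n) (suc (suc r))) G v - (wd f (act (el n (suc (suc r))) (Gx x)) v + wd (δ f) (act (el n (suc r)) (Gx x)) v) + ((f (x + 1ℤ) * act (el (suc n) (suc r)) G v - s) - (f x * act (el (suc n) (suc r)) G v - t)))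
                     (el-wd n r f (Gx (x + 1ℤ)) v) (el-wd n r f (Gx x) v))
                   (trans (lem1 (f x) (f (x + 1ℤ)) (act (el (suc n) (suc (suc r))) G v) (act (el (suc n) (suc r)) G v)
                                  (wd f (act (el n (suc (suc r))) (Gx x)) v) (wd (δ f) (act (el n (suc r)) (Gx x)) v)
                                  (wd f (act (el n (suc r)) (Gx (x + 1ℤ))) v) (wd (δ f) (act (el n r) (Gx (x + 1ℤ))) v)
                                  (wd f (act (el n (suc r)) (Gx x)) v) (wd (δ f) (act (el n r) (Gx x)) v))
                     (cong (λ z → f x * act (el (suc n) (suc (suc r))) G v - (wd f (act (el n (suc (suc r))) (Gx x)) v + (wd f (act (el n (suc r)) (Gx (x + 1ℤ))) v - wd f (act (el n (suc r)) (Gx x)) v)) + (δ f x * act (el (suc n) (suc r)) G v - z))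
                       (sym (trans (wd-congʳ (δ f) (λ u → el-step n r G x u) v)
                         (trans (wd-+ (δ f) _ _ v) (cong (_+_ (wd (δ f) (act (el n (suc r)) (Gx x)) v)) (trans (wd-+ (δ f) _ _ v) (cong (_+_ (wd (δ f) (act (el n r) (Gx (x + 1ℤ))) v)) (wd-neg (δ f) _ v)))))))))

  bin-wd-el-GW : ∀ m a r u → wd (bin a) (act (el m (suc r)) (GW (suc a) m)) u ≡ 0ℤ
  bin-wd-el-GW zero a r u = wd-0 (bin a) (λ v → refl) u
  bin-wd-el-GW (suc m) a r u =
    trans (wd-congʳ (bin a) (λ v → trans (el-wd m r (bin (suc a)) (GW (suc (suc a)) m) v)
        (trans (cong₂ _+_ (bin-wd-el-GW m (suc a) r v) (wd-cong (δ-bin a) (λ _ → refl) v)) (ℤP.+-identityˡ _))) u)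
      (wd-wd (bin a) (act (el m r) (GW (suc (suc a)) m)) u)

  el-V : ∀ n r v → act (el n (suc r)) (V n) v ≡ 0ℤ
  el-V zero r v = refl
  el-V (suc n) r v = trans (el-wd n r (bin 0) (GW 1 n) v) (cong₂ _+_ (bin-wd-el-GW n 0 r v) (wd-0ˡ (act (el n r) (GW 1 n)) (λ x → refl) v))

module TriangleFunction where
  open ShiftOperators
  open OperatorProducts
  open Wedge
  open import Data.Integer.Base using (ℤ; +_; 0ℤ; 1ℤ; -1ℤ; _+_; _*_; _-_; -_)
  open import Data.Fin.Base using (Fin; zero; suc; inject₁; fromℕ)
  open import Data.Vec.Base using (Vec; []; _∷_; _∷ʳ_)
  open _≈_

  private variable n m k : ℕ

  pow : Op n → ℕ → Op n
  pow a zero = con 1ℤ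
  pow a (suc k) = a ⊗ pow a k

  sumOp : ℕ → (ℕ → Op n) → Op n
  sumOp zero h = con 0ℤ
  sumOp (suc k) h = h 0 ⊕ sumOp k (h ∘ suc)

  sumOp-cong : ∀ k {h h' : ℕ → Op n} → (∀ i → i ℕ.< k → h i ≈ h' i) → sumOp k h ≈ sumOp k h'
  sumOp-cong zero e = ≈-refl
  sumOp-cong (suc k) e = R.+-cong (e 0 (ℕ.s≤s ℕ.z≤n)) (sumOp-cong k (λ i i<k → e (suc i) (ℕ.s≤s i<k)))

  sumOp-⊕ : ∀ k (h h' : ℕ → Op n) → sumOp k (λ i → h i ⊕ h' i) ≈ sumOp k h ⊕ sumOp k h'
  sumOp-⊕ zero h h' = ≈-sym (R.+-identityˡ _)
  sumOp-⊕ (suc k) h h' = ≈-trans (R.+-cong ≈-refl (sumOp-⊕ k (h ∘ suc) (h' ∘ suc)))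
    (mk λ f v → +-interchange (act (h 0) f v) (act (h' 0) f v) (act (sumOp k (h ∘ suc)) f v) (act (sumOp k (h' ∘ suc)) f v))

  sumOp-⊗ : ∀ k (p : Op n) h → p ⊗ sumOp k h ≈ sumOp k (λ i → p ⊗ h i)
  sumOp-⊗ zero p h = R.zeroʳ p
  sumOp-⊗ (suc k) p h = ≈-trans (R.distribˡ p _ _) (R.+-cong ≈-refl (sumOp-⊗ k p (h ∘ suc)))

  sumOp-last : ∀ k (h : ℕ → Op n) → sumOp (suc k) h ≈ sumOp k h ⊕ h k
  sumOp-last zero h = R.+-comm _ _
  sumOp-last (suc k) h = ≈-trans (R.+-cong ≈-refl (sumOp-last k (h ∘ suc))) (≈-sym (R.+-assoc _ _ _))

  elg-big : ∀ n (σ : Fin n → Fin m) r → n ℕ.< r → elg n σ r ≈ con 0ℤ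
  elg-big zero σ (suc r) _ = ≈-refl
  elg-big (suc n) σ (suc r) (ℕ.s≤s n<r) = ≈-trans (R.+-cong (elg-big n _ (suc r) (ℕP.m≤n⇒m≤1+n n<r))
    (≈-trans (cong⊗ ≈-refl (elg-big n _ r n<r)) (R.zeroʳ _))) (R.+-identityˡ _)

  module _ (a c : Op m) where
    coef : ℕ → ℕ → Op m
    coef n r = pow a (n ℕ.∸ r) ⊗ pow c r

    prod-elg : ∀ n (σ : Fin n → Fin m) → prodF n (λ t → a ⊕ c ⊗ Δ (σ t)) ≈ sumOp (suc n) (λ r → coef n r ⊗ elg n σ r)
    prod-elg zero σ = mk λ f v → lem (f v)
      where lem : ∀ x → 1ℤ * x ≡ 1ℤ * (1ℤ * (1ℤ * x)) + 0ℤ * x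
            lem = solve-∀
    prod-elg (suc n) σ = ≈-trans (cong⊗ ≈-refl (prod-elg n (σ ∘ suc))) (≈-trans (R.distribʳ _ _ _)
      (≈-trans (R.+-cong (sumOp-⊗ (suc n) a (λ r → coef n r ⊗ e r)) (sumOp-⊗ (suc n) (c ⊗ D) (λ r → coef n r ⊗ e r)))
      (≈-trans (R.+-cong
         (≈-trans (sumOp-cong (suc n) (λ r r≤n → ≈-trans (≈-sym (assoc⊗ a (coef n r) (e r))) (cong⊗ (scale r r≤n) (≈-refl {p = e r}))))
           (≈-trans (≈-sym (R.+-identityʳ _)) (≈-trans (R.+-cong ≈-refl (≈-sym (≈-trans (cong⊗ ≈-refl (elg-big n _ (suc n) ℕP.≤-refl)) (R.zeroʳ _))))
              (≈-sym (sumOp-last (suc n) (λ r → coef (suc n) r ⊗ e r))))))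
         (sumOp-cong (suc n) (λ r _ → shift r)))
      (≈-trans (R.+-assoc _ _ _) (R.+-cong ≈-refl (≈-trans (≈-sym (sumOp-⊕ (suc n) (λ r → coef (suc n) (suc r) ⊗ e (suc r)) (λ r → coef (suc n) (suc r) ⊗ (D ⊗ e r))))
         (sumOp-cong (suc n) (λ r _ → ≈-sym (R.distribˡ (coef (suc n) (suc r)) (e (suc r)) (D ⊗ e r))))))))))
      where
        D : Op m
        D = Δ (σ zero)
        e : ℕ → Op m
        e = elg n (σ ∘ suc)
        scale : ∀ r → r ℕ.< suc n → a ⊗ coef n r ≈ coef (suc n) r
        scale r (ℕ.s≤s r≤n) rewrite ℕP.+-∸-assoc 1 r≤n = ≈-sym (assoc⊗ a _ _)
        shift : ∀ r → (c ⊗ D) ⊗ (coef n r ⊗ e r) ≈ coef (suc n) (suc r) ⊗ (D ⊗ e r)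
        shift r = ≈-trans (interchange⊗ c D (coef n r) (e r)) (cong⊗ (swap⊗ c _ _) ≈-refl)

  act-sumOp-0 : ∀ k (h : ℕ → Op n) f v → (∀ i → act (h i) f v ≡ 0ℤ) → act (sumOp k h) f v ≡ 0ℤ
  act-sumOp-0 zero h f v e = refl
  act-sumOp-0 (suc k) h f v e = cong₂ _+_ (e 0) (act-sumOp-0 k (h ∘ suc) f v (e ∘ suc))

  act-0 : ∀ (p : Op n) v → act p (λ _ → 0ℤ) v ≡ 0ℤ
  act-0 p v = trans (act-* p 0ℤ (λ _ → 0ℤ) v) (ℤP.*-zeroˡ (act p (λ _ → 0ℤ) v))

  prod-V : ∀ n (a c : Op n) v → act (prodF n (λ t → a ⊕ c ⊗ Δ t)) (V n) v ≡ act (pow a n) (V n) v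
  prod-V n a c v = trans (at (prod-elg a c n id) (V n) v) (trans (cong₂ _+_
    (trans (act-cong (pow a n ⊗ con 1ℤ) (el-zero n id (V n)) v) (act-cong (pow a n) (λ u → ℤP.*-identityˡ _) v))
    (act-sumOp-0 n (λ r → coef a c n (suc r) ⊗ el n (suc r)) (V n) v (λ r → trans (act-cong (coef a c n (suc r)) (el-V n r) v) (act-0 (coef a c n (suc r)) v))))
    (ℤP.+-identityʳ _))

  iterδ : ℕ → (ℤ → ℤ) → ℤ → ℤ
  iterδ zero f = f
  iterδ (suc k) f = iterδ k (δ f)

  iterδ-cong : ∀ k {f g : ℤ → ℤ} → (∀ x → f x ≡ g x) → ∀ x → iterδ k f x ≡ iterδ k g x
  iterδ-cong zero e x = e x
  iterδ-cong (suc k) e x = iterδ-cong k (λ y → cong₂ _-_ (e (y + 1ℤ)) (e y)) x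

  iterδ-minus : ∀ k f g x → iterδ k (λ y → f y - g y) x ≡ iterδ k f x - iterδ k g x
  iterδ-minus zero f g x = refl
  iterδ-minus (suc k) f g x = trans (iterδ-cong k (λ y → lem (f (y + 1ℤ)) (g (y + 1ℤ)) (f y) (g y)) x) (iterδ-minus k (δ f) (δ g) x)
    where lem : ∀ a c d e → a - c - (d - e) ≡ a - d - (c - e)
          lem = solve-∀

  iterδ-* : ∀ k c f x → iterδ k (λ y → c * f y) x ≡ c * iterδ k f x
  iterδ-* zero c f x = refl
  iterδ-* (suc k) c f x = trans (iterδ-cong k (λ y → lem c (f (y + 1ℤ)) (f y)) x) (iterδ-* k c (δ f) x)
    where lem : ∀ a c d → a * c - a * d ≡ a * (c - d)
          lem = solve-∀

  iterδ-0 : ∀ k x → iterδ k (λ _ → 0ℤ) x ≡ 0ℤ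
  iterδ-0 zero x = refl
  iterδ-0 (suc k) x = iterδ-0 k x

  iterδ-wd : ∀ k f (G : ℤ → Fn n) v x → iterδ k (λ y → wd f (G y) v) x ≡ wd f (λ u → iterδ k (λ y → G y u) x) v
  iterδ-wd zero f G v x = refl
  iterδ-wd (suc k) f G v x = trans
    (iterδ-cong k (λ y → sym (trans (wd-+ f (G (y + 1ℤ)) (λ u → - G y u) v) (cong (_+_ (wd f (G (y + 1ℤ)) v)) (wd-neg f (G y) v)))) x)
    (iterδ-wd k f (λ y u → G (y + 1ℤ) u - G y u) v x)

  bin-deg : ∀ j x → iterδ (suc j) (bin j) x ≡ 0ℤ
  bin-deg zero x = refl
  bin-deg (suc j) x = trans (iterδ-cong (suc j) (δ-bin j) x) (bin-deg j x)

  iterδ-+ : ∀ i k f x → iterδ (i ℕ.+ k) f x ≡ iterδ k (iterδ i f) x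
  iterδ-+ zero k f x = refl
  iterδ-+ (suc i) k f x = iterδ-+ i k (δ f) x

  GW-deg : ∀ a m v x → iterδ (a ℕ.+ suc m) (λ y → GW a (suc m) (y ∷ v)) x ≡ 0ℤ
  GW-deg a zero [] x rewrite ℕP.+-comm a 1 = trans (iterδ-cong (suc a) (λ y → ℤP.*-identityʳ (bin a y)) x) (bin-deg a x)
  GW-deg a (suc m) v x = trans (iterδ-minus (a ℕ.+ suc (suc m)) (λ y → bin a y * G v) (λ y → wd (bin a) (λ u → G (y ∷ u)) v) x)
    (cong₂ _-_ part1 part2)
    where
      G = GW (suc a) (suc m)
      part1 : iterδ (a ℕ.+ suc (suc m)) (λ y → bin a y * G v) x ≡ 0ℤ
      part1 rewrite ℕP.+-suc a (suc m) = trans (iterδ-cong (suc a ℕ.+ suc m) (λ y → ℤP.*-comm (bin a y) (G v)) x)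
        (trans (iterδ-* (suc a ℕ.+ suc m) (G v) (bin a) x) (trans (cong (G v *_) (trans (iterδ-+ (suc a) (suc m) (bin a) x)
          (trans (iterδ-cong (suc m) (bin-deg a) x) (iterδ-0 (suc m) x)))) (ℤP.*-zeroʳ (G v))))
      part2 : iterδ (a ℕ.+ suc (suc m)) (λ y → wd (bin a) (λ u → G (y ∷ u)) v) x ≡ 0ℤ
      part2 rewrite ℕP.+-suc a (suc m) = trans (iterδ-wd (suc a ℕ.+ suc m) (bin a) (λ y u → G (y ∷ u)) v x)
        (wd-0 (bin a) (λ u → GW-deg (suc a) m u x) v)

  act-powΔ : ∀ k (f : Fn (suc n)) x v → act (pow (Δ zero) k) f (x ∷ v) ≡ iterδ k (λ y → f (y ∷ v)) x
  act-powΔ zero f x v = ℤP.*-identityˡ _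
  act-powΔ (suc k) f x v = trans (⊗-comm-act (Δ zero) (pow (Δ zero) k) f (x ∷ v)) (trans (act-powΔ k (act (Δ zero) f) x v)
    (iterδ-cong k (λ y → cong (_+_ (f ((y + 1ℤ) ∷ v))) (ℤP.-1*i≡-i (f (y ∷ v)))) x))

  powΔ-V : ∀ m u → act (pow (Δ zero) (suc m)) (V (suc m)) u ≡ 0ℤ
  powΔ-V m (x ∷ v) = trans (act-powΔ (suc m) (V (suc m)) x v) (GW-deg 0 m v x)

  unipotent : ∀ k (Z : Fn (suc n)) → (∀ u → act (w zero zero) Z u ≡ 0ℤ) → (∀ u → act (pow (Δ zero) k) Z u ≡ 0ℤ) → ∀ u → Z u ≡ 0ℤ
  unipotent zero Z hw hk u = trans (sym (ℤP.*-identityˡ (Z u))) (hk u)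
  unipotent (suc k) Z hw hk u = trans (sym (ℤP.*-identityˡ (Z u))) (trans (sym (ℤP.+-identityʳ (1ℤ * Z u))) (trans (cong (_+_ (1ℤ * Z u)) (sym (Z'0 (bump zero u)))) (hw u)))
    where
      Z' : Fn _
      Z' = act (Δ zero) Z
      Z'0 : ∀ u → Z' u ≡ 0ℤ
      Z'0 = unipotent k Z' (λ u → trans (⊗-comm-act (w zero zero) (Δ zero) Z u) (trans (act-cong (Δ zero) hw u) (act-0 (Δ zero) u)))
        (λ u → trans (⊗-comm-act (pow (Δ zero) k) (Δ zero) Z u) (hk u))

  PQ : ∀ n → Op (suc n)
  PQ n = prodF n (λ j → w (suc j) zero)

  w-flip : ∀ (t : Fin (suc n)) → w t zero ≈ E zero ⊕ Δ zero ⊗ Δ t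
  w-flip t = mk λ f v → trans
    (cong (λ z → 1ℤ * f v + (f z + -1ℤ * f (bump t v))) (bump-comm zero t v))
    (lem (f v) (f (bump t (bump zero v))) (f (bump t v)) (f (bump zero v)))
    where lem : ∀ a c d e → 1ℤ * a + (c + -1ℤ * d) ≡ e + ((c + -1ℤ * e) + -1ℤ * (d + -1ℤ * a))
          lem = solve-∀

  rotate-op : ∀ m u → act (PQ m) (V (suc m)) u ≡ act (pow (E zero) (suc m) ⊗ PP m) (V (suc m)) u
  rotate-op m u = ℤP.i-j≡0⇒i≡j _ _ (unipotent (suc m) Z hw hk u)
    where
      X : Op (suc m)
      X = pow (E zero) (suc m) ⊗ PP m
      Z : Fn (suc m)
      Z u = act (PQ m) (V (suc m)) u - act X (V (suc m)) u
      one : ∀ k (f : Fn (suc m)) v → act (pow (con 1ℤ) k) f v ≡ f v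
      one zero f v = ℤP.*-identityˡ _
      one (suc k) f v = trans (ℤP.*-identityˡ _) (one k f v)
      hw1 : ∀ u → act (w zero zero) (act (PQ m) (V (suc m))) u ≡ act (pow (E zero) (suc m)) (V (suc m)) u
      hw1 u = trans (at (cong⊗ (w-flip zero) (prodF-cong m (λ j → w-flip (suc j)))) (V (suc m)) u) (prod-V (suc m) (E zero) (Δ zero) u)
      hw2 : ∀ u → act (w zero zero) (act X (V (suc m))) u ≡ act (pow (E zero) (suc m)) (V (suc m)) u
      hw2 u = trans (⊗-comm-act (w zero zero) (pow (E zero) (suc m)) (act (PP m) (V (suc m))) u)
        (act-cong (pow (E zero) (suc m)) (λ v → trans (prod-V (suc m) (con 1ℤ) (E zero) v) (one (suc m) (V (suc m)) v)) u)
      hw : ∀ u → act (w zero zero) Z u ≡ 0ℤ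
      hw u = trans (act-minus (w zero zero) (act (PQ m) (V (suc m))) (act X (V (suc m))) u) (ℤP.i≡j⇒i-j≡0 (trans (hw1 u) (sym (hw2 u))))
      kill : ∀ (p : Op (suc m)) u → act (pow (Δ zero) (suc m)) (act p (V (suc m))) u ≡ 0ℤ
      kill p u = trans (⊗-comm-act (pow (Δ zero) (suc m)) p (V (suc m)) u) (trans (act-cong p (powΔ-V m) u) (act-0 p u))
      hk : ∀ u → act (pow (Δ zero) (suc m)) Z u ≡ 0ℤ
      hk u = trans (act-minus (pow (Δ zero) (suc m)) (act (PQ m) (V (suc m))) (act X (V (suc m))) u) (cong₂ _-_ (kill (PQ m) u) (kill X u))

  α : ∀ n → Fn n
  α n = act (W n) (V n)

  sgn : ℕ → ℤ
  sgn zero = 1ℤ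
  sgn (suc n) = - sgn n

  alt-rotate : ∀ m (G : Fn (suc m)) → AltF (suc m) G → ∀ x v → G (v ∷ʳ x) ≡ sgn m * G (x ∷ v)
  alt-rotate zero G a x [] = sym (ℤP.*-identityˡ _)
  alt-rotate (suc m) G a x (y ∷ v) = trans (alt-rotate m (λ u → G (y ∷ u)) (AltF-tail (suc m) G a y) x v)
    (trans (cong (sgn m *_) (a zero (x ∷ y ∷ v))) (lem (sgn m) (G (x ∷ y ∷ v))))
    where lem : ∀ a c → a * - c ≡ - a * c
          lem = solve-∀

  rotL : Vec ℤ (suc n) → Vec ℤ (suc n)
  rotL (x ∷ v) = v ∷ʳ x

  ρ : Fin (suc n) → Fin (suc n)
  ρ' : Fin (suc n) → Fin (suc (suc n))
  ρ {zero} zero = zero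
  ρ {suc n} zero = suc zero
  ρ {suc n} (suc i) = ρ' (ρ i)
  ρ' zero = zero
  ρ' (suc i) = suc (suc i)

  ρ-inject₁ : ∀ (i : Fin n) → ρ (inject₁ i) ≡ suc i
  ρ-inject₁ {suc n} zero = refl
  ρ-inject₁ {suc n} (suc i) rewrite ρ-inject₁ i = refl

  ρ-last : ∀ n → ρ (fromℕ n) ≡ zero
  ρ-last zero = refl
  ρ-last (suc n) rewrite ρ-last n = refl

  rotL-bump : ∀ (i : Fin (suc n)) u → rotL (bump (ρ i) u) ≡ bump i (rotL u)
  rotL-bump {zero} zero (x ∷ []) = refl
  rotL-bump {suc n} zero (x ∷ y ∷ v) = refl
  rotL-bump {suc n} (suc i) (x ∷ y ∷ v) = trans (aux (ρ i)) (cong (y ∷_) (rotL-bump i (x ∷ v)))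
    where aux : ∀ j → rotL (bump (ρ' j) (x ∷ y ∷ v)) ≡ y ∷ rotL (bump j (x ∷ v))
          aux zero = refl
          aux (suc j) = refl

  act-powE : ∀ k (f : Fn (suc n)) x v → act (pow (E zero) k) f (x ∷ v) ≡ f ((x + + k) ∷ v)
  act-powE zero f x v = trans (ℤP.*-identityˡ _) (cong (λ z → f (z ∷ v)) (sym (ℤP.+-identityʳ x)))
  act-powE (suc k) f x v = trans (act-powE k f (x + 1ℤ) v) (cong (λ z → f (z ∷ v)) (ℤP.+-assoc x 1ℤ (+ k)))

  α-rotate : ∀ m x v → α (suc m) (v ∷ʳ x) ≡ sgn m * α (suc m) ((x + + suc m) ∷ v)
  α-rotate m x v = trans (act-ren ρ rotL rotL-bump (W (suc m)) (V (suc m)) (x ∷ v))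
    (trans (act-cong (ren ρ (W (suc m))) (λ { (y ∷ u) → alt-rotate m (V (suc m)) (GW-alt 0 (suc m)) y u }) (x ∷ v))
    (trans (act-* (ren ρ (W (suc m))) (sgn m) (V (suc m)) (x ∷ v))
    (cong (sgn m *_) (trans (at ren-W (V (suc m)) (x ∷ v))
      (trans (⊗-comm-act (PQ m) (lift (W m)) (V (suc m)) (x ∷ v))
      (trans (act-cong (lift (W m)) (rotate-op m) (x ∷ v))
      (trans (⊗-comm-act (lift (W m)) (pow (E zero) (suc m) ⊗ PP m) (V (suc m)) (x ∷ v))
      (trans (act-powE (suc m) (act (PP m) (act (lift (W m)) (V (suc m)))) x v)
        (cong (λ p → act p (V (suc m)) ((x + + suc m) ∷ v)) (sym (W-suc m)))))))))))
    where
      ren-W : ren ρ (W (suc m)) ≈ PQ m ⊗ lift (W m)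
      ren-W = ≈-trans (≡⇒≈ (ren-Wg ρ (suc m) id)) (≈-trans (Wg-last m ρ)
        (cong⊗ (prodF-cong m (λ j → ≡⇒≈ (cong₂ w (ρ-inject₁ j) (ρ-last m))))
          (≈-trans (Wg-ext m ρ-inject₁) (≡⇒≈ (sym (ren-Wg suc m id))))))

  incr : Vec ℤ n → Vec ℤ n
  incr [] = []
  incr (x ∷ v) = (x + 1ℤ) ∷ incr v

  act-incr : ∀ n (f : Fn n) v → act (prodF n E) f v ≡ f (incr v)
  act-incr zero f [] = ℤP.*-identityˡ _
  act-incr (suc n) f (x ∷ v) = trans (cong (λ p → act p f ((x + 1ℤ) ∷ v)) (sym (ren-prodF suc n E)))
    (trans (act-lift (prodF n E) f (x + 1ℤ) v) (act-incr n (λ u → f ((x + 1ℤ) ∷ u)) v))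

  α-translate : ∀ n v → α n (incr v) ≡ α n v
  α-translate n v = trans (sym (act-incr n (α n) v)) (trans (⊗-comm-act (prodF n E) (W n) (V n) v)
    (act-cong (W n) (λ u → trans (at (prodF-cong n {g = E} {h = λ t → con 1ℤ ⊕ con 1ℤ ⊗ Δ t} (λ t → mk λ f z → lem (f z) (f (bump t z)))) (V n) u)
       (trans (prod-V n (con 1ℤ) (con 1ℤ) u) (one n (V n) u))) v))
    where
      lem : ∀ a c → c ≡ 1ℤ * a + 1ℤ * (c + -1ℤ * a)
      lem = solve-∀
      one : ∀ k (f : Fn n) v → act (pow (con 1ℤ) k) f v ≡ f v
      one zero f v = ℤP.*-identityˡ _
      one (suc k) f v = trans (ℤP.*-identityˡ _) (one k f v)

  α-deg : ∀ m v x → iterδ (suc m) (λ y → α (suc m) (y ∷ v)) x ≡ 0ℤ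
  α-deg m v x = trans (sym (act-powΔ (suc m) (α (suc m)) x v)) (trans (⊗-comm-act (pow (Δ zero) (suc m)) (W (suc m)) (V (suc m)) (x ∷ v))
    (trans (act-cong (W (suc m)) (powΔ-V m) (x ∷ v)) (act-0 (W (suc m)) (x ∷ v))))

module RowSums where
  open ShiftOperators
  open OperatorProducts
  open Wedge
  open TriangleFunction
  open import Data.Integer.Base using (ℤ; +_; 0ℤ; 1ℤ; -1ℤ; _+_; _*_; _-_; -_; ∣_∣)
  open import Data.Bool.Base using (if_then_else_)
  open import Data.Fin.Base using (Fin; zero; suc)
  open import Data.List.Base as L using (List; []; _∷_; _++_; concatMap; applyUpTo)
  open import Data.Vec.Base using (Vec; []; _∷_; tail)
  open _≈_

  private variable n m k : ℕ

  Q : ℤ → Vec ℤ n → Fn n → ℤ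
  Q x [] H = H []
  Q x (k ∷ ks) H = H (incr (k ∷ ks)) - Q k ks (λ v → H (x ∷ v))

  Q-cong : ∀ x (v : Vec ℤ n) {F G : Fn n} → (∀ u → F u ≡ G u) → Q x v F ≡ Q x v G
  Q-cong x [] e = e []
  Q-cong x (k ∷ ks) e = cong₂ _-_ (e _) (Q-cong k ks (λ u → e (x ∷ u)))

  Q-+ : ∀ x (v : Vec ℤ n) (F G : Fn n) → Q x v (λ u → F u + G u) ≡ Q x v F + Q x v G
  Q-+ x [] F G = refl
  Q-+ x (k ∷ ks) F G rewrite Q-+ k ks (λ u → F (x ∷ u)) (λ u → G (x ∷ u)) =
    lem (F (incr (k ∷ ks))) (G (incr (k ∷ ks))) (Q k ks (λ u → F (x ∷ u))) (Q k ks (λ u → G (x ∷ u)))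
    where lem : ∀ a c d e → a + c - (d + e) ≡ (a - d) + (c - e)
          lem = solve-∀

  Q-* : ∀ x (v : Vec ℤ n) c (F : Fn n) → Q x v (λ u → c * F u) ≡ c * Q x v F
  Q-* x [] c F = refl
  Q-* x (k ∷ ks) c F rewrite Q-* k ks c (λ u → F (x ∷ u)) = lem c (F (incr (k ∷ ks))) (Q k ks (λ u → F (x ∷ u)))
    where lem : ∀ a c d → a * c - a * d ≡ a * (c - d)
          lem = solve-∀

  Q-minus : ∀ x (v : Vec ℤ n) (F G : Fn n) → Q x v (λ u → F u - G u) ≡ Q x v F - Q x v G
  Q-minus x v F G = trans (Q-+ x v F (λ u → - G u)) (cong (_+_ (Q x v F)) (trans (Q-cong x v (λ u → sym (ℤP.-1*i≡-i (G u)))) (trans (Q-* x v -1ℤ G) (ℤP.-1*i≡-i _))))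

  skip : Fin (suc n) → Fin (suc (suc n))
  skip zero = zero
  skip (suc j) = suc (suc j)

  ins₁ : ℤ → Vec ℤ (suc n) → Vec ℤ (suc (suc n))
  ins₁ k (x ∷ v) = x ∷ k ∷ v

  act-skip : ∀ (p : Op (suc n)) f k u → act (ren skip p) f (ins₁ k u) ≡ act p (f ∘ ins₁ k) u
  act-skip (E zero) f k (x ∷ v) = refl
  act-skip (E (suc i)) f k (x ∷ v) = refl
  act-skip (con c) f k u = refl
  act-skip (p ⊕ q) f k u = cong₂ _+_ (act-skip p f k u) (act-skip q f k u)
  act-skip (p ⊗ q) f k u = trans (act-skip p (act (ren skip q) f) k u) (act-cong p (act-skip q f k) u)

  PP-suc : ∀ n (F : Fn (suc (suc n))) k u → act (PP (suc n)) F (ins₁ k u) ≡ act (PP n) (λ u → act (w zero (suc zero)) F (ins₁ k u)) u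
  PP-suc n F k u = trans (⊗-comm-act (w zero (suc zero)) (prodF n (λ j → w zero (suc (suc j)))) F (ins₁ k u))
    (trans (cong (λ p → act p (act (w zero (suc zero)) F) (ins₁ k u)) (sym (ren-prodF skip n (λ j → w zero (suc j)))))
      (act-skip (PP n) (act (w zero (suc zero)) F) k u))

  QQ : Fn (suc n) → Fn (suc (suc n))
  QQ K (x ∷ k ∷ ks) = Q k ks (λ u → K (x ∷ u))

  PP-Q : ∀ n (K : Fn (suc n)) x k ks → act (PP (suc n)) (QQ K) (x ∷ k ∷ ks) ≡ Q k ks (λ u → act (PP n) K (x ∷ u))
  PP-Q zero K x k [] = lem (K (x ∷ [])) (K ((x + 1ℤ) ∷ []))
    where lem : ∀ a c → 1ℤ * (1ℤ * a) + (1ℤ * c + -1ℤ * (1ℤ * c)) ≡ 1ℤ * a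
          lem = solve-∀
  PP-Q (suc n) K x k (k' ∷ ks) = trans (PP-suc (suc n) (QQ K) k (x ∷ k' ∷ ks))
    (trans (act-cong (PP (suc n)) step (x ∷ k' ∷ ks))
    (trans (act-minus (PP (suc n)) (act (lift (prodF (suc n) E)) K) (QQ K') (x ∷ k' ∷ ks))
    (cong₂ _-_ (trans (⊗-comm-act (PP (suc n)) (lift (prodF (suc n) E)) K (x ∷ k' ∷ ks))
                 (trans (act-lift (prodF (suc n) E) (act (PP (suc n)) K) x (k' ∷ ks)) (act-incr (suc n) _ (k' ∷ ks))))
      (trans (PP-Q n K' x k' ks) (Q-cong k' ks (λ u → sym (PP-suc n K k (x ∷ u))))))))
    where
      K' : Fn (suc n)
      K' u = act (w zero (suc zero)) K (ins₁ k u)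
      step : ∀ u → act (w zero (suc zero)) (QQ K) (ins₁ k u) ≡ act (lift (prodF (suc n) E)) K u - QQ K' u
      step (x ∷ k' ∷ ks) = trans
        (lem (K (x ∷ incr (k' ∷ ks))) (K ((x + 1ℤ) ∷ incr (k' ∷ ks))) (Q k' ks A) (Q k' ks B) (Q k' ks C))
        (cong₂ _-_ (sym (trans (act-lift (prodF (suc n) E) K x (k' ∷ ks)) (act-incr (suc n) _ (k' ∷ ks))))
          (sym (trans (Q-+ k' ks (λ u → 1ℤ * A u) (λ u → B u + -1ℤ * C u))
            (cong₂ _+_ (Q-* k' ks 1ℤ A) (trans (Q-+ k' ks B (λ u → -1ℤ * C u)) (cong (_+_ (Q k' ks B)) (Q-* k' ks -1ℤ C)))))))
        where
          A B C : Fn n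
          A u = K (x ∷ k ∷ u)
          B u = K ((x + 1ℤ) ∷ (k + 1ℤ) ∷ u)
          C u = K ((x + 1ℤ) ∷ k ∷ u)
          lem : ∀ p q a b c → 1ℤ * (p - a) + ((q - b) + -1ℤ * (q - c)) ≡ p - (1ℤ * a + (b + -1ℤ * c))
          lem = solve-∀

  PP-const : ∀ k (σ : Fin k → Fin n) (g : Fn n) x v → act (prodF k (λ j → w zero (suc (σ j)))) (g ∘ tail) (x ∷ v) ≡ act (prodF k (E ∘ σ)) g v
  PP-const zero σ g x v = refl
  PP-const (suc k) σ g x v = trans (cong₂ _+_ (cong (1ℤ *_) (PP-const k (σ ∘ suc) g x v))
      (cong₂ (λ s t → s + -1ℤ * t) (PP-const k (σ ∘ suc) g (x + 1ℤ) (bump (σ zero) v)) (PP-const k (σ ∘ suc) g (x + 1ℤ) v)))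
    (lem (act (prodF k (E ∘ σ ∘ suc)) g v) (act (prodF k (E ∘ σ ∘ suc)) g (bump (σ zero) v)))
    where lem : ∀ a c → 1ℤ * a + (c + -1ℤ * a) ≡ c
          lem = solve-∀

  W-wedge-one : ∀ n (G : Fn n) x v → act (W (suc n)) (wd (bin 0) G) (x ∷ v) ≡ Q x v (act (W n) G)
  W-wedge-one zero G x [] = lem (G [])
    where lem : ∀ a → 1ℤ * (1ℤ * (1ℤ * a)) ≡ 1ℤ * a
          lem = solve-∀
  W-wedge-one (suc n) G x (k ∷ ks) = trans (cong (λ p → act p (wd (bin 0) G) (x ∷ k ∷ ks)) (W-suc (suc n)))
    (trans (act-cong (PP (suc n)) step (x ∷ k ∷ ks))
    (trans (act-minus (PP (suc n)) (act (W (suc n)) G ∘ tail) (QQ K) (x ∷ k ∷ ks))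
    (cong₂ _-_ (trans (PP-const (suc n) id (act (W (suc n)) G) x (k ∷ ks)) (act-incr (suc n) (act (W (suc n)) G) (k ∷ ks)))
      (trans (PP-Q n K x k ks) (Q-cong k ks (λ u → cong (λ p → act p G (x ∷ u)) (sym (W-suc n))))))))
    where
      K : Fn (suc n)
      K = act (lift (W n)) G
      step : ∀ u → act (lift (W (suc n))) (wd (bin 0) G) u ≡ act (W (suc n)) G (tail u) - QQ K u
      step (x ∷ k ∷ ks) = trans (act-lift (W (suc n)) (wd (bin 0) G) x (k ∷ ks))
        (trans (act-minus (W (suc n)) (λ v → 1ℤ * G v) (wd (bin 0) (λ u → G (x ∷ u))) (k ∷ ks))
        (cong₂ _-_ (act-cong (W (suc n)) (λ v → ℤP.*-identityˡ (G v)) (k ∷ ks))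
          (trans (W-wedge-one n (λ u → G (x ∷ u)) k ks) (Q-cong k ks (λ u → sym (act-lift (W n) G x u))))))

  Hα : ∀ n → Fn n
  Hα n = act (W n) (GW 1 n)

  α-Q : ∀ n x v → α (suc n) (x ∷ v) ≡ Q x v (Hα n)
  α-Q n = W-wedge-one n (GW 1 n)

  mix : Fn n → Fn n
  mix H [] = H []
  mix H (x ∷ v) = mix (λ u → H ((x + 1ℤ) ∷ u) - H (x ∷ u)) v

  mix-cong : {F G : Fn n} → (∀ u → F u ≡ G u) → ∀ v → mix F v ≡ mix G v
  mix-cong e [] = e []
  mix-cong e (x ∷ v) = mix-cong (λ u → cong₂ _-_ (e ((x + 1ℤ) ∷ u)) (e (x ∷ u))) v

  act-mix : ∀ n (H : Fn n) v → act (prodF n Δ) H v ≡ mix H v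
  act-mix zero H [] = ℤP.*-identityˡ _
  act-mix (suc n) H (x ∷ v) = trans (cong₂ (λ s t → s + -1ℤ * t) (inner (x + 1ℤ)) (inner x))
    (trans (cong (_+_ (act (prodF n Δ) (λ u → H ((x + 1ℤ) ∷ u)) v)) (ℤP.-1*i≡-i _))
    (trans (sym (act-minus (prodF n Δ) (λ u → H ((x + 1ℤ) ∷ u)) (λ u → H (x ∷ u)) v)) (act-mix n _ v)))
    where
      inner : ∀ y → act (prodF n (Δ ∘ suc)) H (y ∷ v) ≡ act (prodF n Δ) (λ u → H (y ∷ u)) v
      inner y = trans (cong (λ p → act p H (y ∷ v)) (sym (ren-prodF suc n Δ))) (act-lift (prodF n Δ) H y v)

  mix-act : ∀ n (p : Op n) H v → mix (act p H) v ≡ act p (mix H) v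
  mix-act n p H v = trans (sym (act-mix n (act p H) v)) (trans (⊗-comm-act (prodF n Δ) p H v) (act-cong p (act-mix n H) v))

  mix-wd : ∀ n f (G : Fn n) v → mix (wd f G) v ≡ wd (δ f) (mix G) v
  mix-wd zero f G (x ∷ []) = lem (f (x + 1ℤ)) (f x) (G [])
    where lem : ∀ a c g → a * g - c * g ≡ (a - c) * g
          lem = solve-∀
  mix-wd (suc n) f G (x ∷ v) = trans (mix-cong step v)
    (trans (sym (act-mix (suc n) _ v)) (trans (act-minus (prodF (suc n) Δ) (λ u → δ f x * G u) (wd f Gd) v)
    (cong₂ _-_ (trans (act-* (prodF (suc n) Δ) (δ f x) G v) (cong (δ f x *_) (act-mix (suc n) G v)))
      (trans (act-mix (suc n) (wd f Gd) v) (mix-wd n f Gd v)))))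
    where
      Gd : Fn n
      Gd u = G ((x + 1ℤ) ∷ u) - G (x ∷ u)
      step : ∀ u → wd f G ((x + 1ℤ) ∷ u) - wd f G (x ∷ u) ≡ δ f x * G u - wd f Gd u
      step u = trans (lem (f (x + 1ℤ)) (f x) (G u) (wd f (λ z → G ((x + 1ℤ) ∷ z)) u) (wd f (λ z → G (x ∷ z)) u))
        (cong (λ z → δ f x * G u - z) (sym (trans (wd-+ f (λ z → G ((x + 1ℤ) ∷ z)) (λ z → - G (x ∷ z)) u) (cong (_+_ (wd f (λ z → G ((x + 1ℤ) ∷ z)) u)) (wd-neg f (λ z → G (x ∷ z)) u)))))
        where lem : ∀ a c g s t → (a * g - s) - (c * g - t) ≡ (a - c) * g - (s - t)
              lem = solve-∀

  mix-GW : ∀ n a v → mix (GW (suc a) n) v ≡ GW a n v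
  mix-GW zero a [] = refl
  mix-GW (suc n) a v = trans (mix-wd n (bin (suc a)) (GW (suc (suc a)) n) v) (wd-cong (δ-bin a) (mix-GW n (suc a)) v)

  mix-Hα : ∀ n v → mix (Hα n) v ≡ α n v
  mix-Hα n v = trans (mix-act n (W n) (GW 1 n) v) (act-cong (W n) (mix-GW n 0) v)

  -- The relation H(…,k,k,…) + H(…,k+1,k+1,…) = H(…,k,k+1,…) makes the corrections for
  -- ties in the sum over strictly increasing rows cancel.
  Tie : ∀ n → Fn n → Set
  Tie zero H = ⊤
  Tie (suc zero) H = ⊤
  Tie (suc (suc n)) H = ∀ (i : Fin (suc n)) a v → H (ins i a a v) + H (ins i (a + 1ℤ) (a + 1ℤ) v) ≡ H (ins i a (a + 1ℤ) v)

  Tie-Hα : ∀ n → Tie n (Hα n)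
  Tie-Hα zero = tt
  Tie-Hα (suc zero) = tt
  Tie-Hα (suc (suc n)) = W-tie (GW 1 (suc (suc n))) (GW-alt 1 (suc (suc n)))

  Tie-diff : ∀ n (H : Fn (suc n)) → Tie (suc n) H → ∀ x → Tie n (λ u → H ((x + 1ℤ) ∷ u) - H (x ∷ u))
  Tie-diff zero H t x = tt
  Tie-diff (suc zero) H t x = tt
  Tie-diff (suc (suc n)) H t x i a v = trans (lem (H ((x + 1ℤ) ∷ ins i a a v)) (H (x ∷ ins i a a v)) (H ((x + 1ℤ) ∷ ins i (a + 1ℤ) (a + 1ℤ) v)) (H (x ∷ ins i (a + 1ℤ) (a + 1ℤ) v)))
      (cong₂ _-_ (t (suc i) a ((x + 1ℤ) ∷ v)) (t (suc i) a (x ∷ v)))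
    where lem : ∀ a c d e → (a - c) + (d - e) ≡ (a + d) - (c + e)
          lem = solve-∀

  sumN : ℕ → (ℕ → ℤ) → ℤ
  sumN zero f = 0ℤ
  sumN (suc n) f = sumN n f + f n

  sumN-cong : ∀ n {f g : ℕ → ℤ} → (∀ i → i ℕ.< n → f i ≡ g i) → sumN n f ≡ sumN n g
  sumN-cong zero e = refl
  sumN-cong (suc n) e = cong₂ _+_ (sumN-cong n (λ i i<n → e i (ℕP.m≤n⇒m≤1+n i<n))) (e n ℕP.≤-refl)

  sumN-head : ∀ n f → sumN (suc n) f ≡ f 0 + sumN n (f ∘ suc)
  sumN-head zero f = ℤP.+-comm 0ℤ (f 0)
  sumN-head (suc n) f = trans (cong (_+ f (suc n)) (sumN-head n f)) (ℤP.+-assoc (f 0) _ _)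

  private variable A B : Set

  sumL : (A → ℤ) → List A → ℤ
  sumL f [] = 0ℤ
  sumL f (x ∷ xs) = f x + sumL f xs

  sumL-++ : ∀ (f : A → ℤ) xs ys → sumL f (xs ++ ys) ≡ sumL f xs + sumL f ys
  sumL-++ f [] ys = sym (ℤP.+-identityˡ _)
  sumL-++ f (x ∷ xs) ys = trans (cong (_+_ (f x)) (sumL-++ f xs ys)) (sym (ℤP.+-assoc (f x) _ _))

  sumL-map : ∀ (f : B → ℤ) (g : A → B) xs → sumL f (L.map g xs) ≡ sumL (f ∘ g) xs
  sumL-map f g [] = refl
  sumL-map f g (x ∷ xs) = cong (_+_ (f (g x))) (sumL-map f g xs)

  sumL-concatMap : ∀ (f : B → ℤ) (g : A → List B) xs → sumL f (concatMap g xs) ≡ sumL (λ x → sumL f (g x)) xs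
  sumL-concatMap f g [] = refl
  sumL-concatMap f g (x ∷ xs) = trans (sumL-++ f (g x) (concatMap g xs)) (cong (_+_ (sumL f (g x))) (sumL-concatMap f g xs))

  sumL-cong : {f g : A → ℤ} → (∀ x → f x ≡ g x) → ∀ xs → sumL f xs ≡ sumL g xs
  sumL-cong e [] = refl
  sumL-cong e (x ∷ xs) = cong₂ _+_ (e x) (sumL-cong e xs)

  sumL-applyUpTo : ∀ (f : A → ℤ) (g : ℕ → A) n → sumL f (applyUpTo g n) ≡ sumN n (f ∘ g)
  sumL-applyUpTo f g zero = refl
  sumL-applyUpTo f g (suc n) = trans (cong (_+_ (f (g 0))) (sumL-applyUpTo f (g ∘ suc) n)) (sym (sumN-head n (f ∘ g)))

  rng : ℤ → ℕ → List ℤ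
  rng lo c = applyUpTo (λ i → lo + + i) (suc c)

  next : ℤ → ℤ → ℤ
  next l k = if does (l ℤP.≟ k) then k + 1ℤ else k

  next-≡ : ∀ {l k} → l ≡ k → next l k ≡ k + 1ℤ
  next-≡ {l} {k} e with l ℤP.≟ k
  ... | yes _ = refl
  ... | no ne = contradiction e ne

  next-≢ : ∀ {l k} → l ≢ k → next l k ≡ k
  next-≢ {l} {k} ne with l ℤP.≟ k
  ... | yes e = contradiction e ne
  ... | no _ = refl

  -- the strictly increasing l with lo ≤ l₁ ≤ k₁ ≤ l₂ ≤ k₂ ≤ …
  rows : ℤ → Vec ℤ n → List (Vec ℤ n)
  rows lo [] = [] ∷ []
  rows lo (k ∷ ks) = concatMap (λ l → L.map (l ∷_) (rows (next l k) ks)) (rng lo ∣ k - lo ∣)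

  infix 4 _≼_
  record _≼_ (i j : ℤ) : Set where
    constructor _,_
    field
      gap : ℕ
      shift : j ≡ i + + gap

  Strict : ℤ → Vec ℤ n → Set
  Strict k [] = ⊤
  Strict k (l ∷ ls) = (k + 1ℤ ≼ l) × Strict l ls

  Weak : ℤ → Vec ℤ n → Set
  Weak k [] = ⊤
  Weak k (l ∷ ls) = (k ≼ l) × Strict l ls

  Strict⇒Weak : ∀ {k} (v : Vec ℤ n) → Strict k v → Weak k v
  Strict⇒Weak [] s = tt
  Strict⇒Weak {k = k} (l ∷ v) ((c , e) , s) = (suc c , trans e (ℤP.+-assoc k 1ℤ (+ c))) , s

  Strict⇒Weak₁ : ∀ {k} (v : Vec ℤ n) → Strict k v → Weak (k + 1ℤ) v
  Strict⇒Weak₁ [] s = tt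
  Strict⇒Weak₁ (l ∷ v) s = s

  ∣lo+c-lo∣ : ∀ lo c → ∣ (lo + + c) - lo ∣ ≡ c
  ∣lo+c-lo∣ lo c = cong ∣_∣ (lem lo (+ c))
    where lem : ∀ a c → (a + c) - a ≡ c
          lem = solve-∀

  telescope : ∀ (φ : ℤ → ℤ) lo c → sumN c (λ i → φ ((lo + + i) + 1ℤ) - φ (lo + + i)) ≡ φ (lo + + c) - φ lo
  telescope φ lo zero = sym (trans (cong (λ z → φ z - φ lo) (ℤP.+-identityʳ lo)) (ℤP.+-inverseʳ (φ lo)))
  telescope φ lo (suc c) = trans (cong₂ _+_ (telescope φ lo c) (cong (λ z → φ z - φ (lo + + c)) (trans (ℤP.+-assoc lo (+ c) 1ℤ) (cong (λ z → lo + + z) (ℕP.+-comm c 1)))))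
    (lem (φ (lo + + c)) (φ lo) (φ (lo + + suc c)))
    where lem : ∀ a c d → a - c + (d - a) ≡ d - c
          lem = solve-∀

  sum-rows : ∀ lo c (k : ℤ) (ks : Vec ℤ n) (f : Fn (suc n)) → k ≡ lo + + c → sumL f (rows lo (k ∷ ks)) ≡
    sumN c (λ i → sumL (λ v → f ((lo + + i) ∷ v)) (rows k ks)) + sumL (λ v → f (k ∷ v)) (rows (k + 1ℤ) ks)
  sum-rows lo c k ks f refl rewrite ∣lo+c-lo∣ lo c = trans (sumL-concatMap f (λ l → L.map (l ∷_) (rows (next l k) ks)) (rng lo c))
    (trans (sumL-applyUpTo (λ l → sumL f (L.map (l ∷_) (rows (next l k) ks))) (λ i → lo + + i) (suc c))
    (cong₂ _+_ (sumN-cong c (λ i i<c → trans (sumL-map f _ (rows (next (lo + + i) k) ks)) (cong (λ z → sumL (λ v → f ((lo + + i) ∷ v)) (rows z ks)) (next-≢ (ne i<c)))))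
      (trans (sumL-map f _ (rows (next k k) ks)) (cong (λ z → sumL (λ v → f (k ∷ v)) (rows z ks)) (next-≡ {k} refl)))))
    where
      ne : ∀ {i} → i ℕ.< c → lo + + i ≢ lo + + c
      ne i<c e = ℕP.<⇒≢ i<c (trans (sym (∣lo+c-lo∣ lo _)) (trans (cong (λ z → ∣ z - lo ∣) e) (∣lo+c-lo∣ lo c)))

  sum-mix : ∀ n (H : Fn n) → Tie n H → ∀ lo ks → Weak lo ks → sumL (mix H) (rows lo ks) ≡ Q lo ks H
  sum-mix zero H t lo [] _ = ℤP.+-identityʳ (H [])
  sum-mix (suc n) H t lo (k ∷ ks) ((c , e) , s) = trans (sum-rows lo c k ks (mix H) e)
    (trans (cong₂ _+_ (trans (sumN-cong c (λ i _ → trans (sum-mix n (Hd (lo + + i)) (Tie-diff n H t (lo + + i)) k ks (Strict⇒Weak ks s)) (Q-minus k ks _ _)))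
                             (telescope (λ l → Q k ks (λ u → H (l ∷ u))) lo c))
        (trans (sum-mix n (Hd k) (Tie-diff n H t k) (k + 1ℤ) ks (Strict⇒Weak₁ ks s)) (Q-minus (k + 1ℤ) ks _ _)))
    (trans (cong (λ z → Q k ks (λ u → H (z ∷ u)) - Q k ks (λ u → H (lo ∷ u)) + (Q (k + 1ℤ) ks (λ u → H ((k + 1ℤ) ∷ u)) - Q (k + 1ℤ) ks (λ u → H (k ∷ u)))) (sym e))
    (fin ks H t)))
    where
      Hd : ℤ → Fn n
      Hd x u = H ((x + 1ℤ) ∷ u) - H (x ∷ u)
      fin : ∀ {n} (ks : Vec ℤ n) (H : Fn (suc n)) → Tie (suc n) H → Q k ks (λ u → H (k ∷ u)) - Q k ks (λ u → H (lo ∷ u)) + (Q (k + 1ℤ) ks (λ u → H ((k + 1ℤ) ∷ u)) - Q (k + 1ℤ) ks (λ u → H (k ∷ u)))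
        ≡ H (incr (k ∷ ks)) - Q k ks (λ u → H (lo ∷ u))
      fin [] H t = lem (H (k ∷ [])) (H (lo ∷ [])) (H ((k + 1ℤ) ∷ []))
        where lem : ∀ a c d → a - c + (d - a) ≡ d - c
              lem = solve-∀
      fin (k' ∷ ks) H t = lem (H (k ∷ incr (k' ∷ ks))) (H ((k + 1ℤ) ∷ incr (k' ∷ ks))) _ _ _ _
        (trans (sym (Q-+ k' ks (λ u → H (k ∷ k ∷ u)) (λ u → H ((k + 1ℤ) ∷ (k + 1ℤ) ∷ u)))) (Q-cong k' ks (λ u → t zero k u)))
        where lem : ∀ a b p q r s → p + q ≡ r → a - p - s + (b - q - (a - r)) ≡ b - s
              lem a b p q .(p + q) s refl = go a b p q s
                where go : ∀ a b p q s → a - p - s + (b - q - (a - (p + q))) ≡ b - s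
                      go = solve-∀

  sum-α : ∀ n k0 ks → Strict k0 ks → sumL (α n) (rows k0 ks) ≡ α (suc n) (k0 ∷ ks)
  sum-α n k0 ks s = trans (sumL-cong (λ v → sym (mix-Hα n v)) (rows k0 ks)) (trans (sum-mix n (Hα n) (Tie-Hα n) k0 ks (Strict⇒Weak ks s)) (sym (α-Q n k0 ks)))

module MonotoneTriangles where
  open ShiftOperators
  open TriangleFunction using (α)
  open RowSums
  open import Data.Integer.Base using (ℤ; +_; 0ℤ; 1ℤ; _+_; _-_; -_; ∣_∣)
  open import Data.Bool.Base using (if_then_else_)
  open import Data.List.Base as L using (List; []; _∷_; concatMap)
  open import Data.List.Relation.Unary.All as All using (All; []; _∷_)
  import Data.List.Relation.Unary.All.Properties as AllP
  open import Data.Vec.Base using (Vec; []; _∷_; _∷ʳ_)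

  private variable
    n m k : ℕ
    A B : Set

  sumL-cong-All : ∀ {P : A → Set} {f g : A → ℤ} xs → All P xs → (∀ x → P x → f x ≡ g x) → sumL f xs ≡ sumL g xs
  sumL-cong-All [] [] e = refl
  sumL-cong-All (x ∷ xs) (p ∷ ps) e = cong₂ _+_ (e x p) (sumL-cong-All xs ps e)

  sumL-+ : ∀ (f g : A → ℤ) xs → sumL (λ x → f x + g x) xs ≡ sumL f xs + sumL g xs
  sumL-+ f g [] = refl
  sumL-+ f g (x ∷ xs) = trans (cong (_+_ (f x + g x)) (sumL-+ f g xs)) (+-interchange (f x) (g x) (sumL f xs) (sumL g xs))

  sumL-0 : ∀ {f : A → ℤ} xs → (∀ x → f x ≡ 0ℤ) → sumL f xs ≡ 0ℤ
  sumL-0 [] e = refl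
  sumL-0 (x ∷ xs) e = cong₂ _+_ (e x) (sumL-0 xs e)

  Rows : Set → ℕ → Set
  Rows X zero = ⊤
  Rows X (suc m) = Vec X (suc m) × Rows X m

  Tri : ℕ → Set
  Tri = Rows ℤ

  tris : ∀ m → Vec ℤ (suc m) → List (Tri m)
  tris zero k = tt ∷ []
  tris (suc m) (k ∷ ks) = concatMap (λ l → L.map (l ,_) (tris m l)) (rows k ks)

  sum-tris : ∀ m k (ks : Vec ℤ (suc m)) (F : Tri (suc m) → ℤ) → sumL F (tris (suc m) (k ∷ ks)) ≡ sumL (λ l → sumL (λ t → F (l , t)) (tris m l)) (rows k ks)
  sum-tris m k ks F = trans (sumL-concatMap F (λ l → L.map (l ,_) (tris m l)) (rows k ks)) (sumL-cong (λ l → sumL-map F (l ,_) (tris m l)) (rows k ks))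

  ≼-refl : ∀ {i} → i ≼ i
  ≼-refl {i} = 0 , sym (ℤP.+-identityʳ i)

  ≼-trans : ∀ {i j l} → i ≼ j → j ≼ l → i ≼ l
  ≼-trans {i} (c , refl) (d , refl) = c ℕ.+ d , ℤP.+-assoc i (+ c) (+ d)

  ≼-suc : ∀ i → i ≼ i + 1ℤ
  ≼-suc i = 1 , refl

  Weak⇒Strict : ∀ {j} {k} (v : Vec ℤ n) → j + 1ℤ ≼ k → Weak k v → Strict j v
  Weak⇒Strict [] p w = tt
  Weak⇒Strict (x ∷ v) p (q , s) = ≼-trans p q , s

  Strict⇒Weak-next : ∀ l k (ks : Vec ℤ n) → Strict k ks → Weak (next l k) ks
  Strict⇒Weak-next l k ks s with l ℤP.≟ k
  ... | yes _ = Strict⇒Weak₁ ks s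
  ... | no _ = Strict⇒Weak ks s

  ≼-next : ∀ {lo c k i} → k ≡ lo + + c → i ℕ.< suc c → (lo + + i) + 1ℤ ≼ next (lo + + i) k
  ≼-next {lo} {c} {k} {i} refl (ℕ.s≤s i≤c) with (lo + + i) ℤP.≟ (lo + + c)
  ... | yes e = 0 , trans (cong (_+ 1ℤ) (sym e)) (sym (ℤP.+-identityʳ _))
  ... | no ne with ℕP.m≤n⇒∃[o]m+o≡n i≤c
  ...   | zero , refl = contradiction (cong (λ z → lo + + z) (sym (ℕP.+-identityʳ i))) ne
  ...   | suc d , refl = d , trans (cong (λ z → lo + + z) (trans (ℕP.+-suc i d) (sym (ℕP.+-assoc 1 i d)))) (lem lo (+ i) (+ d))
    where lem : ∀ a c e → a + (1ℤ + c + e) ≡ a + c + 1ℤ + e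
          lem = solve-∀

  rows-All : ∀ {P : Vec ℤ (suc n) → Set} lo c k (ks : Vec ℤ n) → k ≡ lo + + c →
    (∀ i → i ℕ.< suc c → All (λ v → P ((lo + + i) ∷ v)) (rows (next (lo + + i) k) ks)) → All P (rows lo (k ∷ ks))
  rows-All lo c k ks e h = AllP.concat⁺ (AllP.map⁺ (subst (λ z → All _ (rng lo z)) (sym (trans (cong (λ z → ∣ z - lo ∣) e) (∣lo+c-lo∣ lo c)))
    (AllP.applyUpTo⁺₁ (λ i → lo + + i) (suc c) (λ {i} i<c → AllP.map⁺ (h i i<c)))))

  rows-weak : ∀ lo (ks : Vec ℤ n) → Weak lo ks → All (Weak lo) (rows lo ks)
  rows-weak lo [] w = tt ∷ []
  rows-weak lo (k ∷ ks) ((c , e) , s) = rows-All lo c k ks e λ i i<c →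
    All.map (λ {v} wv → (i , refl) , Weak⇒Strict v (≼-next {lo} {c} e i<c) wv) (rows-weak (next (lo + + i) k) ks (Strict⇒Weak-next (lo + + i) k ks s))

  StrictV : Vec ℤ (suc n) → Set
  StrictV (x ∷ v) = Strict x v

  rows-strict : ∀ k0 (ks : Vec ℤ (suc n)) → Strict k0 ks → All StrictV (rows k0 ks)
  rows-strict k0 ks s = All.map (λ { {x ∷ v} w → proj₂ w }) (rows-weak k0 ks (Strict⇒Weak ks s))

  cnt : ∀ m → Vec ℤ (suc m) → ℤ
  cnt m k = sumL (λ _ → 1ℤ) (tris m k)

  cnt-suc : ∀ m k0 (ks : Vec ℤ (suc m)) → cnt (suc m) (k0 ∷ ks) ≡ sumL (cnt m) (rows k0 ks)
  cnt-suc m k0 ks = sum-tris m k0 ks (λ _ → 1ℤ)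

  cnt-α : ∀ m k → StrictV k → cnt m k ≡ α (suc m) k
  cnt-α zero (x ∷ []) s = refl
  cnt-α (suc m) (k0 ∷ ks) s = trans (cnt-suc m k0 ks) (trans (sumL-cong-All (rows k0 ks) (rows-strict k0 ks s) (cnt-α m)) (sum-α (suc m) k0 ks s))

  -- bc s x is the binomial coefficient of x + s over s
  bc : ℕ → ℕ → ℤ
  bc zero x = 1ℤ
  bc (suc s) x = sumN (suc x) (bc s)

  bc-0 : ∀ s → bc s 0 ≡ 1ℤ
  bc-0 zero = refl
  bc-0 (suc s) = trans (ℤP.+-identityˡ _) (bc-0 s)

  statF : ℤ → Tri m → ℕ
  statF {zero} K t = 0
  statF {suc m} K ((l ∷ ls) , t) = if does (l ℤP.≟ K) then suc (statF K t) else 0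

  rows-head : ∀ lo (k : ℤ) (ks : Vec ℤ n) (f : Fn (suc n)) → lo + 1ℤ ≼ k →
    sumL f (rows lo (k ∷ ks)) ≡ sumL (λ v → f (lo ∷ v)) (rows k ks) + sumL f (rows (lo + 1ℤ) (k ∷ ks))
  rows-head lo k ks f (c , e) = trans (sum-rows lo (suc c) k ks f (trans e (ℤP.+-assoc lo 1ℤ (+ c))))
    (trans (cong (_+ R') (sumN-head c _)) (trans (ℤP.+-assoc (R (lo + + 0)) _ R')
      (cong₂ _+_ (cong R (ℤP.+-identityʳ lo))
        (trans (cong (_+ R') (sumN-cong c (λ i _ → cong R (sym (ℤP.+-assoc lo 1ℤ (+ i)))))) (sym (sum-rows (lo + 1ℤ) c k ks f e))))))
    where
      R : ℤ → ℤ
      R l = sumL (λ v → f (l ∷ v)) (rows k ks)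
      R' = sumL (λ v → f (k ∷ v)) (rows (k + 1ℤ) ks)

  ≼⇒≢ : ∀ {i j} → i + 1ℤ ≼ j → j ≢ i
  ≼⇒≢ {i} (c , e) e' = contradiction (trans (sym (∣lo+c-lo∣ i (suc c))) (cong (λ z → ∣ z - i ∣) (trans (sym (ℤP.+-assoc i 1ℤ (+ c))) (trans (sym e) (trans e' (sym (ℤP.+-identityʳ i))))) ))
    λ e'' → ℕP.1+n≢0 (trans e'' (∣lo+c-lo∣ i 0))

  statF-≢ : ∀ {K l} (ls : Vec ℤ m) (t : Tri m) → l ≢ K → statF {suc m} K ((l ∷ ls) , t) ≡ 0
  statF-≢ {K = K} {l} ls t ne with l ℤP.≟ K
  ... | yes e = contradiction e ne
  ... | no _ = refl

  statF-≡ : ∀ {K l} (ls : Vec ℤ m) (t : Tri m) → l ≡ K → statF {suc m} K ((l ∷ ls) , t) ≡ suc (statF {m} K t)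
  statF-≡ {K = K} {l} ls t e with l ℤP.≟ K
  ... | yes _ = refl
  ... | no ne = contradiction e ne

  sum-statF : ∀ m K k (ks : Vec ℤ m) x → Strict K (k ∷ ks) → sumL (λ t → bc (statF K t) x) (tris (suc m) (K ∷ k ∷ ks)) ≡
    sumL (λ v → sumL (λ t → bc (suc (statF K t)) x) (tris m (K ∷ v))) (rows k ks) + sumL (cnt m) (rows (K + 1ℤ) (k ∷ ks))
  sum-statF m K k ks x (p , s) = trans (sum-tris m K (k ∷ ks) (λ t → bc (statF K t) x)) (trans (rows-head K k ks _ p)
    (cong₂ _+_ (sumL-cong (λ v → sumL-cong (λ t → cong (λ z → bc z x) (statF-≡ v t refl)) (tris m (K ∷ v))) (rows k ks))
      (sumL-cong-All (rows (K + 1ℤ) (k ∷ ks)) (rows-weak (K + 1ℤ) (k ∷ ks) (p , s))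
        (λ { (l ∷ ls) (q , _) → sumL-cong (λ t → cong (λ z → bc z x) (statF-≢ ls t (≼⇒≢ q))) (tris m (l ∷ ls)) }))))

  first-diagonal : ∀ m K (ks : Vec ℤ m) x → Strict K ks → cnt m ((K - + x) ∷ ks) ≡ sumL (λ t → bc (statF K t) x) (tris m (K ∷ ks))
  first-diagonal zero K [] x s = refl
  first-diagonal (suc m) K (k ∷ ks) zero s = trans (cong (λ z → cnt (suc m) (z ∷ k ∷ ks)) (ℤP.+-identityʳ K))
    (sumL-cong (λ t → sym (bc-0 (statF K t))) (tris (suc m) (K ∷ k ∷ ks)))
  first-diagonal (suc m) K (k ∷ ks) (suc x) (p , s) = trans (cnt-suc m (K - + suc x) (k ∷ ks))
    (trans (rows-head (K - + suc x) k ks (cnt m) (subst (_≼ k) (sym e1) (≼-trans (x , sym e2) (≼-trans (≼-suc K) p))))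
    (trans (cong₂ _+_ (sumL-cong-All (rows k ks) (rows-weak k ks (Strict⇒Weak ks s)) (λ v wv → first-diagonal m K v (suc x) (Weak⇒Strict v p wv)))
        (trans (cong (λ z → sumL (cnt m) (rows z (k ∷ ks))) e1) (trans (sym (cnt-suc m (K - + x) (k ∷ ks)))
          (trans (first-diagonal (suc m) K (k ∷ ks) x (p , s)) (sum-statF m K k ks x (p , s))))))
    (trans (lem (S0 (suc x)) (S1 x) (sumL (cnt m) (rows (K + 1ℤ) (k ∷ ks))))
    (trans (cong (_+ sumL (cnt m) (rows (K + 1ℤ) (k ∷ ks))) (trans (sym (sumL-+ _ _ (rows k ks)))
        (sumL-cong (λ v → sym (sumL-+ (λ t → bc (suc (statF K t)) x) (λ t → bc (statF K t) (suc x)) (tris m (K ∷ v)))) (rows k ks))))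
      (sym (sum-statF m K k ks (suc x) (p , s)))))))
    where
      S0 S1 : ℕ → ℤ
      S0 x = sumL (λ v → sumL (λ t → bc (statF K t) x) (tris m (K ∷ v))) (rows k ks)
      S1 x = sumL (λ v → sumL (λ t → bc (suc (statF K t)) x) (tris m (K ∷ v))) (rows k ks)
      lem : ∀ a c d → a + (c + d) ≡ (c + a) + d
      lem = solve-∀
      e1 : K - + suc x + 1ℤ ≡ K - + x
      e1 = lem' K (+ x)
        where lem' : ∀ a c → a - (1ℤ + c) + 1ℤ ≡ a - c
              lem' = solve-∀
      e2 : K - + x + + x ≡ K
      e2 = lem' K (+ x)
        where lem' : ∀ a c → a - c + c ≡ a
              lem' = solve-∀

  lst : Vec ℤ (suc n) → ℤ
  lst (x ∷ []) = x
  lst (x ∷ y ∷ v) = lst (y ∷ v)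

  lst-∷ʳ : ∀ (v : Vec ℤ n) x → lst (v ∷ʳ x) ≡ x
  lst-∷ʳ [] x = refl
  lst-∷ʳ (y ∷ []) x = refl
  lst-∷ʳ (y ∷ z ∷ v) x = lst-∷ʳ (z ∷ v) x

  statL : ℤ → Tri m → ℕ
  statL {zero} K t = 0
  statL {suc m} K (l , t) = if does (lst l ℤP.≟ K) then suc (statL K t) else 0

  rows-last-extend : ∀ lo (ks : Vec ℤ n) K (f : Fn (suc n)) → Weak lo (ks ∷ʳ K) →
    sumL f (rows lo (ks ∷ʳ (K + 1ℤ))) ≡ sumL f (rows lo (ks ∷ʳ K)) + sumL (λ v → f (v ∷ʳ (K + 1ℤ))) (rows lo ks)
  rows-last-extend lo [] K f ((c , e) , _) = trans (sum-rows lo (suc c) (K + 1ℤ) [] f e')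
      (cong₂ _+_ (trans (cong (_+_ (sumN c _)) (cong (λ z → f (z ∷ []) + 0ℤ) (sym e))) (sym (sum-rows lo c K [] f e))) refl)
    where
      e' : K + 1ℤ ≡ lo + + suc c
      e' = trans (cong (_+ 1ℤ) e) (trans (ℤP.+-assoc lo (+ c) 1ℤ) (cong (λ z → lo + + z) (ℕP.+-comm c 1)))
  rows-last-extend lo (k ∷ ks) K f ((c , e) , s) = trans (sum-rows lo c k (ks ∷ʳ (K + 1ℤ)) f e)
    (trans (cong₂ _+_ (trans (sumN-cong c (λ i _ → rows-last-extend k ks K (λ v → f ((lo + + i) ∷ v)) (Strict⇒Weak (ks ∷ʳ K) s))) (sumN-+ c _ _))
                      (rows-last-extend (k + 1ℤ) ks K (λ v → f (k ∷ v)) (Strict⇒Weak₁ (ks ∷ʳ K) s)))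
    (trans (+-interchange (sumN c (λ i → sumL (λ v → f ((lo + + i) ∷ v)) (rows k (ks ∷ʳ K)))) (sumN c (λ i → sumL (λ v → f ((lo + + i) ∷ (v ∷ʳ (K + 1ℤ)))) (rows k ks)))
        (sumL (λ v → f (k ∷ v)) (rows (k + 1ℤ) (ks ∷ʳ K))) (sumL (λ v → f (k ∷ (v ∷ʳ (K + 1ℤ)))) (rows (k + 1ℤ) ks)))
      (sym (cong₂ _+_ (sum-rows lo c k (ks ∷ʳ K) f e) (sum-rows lo c k ks (λ v → f (v ∷ʳ (K + 1ℤ))) e)))))
    where
      sumN-+ : ∀ n f g → sumN n (λ i → f i + g i) ≡ sumN n f + sumN n g
      sumN-+ zero f g = refl
      sumN-+ (suc n) f g = trans (cong (_+ (f n + g n)) (sumN-+ n f g)) (+-interchange (sumN n f) (sumN n g) (f n) (g n))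

  rows-last-only : ∀ lo (ks : Vec ℤ n) K (h : Fn (suc n)) → Weak lo (ks ∷ʳ K) → (∀ v → lst v ≢ K → h v ≡ 0ℤ) →
    sumL h (rows lo (ks ∷ʳ K)) ≡ sumL (λ v → h (v ∷ʳ K)) (rows lo ks)
  rows-last-only lo [] K h ((c , e) , _) z = trans (sum-rows lo c K [] h e) (trans (cong (_+ (h (K ∷ []) + 0ℤ))
      (trans (sumN-cong c {g = λ _ → 0ℤ} (λ i i<c → cong (_+ 0ℤ) (z _ (λ e' → ℕP.<⇒≢ i<c (trans (sym (∣lo+c-lo∣ lo i)) (trans (cong (λ z → ∣ z - lo ∣) (trans e' e)) (∣lo+c-lo∣ lo c))))))) (sumN-0 c)))
      (ℤP.+-identityˡ _))
    where
      sumN-0 : ∀ n → sumN n (λ _ → 0ℤ) ≡ 0ℤ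
      sumN-0 zero = refl
      sumN-0 (suc n) = trans (ℤP.+-identityʳ _) (sumN-0 n)
  rows-last-only lo (k ∷ ks) K h ((c , e) , s) z = trans (sum-rows lo c k (ks ∷ʳ K) h e)
    (trans (cong₂ _+_ (sumN-cong c (λ i _ → rows-last-only k ks K (λ v → h ((lo + + i) ∷ v)) (Strict⇒Weak (ks ∷ʳ K) s) (zl (lo + + i))))
                      (rows-last-only (k + 1ℤ) ks K (λ v → h (k ∷ v)) (Strict⇒Weak₁ (ks ∷ʳ K) s) (zl k)))
      (sym (sum-rows lo c k ks (λ v → h (v ∷ʳ K)) e)))
    where
      zl : ∀ y v → lst v ≢ K → h (y ∷ v) ≡ 0ℤ
      zl y (x ∷ v) ne = z (y ∷ x ∷ v) ne

  rows-weak-∷ʳ : ∀ lo (ks : Vec ℤ n) K → Weak lo (ks ∷ʳ K) → All (λ v → Weak lo (v ∷ʳ K)) (rows lo ks)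
  rows-weak-∷ʳ lo [] K w = w ∷ []
  rows-weak-∷ʳ lo (k ∷ ks) K ((c , e) , s) = rows-All lo c k ks e λ i i<c →
    All.map (λ {v} wv → (i , refl) , Weak⇒Strict (v ∷ʳ K) (≼-next {lo} {c} e i<c) wv) (rows-weak-∷ʳ (next (lo + + i) k) ks K (Strict⇒Weak-next (lo + + i) k (ks ∷ʳ K) s))

  statL-≢ : ∀ {K} (l : Vec ℤ (suc m)) (t : Tri m) → lst l ≢ K → statL {suc m} K (l , t) ≡ 0
  statL-≢ {K = K} l t ne with lst l ℤP.≟ K
  ... | yes e = contradiction e ne
  ... | no _ = refl

  statL-≡ : ∀ {K} (l : Vec ℤ (suc m)) (t : Tri m) → lst l ≡ K → statL {suc m} K (l , t) ≡ suc (statL {m} K t)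
  statL-≡ {K = K} l t e with lst l ℤP.≟ K
  ... | yes _ = refl
  ... | no ne = contradiction e ne

  Strict-∷ʳ : ∀ {k0} (ks : Vec ℤ n) {K K'} → K ≼ K' → Strict k0 (ks ∷ʳ K) → Strict k0 (ks ∷ʳ K')
  Strict-∷ʳ [] p (q , _) = ≼-trans q p , tt
  Strict-∷ʳ (k ∷ ks) p (q , s) = q , Strict-∷ʳ ks p s

  StrictV-∷ʳ : ∀ {lo} (v : Vec ℤ n) K → Weak lo (v ∷ʳ K) → StrictV (v ∷ʳ K)
  StrictV-∷ʳ [] K w = tt
  StrictV-∷ʳ (x ∷ v) K (_ , s) = s

  last-diagonal : ∀ m (ks : Vec ℤ m) K x → StrictV (ks ∷ʳ K) → cnt m (ks ∷ʳ (K + + x)) ≡ sumL (λ t → bc (statL K t) x) (tris m (ks ∷ʳ K))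
  last-diagonal zero [] K x s = refl
  last-diagonal (suc m) ks K zero s = trans (cong (λ z → cnt (suc m) (ks ∷ʳ z)) (ℤP.+-identityʳ K))
    (sumL-cong (λ t → sym (bc-0 (statL K t))) (tris (suc m) (ks ∷ʳ K)))
  last-diagonal (suc m) (k ∷ ks) K (suc x) s = trans (cong (λ z → cnt (suc m) (k ∷ (ks ∷ʳ z))) eK)
    (trans (cnt-suc m k (ks ∷ʳ (K + + x + 1ℤ)))
    (trans (rows-last-extend k ks (K + + x) (cnt m) (Strict⇒Weak _ (Strict-∷ʳ ks (x , refl) s)))
    (trans (cong₂ _+_ (trans (sym (cnt-suc m k (ks ∷ʳ (K + + x)))) (trans (last-diagonal (suc m) (k ∷ ks) K x s) (sum-tris m k (ks ∷ʳ K) _)))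
       (trans (sumL-cong-All (rows k ks) (rows-weak-∷ʳ k ks K (Strict⇒Weak _ s))
          (λ v wv → trans (cong (λ z → cnt m (v ∷ʳ z)) (sym eK)) (trans (last-diagonal m v K (suc x) (StrictV-∷ʳ v K wv)) (sym (h-≡ v)))))
         (sym (rows-last-only k ks K h (Strict⇒Weak _ s) h-0))))
    (trans (sym (sumL-+ (G x) h (rows k (ks ∷ʳ K))))
    (trans (sumL-cong (λ l → lem (G x l) (G (suc x) l)) (rows k (ks ∷ʳ K))) (sym (sum-tris m k (ks ∷ʳ K) _)))))))
    where
      eK : K + + suc x ≡ K + + x + 1ℤ
      eK = trans (cong (λ z → K + + z) (ℕP.+-comm 1 x)) (sym (ℤP.+-assoc K (+ x) 1ℤ))
      G : ℕ → Vec ℤ (suc m) → ℤ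
      G x l = sumL (λ t → bc (statL K (l , t)) x) (tris m l)
      h : Vec ℤ (suc m) → ℤ
      h l = G (suc x) l - G x l
      lem : ∀ a c → a + (c - a) ≡ c
      lem = solve-∀
      h-0 : ∀ l → lst l ≢ K → h l ≡ 0ℤ
      h-0 l ne = ℤP.i≡j⇒i-j≡0 (sumL-cong (λ t → trans (cong (λ z → bc z (suc x)) (statL-≢ l t ne)) (sym (cong (λ z → bc z x) (statL-≢ l t ne)))) (tris m l))
      h-≡ : ∀ v → h (v ∷ʳ K) ≡ sumL (λ t → bc (statL K t) (suc x)) (tris m (v ∷ʳ K))
      h-≡ v = trans (cong (_- G x (v ∷ʳ K)) (trans (sumL-cong (λ t → cong (λ z → bc z (suc x)) (st t)) (tris m (v ∷ʳ K)))
          (trans (sumL-+ (λ t → bc (suc (statL K t)) x) (λ t → bc (statL K t) (suc x)) (tris m (v ∷ʳ K)))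
            (cong (_+ sumL (λ t → bc (statL K t) (suc x)) (tris m (v ∷ʳ K))) (sumL-cong (λ t → cong (λ z → bc z x) (sym (st t))) (tris m (v ∷ʳ K)))))))
          (lem' (G x (v ∷ʳ K)) _)
        where
          st : ∀ t → statL K ((v ∷ʳ K) , t) ≡ suc (statL K t)
          st t = statL-≡ (v ∷ʳ K) t (lst-∷ʳ v K)
          lem' : ∀ a c → a + c - a ≡ c
          lem' = solve-∀

module Polynomials where
  open ShiftOperators using (+-interchange)
  open Wedge using (δ)
  open TriangleFunction using (iterδ; iterδ-cong; iterδ-minus; iterδ-0; sgn)
  open RowSums
  open MonotoneTriangles using (bc; bc-0)
  open import Data.Empty using (⊥-elim)
  open import Data.Integer.Base using (ℤ; +_; 0ℤ; 1ℤ; -1ℤ; _+_; _*_; _-_; -_; ∣_∣; _^_; NonZero)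

  sumN-+ : ∀ n f g → sumN n (λ i → f i + g i) ≡ sumN n f + sumN n g
  sumN-+ zero f g = refl
  sumN-+ (suc n) f g = trans (cong (_+ (f n + g n)) (sumN-+ n f g)) (+-interchange (sumN n f) (sumN n g) (f n) (g n))

  sumN-* : ∀ n c f → sumN n (λ i → c * f i) ≡ c * sumN n f
  sumN-* zero c f = sym (ℤP.*-zeroʳ c)
  sumN-* (suc n) c f = trans (cong (_+ c * f n) (sumN-* n c f)) (sym (ℤP.*-distribˡ-+ c (sumN n f) (f n)))

  sumN-minus : ∀ n f g → sumN n (λ i → f i - g i) ≡ sumN n f - sumN n g
  sumN-minus n f g = trans (sumN-+ n f (λ i → - g i)) (cong (_+_ (sumN n f)) (trans (sumN-cong n (λ i _ → sym (ℤP.-1*i≡-i (g i)))) (trans (sumN-* n -1ℤ g) (ℤP.-1*i≡-i (sumN n g)))))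

  sumN-0 : ∀ n {f} → (∀ i → i ℕ.< n → f i ≡ 0ℤ) → sumN n f ≡ 0ℤ
  sumN-0 zero e = refl
  sumN-0 (suc n) e = cong₂ _+_ (sumN-0 n (λ i i<n → e i (ℕP.m≤n⇒m≤1+n i<n))) (e n ℕP.≤-refl)

  sumN-split : ∀ a b f → sumN (a ℕ.+ b) f ≡ sumN a f + sumN b (λ i → f (a ℕ.+ i))
  sumN-split a zero f = trans (cong (λ z → sumN z f) (ℕP.+-identityʳ a)) (sym (ℤP.+-identityʳ _))
  sumN-split a (suc b) f = trans (cong (λ z → sumN z f) (ℕP.+-suc a b)) (trans (cong (_+ f (a ℕ.+ b)) (sumN-split a b f)) (ℤP.+-assoc (sumN a f) _ _))

  sumN-swap : ∀ a b (f : ℕ → ℕ → ℤ) → sumN a (λ i → sumN b (f i)) ≡ sumN b (λ j → sumN a (λ i → f i j))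
  sumN-swap zero b f = sym (sumN-0 b (λ _ _ → refl))
  sumN-swap (suc a) b f = trans (cong (_+ sumN b (f a)) (sumN-swap a b f)) (sym (sumN-+ b (λ j → sumN a (λ i → f i j)) (f a)))

  sumN-reverse : ∀ d f → sumN (suc d) f ≡ sumN (suc d) (λ k → f (d ℕ.∸ k))
  sumN-reverse zero f = refl
  sumN-reverse (suc d) f = trans (cong (_+ f (suc d)) (sumN-reverse d f)) (trans (ℤP.+-comm _ (f (suc d))) (sym (sumN-head (suc d) (λ k → f (suc d ℕ.∸ k)))))

  sgn-sq : ∀ m → sgn m * sgn m ≡ 1ℤ
  sgn-sq zero = refl
  sgn-sq (suc m) = trans (lem (sgn m)) (sgn-sq m)
    where lem : ∀ a → - a * - a ≡ a * a
          lem = solve-∀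

  sgn-∸ : ∀ {s m} → s ℕ.≤ m → sgn s * sgn m ≡ sgn (m ℕ.∸ s)
  sgn-∸ {zero} z≤n = ℤP.*-identityˡ _
  sgn-∸ {suc s} {suc m} (s≤s p) = trans (lem (sgn s) (sgn m)) (sgn-∸ p)
    where lem : ∀ a b → - a * - b ≡ a * b
          lem = solve-∀

  neg-^ : ∀ X k → (- X) ^ k ≡ sgn k * X ^ k
  neg-^ X zero = refl
  neg-^ X (suc k) = trans (cong (- X *_) (neg-^ X k)) (lem X (sgn k) (X ^ k))
    where lem : ∀ a b c → - a * (b * c) ≡ - b * (a * c)
          lem = solve-∀

  ^-+ : ∀ X a b → X ^ (a ℕ.+ b) ≡ X ^ a * X ^ b
  ^-+ X zero b = sym (ℤP.*-identityˡ _)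
  ^-+ X (suc a) b = trans (cong (X *_) (^-+ X a b)) (sym (ℤP.*-assoc X _ _))

  iterδ-suc : ∀ s f x → iterδ s f (x + 1ℤ) ≡ iterδ s f x + iterδ (suc s) f x
  iterδ-suc zero f x = lem (f (x + 1ℤ)) (f x)
    where lem : ∀ a b → a ≡ b + (a - b)
          lem = solve-∀
  iterδ-suc (suc s) f x = iterδ-suc s (δ f) x

  -- a homogeneous polynomial of degree d, the coefficient of X^k Y^(d - k) being c k
  hom : ℕ → (ℕ → ℤ) → ℤ → ℤ → ℤ
  hom d c X Y = sumN (suc d) (λ k → c k * (X ^ k * Y ^ (d ℕ.∸ k)))

  hom-cong : ∀ d {c c'} X Y → (∀ k → k ℕ.≤ d → c k ≡ c' k) → hom d c X Y ≡ hom d c' X Y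
  hom-cong d X Y e = sumN-cong (suc d) λ { k (s≤s k≤d) → cong (_* (X ^ k * Y ^ (d ℕ.∸ k))) (e k k≤d) }

  hom-suc : ∀ d c X Y → hom (suc d) c X Y ≡ Y * hom d c X Y + c (suc d) * X ^ suc d
  hom-suc d c X Y = cong₂ _+_
    (trans (sumN-cong (suc d) (λ { k (s≤s k≤d) → trans (cong (λ z → c k * (X ^ k * Y ^ z)) (ℕP.+-∸-assoc 1 k≤d)) (lem (c k) (X ^ k) Y (Y ^ (d ℕ.∸ k))) }))
      (sumN-* (suc d) Y _))
    (cong (c (suc d) *_) (trans (cong (λ z → X ^ suc d * Y ^ z) (ℕP.n∸n≡0 (suc d))) (ℤP.*-identityʳ _)))
    where lem : ∀ a b y z → a * (b * (y * z)) ≡ y * (a * (b * z))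
          lem = solve-∀

  hom-reverse : ∀ d c X Y → hom d c Y X ≡ hom d (λ k → c (d ℕ.∸ k)) X Y
  hom-reverse d c X Y = trans (sumN-reverse d _) (sumN-cong (suc d) λ { k (s≤s k≤d) →
    cong (c (d ℕ.∸ k) *_) (trans (ℤP.*-comm (Y ^ (d ℕ.∸ k)) _) (cong (λ z → X ^ z * Y ^ (d ℕ.∸ k)) (ℕP.m∸[m∸n]≡n k≤d))) })

  -- multiplication by Y - X
  mul : (ℕ → ℤ) → ℕ → ℤ
  mul c zero = c zero
  mul c (suc k) = c (suc k) - c k

  hom-mul : ∀ d c X Y → c (suc d) ≡ 0ℤ → hom (suc d) (mul c) X Y ≡ (Y - X) * hom d c X Y
  hom-mul zero c X Y e = trans (cong (λ z → 0ℤ + c 0 * (1ℤ * (Y * 1ℤ)) + (z - c 0) * (X * 1ℤ * 1ℤ)) e) (lem (c 0) X Y)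
    where lem : ∀ a X Y → 0ℤ + a * (1ℤ * (Y * 1ℤ)) + (0ℤ - a) * (X * 1ℤ * 1ℤ) ≡ (Y - X) * (0ℤ + a * (1ℤ * 1ℤ))
          lem = solve-∀
  hom-mul (suc d) c X Y e = trans (hom-suc (suc d) (mul c) X Y)
    (trans (cong₂ _+_ (cong (Y *_) gen) (cong (λ z → (z - c (suc d)) * X ^ suc (suc d)) e))
    (trans (lem (hom d c X Y) (c (suc d)) X Y (X ^ suc d)) (cong ((Y - X) *_) (sym (hom-suc d c X Y)))))
    where
      c' : ℕ → ℤ
      c' k with k ℕP.≤? d
      ... | yes _ = c k
      ... | no _ = 0ℤ
      c'-≤ : ∀ k → k ℕ.≤ d → c' k ≡ c k
      c'-≤ k p with k ℕP.≤? d
      ... | yes _ = refl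
      ... | no np = contradiction p np
      c'-top : c' (suc d) ≡ 0ℤ
      c'-top with suc d ℕP.≤? d
      ... | yes p = contradiction p ℕP.1+n≰n
      ... | no _ = refl
      mul-≤ : ∀ k → k ℕ.≤ d → mul c' k ≡ mul c k
      mul-≤ zero p = c'-≤ zero p
      mul-≤ (suc k) p = cong₂ _-_ (c'-≤ (suc k) p) (c'-≤ k (ℕP.<⇒≤ p))
      gen : hom (suc d) (mul c) X Y ≡ (Y - X) * hom d c X Y + c (suc d) * X ^ suc d
      gen = trans (hom-suc d (mul c) X Y) (trans (cong (λ z → Y * z + (c (suc d) - c d) * X ^ suc d) (sym (hom-cong d X Y mul-≤)))
        (trans (lem' (Y * hom d (mul c') X Y) (c (suc d)) (c d) (X ^ suc d))
          (cong (_+ c (suc d) * X ^ suc d) (trans (trans (cong₂ (λ s t → Y * hom d (mul c') X Y + (s - t) * X ^ suc d) (sym c'-top) (sym (c'-≤ d ℕP.≤-refl))) (sym (hom-suc d (mul c') X Y)))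
            (trans (hom-mul d c' X Y c'-top) (cong ((Y - X) *_) (hom-cong d X Y c'-≤)))))))
        where lem' : ∀ a b c x → a + (b - c) * x ≡ (a + (0ℤ - c) * x) + b * x
              lem' = solve-∀
      lem : ∀ h a X Y x → Y * ((Y - X) * h + a * x) + (0ℤ - a) * (X * x) ≡ (Y - X) * (Y * h + a * x)
      lem = solve-∀

  mulp : ℕ → (ℕ → ℤ) → ℕ → ℤ
  mulp zero c = c
  mulp (suc j) c = mul (mulp j c)

  Supp : ℕ → (ℕ → ℤ) → Set
  Supp d c = ∀ k → d ℕ.< k → c k ≡ 0ℤ

  mul-supp : ∀ {d c} → Supp d c → Supp (suc d) (mul c)
  mul-supp s (suc k) (s≤s p) = cong₂ _-_ (s (suc k) (ℕP.m≤n⇒m≤1+n p)) (s k p)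

  mulp-supp : ∀ j {d c} → Supp d c → Supp (j ℕ.+ d) (mulp j c)
  mulp-supp zero s = s
  mulp-supp (suc j) s = mul-supp (mulp-supp j s)

  hom-mulp : ∀ j d c X Y → Supp d c → hom (j ℕ.+ d) (mulp j c) X Y ≡ (Y - X) ^ j * hom d c X Y
  hom-mulp zero d c X Y s = sym (ℤP.*-identityˡ _)
  hom-mulp (suc j) d c X Y s = trans (hom-mul (j ℕ.+ d) (mulp j c) X Y (mulp-supp j s _ ℕP.≤-refl))
    (trans (cong ((Y - X) *_) (hom-mulp j d c X Y s)) (sym (ℤP.*-assoc (Y - X) _ _)))

  mul-anti : ∀ d c ε → Supp d c → (∀ k → k ℕ.≤ d → c (d ℕ.∸ k) ≡ ε * c k) → ∀ k → k ℕ.≤ suc d → mul c (suc d ℕ.∸ k) ≡ - ε * mul c k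
  mul-anti d c ε s h zero _ = trans (cong₂ _-_ (s (suc d) ℕP.≤-refl) (h 0 z≤n)) (lem ε (c 0))
    where lem : ∀ a b → 0ℤ - a * b ≡ - a * b
          lem = solve-∀
  mul-anti d c ε s h (suc k) (s≤s k≤d) with ℕP.m≤n⇒m<n∨m≡n k≤d
  ... | inj₂ refl = trans (cong (mul c) (ℕP.n∸n≡0 d)) (trans (trans (cong c (sym (ℕP.n∸n≡0 d))) (h d ℕP.≤-refl)) (trans (lem ε (c d)) (cong (λ z → - ε * (z - c d)) (sym (s (suc d) ℕP.≤-refl)))))
    where lem : ∀ a b → a * b ≡ - a * (0ℤ - b)
          lem = solve-∀
  ... | inj₁ k<d = trans (cong (mul c) e) (trans (cong₂ _-_ (trans (cong c (sym e)) (h k k≤d)) (h (suc k) k<d)) (lem ε (c k) (c (suc k))))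
    where
      e : d ℕ.∸ k ≡ suc (d ℕ.∸ suc k)
      e = ℕP.+-∸-assoc 1 k<d
      lem : ∀ a b c → a * b - a * c ≡ - a * (c - b)
      lem = solve-∀

  mulp-anti : ∀ j d c → Supp d c → (∀ k → k ℕ.≤ d → c (d ℕ.∸ k) ≡ c k) → ∀ k → k ℕ.≤ j ℕ.+ d → mulp j c (j ℕ.+ d ℕ.∸ k) ≡ sgn j * mulp j c k
  mulp-anti zero d c s h k p = trans (h k p) (sym (ℤP.*-identityˡ _))
  mulp-anti (suc j) d c s h = mul-anti (j ℕ.+ d) (mulp j c) (sgn j) (mulp-supp j s) (mulp-anti j d c s h)

  -- the polynomial c₀ + c₁ w + … with D coefficients
  poly : ℕ → (ℕ → ℤ) → ℤ → ℤ
  poly zero c w = 0ℤ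
  poly (suc D) c w = c 0 + w * poly D (c ∘ suc) w

  poly-zero : ∀ D c → (∀ w .{{_ : NonZero w}} → poly D c w ≡ 0ℤ) → ∀ k → k ℕ.< D → c k ≡ 0ℤ
  poly-zero (suc D) c h zero _ with ∣ poly D (c ∘ suc) (+ suc ∣ c 0 ∣) ∣ in eq
  ... | zero = trans (sym (ℤP.+-identityʳ (c 0))) (trans (cong (_+_ (c 0)) (sym (trans (cong (+ suc ∣ c 0 ∣ *_) (ℤP.∣i∣≡0⇒i≡0 eq)) (ℤP.*-zeroʳ (+ suc ∣ c 0 ∣))))) (h (+ suc ∣ c 0 ∣)))
  ... | suc p = ⊥-elim (ℕP.<⇒≱ (ℕP.n<1+n ∣ c 0 ∣) (subst (ℕ._≤ ∣ c 0 ∣) refl (ℕP.≤-trans (ℕP.m≤m*n (suc ∣ c 0 ∣) (suc p)) (ℕP.≤-reflexive (sym abs)))))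
    where
      abs : ∣ c 0 ∣ ≡ suc ∣ c 0 ∣ ℕ.* suc p
      abs = trans (cong ∣_∣ (lem (c 0) (+ suc ∣ c 0 ∣ * poly D (c ∘ suc) (+ suc ∣ c 0 ∣)) (h (+ suc ∣ c 0 ∣)))) (trans (ℤP.∣-i∣≡∣i∣ (+ suc ∣ c 0 ∣ * poly D (c ∘ suc) (+ suc ∣ c 0 ∣)))
        (trans (ℤP.abs-* (+ suc ∣ c 0 ∣) (poly D (c ∘ suc) (+ suc ∣ c 0 ∣))) (cong (suc ∣ c 0 ∣ ℕ.*_) eq)))
        where lem : ∀ a b → a + b ≡ 0ℤ → a ≡ - b
              lem a b e = trans (go a b) (trans (cong (_- b) e) (ℤP.+-identityˡ (- b)))
                where go : ∀ a b → a ≡ (a + b) - b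
                      go = solve-∀
  poly-zero (suc D) c h (suc k) (s≤s p) = poly-zero D (c ∘ suc) (λ w → ℤP.*-cancelˡ-≡ w (poly D (c ∘ suc) w) 0ℤ
    (trans (trans (sym (ℤP.+-identityˡ _)) (trans (cong (_+ w * poly D (c ∘ suc) w) (sym (poly-zero (suc D) c h 0 (s≤s z≤n)))) (h w))) (sym (ℤP.*-zeroʳ w)))) k p

  poly-sum : ∀ D c w → poly D c w ≡ sumN D (λ k → c k * w ^ k)
  poly-sum zero c w = refl
  poly-sum (suc D) c w = trans (cong₂ _+_ (sym (ℤP.*-identityʳ (c 0))) (trans (cong (w *_) (poly-sum D (c ∘ suc) w)) (trans (sym (sumN-* D w _)) (sumN-cong D (λ k _ → lem w (c (suc k)) (w ^ k))))))
    (sym (sumN-head D (λ k → c k * w ^ k)))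
    where lem : ∀ a b c → a * (b * c) ≡ b * (a * c)
          lem = solve-∀

  1^ : ∀ k → 1ℤ ^ k ≡ 1ℤ
  1^ zero = refl
  1^ (suc k) = trans (ℤP.*-identityˡ _) (1^ k)

  hom-poly : ∀ d c w → hom d c w 1ℤ ≡ poly (suc d) c w
  hom-poly d c w = trans (sumN-cong (suc d) (λ k _ → cong (c k *_) (trans (cong (w ^ k *_) (1^ (d ℕ.∸ k))) (ℤP.*-identityʳ (w ^ k))))) (sym (poly-sum (suc d) c w))

  mul-const : ∀ c D K → Supp D c → (∀ k → suc K ℕ.≤ k → mul c k ≡ 0ℤ) → ∀ k → K ℕ.≤ k → c k ≡ 0ℤ
  mul-const c D K s h k K≤k = go (suc D) k K≤k (ℕP.m≤m+n (suc D) k)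
    where
      go : ∀ j k → K ℕ.≤ k → D ℕ.< j ℕ.+ k → c k ≡ 0ℤ
      go zero k p q = s k q
      go (suc j) k p q = trans (lem (c (suc k)) (c k) (h (suc k) (s≤s p))) (go j (suc k) (ℕP.m≤n⇒m≤1+n p) (subst (D ℕ.<_) (sym (ℕP.+-suc j k)) q))
        where lem : ∀ a b → a - b ≡ 0ℤ → b ≡ a
              lem a b e = sym (ℤP.i-j≡0⇒i≡j a b e)

  mulp-zero : ∀ j c D K → Supp D c → K ℕ.≤ j → (∀ k → K ℕ.≤ k → mulp j c k ≡ 0ℤ) → ∀ k → c k ≡ 0ℤ
  mulp-zero zero c D zero s K≤j h k = h k z≤n
  mulp-zero (suc j) c D zero s K≤j h = mulp-zero j c D 0 s z≤n (mul-const (mulp j c) (j ℕ.+ D) 0 (mulp-supp j s) (λ k _ → h k z≤n))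
  mulp-zero (suc j) c D (suc K) s (s≤s K≤j) h = mulp-zero j c D K s K≤j (mul-const (mulp j c) (j ℕ.+ D) K (mulp-supp j s) h)

  -- the coefficients of the polynomial obtained by the substitution X ↦ -X, Y ↦ Y - X
  subst-coef : ∀ d c → Σ (ℕ → ℤ) λ c' → Supp d c' × (∀ X Y → hom d c (- X) (Y - X) ≡ hom d c' X Y)
  subst-coef zero c = (λ { zero → c 0 ; (suc _) → 0ℤ }) , (λ { (suc k) _ → refl }) , λ X Y → refl
  subst-coef (suc d) c with subst-coef d c
  ... | c' , s , e = c'' , supp , λ X Y → trans (hom-suc d c (- X) (Y - X)) (trans (cong₂ _+_ (trans (cong ((Y - X) *_) (e X Y)) (sym (hom-mul d c' X Y (s (suc d) ℕP.≤-refl)))) (cong (c (suc d) *_) (neg-^ X (suc d))))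
        (trans (cong (_+ c (suc d) * (sgn (suc d) * X ^ suc d)) (hom-suc d (mul c') X Y)) (trans (lem (Y * hom d (mul c') X Y) (mul c' (suc d)) (X ^ suc d) (c (suc d)) (sgn (suc d)))
          (trans (cong₂ (λ s t → Y * s + t * X ^ suc d) (hom-cong d X Y (λ k k≤d → sym (c''-≤ k k≤d))) (sym c''-top)) (sym (hom-suc d c'' X Y))))))
    where
      c'' : ℕ → ℤ
      c'' k with k ℕP.≟ suc d
      ... | yes _ = mul c' k + c (suc d) * sgn (suc d)
      ... | no _ = mul c' k
      c''-top : c'' (suc d) ≡ mul c' (suc d) + c (suc d) * sgn (suc d)
      c''-top with suc d ℕP.≟ suc d
      ... | yes _ = refl
      ... | no ne = contradiction refl ne
      c''-≤ : ∀ k → k ℕ.≤ d → c'' k ≡ mul c' k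
      c''-≤ k p with k ℕP.≟ suc d
      ... | yes refl = contradiction p ℕP.1+n≰n
      ... | no _ = refl
      supp : Supp (suc d) c''
      supp k p with k ℕP.≟ suc d
      ... | yes refl = contradiction p (ℕP.<-irrefl refl)
      ... | no _ = mul-supp s k p
      lem : ∀ a b x c g → (a + b * x) + c * (g * x) ≡ a + (b + c * g) * x
      lem = solve-∀

  cb : ℕ → ℕ → ℤ
  cb zero zero = 1ℤ
  cb zero (suc s) = 0ℤ
  cb (suc i) zero = 1ℤ
  cb (suc i) (suc s) = cb i s + cb i (suc s)

  cb-0 : ∀ i → cb i 0 ≡ 1ℤ
  cb-0 zero = refl
  cb-0 (suc i) = refl

  binomial : ∀ i m Z Y → i ℕ.≤ m → sumN (suc m) (λ s → cb i s * (Z ^ (m ℕ.∸ s) * Y ^ s)) ≡ Z ^ (m ℕ.∸ i) * (Y + Z) ^ i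
  binomial zero m Z Y _ = trans (sumN-head m _) (trans (cong₂ _+_ (ℤP.*-identityˡ (Z ^ m * 1ℤ)) (sumN-0 m (λ _ _ → refl))) (ℤP.+-identityʳ (Z ^ m * 1ℤ)))
  binomial (suc i) (suc m) Z Y (s≤s i≤m) = trans (sumN-head (suc m) _)
    (trans (cong (_+_ (1ℤ * (Z ^ suc m * 1ℤ))) (trans (sumN-cong (suc m) (λ s _ → split s)) (sumN-+ (suc m) _ _)))
    (trans (lem (1ℤ * (Z ^ suc m * 1ℤ)) (sumN (suc m) (λ s → Y * (cb i s * (Z ^ (m ℕ.∸ s) * Y ^ s)))) (sumN (suc m) (λ s → cb i (suc s) * (Z ^ (m ℕ.∸ s) * Y ^ suc s))))
    (trans (cong₂ _+_ (trans (cong (λ z → z * (Z ^ suc m * 1ℤ) + sumN (suc m) (λ s → cb i (suc s) * (Z ^ (m ℕ.∸ s) * Y ^ suc s))) (sym (cb-0 i)))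
                        (trans (sym (sumN-head (suc m) (λ s → cb i s * (Z ^ (suc m ℕ.∸ s) * Y ^ s)))) (binomial i (suc m) Z Y (ℕP.m≤n⇒m≤1+n i≤m))))
                      (trans (sumN-* (suc m) Y _) (cong (Y *_) (binomial i m Z Y i≤m))))
    (trans (cong (λ z → Z ^ z * (Y + Z) ^ i + Y * (Z ^ (m ℕ.∸ i) * (Y + Z) ^ i)) (ℕP.+-∸-assoc 1 i≤m)) (lem' Z Y (Z ^ (m ℕ.∸ i)) ((Y + Z) ^ i))))))
    where
      split : ∀ s → cb (suc i) (suc s) * (Z ^ (m ℕ.∸ s) * Y ^ suc s) ≡ Y * (cb i s * (Z ^ (m ℕ.∸ s) * Y ^ s)) + cb i (suc s) * (Z ^ (m ℕ.∸ s) * Y ^ suc s)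
      split s = go (cb i s) (cb i (suc s)) (Z ^ (m ℕ.∸ s)) Y (Y ^ s)
        where go : ∀ a b z y p → (a + b) * (z * (y * p)) ≡ y * (a * (z * p)) + b * (z * (y * p))
              go = solve-∀
      lem : ∀ a b c → a + (b + c) ≡ (a + c) + b
      lem = solve-∀
      lem' : ∀ Z Y z p → Z * z * p + Y * (z * p) ≡ z * ((Y + Z) * p)
      lem' = solve-∀

  iterd : ℕ → (ℕ → ℤ) → ℕ → ℤ
  iterd zero f = f
  iterd (suc s) f = iterd s (λ x → f (suc x) - f x)

  iterd-cong : ∀ s {f g : ℕ → ℤ} → (∀ x → f x ≡ g x) → ∀ x → iterd s f x ≡ iterd s g x
  iterd-cong zero e = e
  iterd-cong (suc s) e = iterd-cong s (λ x → cong₂ _-_ (e (suc x)) (e x))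

  iterd-+ : ∀ s f g x → iterd s (λ x → f x + g x) x ≡ iterd s f x + iterd s g x
  iterd-+ zero f g x = refl
  iterd-+ (suc s) f g x = trans (iterd-cong s (λ y → lem (f (suc y)) (g (suc y)) (f y) (g y)) x) (iterd-+ s _ _ x)
    where lem : ∀ a b c d → a + b - (c + d) ≡ (a - c) + (b - d)
          lem = solve-∀

  iterd-* : ∀ s c f x → iterd s (λ x → c * f x) x ≡ c * iterd s f x
  iterd-* zero c f x = refl
  iterd-* (suc s) c f x = trans (iterd-cong s (λ y → lem c (f (suc y)) (f y)) x) (iterd-* s c _ x)
    where lem : ∀ a b c → a * b - a * c ≡ a * (b - c)
          lem = solve-∀

  iterd-sumN : ∀ s n (f : ℕ → ℕ → ℤ) x → iterd s (λ x → sumN n (λ i → f i x)) x ≡ sumN n (λ i → iterd s (f i) x)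
  iterd-sumN s zero f x = z s x
    where z : ∀ s x → iterd s (λ _ → 0ℤ) x ≡ 0ℤ
          z zero x = refl
          z (suc s) x = z s x
  iterd-sumN s (suc n) f x = trans (iterd-+ s _ (f n) x) (cong (_+ iterd s (f n) x) (iterd-sumN s n f x))

  iterd-bc : ∀ i s → iterd s (bc i) 0 ≡ cb i s
  iterd-bc zero zero = refl
  iterd-bc zero (suc s) = z s 0
    where z : ∀ s x → iterd s (λ _ → 0ℤ) x ≡ 0ℤ
          z zero x = refl
          z (suc s) x = z s x
  iterd-bc (suc i) zero = bc-0 (suc i)
  iterd-bc (suc i) (suc s) = trans (iterd-cong s (λ x → lem (bc (suc i) x) (bc i x) (bc i (suc x))) 0)
    (trans (iterd-+ s (bc i) _ 0) (cong₂ _+_ (iterd-bc i s) (iterd-bc i (suc s))))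
    where lem : ∀ a b c → a + c - a ≡ b + (c - b)
          lem = solve-∀

  iterδ-iterd : ∀ s (ρ : ℤ → ℤ) b c (σ : ℕ → ℤ) → (∀ x → ρ (b + + x) ≡ c * σ x) → ∀ x → iterδ s ρ (b + + x) ≡ c * iterd s σ x
  iterδ-iterd zero ρ b c σ h = h
  iterδ-iterd (suc s) ρ b c σ h = iterδ-iterd s (δ ρ) b c _ λ x → trans (cong₂ _-_ (trans (cong ρ (trans (ℤP.+-assoc b (+ x) 1ℤ) (cong (λ z → b + + z) (ℕP.+-comm x 1)))) (h (suc x))) (h x))
      (lem c (σ (suc x)) (σ x))
    where lem : ∀ a b c → a * b - a * c ≡ a * (b - c)
          lem = solve-∀

  deg-linear : ∀ d f c → (∀ x → iterδ d f x ≡ 0ℤ) → ∀ x → iterδ (suc d) (λ x → (x - c) * f x) x ≡ 0ℤ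
  deg-linear zero f c h x = trans (cong₂ (λ s t → (x + 1ℤ - c) * s - (x - c) * t) (h (x + 1ℤ)) (h x)) (lem (x + 1ℤ - c) (x - c))
    where lem : ∀ a b → a * 0ℤ - b * 0ℤ ≡ 0ℤ
          lem = solve-∀
  deg-linear (suc d) f c h x = trans (iterδ-cong (suc d) (λ y → lem y c (f (y + 1ℤ)) (f y)) x)
    (trans (iterδ-minus (suc d) (λ y → (y - c) * δ f y) (λ y → - f (y + 1ℤ)) x)
      (cong₂ _-_ (deg-linear d (δ f) c h x) (trans (iterδ-cong (suc d) (λ y → lem' (f (y + 1ℤ))) x) (trans (iterδ-minus (suc d) (λ _ → 0ℤ) (λ y → f (y + 1ℤ)) x) (cong₂ _-_ (iterδ-0 (suc d) x) (trans (shift (suc d) f x) (h (x + 1ℤ))))))))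
    where
      lem : ∀ y c a b → (y + 1ℤ - c) * a - (y - c) * b ≡ (y - c) * (a - b) - - a
      lem = solve-∀
      lem' : ∀ a → - a ≡ 0ℤ - a
      lem' = solve-∀
      shift : ∀ d f x → iterδ d (λ y → f (y + 1ℤ)) x ≡ iterδ d f (x + 1ℤ)
      shift zero f x = refl
      shift (suc d) f x = shift d (δ f) x

  -- summation by parts against multiplication by Y - X
  sum-mul : ∀ D c (p : ℤ → ℤ) → c D ≡ 0ℤ → sumN (suc D) (λ k → mul c k * p (+ k)) ≡ - sumN D (λ k → c k * δ p (+ k))
  sum-mul D c p e = trans (gen D) (trans (cong (λ z → z * p (+ D) - sumN D (λ k → c k * δ p (+ k))) e) (ℤP.+-identityˡ _))
    where
      gen : ∀ D → sumN (suc D) (λ k → mul c k * p (+ k)) ≡ c D * p (+ D) - sumN D (λ k → c k * δ p (+ k))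
      gen zero = trans (ℤP.+-identityˡ (c 0 * p (+ 0))) (sym (ℤP.+-identityʳ (c 0 * p (+ 0))))
      gen (suc D) = trans (cong (_+ (c (suc D) - c D) * p (+ suc D)) (gen D))
        (trans (lem (c D) (p (+ D)) (sumN D (λ k → c k * δ p (+ k))) (c (suc D)) (p (+ suc D)))
          (cong (λ z → c (suc D) * p (+ suc D) - (sumN D (λ k → c k * δ p (+ k)) + c D * (p z - p (+ D)))) (cong +_ (ℕP.+-comm 1 D))))
        where lem : ∀ a b s c d → (a * b - s) + (c - a) * d ≡ c * d - (s + a * (d - b))
              lem = solve-∀

  sum-mulp : ∀ j d c (p : ℤ → ℤ) → Supp d c → (∀ x → iterδ j p x ≡ 0ℤ) → sumN (suc (j ℕ.+ d)) (λ k → mulp j c k * p (+ k)) ≡ 0ℤ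
  sum-mulp zero d c p s h = sumN-0 (suc d) (λ k _ → trans (cong (c k *_) (h (+ k))) (ℤP.*-zeroʳ (c k)))
  sum-mulp (suc j) d c p s h = trans (sum-mul (suc (j ℕ.+ d)) (mulp j c) p (mulp-supp j s _ ℕP.≤-refl)) (cong -_ (sum-mulp j d c (δ p) s h))

module RefinedRatio where
  open TriangleFunction using (iterδ; iterδ-cong; sgn)
  open RowSums
  open MonotoneTriangles using (bc)
  open Polynomials
  open import Data.Nat.Base using (_!)
  open import Data.Integer.Base using (ℤ; +_; 0ℤ; 1ℤ; -1ℤ; _+_; _*_; _-_; -_; _^_; NonZero)

  -- x (x - 1) ⋯ (x - n + 1)
  fall : ℕ → ℤ → ℤ
  fall zero x = 1ℤ
  fall (suc n) x = (x - + n) * fall n x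

  -- (x - a) (x - a - 1) ⋯ (x - a - n + 1)
  window : ℕ → ℕ → ℤ → ℤ
  window a zero x = 1ℤ
  window a (suc n) x = (x - + (a ℕ.+ n)) * window a n x

  fall-value : ∀ a n → fall n (+ (a ℕ.+ n)) * + (a !) ≡ + ((a ℕ.+ n) !)
  fall-value a zero = trans (ℤP.*-identityˡ _) (cong (λ z → + (z !)) (sym (ℕP.+-identityʳ a)))
  fall-value a (suc n) = trans (cong₂ (λ s t → s * fall n (+ t) * + (a !)) (trans (cong (λ z → + z - + n) (ℕP.+-suc a n)) (lem (+ a) (+ n))) (ℕP.+-suc a n))
    (trans (lem' (+ suc a) (fall n (+ (suc a ℕ.+ n))) (+ (a !))) (trans (cong (fall n (+ (suc a ℕ.+ n)) *_) (sym (ℤP.pos-* (suc a) (a !)))) (trans (fall-value (suc a) n) (cong (λ z → + (z !)) (sym (ℕP.+-suc a n))))))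
    where
      lem : ∀ a n → 1ℤ + (a + n) - n ≡ 1ℤ + a
      lem = solve-∀
      lem' : ∀ a f b → a * f * b ≡ f * (a * b)
      lem' = solve-∀

  fall-zero : ∀ n k → k ℕ.< n → fall n (+ k) ≡ 0ℤ
  fall-zero (suc n) k (s≤s k≤n) with ℕP.m≤n⇒m<n∨m≡n k≤n
  ... | inj₁ k<n = trans (cong ((+ k - + n) *_) (fall-zero n k k<n)) (ℤP.*-zeroʳ (+ k - + n))
  ... | inj₂ refl = cong (_* fall k (+ k)) (ℤP.+-inverseʳ (+ k))

  window-zero : ∀ a n i → i ℕ.< n → window a n (+ (a ℕ.+ i)) ≡ 0ℤ
  window-zero a (suc n) i (s≤s i≤n) with ℕP.m≤n⇒m<n∨m≡n i≤n
  ... | inj₁ i<n = trans (cong ((+ (a ℕ.+ i) - + (a ℕ.+ n)) *_) (window-zero a n i i<n)) (ℤP.*-zeroʳ (+ (a ℕ.+ i) - + (a ℕ.+ n)))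
  ... | inj₂ refl = cong (_* window a i (+ (a ℕ.+ i))) (ℤP.+-inverseʳ (+ (a ℕ.+ i)))

  window-below : ∀ a n → window (suc a) n (+ a) ≡ sgn n * + (n !)
  window-below a zero = refl
  window-below a (suc n) = trans (cong₂ _*_ (lem (+ a) (+ n)) (window-below a n)) (trans (lem' (+ suc n) (sgn n) (+ (n !))) (cong (- sgn n *_) (sym (ℤP.pos-* (suc n) (n !)))))
    where
      lem : ∀ a n → a - (1ℤ + (a + n)) ≡ - (1ℤ + n)
      lem = solve-∀
      lem' : ∀ a b c → - a * (b * c) ≡ - b * (a * c)
      lem' = solve-∀

  window-above : ∀ a n j → window a n (+ (a ℕ.+ (n ℕ.+ j))) * + (j !) ≡ + ((n ℕ.+ j) !)
  window-above a zero j = ℤP.*-identityˡ _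
  window-above a (suc n) j = trans (cong₂ (λ s t → s * window a n (+ (a ℕ.+ t)) * + (j !)) (lem (+ a) (+ n) (+ j)) (sym (ℕP.+-suc n j)))
    (trans (lem' (+ suc j) (window a n (+ (a ℕ.+ (n ℕ.+ suc j)))) (+ (j !))) (trans (cong (window a n (+ (a ℕ.+ (n ℕ.+ suc j))) *_) (sym (ℤP.pos-* (suc j) (j !)))) (trans (window-above a n (suc j)) (cong (λ z → + (z !)) (ℕP.+-suc n j)))))
    where
      lem : ∀ a n j → a + (1ℤ + n + j) - (a + n) ≡ 1ℤ + j
      lem = solve-∀
      lem' : ∀ a f b → a * f * b ≡ f * (a * b)
      lem' = solve-∀

  window-deg : ∀ a n d f → (∀ x → iterδ d f x ≡ 0ℤ) → ∀ x → iterδ (n ℕ.+ d) (λ x → window a n x * f x) x ≡ 0ℤ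
  window-deg a zero d f h x = trans (iterδ-cong d (λ y → ℤP.*-identityˡ (f y)) x) (h x)
  window-deg a (suc n) d f h x = trans (iterδ-cong (suc n ℕ.+ d) (λ y → ℤP.*-assoc (y - + (a ℕ.+ n)) (window a n y) (f y)) x)
    (deg-linear (n ℕ.+ d) (λ y → window a n y * f y) (+ (a ℕ.+ n)) (window-deg a n d f h) x)

  fall-window : ∀ n x → fall n x ≡ window 0 n x * 1ℤ
  fall-window zero x = refl
  fall-window (suc n) x = trans (cong ((x - + n) *_) (fall-window n x)) (sym (ℤP.*-assoc (x - + n) _ 1ℤ))

  -- With A(w) = ∑ N_i w^i, the coefficients of A(w) (1 - w)^(2m+1) in degrees m+1, …, 2m vanish:
  -- they form the middle part of a polynomial on which the group generated by the two
  -- substitutions w ↦ 1/w and w ↦ w/(w-1) acts by a sign.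
  module Ratio (m' : ℕ) (N : ℕ → ℤ) (N-supp : Supp (suc m') N) (N-pal : ∀ i → i ℕ.≤ suc m' → N (suc m' ℕ.∸ i) ≡ N i)
    (ρ : ℤ → ℤ) (ρ-deg : ∀ x → iterδ (suc (suc m')) ρ x ≡ 0ℤ) (N-ρ : ∀ s → s ℕ.≤ suc m' → N s ≡ sgn s * iterδ s ρ 0ℤ)
    (ρ-reflect : ∀ x → ρ (+ (2 ℕ.* suc m' ℕ.+ 1) + + x) ≡ sgn (suc m') * sumN (suc (suc m')) (λ i → N i * bc i x)) where

    m J : ℕ
    m = suc m'
    J = 2 ℕ.* m ℕ.+ 1

    F : ℕ → ℤ
    F = mulp J N

    F-step : ∀ j s → s ℕ.≤ m → mulp j N (m ℕ.∸ s) ≡ sgn s * iterδ s ρ (+ j)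
    F-step zero s p = trans (N-pal s p) (N-ρ s p)
    F-step (suc j) s p with ℕP.m≤n⇒m<n∨m≡n p
    ... | inj₂ refl = trans (cong (mul (mulp j N)) (ℕP.n∸n≡0 m)) (trans (cong (mulp j N) (sym (ℕP.n∸n≡0 m))) (trans (F-step j m ℕP.≤-refl)
          (cong (sgn m *_) (trans (trans (sym (ℤP.+-identityʳ (iterδ m ρ (+ j)))) (cong (_+_ (iterδ m ρ (+ j))) (sym (ρ-deg (+ j))))) (trans (sym (iterδ-suc m ρ (+ j))) (cong (λ z → iterδ m ρ (+ z)) (ℕP.+-comm j 1)))))))
    ... | inj₁ s<m = trans (cong (mul (mulp j N)) e) (trans (cong₂ _-_ (trans (cong (mulp j N) (sym e)) (F-step j s p)) (F-step j (suc s) s<m))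
          (trans (lem (sgn s) (iterδ s ρ (+ j)) (iterδ (suc s) ρ (+ j))) (cong (sgn s *_) (trans (sym (iterδ-suc s ρ (+ j))) (cong (λ z → iterδ s ρ (+ z)) (ℕP.+-comm j 1))))))
      where
        e : m ℕ.∸ s ≡ suc (m ℕ.∸ suc s)
        e = ℕP.+-∸-assoc 1 s<m
        lem : ∀ a b c → a * b - - a * c ≡ a * (b + c)
        lem = solve-∀

    F-low : ∀ s → s ℕ.≤ m → F (m ℕ.∸ s) ≡ sgn s * (sgn m * sumN (suc m) (λ i → N i * cb i s))
    F-low s p = trans (F-step J s p) (cong (sgn s *_) (trans (cong (iterδ s ρ) (sym (ℤP.+-identityʳ (+ J)))) (trans (iterδ-iterd s ρ (+ J) (sgn m) σ ρ-reflect 0)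
        (cong (sgn m *_) (trans (iterd-sumN s (suc m) (λ i x → N i * bc i x) 0) (sumN-cong (suc m) (λ i _ → trans (iterd-* s (N i) (bc i) 0) (cong (N i *_) (iterd-bc i s)))))))))
      where
        σ : ℕ → ℤ
        σ x = sumN (suc m) (λ i → N i * bc i x)

    A D : ℤ → ℤ → ℤ
    A = hom m N
    D = hom m F

    A-sym : ∀ X Y → A Y X ≡ A X Y
    A-sym X Y = trans (hom-reverse m N X Y) (hom-cong m X Y N-pal)

    D-A : ∀ X Y → D X Y ≡ A (- X) (Y - X)
    D-A X Y = trans (sumN-reverse m _) (trans (sumN-cong (suc m) term) (trans (sumN-swap (suc m) (suc m) _)
      (trans (sumN-cong (suc m) inner) (sym (trans (hom-reverse m N (Y - X) (- X)) (sumN-cong (suc m) λ { i (s≤s p) → cong₂ _*_ (N-pal i p) (ℤP.*-comm ((Y - X) ^ i) _) }))))))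
      where
        g : ℕ → ℕ → ℤ
        g s i = N i * (cb i s * ((- X) ^ (m ℕ.∸ s) * Y ^ s))
        term : ∀ s → s ℕ.< suc m → F (m ℕ.∸ s) * (X ^ (m ℕ.∸ s) * Y ^ (m ℕ.∸ (m ℕ.∸ s))) ≡ sumN (suc m) (g s)
        term s (s≤s p) = trans (cong₂ (λ u v → u * (X ^ (m ℕ.∸ s) * Y ^ v)) (F-low s p) (ℕP.m∸[m∸n]≡n p))
          (trans (lem (sgn s) (sgn m) (sumN (suc m) (λ i → N i * cb i s)) (X ^ (m ℕ.∸ s)) (Y ^ s))
          (trans (cong (λ z → z * X ^ (m ℕ.∸ s) * Y ^ s * sumN (suc m) (λ i → N i * cb i s)) (sgn-∸ p))
          (trans (cong (λ z → z * Y ^ s * sumN (suc m) (λ i → N i * cb i s)) (sym (neg-^ X (m ℕ.∸ s))))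
          (trans (sym (sumN-* (suc m) ((- X) ^ (m ℕ.∸ s) * Y ^ s) (λ i → N i * cb i s))) (sumN-cong (suc m) (λ i _ → lem' ((- X) ^ (m ℕ.∸ s)) (Y ^ s) (N i) (cb i s)))))))
          where
            lem : ∀ a b c x y → a * (b * c) * (x * y) ≡ a * b * x * y * c
            lem = solve-∀
            lem' : ∀ x y n c → x * y * (n * c) ≡ n * (c * (x * y))
            lem' = solve-∀
        inner : ∀ i → i ℕ.< suc m → sumN (suc m) (λ s → g s i) ≡ N i * ((- X) ^ (m ℕ.∸ i) * (Y - X) ^ i)
        inner i (s≤s p) = trans (sumN-* (suc m) (N i) _) (cong (N i *_) (binomial i m (- X) Y p))

    d : ℕ
    d = J ℕ.+ m

    mid : ℕ → ℤ
    mid j = F (suc m ℕ.+ j)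

    d-split : suc d ≡ suc m ℕ.+ m ℕ.+ suc m
    d-split = lem m
      where lem : ∀ m → suc (2 ℕ.* m ℕ.+ 1 ℕ.+ m) ≡ suc m ℕ.+ m ℕ.+ suc m
            lem = solveℕ

    F-top : ∀ j → j ℕ.≤ m → F (J ℕ.+ j) ≡ - F (m ℕ.∸ j)
    F-top j p = trans (cong F (sym (trans (ℕP.+-∸-assoc J (ℕP.m∸n≤m m j)) (cong (J ℕ.+_) (ℕP.m∸[m∸n]≡n p)))))
      (trans (mulp-anti J m N N-supp N-pal (m ℕ.∸ j) (ℕP.≤-trans (ℕP.m∸n≤m m j) (ℕP.m≤n+m m J)))
        (trans (cong (_* F (m ℕ.∸ j)) sgn-J) (ℤP.-1*i≡-i _)))
      where
        even : ∀ k → sgn (k ℕ.+ k) ≡ 1ℤ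
        even zero = refl
        even (suc k) = trans (cong (λ z → - sgn z) (ℕP.+-suc k k)) (trans (ℤP.neg-involutive (sgn (k ℕ.+ k))) (even k))
        sgn-J : sgn J ≡ -1ℤ
        sgn-J = trans (cong sgn (lem m)) (cong -_ (even m))
          where lem : ∀ m → 2 ℕ.* m ℕ.+ 1 ≡ suc (m ℕ.+ m)
                lem = solveℕ

    three-term : ∀ X Y → hom d F X Y ≡ Y ^ J * D X Y + (X ^ suc m * Y ^ suc m) * hom m' mid X Y - X ^ J * D Y X
    three-term X Y = trans (cong (λ z → sumN z h) d-split) (trans (sumN-split (suc m ℕ.+ m) (suc m) h) (trans (cong (_+ sumN (suc m) (λ i → h (suc m ℕ.+ m ℕ.+ i))) (sumN-split (suc m) m h))
        (cong₂ _+_ (cong₂ _+_ part1 part2) part3)))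
      where
        h : ℕ → ℤ
        h k = F k * (X ^ k * Y ^ (d ℕ.∸ k))
        part1 : sumN (suc m) h ≡ Y ^ J * D X Y
        part1 = trans (sumN-cong (suc m) λ { k (s≤s p) → trans (cong (λ z → F k * (X ^ k * z)) (trans (cong (Y ^_) (ℕP.+-∸-assoc J p)) (^-+ Y J (m ℕ.∸ k)))) (lem (F k) (X ^ k) (Y ^ J) (Y ^ (m ℕ.∸ k))) })
            (sumN-* (suc m) (Y ^ J) _)
          where lem : ∀ a b c e → a * (b * (c * e)) ≡ c * (a * (b * e))
                lem = solve-∀
        part2 : sumN m (λ i → h (suc m ℕ.+ i)) ≡ (X ^ suc m * Y ^ suc m) * hom m' mid X Y
        part2 = trans (sumN-cong m λ { j (s≤s p) → trans (cong₂ (λ s t → F (suc m ℕ.+ j) * (s * t)) (^-+ X (suc m) j) (trans (cong (Y ^_) (e j p)) (^-+ Y (suc m) (m' ℕ.∸ j))))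
              (lem (F (suc m ℕ.+ j)) (X ^ suc m) (X ^ j) (Y ^ suc m) (Y ^ (m' ℕ.∸ j))) })
            (sumN-* m (X ^ suc m * Y ^ suc m) _)
          where
            lem : ∀ a b c e f → a * ((b * c) * (e * f)) ≡ (b * e) * (a * (c * f))
            lem = solve-∀
            e : ∀ j → j ℕ.≤ m' → d ℕ.∸ (suc m ℕ.+ j) ≡ suc m ℕ.+ (m' ℕ.∸ j)
            e j p = trans (cong (ℕ._∸ (suc m ℕ.+ j)) (lem' m')) (trans (sym (ℕP.∸-+-assoc (suc m ℕ.+ (suc m ℕ.+ m')) (suc m) j)) (trans (cong (ℕ._∸ j) (ℕP.m+n∸m≡n (suc m) (suc m ℕ.+ m'))) (ℕP.+-∸-assoc (suc m) p)))
              where lem' : ∀ m' → 2 ℕ.* suc m' ℕ.+ 1 ℕ.+ suc m' ≡ suc (suc m') ℕ.+ (suc (suc m') ℕ.+ m')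
                    lem' = solveℕ
        part3 : sumN (suc m) (λ i → h (suc m ℕ.+ m ℕ.+ i)) ≡ - (X ^ J * D Y X)
        part3 = trans (sumN-cong (suc m) λ { j (s≤s p) → trans (cong (λ z → h (z ℕ.+ j)) eJ) (trans (cong₂ (λ s t → s * t) (F-top j p) (cong₂ _*_ (^-+ X J j) (cong (Y ^_) (ℕP.[m+n]∸[m+o]≡n∸o J m j)))) (lem (F (m ℕ.∸ j)) (X ^ J) (X ^ j) (Y ^ (m ℕ.∸ j)))) })
            (trans (sumN-* (suc m) (- X ^ J) _) (trans (cong (- X ^ J *_) (sym (hom-reverse m F X Y))) (lem' (X ^ J) (D Y X))))
          where
            lem : ∀ a b c e → - a * ((b * c) * e) ≡ - b * (a * (c * e))
            lem = solve-∀
            lem' : ∀ a b → - a * b ≡ - (a * b)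
            lem' = solve-∀
            eJ : suc m ℕ.+ m ≡ J
            eJ = lem'' m
              where lem'' : ∀ m → suc m ℕ.+ m ≡ 2 ℕ.* m ℕ.+ 1
                    lem'' = solveℕ

    f1 : ∀ X Y → hom d F X Y ≡ (Y - X) ^ J * A X Y
    f1 X Y = hom-mulp J m N X Y N-supp

    sgn-even : sgn J ≡ -1ℤ
    sgn-even = trans (cong sgn (lem m)) (cong -_ (even m))
      where
        lem : ∀ m → 2 ℕ.* m ℕ.+ 1 ≡ suc (m ℕ.+ m)
        lem = solveℕ
        even : ∀ k → sgn (k ℕ.+ k) ≡ 1ℤ
        even zero = refl
        even (suc k) = trans (cong (λ z → - sgn z) (ℕP.+-suc k k)) (trans (ℤP.neg-involutive (sgn (k ℕ.+ k))) (even k))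

    M : ℤ → ℤ → ℤ
    M X Y = (X ^ suc m * Y ^ suc m) * hom m' mid X Y

    M-flip : ∀ X Y → M X Y + M (- X) (Y - X) ≡ 0ℤ
    M-flip X Y = trans (cong₂ _+_ (iso (hom d F X Y) (Y ^ J * D X Y) (M X Y) (X ^ J * D Y X) (three-term X Y))
                                  (iso (hom d F (- X) (Y - X)) ((Y - X) ^ J * D (- X) (Y - X)) (M (- X) (Y - X)) ((- X) ^ J * D (Y - X) (- X)) (three-term (- X) (Y - X))))
      (trans (cong₂ _+_ (cong (λ z → z - Y ^ J * D X Y + X ^ J * D Y X) (f1 X Y))
                (cong₂ (λ s t → s - (Y - X) ^ J * t + (- X) ^ J * D (Y - X) (- X)) (trans (f1 (- X) (Y - X)) (cong₂ (λ s t → s ^ J * t) (e1 X Y) (sym (D-A X Y)))) dA))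
      (trans (cong (λ z → ((Y - X) ^ J * A X Y - Y ^ J * D X Y + X ^ J * D Y X) + (Y ^ J * D X Y - (Y - X) ^ J * A X Y + z)) (cong₂ _*_ (trans (neg-^ X J) (cong (_* X ^ J) sgn-even)) dd))
        (lem ((Y - X) ^ J * A X Y) (Y ^ J * D X Y) (X ^ J) (D Y X))))
      where
        iso : ∀ f a b c → f ≡ a + b - c → b ≡ f - a + c
        iso .(a + b - c) a b c refl = go a b c
          where go : ∀ a b c → b ≡ a + b - c - a + c
                go = solve-∀
        e1 : ∀ X Y → Y - X - - X ≡ Y
        e1 = solve-∀
        dA : D (- X) (Y - X) ≡ A X Y
        dA = trans (D-A (- X) (Y - X)) (cong₂ A (ℤP.neg-involutive X) (e1 X Y))
        dd : D (Y - X) (- X) ≡ D Y X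
        dd = trans (D-A (Y - X) (- X)) (trans (A-sym (- X - (Y - X)) (- (Y - X))) (trans (cong₂ A (e2 X Y) (e3 X Y)) (sym (D-A Y X))))
          where
            e2 : ∀ X Y → - X - (Y - X) ≡ - Y
            e2 = solve-∀
            e3 : ∀ X Y → - (Y - X) ≡ X - Y
            e3 = solve-∀
        lem : ∀ a b x e → (a - b + x * e) + (b - a + -1ℤ * x * e) ≡ 0ℤ
        lem = solve-∀

    mid-zero : ∀ k → k ℕ.< m → mid k ≡ 0ℤ
    mid-zero = λ k k<m → trans (sym (mid'-≤ k k<m)) (trans (cmp k (ℕP.≤-trans k<m (ℕP.≤-trans (ℕP.n≤1+n m) (ℕP.≤-trans (ℕP.m≤m+n (suc m) m') (ℕP.≤-trans (ℕP.n≤1+n E) (ℕP.n≤1+n (suc E)))))))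
        (trans (cong (- sgn (suc m) *_) (mulp-0 (suc m) g'-zero k)) (ℤP.*-zeroʳ (- sgn (suc m)))))
      where
        g' : ℕ → ℤ
        g' = proj₁ (subst-coef m' mid)
        g'-supp : Supp m' g'
        g'-supp = proj₁ (proj₂ (subst-coef m' mid))
        mid' : ℕ → ℤ
        mid' k with k ℕP.<? m
        ... | yes _ = mid k
        ... | no _ = 0ℤ
        mid'-≤ : ∀ k → k ℕ.< m → mid' k ≡ mid k
        mid'-≤ k p with k ℕP.<? m
        ... | yes _ = refl
        ... | no np = contradiction p np
        mid'-≥ : ∀ k → m ℕ.≤ k → mid' k ≡ 0ℤ
        mid'-≥ k p with k ℕP.<? m
        ... | yes q = contradiction p (ℕP.<⇒≱ q)
        ... | no _ = refl
        E : ℕ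
        E = suc m ℕ.+ m'
        mid'-poly : ∀ w → poly (suc E) mid' w ≡ hom m' mid w 1ℤ
        mid'-poly w = trans (poly-sum (suc E) mid' w) (trans (cong (λ z → sumN z (λ k → mid' k * w ^ k)) (lem m'))
            (trans (sumN-split m (suc m) _) (trans (cong₂ _+_ (sumN-cong m (λ k p → cong (_* w ^ k) (mid'-≤ k p))) (sumN-0 (suc m) (λ i _ → cong (_* w ^ (m ℕ.+ i)) (mid'-≥ (m ℕ.+ i) (ℕP.m≤m+n m i)))))
              (trans (ℤP.+-identityʳ _) (trans (sym (poly-sum m mid w)) (sym (hom-poly m' mid w)))))))
          where lem : ∀ m' → suc (suc (suc m') ℕ.+ m') ≡ suc m' ℕ.+ suc (suc m')
                lem = solveℕ
        diff : ℕ → ℤ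
        diff k = mid' k + sgn (suc m) * mulp (suc m) g' k
        poly-diff : ∀ D w → poly D diff w ≡ poly D mid' w + sgn (suc m) * poly D (mulp (suc m) g') w
        poly-diff D w = trans (poly-sum D diff w) (trans (sumN-cong D (λ k _ → lem (mid' k) (sgn (suc m)) (mulp (suc m) g' k) (w ^ k)))
            (trans (sumN-+ D _ _) (cong₂ _+_ (sym (poly-sum D mid' w)) (trans (sumN-* D (sgn (suc m)) _) (cong (sgn (suc m) *_) (sym (poly-sum D (mulp (suc m) g') w)))))))
          where lem : ∀ a b c e → (a + b * c) * e ≡ a * e + b * (c * e)
                lem = solve-∀
        pow-nz : ∀ w .{{_ : NonZero w}} k → NonZero (w ^ k)
        pow-nz w zero = _
        pow-nz w {{nz}} (suc k) = ℤP.i*j≢0 w (w ^ k) {{nz}} {{pow-nz w {{nz}} k}}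
        vanish : ∀ w .{{_ : NonZero w}} → poly (suc E) diff w ≡ 0ℤ
        vanish w = ℤP.*-cancelˡ-≡ (w ^ suc m) (poly (suc E) diff w) 0ℤ {{pow-nz w (suc m)}}
          (trans (cong (w ^ suc m *_) (trans (poly-diff (suc E) w) (cong₂ (λ s t → s + sgn (suc m) * t) (mid'-poly w)
              (trans (sym (hom-poly E (mulp (suc m) g') w)) (trans (hom-mulp (suc m) m' g' w 1ℤ g'-supp) (cong ((1ℤ - w) ^ suc m *_) (sym (proj₂ (proj₂ (subst-coef m' mid)) w 1ℤ))))))))
            (trans (trans (lem (w ^ suc m) (hom m' mid w 1ℤ) (sgn (suc m)) ((1ℤ - w) ^ suc m) (hom m' mid (- w) (1ℤ - w)))
               (cong₂ (λ s t → (w ^ suc m * s) * hom m' mid w 1ℤ + (t * (1ℤ - w) ^ suc m) * hom m' mid (- w) (1ℤ - w)) (sym (1^ (suc m))) (sym (neg-^ w (suc m)))))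
              (trans (M-flip w 1ℤ) (sym (ℤP.*-zeroʳ (w ^ suc m))))))
          where lem : ∀ x h g y h' → x * (h + g * (y * h')) ≡ (x * 1ℤ) * h + ((g * x) * y) * h'
                lem = solve-∀
        cmp : ∀ k → k ℕ.< suc (suc E) → mid' k ≡ - sgn (suc m) * mulp (suc m) g' k
        cmp k p with k ℕP.<? suc E
        ... | yes q = lem (mid' k) (sgn (suc m)) (mulp (suc m) g' k) (poly-zero (suc E) diff vanish k q)
          where lem : ∀ a b c → a + b * c ≡ 0ℤ → a ≡ - b * c
                lem a b c e = trans (go a b c) (trans (cong (λ z → z + - b * c) e) (ℤP.+-identityˡ (- b * c)))
                  where go : ∀ a b c → a ≡ a + b * c + - b * c
                        go = solve-∀
        ... | no q = trans (mid'-≥ k (ℕP.≤-trans (ℕP.≤-trans (ℕP.n≤1+n m) (ℕP.≤-trans (ℕP.m≤m+n (suc m) m') (ℕP.n≤1+n E))) (ℕP.≮⇒≥ q)))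
              (sym (trans (cong (- sgn (suc m) *_) (mulp-supp (suc m) g'-supp k (ℕP.≮⇒≥ q))) (ℤP.*-zeroʳ (- sgn (suc m)))))
        g'-zero : ∀ k → g' k ≡ 0ℤ
        g'-zero = mulp-zero (suc m) g' m' m g'-supp (ℕP.n≤1+n m) (λ k p → cancel k p)
          where
            cancel : ∀ k → m ℕ.≤ k → mulp (suc m) g' k ≡ 0ℤ
            cancel k p with k ℕP.<? suc (suc E)
            ... | no q = mulp-supp (suc m) g'-supp k (ℕP.≤-trans (ℕP.n≤1+n (suc E)) (ℕP.≮⇒≥ q))
            ... | yes q = trans (sym (ℤP.*-identityˡ (mulp (suc m) g' k))) (trans (cong (_* mulp (suc m) g' k) (sym (sgn-sq (suc m)))) (trans (lem (sgn (suc m)) (mulp (suc m) g' k))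
                    (trans (cong (λ z → - sgn (suc m) * z) (sym (cmp k q))) (trans (cong (- sgn (suc m) *_) (mid'-≥ k p)) (ℤP.*-zeroʳ (- sgn (suc m)))))))
              where lem : ∀ a c → a * a * c ≡ - a * (- a * c)
                    lem = solve-∀
        mulp-0 : ∀ j {c} → (∀ k → c k ≡ 0ℤ) → ∀ k → mulp j c k ≡ 0ℤ
        mulp-0 zero e k = e k
        mulp-0 (suc j) e zero = mulp-0 j e 0
        mulp-0 (suc j) e (suc k) = cong₂ _-_ (mulp-0 j e (suc k)) (mulp-0 j e k)

    test : ℤ → ℤ
    test x = window (suc J) m' x * fall (suc m) x

    test-deg : ∀ x → iterδ J test x ≡ 0ℤ
    test-deg x = trans (cong (λ z → iterδ z test x) (lem m')) (window-deg (suc J) m' (suc (suc m)) (fall (suc m)) (λ y → trans (iterδ-cong (suc (suc m)) (fall-window (suc m)) y)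
        (trans (cong (λ z → iterδ z (λ x → window 0 (suc m) x * 1ℤ) y) (ℕP.+-comm 1 (suc m))) (window-deg 0 (suc m) 1 (λ _ → 1ℤ) (λ _ → refl) y))) x)
      where lem : ∀ m' → 2 ℕ.* suc m' ℕ.+ 1 ≡ m' ℕ.+ suc (suc (suc m'))
            lem = solveℕ

    two-terms : F J * test (+ J) + F d * test (+ d) ≡ 0ℤ
    two-terms = trans (sym collapse) (sum-mulp J m N test N-supp test-deg)
      where
        h : ℕ → ℤ
        h k = F k * test (+ k)
        eJ : suc m ℕ.+ m ≡ J
        eJ = lem'' m
          where lem'' : ∀ m → suc m ℕ.+ m ≡ 2 ℕ.* m ℕ.+ 1
                lem'' = solveℕ
        low : ∀ k → k ℕ.< suc m → h k ≡ 0ℤ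
        low k p = trans (cong (λ z → F k * (window (suc J) m' (+ k) * z)) (fall-zero (suc m) k p)) (trans (cong (F k *_) (ℤP.*-zeroʳ (window (suc J) m' (+ k)))) (ℤP.*-zeroʳ (F k)))
        middle : ∀ k → k ℕ.< m → h (suc m ℕ.+ k) ≡ 0ℤ
        middle k p = cong (_* test (+ (suc m ℕ.+ k))) (mid-zero k p)
        high : ∀ k → k ℕ.< m' → h (suc m ℕ.+ m ℕ.+ suc k) ≡ 0ℤ
        high k p = trans (cong h (trans (cong (ℕ._+ suc k) eJ) (ℕP.+-suc J k))) (trans (cong (λ z → F (suc J ℕ.+ k) * (z * fall (suc m) (+ (suc J ℕ.+ k)))) (window-zero (suc J) m' k p)) (ℤP.*-zeroʳ (F (suc J ℕ.+ k))))
        collapse : sumN (suc (J ℕ.+ m)) h ≡ h J + h d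
        collapse = trans (cong (λ z → sumN z h) d-split) (trans (sumN-split (suc m ℕ.+ m) (suc m) h)
          (cong₂ _+_ (trans (sumN-split (suc m) m h) (cong₂ _+_ (sumN-0 (suc m) low) (sumN-0 m middle))) refl) ⟨trans⟩
          (trans (ℤP.+-identityˡ _) (cong₂ _+_ (trans (sumN-head m' (λ i → h (suc m ℕ.+ m ℕ.+ i))) (trans (cong₂ _+_ (cong h (trans (ℕP.+-identityʳ (suc m ℕ.+ m)) eJ)) (sumN-0 m' high)) (ℤP.+-identityʳ (h J))))
            (cong (λ z → h (z ℕ.+ m)) eJ))))
          where
            _⟨trans⟩_ : ∀ {a b c : ℤ} → a ≡ b → b ≡ c → a ≡ c
            _⟨trans⟩_ = trans

    total : ℤ
    total = sumN (suc m) N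

    F-J : F J ≡ - (sgn m * total)
    F-J = trans (cong F (sym (ℕP.+-identityʳ J))) (trans (F-top 0 z≤n) (cong -_ (trans (F-low 0 z≤n) (trans (ℤP.*-identityˡ _) (cong (sgn m *_) (sumN-cong (suc m) (λ i _ → trans (cong (N i *_) (cb-0 i)) (ℤP.*-identityʳ (N i)))))))))

    F-d : F d ≡ - N 0
    F-d = trans (F-top m ℕP.≤-refl) (cong -_ (trans (cong F (ℕP.n∸n≡0 m)) (F0 J)))
      where
        F0 : ∀ j → mulp j N 0 ≡ N 0
        F0 zero = refl
        F0 (suc j) = F0 j

    ratio : total * + (J !) * + ((2 ℕ.* m) !) ≡ N 0 * + ((3 ℕ.* m ℕ.+ 1) !) * + (m !)
    ratio = ℤP.*-cancelˡ-≡ (+ (m' !)) _ _ {{m' ℕP.!≢0}} (trans (lem (+ (m' !)) total (+ (J !)) (+ ((2 ℕ.* m) !)))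
      (trans (cong (λ z → total * z * + ((2 ℕ.* m) !) * + (m' !)) (sym fJ)) (trans (trans (trans (sym (ℤP.*-identityˡ (total * (fall (suc m) (+ J) * + (m !)) * + ((2 ℕ.* m) !) * + (m' !)))) (cong (λ z → z * (total * (fall (suc m) (+ J) * + (m !)) * + ((2 ℕ.* m) !) * + (m' !))) (sym (sgn-sq m')))) (lem1 (sgn m') total (fall (suc m) (+ J)) (+ (m !)) (+ ((2 ℕ.* m) !)) (+ (m' !))))
      (trans (cong (λ z → z * + (m !) * + ((2 ℕ.* m) !)) main) (trans (lem2 (N 0) (+ (m' !)) (fall (suc m) (+ d)) (+ (m !)) (+ ((2 ℕ.* m) !))) (cong (λ z → + (m' !) * (N 0 * z * + (m !))) fd))))))
      where
        fJ : fall (suc m) (+ J) * + (m !) ≡ + (J !)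
        fJ = trans (cong (λ z → fall (suc m) (+ z) * + (m !)) (e m)) (trans (fall-value m (suc m)) (cong (λ z → + (z !)) (sym (e m))))
          where e : ∀ m → 2 ℕ.* m ℕ.+ 1 ≡ m ℕ.+ suc m
                e = solveℕ
        fd : fall (suc m) (+ d) * + ((2 ℕ.* m) !) ≡ + ((3 ℕ.* m ℕ.+ 1) !)
        fd = trans (cong (λ z → fall (suc m) (+ z) * + ((2 ℕ.* m) !)) (e m)) (trans (fall-value (2 ℕ.* m) (suc m)) (cong (λ z → + (z !)) (e' m)))
          where
            e : ∀ m → 2 ℕ.* m ℕ.+ 1 ℕ.+ m ≡ 2 ℕ.* m ℕ.+ suc m
            e = solveℕ
            e' : ∀ m → 2 ℕ.* m ℕ.+ suc m ≡ 3 ℕ.* m ℕ.+ 1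
            e' = solveℕ
        testJ : test (+ J) ≡ sgn m' * + (m' !) * fall (suc m) (+ J)
        testJ = cong (_* fall (suc m) (+ J)) (window-below J m')
        testd : test (+ d) ≡ + (m' !) * fall (suc m) (+ d)
        testd = cong (_* fall (suc m) (+ d)) (trans (cong (λ z → window (suc J) m' (+ z)) (e m')) (trans (sym (ℤP.*-identityʳ _)) (trans (window-above (suc J) m' 0) (cong (λ z → + (z !)) (ℕP.+-identityʳ m')))))
          where e : ∀ m' → 2 ℕ.* suc m' ℕ.+ 1 ℕ.+ suc m' ≡ suc (2 ℕ.* suc m' ℕ.+ 1) ℕ.+ (m' ℕ.+ 0)
                e = solveℕ
        main : sgn m' * sgn m' * (total * fall (suc m) (+ J) * + (m' !)) ≡ N 0 * + (m' !) * fall (suc m) (+ d)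
        main = trans (lem3 (sgn m') total (fall (suc m) (+ J)) (+ (m' !)) (N 0) (fall (suc m) (+ d)))
          (trans (cong (_+ N 0 * + (m' !) * fall (suc m) (+ d)) (trans (sym (cong₂ _+_ (cong₂ _*_ F-J testJ) (cong₂ _*_ F-d testd))) two-terms)) (ℤP.+-identityˡ _))
          where lem3 : ∀ s t f q n g → s * s * (t * f * q) ≡ (- (- s * t) * (s * q * f) + - n * (q * g)) + n * q * g
                lem3 = solve-∀
        lem : ∀ a b c e → a * (b * c * e) ≡ b * c * e * a
        lem = solve-∀
        lem1 : ∀ s t f a b c → s * s * (t * (f * a) * b * c) ≡ s * s * (t * f * c) * a * b
        lem1 = solve-∀
        lem2 : ∀ n q g a b → n * q * g * a * b ≡ q * (n * (g * b) * a)
        lem2 = solve-∀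

module TriangleRatio where
  open Wedge using (δ; bin; δ-bin)
  open TriangleFunction
  open RowSums
  open MonotoneTriangles
  open Polynomials
  open RefinedRatio
  open import Data.Nat.Base using (_!)
  open import Data.Integer.Base using (ℤ; +_; -[1+_]; 0ℤ; 1ℤ; _+_; _*_; _-_; -_; ∣_∣)
  open import Data.List.Base using (List; []; _∷_)
  open import Data.Vec.Base using (Vec; []; _∷_; _∷ʳ_)

  private variable A : Set

  iota : ℤ → ∀ n → Vec ℤ n
  iota k zero = []
  iota k (suc n) = k ∷ iota (k + 1ℤ) n

  iota-strict : ∀ k n → Strict k (iota (k + 1ℤ) n)
  iota-strict k zero = tt
  iota-strict k (suc n) = ≼-refl , iota-strict (k + 1ℤ) n

  iota-∷ʳ : ∀ k n → iota k (suc n) ≡ iota k n ∷ʳ (k + + n)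
  iota-∷ʳ k zero = cong (_∷ []) (sym (ℤP.+-identityʳ k))
  iota-∷ʳ k (suc n) = cong (k ∷_) (trans (iota-∷ʳ (k + 1ℤ) n) (cong (λ z → iota (k + 1ℤ) n ∷ʳ z) (ℤP.+-assoc k 1ℤ (+ n))))

  incr-iota : ∀ k n → incr (iota k n) ≡ iota (k + 1ℤ) n
  incr-iota k zero = refl
  incr-iota k (suc n) = cong ((k + 1ℤ) ∷_) (incr-iota (k + 1ℤ) n)

  ind : ℕ → ℕ → ℤ
  ind zero zero = 1ℤ
  ind zero (suc i) = 0ℤ
  ind (suc a) zero = 0ℤ
  ind (suc a) (suc i) = ind a i

  ind-≡ : ∀ a → ind a a ≡ 1ℤ
  ind-≡ zero = refl
  ind-≡ (suc a) = ind-≡ a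

  ind-≢ : ∀ {a i} → a ≢ i → ind a i ≡ 0ℤ
  ind-≢ {zero} {zero} ne = contradiction refl ne
  ind-≢ {zero} {suc i} ne = refl
  ind-≢ {suc a} {zero} ne = refl
  ind-≢ {suc a} {suc i} ne = ind-≢ (λ e → ne (cong suc e))

  ind-sym : ∀ a i → ind a i ≡ ind i a
  ind-sym zero zero = refl
  ind-sym zero (suc i) = refl
  ind-sym (suc a) zero = refl
  ind-sym (suc a) (suc i) = ind-sym a i

  sum-ind : ∀ n a (g : ℕ → ℤ) → a ℕ.< n → sumN n (λ i → ind a i * g i) ≡ g a
  sum-ind (suc n) a g (s≤s a≤n) with ℕP.m≤n⇒m<n∨m≡n a≤n
  ... | inj₁ a<n = trans (cong₂ _+_ (sum-ind n a g a<n) (cong (_* g n) (ind-≢ (ℕP.<⇒≢ a<n)))) (ℤP.+-identityʳ (g a))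
  ... | inj₂ refl = trans (cong₂ _+_ (sumN-0 n (λ i i<n → cong (_* g i) (ind-≢ (λ e → ℕP.<⇒≢ i<n (sym e))))) (trans (cong (_* g a) (ind-≡ a)) (ℤP.*-identityˡ (g a)))) (ℤP.+-identityˡ (g a))

  distribution : (A → ℕ) → List A → ℕ → ℤ
  distribution stat xs i = sumL (λ t → ind (stat t) i) xs

  sumL-*ʳ : ∀ (f : A → ℤ) c xs → sumL (λ x → f x * c) xs ≡ sumL f xs * c
  sumL-*ʳ f c [] = refl
  sumL-*ʳ f c (x ∷ xs) = trans (cong (_+_ (f x * c)) (sumL-*ʳ f c xs)) (sym (ℤP.*-distribʳ-+ c (f x) (sumL f xs)))

  sumN-sumL : ∀ n (f : ℕ → A → ℤ) xs → sumN n (λ i → sumL (f i) xs) ≡ sumL (λ x → sumN n (λ i → f i x)) xs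
  sumN-sumL zero f xs = sym (sumL-0 xs (λ _ → refl))
  sumN-sumL (suc n) f xs = trans (cong (_+ sumL (f n) xs) (sumN-sumL n f xs)) (sym (sumL-+ (λ x → sumN n (λ i → f i x)) (f n) xs))

  sum-distribution : ∀ n (stat : A → ℕ) (g : ℕ → ℤ) xs → (∀ t → stat t ℕ.< n) →
    sumN n (λ i → distribution stat xs i * g i) ≡ sumL (λ t → g (stat t)) xs
  sum-distribution n stat g xs h = trans (sumN-cong n (λ i _ → sym (sumL-*ʳ (λ t → ind (stat t) i) (g i) xs)))
    (trans (sumN-sumL n (λ i t → ind (stat t) i * g i) xs) (sumL-cong (λ t → sum-ind n (stat t) g (h t)) xs))

  statF-≤ : ∀ {m} K (t : Tri m) → statF {m} K t ℕ.≤ m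
  statF-≤ {zero} K t = z≤n
  statF-≤ {suc m} K ((l ∷ ls) , t) with l ℤP.≟ K
  ... | yes _ = s≤s (statF-≤ {m} K t)
  ... | no _ = z≤n

  statL-≤ : ∀ {m} K (t : Tri m) → statL {m} K t ℕ.≤ m
  statL-≤ {zero} K t = z≤n
  statL-≤ {suc m} K (l , t) with lst l ℤP.≟ K
  ... | yes _ = s≤s (statL-≤ {m} K t)
  ... | no _ = z≤n

  constant : ∀ (f : ℤ → ℤ) → (∀ x → δ f x ≡ 0ℤ) → ∀ x → f x ≡ f 0ℤ
  constant f h (+ zero) = refl
  constant f h (+ suc n) = trans (cong f (cong +_ (ℕP.+-comm 1 n))) (trans (ℤP.i-j≡0⇒i≡j _ _ (h (+ n))) (constant f h (+ n)))
  constant f h -[1+ zero ] = sym (ℤP.i-j≡0⇒i≡j _ _ (h -[1+ zero ]))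
  constant f h -[1+ suc n ] = trans (sym (ℤP.i-j≡0⇒i≡j _ _ (h -[1+ suc n ]))) (constant f h -[1+ n ])

  poly-determined : ∀ d c (f : ℤ → ℤ) → (∀ x → iterδ d f x ≡ 0ℤ) → (∀ x → f -[1+ c ℕ.+ x ] ≡ 0ℤ) → ∀ x → f x ≡ 0ℤ
  poly-determined zero c f h z = h
  poly-determined (suc d) c f h z x = trans (constant f (poly-determined d (suc c) (δ f) h (λ x → cong₂ _-_ (z x) (trans (cong (λ k → f -[1+ k ]) (sym (ℕP.+-suc c x))) (z (suc x))))) x)
    (trans (sym (constant f (poly-determined d (suc c) (δ f) h (λ x → cong₂ _-_ (z x) (trans (cong (λ k → f -[1+ k ]) (sym (ℕP.+-suc c x))) (z (suc x))))) -[1+ c ℕ.+ 0 ])) (z 0))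

  bin-neg : ∀ i x → bin i -[1+ x ] ≡ sgn i * bc i x
  bin-neg zero x = refl
  bin-neg (suc i) zero = trans (cong -_ (bin-neg i zero)) (lem (sgn i) (bc i 0))
    where lem : ∀ a b → - (a * b) ≡ - a * (0ℤ + b)
          lem = solve-∀
  bin-neg (suc i) (suc x) = trans (cong₂ _-_ (bin-neg (suc i) x) (bin-neg i (suc x))) (lem (sgn i) (bc (suc i) x) (bc i (suc x)))
    where lem : ∀ a b c → - a * b - a * c ≡ - a * (b + c)
          lem = solve-∀

  iterδ-bin : ∀ i s → iterδ s (bin i) 0ℤ ≡ ind i s
  iterδ-bin zero zero = refl
  iterδ-bin (suc i) zero = refl
  iterδ-bin zero (suc s) = iterδ-0 s 0ℤ
  iterδ-bin (suc i) (suc s) = trans (iterδ-cong s (δ-bin i) 0ℤ) (iterδ-bin i s)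

  iterδ-sumN : ∀ k n (f : ℕ → ℤ → ℤ) x → iterδ k (λ y → sumN n (λ i → f i y)) x ≡ sumN n (λ i → iterδ k (f i) x)
  iterδ-sumN zero n f x = refl
  iterδ-sumN (suc k) n f x = trans (iterδ-cong k (λ y → sym (sumN-minus n (λ i → f i (y + 1ℤ)) (λ i → f i y))) x) (iterδ-sumN k n (λ i → δ (f i)) x)

  bin-deg-≤ : ∀ i d → i ℕ.≤ d → ∀ x → iterδ (suc d) (bin i) x ≡ 0ℤ
  bin-deg-≤ zero d _ x = iterδ-0 d x
  bin-deg-≤ (suc i) (suc d) (s≤s p) x = trans (iterδ-cong (suc d) (δ-bin i) x) (bin-deg-≤ i d p x)

  rows-iota : ∀ k n → rows k (iota k n) ≡ iota k n ∷ []
  rows-iota k zero = refl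
  rows-iota k (suc n) rewrite trans (cong (λ z → ∣ z - k ∣) (sym (ℤP.+-identityʳ k))) (∣lo+c-lo∣ k 0) | ℤP.+-identityʳ k | next-≡ {k} refl | rows-iota (k + 1ℤ) n = refl

  a : ℕ → ℤ
  a m = cnt m (iota 0ℤ (suc m))

  module _ (m' : ℕ) where
    private
      m : ℕ
      m = suc m'

    triangles : List (Tri m)
    triangles = tris m (iota 0ℤ (suc m))

    NL NF : ℕ → ℤ
    NL = distribution (statL {m} (+ m)) triangles
    NF = distribution (statF {m} 0ℤ) triangles

    module _ (pal : ∀ i → i ℕ.≤ m → NL (m ℕ.∸ i) ≡ NL i) (NF≡NL : ∀ i → i ℕ.≤ m → NF i ≡ NL i) where
      ρ₀ : ℤ → ℤ
      ρ₀ r = α (suc m) ((r + 1ℤ) ∷ iota 1ℤ m)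

      σ : ℕ → ℤ
      σ x = sumN (suc m) (λ i → NL i * bc i x)

      σ-last : ∀ x → σ x ≡ α (suc m) (iota 0ℤ m ∷ʳ (+ m + + x))
      σ-last x = trans (sum-distribution (suc m) (statL {m} (+ m)) (λ i → bc i x) triangles (λ t → s≤s (statL-≤ {m} (+ m) t)))
        (trans (cong (λ v → sumL (λ t → bc (statL {m} (+ m) t) x) (tris m v)) (iota-∷ʳ 0ℤ m))
        (trans (sym (last-diagonal m (iota 0ℤ m) (+ m) x (subst StrictV (iota-∷ʳ 0ℤ m) (iota-strict 0ℤ m))))
          (cnt-α m (iota 0ℤ m ∷ʳ (+ m + + x)) (Strict-∷ʳ (iota 1ℤ m') (x , refl) (subst StrictV (iota-∷ʳ 0ℤ m) (iota-strict 0ℤ m))))))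

      σ-first : ∀ x → σ x ≡ ρ₀ -[1+ x ]
      σ-first x = trans (sumN-cong (suc m) (λ { i (s≤s p) → cong (_* bc i x) (sym (NF≡NL i p)) }))
        (trans (sum-distribution (suc m) (statF {m} 0ℤ) (λ i → bc i x) triangles (λ t → s≤s (statF-≤ {m} 0ℤ t)))
        (trans (sym (first-diagonal m 0ℤ (iota 1ℤ m) x (iota-strict 0ℤ m)))
        (trans (cnt-α m ((0ℤ - + x) ∷ iota 1ℤ m) ((x , lem' (+ x)) , iota-strict 1ℤ m'))
          (cong (λ z → α (suc m) (z ∷ iota 1ℤ m)) (lem x)))))
        where
          lem : ∀ x → 0ℤ - + x ≡ -[1+ x ] + 1ℤ
          lem zero = refl
          lem (suc x) = refl
          lem' : ∀ x → 1ℤ ≡ 0ℤ - x + 1ℤ + x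
          lem' = solve-∀

      ρ₀-deg : ∀ x → iterδ (suc m) ρ₀ x ≡ 0ℤ
      ρ₀-deg x = trans (shift (suc m) (λ y → α (suc m) (y ∷ iota 1ℤ m)) x) (α-deg m (iota 1ℤ m) (x + 1ℤ))
        where
          shift : ∀ d f x → iterδ d (λ y → f (y + 1ℤ)) x ≡ iterδ d f (x + 1ℤ)
          shift zero f x = refl
          shift (suc d) f x = shift d (δ f) x

      R : ℤ → ℤ
      R r = sumN (suc m) (λ i → (sgn i * NL i) * bin i r)

      ρ₀-R : ∀ x → ρ₀ x ≡ R x
      ρ₀-R x = ℤP.i-j≡0⇒i≡j _ _ (poly-determined (suc m) 0 (λ x → ρ₀ x - R x) deg neg x)
        where
          neg : ∀ x → ρ₀ -[1+ x ] - R -[1+ x ] ≡ 0ℤ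
          neg x = ℤP.i≡j⇒i-j≡0 (trans (sym (σ-first x)) (sumN-cong (suc m) (λ i _ → trans (trans (sym (ℤP.*-identityˡ (NL i * bc i x))) (cong (_* (NL i * bc i x)) (sym (sgn-sq i))))
              (trans (lem (sgn i) (NL i) (bc i x)) (cong ((sgn i * NL i) *_) (sym (bin-neg i x)))))))
            where lem : ∀ s n b → s * s * (n * b) ≡ (s * n) * (s * b)
                  lem = solve-∀
          deg : ∀ x → iterδ (suc m) (λ x → ρ₀ x - R x) x ≡ 0ℤ
          deg x = trans (iterδ-minus (suc m) ρ₀ R x) (cong₂ _-_ (ρ₀-deg x) (trans (iterδ-sumN (suc m) (suc m) (λ i r → (sgn i * NL i) * bin i r) x)
            (sumN-0 (suc m) (λ { i (s≤s p) → trans (iterδ-* (suc m) (sgn i * NL i) (bin i) x) (trans (cong ((sgn i * NL i) *_) (bin-deg-≤ i m p x)) (ℤP.*-zeroʳ (sgn i * NL i))) }))))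

      NL-ρ₀ : ∀ s → s ℕ.≤ m → NL s ≡ sgn s * iterδ s ρ₀ 0ℤ
      NL-ρ₀ s p = sym (trans (cong (sgn s *_) (trans (iterδ-cong s ρ₀-R 0ℤ) (trans (iterδ-sumN s (suc m) (λ i r → (sgn i * NL i) * bin i r) 0ℤ)
          (trans (sumN-cong (suc m) (λ i _ → trans (iterδ-* s (sgn i * NL i) (bin i) 0ℤ) (trans (cong ((sgn i * NL i) *_) (trans (iterδ-bin i s) (ind-sym i s))) (ℤP.*-comm (sgn i * NL i) _))))
            (sum-ind (suc m) s (λ i → sgn i * NL i) (s≤s p))))))
        (trans (sym (ℤP.*-assoc (sgn s) (sgn s) (NL s))) (trans (cong (_* NL s) (sgn-sq s)) (ℤP.*-identityˡ (NL s)))))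

      ρ₀-reflect : ∀ x → ρ₀ (+ (2 ℕ.* m ℕ.+ 1) + + x) ≡ sgn m * σ x
      ρ₀-reflect x = trans (trans (cong (λ z → α (suc m) ((+ (2 ℕ.* m ℕ.+ 1) + + x + 1ℤ) ∷ z)) (sym (incr-iota 0ℤ m)))
          (α-translate (suc m) ((+ (2 ℕ.* m ℕ.+ 1) + + x) ∷ iota 0ℤ m)))
        (trans (sym (ℤP.*-identityˡ _)) (trans (cong₂ (λ s t → s * α (suc m) (t ∷ iota 0ℤ m)) (sym (sgn-sq m)) (cong +_ (lem m x)))
        (trans (ℤP.*-assoc (sgn m) (sgn m) _) (cong (sgn m *_) (trans (sym (α-rotate m (+ m + + x) (iota 0ℤ m))) (sym (σ-last x)))))))
        where lem : ∀ m x → 2 ℕ.* m ℕ.+ 1 ℕ.+ x ≡ m ℕ.+ x ℕ.+ suc m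
              lem = solveℕ

      NL-supp : Supp m NL
      NL-supp k p = sumL-0 triangles (λ t → ind-≢ (λ e → ℕP.<⇒≱ p (subst (ℕ._≤ m) e (statL-≤ {m} (+ m) t))))

      total-a : sumN (suc m) NL ≡ a m
      total-a = trans (sumN-cong (suc m) (λ i _ → sym (ℤP.*-identityʳ (NL i)))) (sum-distribution (suc m) (statL {m} (+ m)) (λ _ → 1ℤ) triangles (λ t → s≤s (statL-≤ {m} (+ m) t)))

      NL-0 : NL 0 ≡ a m'
      NL-0 = trans (NL-ρ₀ 0 z≤n) (trans (ℤP.*-identityˡ _) (trans (α-Q m 1ℤ (iota 1ℤ m))
        (trans (sym (sum-mix m (Hα m) (Tie-Hα m) 1ℤ (iota 1ℤ m) (≼-refl , iota-strict 1ℤ m')))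
        (trans (sumL-cong (mix-Hα m) (rows 1ℤ (iota 1ℤ m))) (trans (cong (sumL (α m)) (rows-iota 1ℤ m)) (trans (ℤP.+-identityʳ _)
          (trans (cong (α m) (sym (incr-iota 0ℤ m))) (trans (α-translate m (iota 0ℤ m)) (sym (cnt-α m' (iota 0ℤ m) (iota-strict 0ℤ m')))))))))))

      a-ratio : a m * + ((2 ℕ.* m ℕ.+ 1) !) * + ((2 ℕ.* m) !) ≡ a m' * + ((3 ℕ.* m ℕ.+ 1) !) * + (m !)
      a-ratio = subst₂ (λ s t → s * + ((2 ℕ.* m ℕ.+ 1) !) * + ((2 ℕ.* m) !) ≡ t * + ((3 ℕ.* m ℕ.+ 1) !) * + (m !)) total-a NL-0
        (Ratio.ratio m' NL NL-supp pal ρ₀ ρ₀-deg NL-ρ₀ ρ₀-reflect)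

module Contraction where
  open ShiftOperators using (+-interchange)
  open OperatorProducts using (Alt)
  open Wedge
  open TriangleFunction using (sgn)
  open RowSums using (sumN)
  open import Data.Integer.Base using (ℤ; +_; 0ℤ; 1ℤ; -1ℤ; _+_; _*_; _-_; -_)
  open import Data.Fin.Base using (zero; suc)
  open import Data.Vec.Base using (Vec; []; _∷_; _∷ʳ_)

  private variable n : ℕ

  FN : ℕ → Set
  FN n = Vec ℕ n → ℤ

  -- ∑_{lo ≤ x < lo + c} f x
  sI : ℕ → ℕ → (ℕ → ℤ) → ℤ
  sI lo zero f = 0ℤ
  sI lo (suc c) f = f lo + sI (suc lo) c f

  sI-cong : ∀ lo c {f g : ℕ → ℤ} → (∀ x → lo ℕ.≤ x → f x ≡ g x) → sI lo c f ≡ sI lo c g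
  sI-cong lo zero e = refl
  sI-cong lo (suc c) e = cong₂ _+_ (e lo ℕP.≤-refl) (sI-cong (suc lo) c (λ x p → e x (ℕP.<⇒≤ p)))

  sI-+ : ∀ lo c f g → sI lo c (λ x → f x + g x) ≡ sI lo c f + sI lo c g
  sI-+ lo zero f g = refl
  sI-+ lo (suc c) f g = trans (cong (_+_ (f lo + g lo)) (sI-+ (suc lo) c f g)) (+-interchange (f lo) (g lo) (sI (suc lo) c f) (sI (suc lo) c g))

  sI-* : ∀ lo c k f → sI lo c (λ x → k * f x) ≡ k * sI lo c f
  sI-* lo zero k f = sym (ℤP.*-zeroʳ k)
  sI-* lo (suc c) k f = trans (cong (_+_ (k * f lo)) (sI-* (suc lo) c k f)) (sym (ℤP.*-distribˡ-+ k (f lo) _))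

  -- ∑ F e over lo ≤ e₁ < e₂ < ⋯ < eₙ < lo + c
  Φ : ∀ n → ℕ → ℕ → FN n → ℤ
  Φ zero lo c F = F []
  Φ (suc n) lo zero F = 0ℤ
  Φ (suc n) lo (suc c) F = Φ n (suc lo) c (λ v → F (lo ∷ v)) + Φ (suc n) (suc lo) c F

  Φ-cong : ∀ n lo c {F G : FN n} → (∀ v → F v ≡ G v) → Φ n lo c F ≡ Φ n lo c G
  Φ-cong zero lo c e = e []
  Φ-cong (suc n) lo zero e = refl
  Φ-cong (suc n) lo (suc c) e = cong₂ _+_ (Φ-cong n (suc lo) c (λ v → e (lo ∷ v))) (Φ-cong (suc n) (suc lo) c e)

  Φ-+ : ∀ n lo c (F G : FN n) → Φ n lo c (λ v → F v + G v) ≡ Φ n lo c F + Φ n lo c G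
  Φ-+ zero lo c F G = refl
  Φ-+ (suc n) lo zero F G = refl
  Φ-+ (suc n) lo (suc c) F G = trans (cong₂ _+_ (Φ-+ n (suc lo) c _ _) (Φ-+ (suc n) (suc lo) c F G))
    (+-interchange (Φ n (suc lo) c (λ v → F (lo ∷ v))) (Φ n (suc lo) c (λ v → G (lo ∷ v))) (Φ (suc n) (suc lo) c F) (Φ (suc n) (suc lo) c G))

  Φ-* : ∀ n lo c k (F : FN n) → Φ n lo c (λ v → k * F v) ≡ k * Φ n lo c F
  Φ-* zero lo c k F = refl
  Φ-* (suc n) lo zero k F = sym (ℤP.*-zeroʳ k)
  Φ-* (suc n) lo (suc c) k F = trans (cong₂ _+_ (Φ-* n (suc lo) c k _) (Φ-* (suc n) (suc lo) c k F)) (sym (ℤP.*-distribˡ-+ k (Φ n (suc lo) c (λ v → F (lo ∷ v))) (Φ (suc n) (suc lo) c F)))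

  Φ-neg : ∀ n lo c (F : FN n) → Φ n lo c (λ v → - F v) ≡ - Φ n lo c F
  Φ-neg n lo c F = trans (Φ-cong n lo c (λ v → sym (ℤP.-1*i≡-i (F v)))) (trans (Φ-* n lo c -1ℤ F) (ℤP.-1*i≡-i (Φ n lo c F)))

  ι : ℕ → ℕ → (ℕ → ℤ) → FN (suc n) → FN n
  ι lo c g F e = sI lo c (λ a → g a * F (a ∷ e))

  PI : ℕ → ℕ → (ℕ → ℤ) → ∀ n → FN n → ℤ
  PI lo c g zero F = 0ℤ
  PI lo c g (suc n) F = Φ n lo c (ι lo c g F)

  PI-cong : ∀ lo c {g h : ℕ → ℤ} n F → (∀ x → lo ℕ.≤ x → g x ≡ h x) → PI lo c g n F ≡ PI lo c h n F
  PI-cong lo c zero F e = refl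
  PI-cong lo c (suc n) F e = Φ-cong n lo c (λ v → sI-cong lo c (λ x p → cong (_* F (x ∷ v)) (e x p)))

  PI-lin : ∀ lo c g k n F → PI lo c (λ a → g a + k) n F ≡ PI lo c g n F + k * PI lo c (λ _ → 1ℤ) n F
  PI-lin lo c g k zero F = sym (trans (ℤP.+-identityˡ _) (ℤP.*-zeroʳ k))
  PI-lin lo c g k (suc n) F = trans (Φ-cong n lo c (λ e → trans (sI-cong lo c (λ a _ → lem (g a) k (F (a ∷ e)))) (trans (sI-+ lo c _ _) (cong (_+_ (ι lo c g F e)) (sI-* lo c k _)))))
    (trans (Φ-+ n lo c (ι lo c g F) (λ e → k * ι lo c (λ _ → 1ℤ) F e)) (cong (_+_ (Φ n lo c (ι lo c g F))) (Φ-* n lo c k (ι lo c (λ _ → 1ℤ) F))))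
    where lem : ∀ g k f → (g + k) * f ≡ g * f + k * (1ℤ * f)
          lem = solve-∀

  alt-tie : ∀ n (F : FN (suc (suc n))) → Alt F → ∀ x e → F (x ∷ x ∷ e) ≡ 0ℤ
  alt-tie n F alt x e = OperatorProducts.x≡-x⇒x≡0 _ (alt zero (x ∷ x ∷ e))

  PI-step : ∀ lo c g n (F : FN (suc n)) → AltF (suc n) F →
    PI lo (suc c) g (suc n) F ≡ PI (suc lo) c g (suc n) F + g lo * Φ n (suc lo) c (λ v → F (lo ∷ v)) - PI (suc lo) c g n (λ v → F (lo ∷ v))
  PI-step lo c g zero F alt = lem (g lo * F (lo ∷ [])) (ι (suc lo) c g F [])
    where lem : ∀ a b → a + b ≡ b + a - 0ℤ
          lem = solve-∀
  PI-step lo c g (suc n) F alt = trans (cong₂ _+_ left right)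
    (lem (Φ (suc n) (suc lo) c (ι (suc lo) c g F)) (g lo * Φ (suc n) (suc lo) c (λ v → F (lo ∷ v))) (Φ n (suc lo) c (ι (suc lo) c g (λ v → F (lo ∷ v)))))
    where
      lem : ∀ a b c → - c + (b + a) ≡ a + b - c
      lem = solve-∀
      left : Φ n (suc lo) c (λ v → ι lo (suc c) g F (lo ∷ v)) ≡ - Φ n (suc lo) c (ι (suc lo) c g (λ v → F (lo ∷ v)))
      left = trans (Φ-cong n (suc lo) c (λ e → trans (cong₂ _+_ (trans (cong (g lo *_) (alt-tie n F alt lo e)) (ℤP.*-zeroʳ (g lo)))
          (trans (sI-cong (suc lo) c (λ a _ → trans (cong (g a *_) (alt zero (lo ∷ a ∷ e))) (lem' (g a) (F (lo ∷ a ∷ e))))) (sI-* (suc lo) c -1ℤ _))) (trans (ℤP.+-identityˡ _) (ℤP.-1*i≡-i _))))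
          (Φ-neg n (suc lo) c (ι (suc lo) c g (λ v → F (lo ∷ v))))
        where lem' : ∀ a b → a * - b ≡ -1ℤ * (a * b)
              lem' = solve-∀
      right : Φ (suc n) (suc lo) c (ι lo (suc c) g F) ≡ g lo * Φ (suc n) (suc lo) c (λ v → F (lo ∷ v)) + Φ (suc n) (suc lo) c (ι (suc lo) c g F)
      right = trans (Φ-+ (suc n) (suc lo) c (λ e → g lo * F (lo ∷ e)) (ι (suc lo) c g F)) (cong (_+ Φ (suc n) (suc lo) c (ι (suc lo) c g F)) (Φ-* (suc n) (suc lo) c (g lo) (λ v → F (lo ∷ v))))

  ε : ℕ → ℤ
  ε zero = 1ℤ
  ε (suc n) = 1ℤ - ε n

  PI-one : ∀ lo c n F → AltF n F → PI lo c (λ _ → 1ℤ) n F ≡ (1ℤ - ε n) * Φ n lo c F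
  PI-one lo c zero F alt = refl
  PI-one lo zero (suc zero) F alt = refl
  PI-one lo zero (suc (suc n)) F alt = sym (ℤP.*-zeroʳ (1ℤ - ε (suc (suc n))))
  PI-one lo (suc c) (suc n) F alt = trans (PI-step lo c (λ _ → 1ℤ) n F alt)
    (trans (cong₂ (λ s t → s + 1ℤ * Φ n (suc lo) c (λ v → F (lo ∷ v)) - t) (PI-one (suc lo) c (suc n) F alt) (PI-one (suc lo) c n (λ v → F (lo ∷ v)) (AltF-tail n F alt lo)))
      (lem (ε n) (Φ n (suc lo) c (λ v → F (lo ∷ v))) (Φ (suc n) (suc lo) c F)))
    where lem : ∀ e a b → (1ℤ - (1ℤ - e)) * b + 1ℤ * a - (1ℤ - e) * a ≡ (1ℤ - (1ℤ - e)) * (a + b)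
          lem = solve-∀

  sg : ℕ → ℕ → ℤ
  sg zero zero = 0ℤ
  sg zero (suc x) = -1ℤ
  sg (suc a) zero = 1ℤ
  sg (suc a) (suc x) = sg a x

  sg-refl : ∀ a → sg a a ≡ 0ℤ
  sg-refl zero = refl
  sg-refl (suc a) = sg-refl a

  sg-> : ∀ a x → x ℕ.< a → sg a x ≡ 1ℤ
  sg-> (suc a) zero _ = refl
  sg-> (suc a) (suc x) (s≤s p) = sg-> a x p

  sg-anti : ∀ a x → sg x a ≡ - sg a x
  sg-anti zero zero = refl
  sg-anti zero (suc x) = refl
  sg-anti (suc a) zero = refl
  sg-anti (suc a) (suc x) = sg-anti a x

  QI : ℕ → ℕ → (ℕ → ℤ) → ℕ → ℤ
  QI lo c q a = sI lo c (λ x → sg a x * q x)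

  QI-tail : ∀ lo c q a → suc lo ℕ.≤ a → QI lo (suc c) q a ≡ QI (suc lo) c q a + q lo
  QI-tail lo c q a p = trans (cong (λ z → z * q lo + QI (suc lo) c q a) (sg-> a lo p)) (lem (q lo) (QI (suc lo) c q a))
    where lem : ∀ a b → 1ℤ * a + b ≡ b + a
          lem = solve-∀

  QI-lo : ∀ lo c q → QI lo (suc c) q lo ≡ - sI (suc lo) c q
  QI-lo lo c q = trans (cong₂ _+_ (cong (_* q lo) (sg-refl lo)) (trans (sI-cong (suc lo) c (λ x p → cong (_* q x) (trans (sg-anti x lo) (cong -_ (sg-> x lo p))))) (sI-* (suc lo) c -1ℤ q)))
    (trans (ℤP.+-identityˡ _) (ℤP.-1*i≡-i _))

  -- Summing q over the complement of an increasing sequence e with alternating signs amounts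
  -- to an alternating sum over e itself of the function QI.
  contract : ∀ lo c q n (F : FN n) → AltF n F →
    Φ (suc n) lo c (wd q F) ≡ ε n * (sI lo c q * Φ n lo c F) + PI lo c (QI lo c q) n F
  contract lo zero q zero F alt = refl
  contract lo zero q (suc zero) F alt = refl
  contract lo zero q (suc (suc n)) F alt = sym (trans (ℤP.+-identityʳ _) (ℤP.*-zeroʳ (ε (suc (suc n)))))
  contract lo (suc c) q zero F alt = trans (cong (_+_ (q lo * F [])) (contract (suc lo) c q zero F alt)) (lem (q lo) (sI (suc lo) c q) (F []))
    where lem : ∀ a s f → a * f + (1ℤ * (s * f) + 0ℤ) ≡ 1ℤ * ((a + s) * f) + 0ℤ
          lem = solve-∀
  contract lo (suc c) q (suc n) F alt = trans (cong₂ _+_ lhs (contract (suc lo) c q (suc n) F alt))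
    (trans (lem (ε n) (q lo) S (Φ (suc n) (suc lo) c F) (Φ n (suc lo) c Fl) (PI (suc lo) c Q' n Fl) (PI (suc lo) c Q' (suc n) F))
    (cong (_+_ (ε (suc n) * ((q lo + S) * (Φ n (suc lo) c Fl + Φ (suc n) (suc lo) c F)))) (sym rhs)))
    where
      Fl : FN n
      Fl v = F (lo ∷ v)
      S = sI (suc lo) c q
      Q' = QI (suc lo) c q
      lhs : Φ (suc n) (suc lo) c (λ v → wd q F (lo ∷ v)) ≡ q lo * Φ (suc n) (suc lo) c F - (ε n * (S * Φ n (suc lo) c Fl) + PI (suc lo) c Q' n Fl)
      lhs = trans (Φ-+ (suc n) (suc lo) c (λ v → q lo * F v) (λ v → - wd q Fl v))
        (cong₂ _+_ (Φ-* (suc n) (suc lo) c (q lo) F) (trans (Φ-neg (suc n) (suc lo) c (wd q Fl)) (cong -_ (contract (suc lo) c q n Fl (AltF-tail n F alt lo)))))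
      rhs : PI lo (suc c) (QI lo (suc c) q) (suc n) F ≡
        (PI (suc lo) c Q' (suc n) F + q lo * ((1ℤ - ε (suc n)) * Φ (suc n) (suc lo) c F)) + - S * Φ n (suc lo) c Fl - (PI (suc lo) c Q' n Fl + q lo * ((1ℤ - ε n) * Φ n (suc lo) c Fl))
      rhs = trans (PI-step lo c (QI lo (suc c) q) n F alt) (cong₂ _-_ (cong₂ _+_
          (trans (PI-cong (suc lo) c (suc n) F (λ x p → QI-tail lo c q x p)) (trans (PI-lin (suc lo) c Q' (q lo) (suc n) F) (cong (λ z → PI (suc lo) c Q' (suc n) F + q lo * z) (PI-one (suc lo) c (suc n) F alt))))
          (cong (_* Φ n (suc lo) c Fl) (QI-lo lo c q)))
          (trans (PI-cong (suc lo) c n Fl (λ x p → QI-tail lo c q x p)) (trans (PI-lin (suc lo) c Q' (q lo) n Fl) (cong (λ z → PI (suc lo) c Q' n Fl + q lo * z) (PI-one (suc lo) c n Fl (AltF-tail n F alt lo))))))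
      lem : ∀ e q S A B P R → q * A - (e * (S * B) + P) + ((1ℤ - e) * (S * A) + R) ≡
        (1ℤ - e) * ((q + S) * (B + A)) + ((R + q * ((1ℤ - (1ℤ - e)) * A)) + - S * B - (P + q * ((1ℤ - e) * B)))
      lem = solve-∀

  wl : Vec (ℕ → ℤ) n → FN n
  wl [] v = 1ℤ
  wl (f ∷ fs) = wd f (wl fs)

  wl-alt : ∀ n (fs : Vec (ℕ → ℤ) n) → AltF n (wl fs)
  wl-alt zero [] = tt
  wl-alt (suc zero) fs = tt
  wl-alt (suc (suc n)) (f ∷ fs) = wd-alt n f (wl fs) (wl-alt (suc n) fs)

  ι-wd-1 : ∀ lo c g f (G : FN 0) e → ι lo c g (wd f G) e ≡ sI lo c (λ a → g a * f a) * G e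
  ι-wd-1 lo c g f G [] = trans (sI-cong lo c (λ a _ → lem (g a) (f a) (G []))) (trans (sI-* lo c (G []) _) (ℤP.*-comm (G []) _))
    where lem : ∀ a b c → a * (b * c) ≡ c * (a * b)
          lem = solve-∀

  wd-sI : ∀ n f lo c (G : ℕ → FN n) e → sI lo c (λ a → wd f (G a) e) ≡ wd f (λ u → sI lo c (λ a → G a u)) e
  wd-sI n f lo zero G e = sym (wd-0 f (λ _ → refl) e)
  wd-sI n f lo (suc c) G e = trans (cong (_+_ (wd f (G lo) e)) (wd-sI n f (suc lo) c G e)) (sym (wd-+ f (G lo) (λ u → sI (suc lo) c (λ a → G a u)) e))

  ι-wd : ∀ n lo c g f (G : FN (suc n)) e → ι lo c g (wd f G) e ≡ sI lo c (λ a → g a * f a) * G e - wd f (ι lo c g G) e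
  ι-wd n lo c g f G e = trans (sI-cong lo c (λ a _ → lem (g a) (f a) (G e) (wd f (λ u → G (a ∷ u)) e)))
    (trans (sI-+ lo c _ _) (cong₂ _+_ (trans (sI-* lo c (G e) _) (ℤP.*-comm (G e) _))
      (trans (sI-* lo c -1ℤ _) (trans (ℤP.-1*i≡-i _) (cong -_ (trans (sI-cong lo c (λ a _ → sym (wd-* f (g a) (λ u → G (a ∷ u)) e))) (wd-sI n f lo c (λ a u → g a * G (a ∷ u)) e)))))))
    where lem : ∀ a b c w → a * (b * c - w) ≡ c * (a * b) + -1ℤ * (a * w)
          lem = solve-∀

  data Kills (lo c : ℕ) (g : ℕ → ℤ) : ∀ {n} → Vec (ℕ → ℤ) n → Set where
    [] : Kills lo c g []
    _∷_ : ∀ {n f} {fs : Vec (ℕ → ℤ) n} → sI lo c (λ a → g a * f a) ≡ 0ℤ → Kills lo c g fs → Kills lo c g (f ∷ fs)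

  ι-kills : ∀ lo c g (fs : Vec (ℕ → ℤ) (suc n)) → Kills lo c g fs → ∀ e → ι lo c g (wl fs) e ≡ 0ℤ
  ι-kills lo c g (f ∷ []) (k ∷ []) e = trans (ι-wd-1 lo c g f (λ _ → 1ℤ) e) (cong (_* 1ℤ) k)
  ι-kills lo c g (f ∷ h ∷ fs) (k ∷ ks) e = trans (ι-wd _ lo c g f (wl (h ∷ fs)) e)
    (trans (cong₂ (λ s t → s * wl (h ∷ fs) e - t) k (wd-0 f (ι-kills lo c g (h ∷ fs) ks) e)) (ℤP.+-identityʳ _))

  Φ-contract : ∀ lo c q f (fs : Vec (ℕ → ℤ) n) → ε n ≡ 1ℤ → Kills lo c (QI lo c q) fs →
    Φ (suc (suc n)) lo c (wl (q ∷ f ∷ fs)) ≡ sI lo c (λ a → QI lo c q a * f a) * Φ n lo c (wl fs)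
  Φ-contract {n} lo c q f fs e ks = trans (contract lo c q (suc n) (wl (f ∷ fs)) (wl-alt (suc n) (f ∷ fs)))
    (trans (cong (λ z → (1ℤ - z) * (sI lo c q * Φ (suc n) lo c (wl (f ∷ fs))) + Φ n lo c (ι lo c (QI lo c q) (wl (f ∷ fs)))) e)
    (trans (ℤP.+-identityˡ _) (trans (Φ-cong n lo c (step fs ks)) (Φ-* n lo c (sI lo c (λ a → QI lo c q a * f a)) (wl fs)))))
    where
      step : ∀ {n} (fs : Vec (ℕ → ℤ) n) → Kills lo c (QI lo c q) fs → ∀ v → ι lo c (QI lo c q) (wl (f ∷ fs)) v ≡ sI lo c (λ a → QI lo c q a * f a) * wl fs v
      step [] [] v = ι-wd-1 lo c (QI lo c q) f (λ _ → 1ℤ) v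
      step (h ∷ fs) ks v = trans (ι-wd _ lo c (QI lo c q) f (wl (h ∷ fs)) v)
        (trans (cong (λ z → sI lo c (λ a → QI lo c q a * f a) * wl (h ∷ fs) v - z) (wd-0 f (ι-kills lo c (QI lo c q) (h ∷ fs) ks) v)) (ℤP.+-identityʳ _))

  wd-swap : ∀ n (f g : ℕ → ℤ) (G : FN n) v → wd f (wd g G) v ≡ - wd g (wd f G) v
  wd-swap zero f g G (x ∷ y ∷ []) = lem (f x) (f y) (g x) (g y) (G [])
    where lem : ∀ a b c d e → a * (d * e) - b * (c * e) ≡ - (c * (b * e) - d * (a * e))
          lem = solve-∀
  wd-swap (suc n) f g G (x ∷ v) = trans (expand f g) (trans (lem (f x) (wd g G v) (g x) (wd f G v) (wd f (wd g Gx) v) (wd g (wd f Gx) v) (wd-swap n f g Gx v)) (cong -_ (sym (expand g f))))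
    where
      Gx : FN n
      Gx u = G (x ∷ u)
      expand : ∀ f g → wd f (wd g G) (x ∷ v) ≡ f x * wd g G v - (g x * wd f G v - wd f (wd g Gx) v)
      expand f g = cong (λ z → f x * wd g G v - z) (trans (wd-+ f (λ u → g x * G u) (λ u → - wd g Gx u) v) (cong₂ _+_ (wd-* f (g x) G v) (wd-neg f (wd g Gx) v)))
      lem : ∀ a p b r s t → s ≡ - t → a * p - (b * r - s) ≡ - (b * r - (a * p - t))
      lem a p b r .(- t) t refl = go a p b r t
        where go : ∀ a p b r t → a * p - (b * r - - t) ≡ - (b * r - (a * p - t))
              go = solve-∀

  wl-move : ∀ {n} f (fs : Vec (ℕ → ℤ) n) v → wl (f ∷ fs) v ≡ sgn n * wl (fs ∷ʳ f) v
  wl-move f [] v = sym (ℤP.*-identityˡ _)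
  wl-move {suc n} f (g ∷ fs) v = trans (wd-swap n f g (wl fs) v)
    (trans (cong -_ (trans (wd-congʳ g (wl-move f fs) v) (wd-* g (sgn n) (wl (fs ∷ʳ f)) v))) (lem (sgn n) (wl (g ∷ (fs ∷ʳ f)) v)))
    where lem : ∀ a b → - (a * b) ≡ - a * b
          lem = solve-∀

  data Has (f : ℕ → ℤ) : ∀ {n} → Vec (ℕ → ℤ) n → Set where
    here : ∀ {n} {fs : Vec (ℕ → ℤ) n} → Has f (f ∷ fs)
    there : ∀ {n g} {fs : Vec (ℕ → ℤ) n} → Has f fs → Has f (g ∷ fs)

  wl-has : ∀ {n f} {fs : Vec (ℕ → ℤ) n} → Has f fs → ∀ v → wl (f ∷ fs) v ≡ 0ℤ
  wl-has {f = f} {_ ∷ fs} here v = wd-wd f (wl fs) v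
  wl-has {f = f} {g ∷ fs} (there h) v = trans (wd-swap _ f g (wl fs) v) (cong -_ (wd-0 g (wl-has h) v))

  wd-sumN : ∀ {n} k (κ : ℕ → ℤ) (f : ℕ → ℕ → ℤ) (G : FN n) v → wd (λ x → sumN k (λ j → κ j * f j x)) G v ≡ sumN k (λ j → κ j * wd (f j) G v)
  wd-sumN zero κ f G v = wd-0ˡ G (λ _ → refl) v
  wd-sumN (suc k) κ f G v = trans (wd-lin (λ x → sumN k (λ j → κ j * f j x)) (κ k) (f k) G v) (cong (_+ κ k * wd (f k) G v) (wd-sumN k κ f G v))
    where
      wd-lin : ∀ {n} (p : ℕ → ℤ) c (q : ℕ → ℤ) (G : FN n) v → wd (λ x → p x + c * q x) G v ≡ wd p G v + c * wd q G v
      wd-lin {zero} p c q G (x ∷ []) = lem (p x) c (q x) (G [])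
        where lem : ∀ a b c d → (a + b * c) * d ≡ a * d + b * (c * d)
              lem = solve-∀
      wd-lin {suc n} p c q G (x ∷ v) rewrite wd-lin p c q (λ u → G (x ∷ u)) v = lem (p x) c (q x) (G v) (wd p (λ u → G (x ∷ u)) v) (wd q (λ u → G (x ∷ u)) v)
        where lem : ∀ a b c d s t → (a + b * c) * d - (s + b * t) ≡ (a * d - s) + b * (c * d - t)
              lem = solve-∀

module RowFunctions where
  open RowSums using (sumN; sumN-cong; sumN-head)
  open Polynomials using (sumN-+; sumN-*; sumN-0; sumN-swap; sumN-minus)
  open TriangleRatio using (ind; ind-≢; sum-ind)
  open Contraction
  open import Data.Nat.Base using (_!)
  open import Data.Integer.Base using (ℤ; +_; -[1+_]; 0ℤ; 1ℤ; -1ℤ; _+_; _*_; _-_; -_; _≤_; +≤+)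

  -- binomial coefficients with integer lower index
  Ch : ℕ → ℤ → ℤ
  Ch zero (+ zero) = 1ℤ
  Ch zero (+ suc n) = 0ℤ
  Ch zero -[1+ n ] = 0ℤ
  Ch (suc k) z = Ch k z + Ch k (z - 1ℤ)

  Ch-above : ∀ k g → Ch k (+ (suc k ℕ.+ g)) ≡ 0ℤ
  Ch-above zero g = refl
  Ch-above (suc k) g = cong₂ _+_ (trans (cong (λ z → Ch k (+ suc z)) (sym (ℕP.+-suc k g))) (Ch-above k (suc g))) (Ch-above k g)

  Ch-below : ∀ k g → Ch k -[1+ g ] ≡ 0ℤ
  Ch-below zero g = refl
  Ch-below (suc k) g = cong₂ _+_ (Ch-below k g) (trans (cong (λ z → Ch k -[1+ suc z ]) (ℕP.+-identityʳ g)) (Ch-below k (suc g)))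

  -- P j a is the coefficient of u^a in (u (1 + u))^j
  P : ℕ → ℕ → ℤ
  P j a = Ch j (+ (2 ℕ.* j) - + a)

  P-suc-0 : ∀ j → P (suc j) 0 ≡ 0ℤ
  P-suc-0 j = trans (cong (Ch (suc j)) (trans (ℤP.+-identityʳ _) (cong +_ (lem j)))) (Ch-above (suc j) j)
    where lem : ∀ j → 2 ℕ.* suc j ≡ suc (suc j) ℕ.+ j
          lem = solveℕ

  P-suc-1 : ∀ j → P (suc j) 1 ≡ P j 0
  P-suc-1 j = trans (cong₂ _+_ (trans (cong (Ch j) (trans (cong (_- 1ℤ) (cong +_ (lem j))) refl)) (Ch-above j j)) (cong (Ch j) (trans (cong (λ z → + z - 1ℤ - 1ℤ) (ℕP.*-suc 2 j)) (lem' (+ (2 ℕ.* j))))))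
      (ℤP.+-identityˡ _)
    where
      lem : ∀ j → 2 ℕ.* suc j ≡ suc (suc j ℕ.+ j)
      lem = solveℕ
      lem' : ∀ z → + 2 + z - 1ℤ - 1ℤ ≡ z - 0ℤ
      lem' = solve-∀

  P-suc-suc : ∀ j a → P (suc j) (suc (suc a)) ≡ P j (suc a) + P j a
  P-suc-suc j a = trans (ℤP.+-comm (Ch j (+ (2 ℕ.* suc j) - + suc (suc a))) _) (cong₂ _+_
     (cong (Ch j) (trans (cong (λ z → + z - + suc (suc a) - 1ℤ) (ℕP.*-suc 2 j)) (lem (+ (2 ℕ.* j)) (+ a))))
     (cong (Ch j) (trans (cong (λ z → + z - + suc (suc a)) (ℕP.*-suc 2 j)) (lem' (+ (2 ℕ.* j)) (+ a)))))
    where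
      lem : ∀ z a → + 2 + z - (+ 2 + a) - 1ℤ ≡ z - (1ℤ + a)
      lem = solve-∀
      lem' : ∀ z a → + 2 + z - (+ 2 + a) ≡ z - a
      lem' = solve-∀

  P-supp : ∀ j a → 2 ℕ.* j ℕ.< a → P j a ≡ 0ℤ
  P-supp j a p with ℕP.m≤n⇒∃[o]m+o≡n p
  ... | g , refl = trans (cong (Ch j) (lem (+ (2 ℕ.* j)) (+ g))) (trans (cong (Ch j) neg) (Ch-below j g))
    where
      lem : ∀ z g → z - (1ℤ + z + g) ≡ - (1ℤ + g)
      lem = solve-∀
      neg : - (1ℤ + + g) ≡ -[1+ g ]
      neg = refl

  P-adjacent : ∀ j a → P j a + P j (suc a) ≡ Ch (suc j) (+ (2 ℕ.* j) - + a)
  P-adjacent j a = cong (_+_ (P j a)) (cong (Ch j) (lem (+ (2 ℕ.* j)) (+ a)))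
    where lem : ∀ z a → z - (1ℤ + a) ≡ z - a - 1ℤ
          lem = solve-∀

  -- the value of the linear functional u^a ↦ h a at (u (1 + u))^i
  Ev : ℕ → (ℕ → ℤ) → ℤ
  Ev zero h = h 0
  Ev (suc i) h = Ev i (λ a → h (suc a) + h (suc (suc a)))

  Ev-cong : ∀ i {h g : ℕ → ℤ} → (∀ a → h a ≡ g a) → Ev i h ≡ Ev i g
  Ev-cong zero e = e 0
  Ev-cong (suc i) e = Ev-cong i (λ a → cong₂ _+_ (e (suc a)) (e (suc (suc a))))

  Ev-lin : ∀ i c h g → Ev i (λ a → h a + c * g a) ≡ Ev i h + c * Ev i g
  Ev-lin zero c h g = refl
  Ev-lin (suc i) c h g = trans (Ev-cong i (λ a → lem (h (suc a)) c (g (suc a)) (h (suc (suc a))) (g (suc (suc a))))) (Ev-lin i c _ _)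
    where lem : ∀ a c b d e → (a + c * b) + (d + c * e) ≡ (a + d) + c * (b + e)
          lem = solve-∀

  Ev-0 : ∀ i → Ev i (λ _ → 0ℤ) ≡ 0ℤ
  Ev-0 zero = refl
  Ev-0 (suc i) = Ev-0 i

  Ev-sumN : ∀ i n (κ : ℕ → ℤ) (f : ℕ → ℕ → ℤ) → Ev i (λ a → sumN n (λ j → κ j * f j a)) ≡ sumN n (λ j → κ j * Ev i (f j))
  Ev-sumN i zero κ f = Ev-0 i
  Ev-sumN i (suc n) κ f = trans (Ev-lin i (κ n) _ (f n)) (cong (_+ κ n * Ev i (f n)) (Ev-sumN i n κ f))

  Ev-Ch : ∀ i k t → Ev i (λ a → Ch k (t - + a)) ≡ Ch (k ℕ.+ i) (t - + i)
  Ev-Ch zero k t = cong (λ z → Ch z (t - 0ℤ)) (sym (ℕP.+-identityʳ k))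
  Ev-Ch (suc i) k t = trans (Ev-cong i (λ a → cong₂ (λ s t → Ch k s + Ch k t) (lem t (+ a)) (lem' t (+ a)))) (trans (Ev-Ch i (suc k) (t - 1ℤ)) (cong₂ Ch (sym (ℕP.+-suc k i)) (sym (lem t (+ i)))))
    where
      lem : ∀ t a → t - (1ℤ + a) ≡ t - 1ℤ - a
      lem = solve-∀
      lem' : ∀ t a → t - (+ 2 + a) ≡ t - 1ℤ - a - 1ℤ
      lem' = solve-∀

  pairing : ∀ i B h → 2 ℕ.* i ℕ.< B → sumN B (λ a → P i a * h a) ≡ Ev i h
  pairing zero (suc B) h _ = trans (sumN-head B _) (trans (cong₂ _+_ (ℤP.*-identityˡ (h 0)) (sumN-0 B (λ _ _ → refl))) (ℤP.+-identityʳ (h 0)))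
  pairing (suc i) (suc zero) h (s≤s p) = contradiction p (subst (λ z → z ℕ.≰ 0) (sym (ℕP.*-suc 2 i)) λ ())
  pairing (suc i) (suc (suc B)) h p = trans (sumN-head (suc B) (λ a → P (suc i) a * h a)) (trans (cong₂ _+_ (cong (_* h 0) (P-suc-0 i)) (sumN-head B (λ a → P (suc i) (suc a) * h (suc a))))
    (trans (ℤP.+-identityˡ (P (suc i) 1 * h 1 + sumN B (λ a → P (suc i) (suc (suc a)) * h (suc (suc a))))) (trans (cong₂ _+_ (cong (_* h 1) (P-suc-1 i)) split)
    (trans (sym (ℤP.+-assoc (P i 0 * h 1) (sumN B (λ a → P i (suc a) * h (suc (suc a)))) (sumN B (λ a → P i a * h (suc (suc a))))))
    (trans (cong (_+ sumN B (λ a → P i a * h (suc (suc a)))) (trans (sym (sumN-head B (λ a → P i a * h (suc a)))) (trans (cong (_+_ (sumN B (λ a → P i a * h (suc a)))) (cong (_* h (suc B)) (P-supp i B q))) (ℤP.+-identityʳ (sumN B (λ a → P i a * h (suc a)))))))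
    (trans (sym (sumN-+ B (λ a → P i a * h (suc a)) (λ a → P i a * h (suc (suc a))))) (trans (sumN-cong B (λ a _ → sym (ℤP.*-distribˡ-+ (P i a) (h (suc a)) (h (suc (suc a)))))) (pairing i B (λ a → h (suc a) + h (suc (suc a))) q))))))))
    where
      q : 2 ℕ.* i ℕ.< B
      q = ℕP.≤-pred (ℕP.≤-pred (subst (ℕ._< suc (suc B)) (ℕP.*-suc 2 i) p))
      split : sumN B (λ a → P (suc i) (suc (suc a)) * h (suc (suc a))) ≡ sumN B (λ a → P i (suc a) * h (suc (suc a))) + sumN B (λ a → P i a * h (suc (suc a)))
      split = trans (sumN-cong B (λ a _ → trans (cong (_* h (suc (suc a))) (P-suc-suc i a)) (ℤP.*-distribʳ-+ (h (suc (suc a))) (P i (suc a)) (P i a))))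
        (sumN-+ B (λ a → P i (suc a) * h (suc (suc a))) (λ a → P i a * h (suc (suc a))))

  sI-sumN : ∀ lo c f → sI lo c f ≡ sumN c (λ i → f (lo ℕ.+ i))
  sI-sumN lo zero f = refl
  sI-sumN lo (suc c) f = trans (cong₂ _+_ (cong f (sym (ℕP.+-identityʳ lo))) (trans (sI-sumN (suc lo) c f) (sumN-cong c (λ i _ → cong f (sym (ℕP.+-suc lo i)))))) (sym (sumN-head c (λ i → f (lo ℕ.+ i))))

  sg-diff : ∀ a x → sg (suc a) x - sg a x ≡ ind a x + ind (suc a) x
  sg-diff zero zero = refl
  sg-diff zero (suc zero) = refl
  sg-diff zero (suc (suc x)) = refl
  sg-diff (suc a) zero = refl
  sg-diff (suc a) (suc x) = sg-diff a x

  QI-diff : ∀ B q a → (∀ x → B ℕ.≤ x → q x ≡ 0ℤ) → QI 0 B q (suc a) - QI 0 B q a ≡ q a + q (suc a)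
  QI-diff B q a s = trans (cong₂ _-_ (sI-sumN 0 B (λ x → sg (suc a) x * q x)) (sI-sumN 0 B (λ x → sg a x * q x))) (trans (sym (sumN-minus B (λ x → sg (suc a) x * q x) (λ x → sg a x * q x)))
    (trans (sumN-cong B (λ x _ → trans (lem (sg (suc a) x) (sg a x) (q x)) (trans (cong (_* q x) (sg-diff a x)) (ℤP.*-distribʳ-+ (q x) (ind a x) (ind (suc a) x)))))
    (trans (sumN-+ B (λ x → ind a x * q x) (λ x → ind (suc a) x * q x)) (cong₂ _+_ (pick a) (pick (suc a))))))
    where
      lem : ∀ a b c → a * c - b * c ≡ (a - b) * c
      lem = solve-∀
      pick : ∀ a → sumN B (λ x → ind a x * q x) ≡ q a
      pick a with a ℕP.<? B
      ... | yes p = sum-ind B a q p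
      ... | no np = trans (sumN-0 B (λ x x<B → cong (_* q x) (ind-≢ {a} {x} (λ { refl → np x<B })))) (sym (s a (ℕP.≮⇒≥ np)))

  Br : ℕ → (ℕ → ℤ) → (ℕ → ℤ) → ℤ
  Br B q f = sI 0 B (λ a → QI 0 B q a * f a)

  Br-anti : ∀ B q f → Br B q f ≡ - Br B f q
  Br-anti B q f = trans (expand q f) (trans (sumN-swap B B (λ a x → sg a x * q x * f a)) (trans (sumN-cong B (λ x _ → trans (sumN-cong B (λ a _ → trans (cong (λ z → z * q x * f a) (sg-anti x a)) (lem (sg x a) (q x) (f a)))) (sumN-* B -1ℤ (λ a → sg x a * f a * q x))))
     (trans (sumN-* B -1ℤ (λ x → sumN B (λ a → sg x a * f a * q x))) (trans (ℤP.-1*i≡-i (sumN B (λ x → sumN B (λ a → sg x a * f a * q x)))) (cong -_ (sym (expand f q)))))))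
    where
      lem : ∀ a b c → - a * b * c ≡ -1ℤ * (a * c * b)
      lem = solve-∀
      expand : ∀ q f → Br B q f ≡ sumN B (λ a → sumN B (λ x → sg a x * q x * f a))
      expand q f = trans (sI-sumN 0 B (λ a → QI 0 B q a * f a)) (sumN-cong B (λ a _ → trans (cong (_* f a) (sI-sumN 0 B (λ x → sg a x * q x))) (trans (ℤP.*-comm (sumN B (λ x → sg a x * q x)) (f a)) (trans (sym (sumN-* B (f a) (λ x → sg a x * q x))) (sumN-cong B (λ x _ → ℤP.*-comm (f a) (sg a x * q x)))))))

  Br-P : ∀ B q i → 2 ℕ.* i ℕ.< B → Br B q (P i) ≡ Ev i (QI 0 B q)
  Br-P B q i p = trans (sI-sumN 0 B (λ a → QI 0 B q a * P i a)) (trans (sumN-cong B (λ a _ → ℤP.*-comm (QI 0 B q a) (P i a))) (pairing i B (QI 0 B q) p))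

  Br-sum : ∀ B q n (κ : ℕ → ℤ) → Br B q (λ x → sumN n (λ j → κ j * P j x)) ≡ sumN n (λ j → κ j * Br B q (P j))
  Br-sum B q n κ = trans (sI-sumN 0 B (λ a → QI 0 B q a * sumN n (λ j → κ j * P j a))) (trans (sumN-cong B {g = λ a → sumN n (λ j → κ j * (QI 0 B q a * P j a))} (λ a _ → trans (sym (sumN-* n (QI 0 B q a) (λ j → κ j * P j a))) (sumN-cong n {g = λ j → κ j * (QI 0 B q a * P j a)} (λ j _ → lem (QI 0 B q a) (κ j) (P j a)))))
      (trans (sumN-swap B n (λ a j → κ j * (QI 0 B q a * P j a))) (sumN-cong n (λ j _ → trans (sumN-* B (κ j) (λ a → QI 0 B q a * P j a)) (cong (κ j *_) (sym (sI-sumN 0 B (λ a → QI 0 B q a * P j a))))))))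
    where lem : ∀ a b c → a * (b * c) ≡ b * (a * c)
          lem = solve-∀

  module Scaled (L : ℕ) where
    private
      rising : ℕ → ℕ → ℤ
      rising n zero = 1ℤ
      rising n (suc g) = + suc n * rising (suc n) g

    -- L! / z!, which is 0 for negative z
    φ : ℤ → ℤ
    φ (+ n) = rising n (L ℕ.∸ n)
    φ -[1+ n ] = 0ℤ

    φ-rec : ∀ z → z ≤ + L → φ (z - 1ℤ) ≡ z * φ z
    φ-rec (+ zero) p = refl
    φ-rec (+ suc n) (+≤+ p) = cong (rising n) (ℕP.+-∸-assoc 1 p)
    φ-rec -[1+ n ] p = sym (ℤP.*-zeroʳ -[1+ n ])

    φ-fact : ∀ n → n ℕ.≤ L → φ (+ n) * + (n !) ≡ + (L !)
    φ-fact n p = trans (go (L ℕ.∸ n) n) (cong (λ z → + (z !)) (ℕP.m+[n∸m]≡n p))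
      where
        go : ∀ g n → rising n g * + (n !) ≡ + ((n ℕ.+ g) !)
        go zero n = trans (ℤP.*-identityˡ _) (cong (λ z → + (z !)) (sym (ℕP.+-identityʳ n)))
        go (suc g) n = trans (lem (+ suc n) (rising (suc n) g) (+ (n !))) (trans (cong (rising (suc n) g *_) (sym (ℤP.pos-* (suc n) (n !)))) (trans (go g (suc n)) (cong (λ z → + (z !)) (sym (ℕP.+-suc n g)))))
          where lem : ∀ a b c → a * b * c ≡ b * (a * c)
                lem = solve-∀

    Ch-φ : ∀ k z → k ℕ.≤ L → Ch k z * (φ 0ℤ * φ 0ℤ) ≡ + (k !) * φ z * φ (+ k - z)
    Ch-φ zero (+ zero) p = lem (φ 0ℤ)
      where lem : ∀ a → 1ℤ * (a * a) ≡ 1ℤ * a * a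
            lem = solve-∀
    Ch-φ zero (+ suc n) p = sym (ℤP.*-zeroʳ (1ℤ * φ (+ suc n)))
    Ch-φ zero -[1+ n ] p = refl
    Ch-φ (suc k) z p = trans (ℤP.*-distribʳ-+ (φ 0ℤ * φ 0ℤ) (Ch k z) (Ch k (z - 1ℤ)))
      (trans (cong₂ _+_ (Ch-φ k z (ℕP.<⇒≤ p)) (Ch-φ k (z - 1ℤ) (ℕP.<⇒≤ p))) (trans (cong₂ (λ s t → + (k !) * φ z * φ s + + (k !) * φ (z - 1ℤ) * φ t) (e1 (+ k) z) (e2 (+ k) z)) (step z)))
      where
        e1 : ∀ k z → k - z ≡ 1ℤ + k - z - 1ℤ
        e1 = solve-∀
        e2 : ∀ k z → k - (z - 1ℤ) ≡ 1ℤ + k - z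
        e2 = solve-∀
        lem : ∀ f a k z b → f * a * ((1ℤ + k - z) * b) + f * (z * a) * b ≡ ((1ℤ + k) * f) * a * b
        lem = solve-∀
        step : ∀ z → + (k !) * φ z * φ (+ suc k - z - 1ℤ) + + (k !) * φ (z - 1ℤ) * φ (+ suc k - z) ≡ + (suc k !) * φ z * φ (+ suc k - z)
        step -[1+ n ] = lem0 (+ (k !)) (φ (+ suc k - -[1+ n ] - 1ℤ)) (φ (+ suc k - -[1+ n ])) (+ (suc k !))
          where lem0 : ∀ f a b c → f * 0ℤ * a + f * 0ℤ * b ≡ c * 0ℤ * b
                lem0 = solve-∀
        step (+ n) with n ℕP.≤? suc k
        ... | yes q = trans (cong₂ (λ s t → + (k !) * φ (+ n) * s + + (k !) * t * φ (+ suc k - + n)) (φ-rec (+ suc k - + n) (ℤP.i≤j⇒i-k≤j (+ n) (+≤+ p))) (φ-rec (+ n) (+≤+ (ℕP.≤-trans q p))))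
                (trans (lem (+ (k !)) (φ (+ n)) (+ k) (+ n) (φ (+ suc k - + n))) (cong (λ z → z * φ (+ n) * φ (+ suc k - + n)) (sym (ℤP.pos-* (suc k) (k !)))))
        ... | no q with ℕP.m≤n⇒∃[o]m+o≡n (ℕP.≰⇒> q)
        ...   | g , refl = trans (cong (λ z → + (k !) * φ (+ n) * φ (z - 1ℤ) + + (k !) * φ (+ n - 1ℤ) * φ z) neg) (trans (lem0 (+ (k !)) (φ (+ n)) (φ (+ n - 1ℤ)) (+ (suc k !))) (cong (λ z → + (suc k !) * φ (+ n) * φ z) (sym neg)))
          where
            neg : + suc k - + (suc (suc k) ℕ.+ g) ≡ -[1+ g ]
            neg = lem1 (+ k) (+ g)
              where lem1 : ∀ k g → 1ℤ + k - (+ 2 + k + g) ≡ - (1ℤ + g)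
                    lem1 = solve-∀
            lem0 : ∀ f a b c → f * a * 0ℤ + f * b * 0ℤ ≡ c * a * 0ℤ
            lem0 = solve-∀

module Hypergeometric where
  open TriangleFunction using (sgn)
  open RowSums using (sumN; sumN-cong)
  open Polynomials using (sumN-+; sumN-*; sumN-0)
  open RowFunctions
  open import Data.Nat.Base using (_!)
  open import Data.Integer.Base using (ℤ; +_; -[1+_]; 0ℤ; 1ℤ; -1ℤ; _+_; _*_; _-_; -_; _≤_; +≤+)

  module WZ (M : ℕ) where
    L : ℕ
    L = 4 ℕ.* M ℕ.+ 8
    open Scaled L public

    -- the coefficients of the polynomial orthogonal to (p - 2) p^i, i < M, with p = u (1 + u)
    κ : ℕ → ℤ
    κ j = sgn j * + ((2 ℕ.* j) !) * + (3 ℕ.* j ℕ.+ 2) * φ (+ j) * φ (+ suc j)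
      * + ((M ℕ.+ 1 ℕ.+ j) !) * + ((2 ℕ.* M ℕ.+ 1 ℕ.∸ j) !) * φ (+ M - + j) * φ (+ (2 ℕ.* M ℕ.+ 2 ℕ.+ j))

    weight : ℕ → ℕ → ℤ
    weight i j = + ((i ℕ.+ j) !) * φ (+ (2 ℕ.* j ℕ.+ 1) - + i) * φ (+ (2 ℕ.* i) - + j)

    G : ℕ → ℕ → ℤ
    G i j = sgn j * + ((2 ℕ.* j) !) * φ (+ j) * φ (+ j)
      * + ((M ℕ.+ 1 ℕ.+ j) !) * + ((2 ℕ.* M ℕ.+ 2 ℕ.∸ j) !) * φ (+ M - + j) * φ (+ (2 ℕ.* M ℕ.+ 1 ℕ.+ j))
      * (+ ((i ℕ.+ j) !) * φ (+ (2 ℕ.* j) - 1ℤ - + i) * φ (+ (2 ℕ.* i ℕ.+ 2) - + j))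

    module _ (i j : ℕ) (i≤ : i ℕ.≤ 2 ℕ.* M ℕ.+ 1) (j≤M : j ℕ.≤ M) where
      private
        I J m z y D : ℤ
        I = + i
        J = + j
        m = + M
        z = + (2 ℕ.* j ℕ.+ 1) - + i
        y = + (2 ℕ.* i ℕ.+ 2) - + j
        D = + (2 ℕ.* M ℕ.+ 2) - + j

        base : ℤ
        base = sgn j * + ((2 ℕ.* j) !) * φ (+ suc j) * φ (+ suc j)
          * + ((M ℕ.+ 1 ℕ.+ j) !) * + ((2 ℕ.* M ℕ.+ 1 ℕ.∸ j) !) * φ (+ M - + j) * φ (+ (2 ℕ.* M ℕ.+ 2 ℕ.+ j))
          * (+ ((i ℕ.+ j) !) * φ z * φ y)

        sub-≤ : ∀ a b → a ℕ.≤ L → + a - + b ≤ + L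
        sub-≤ a b p = ℤP.i≤j⇒i-k≤j (+ b) (+≤+ p)

        2j+1≤L : 2 ℕ.* j ℕ.+ 1 ℕ.≤ L
        2j+1≤L = ℕP.+-mono-≤ (ℕP.*-mono-≤ {2} {4} (s≤s (s≤s z≤n)) j≤M) (s≤s z≤n)

        2i+2≤L : 2 ℕ.* i ℕ.+ 2 ℕ.≤ L
        2i+2≤L = ℕP.≤-trans (ℕP.+-monoˡ-≤ 2 (ℕP.*-monoʳ-≤ 2 i≤)) (subst₂ ℕ._≤_ (lem M) (lem' M) (ℕP.m≤m+n (4 ℕ.* M ℕ.+ 4) 4))
          where
            lem : ∀ M → 4 ℕ.* M ℕ.+ 4 ≡ 2 ℕ.* (2 ℕ.* M ℕ.+ 1) ℕ.+ 2
            lem = solveℕ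
            lem' : ∀ M → 4 ℕ.* M ℕ.+ 4 ℕ.+ 4 ≡ 4 ℕ.* M ℕ.+ 8
            lem' = solveℕ

        M≤L : M ℕ.≤ L
        M≤L = ℕP.≤-trans (ℕP.m≤n*m M 4) (ℕP.m≤m+n (4 ℕ.* M) 8)

        j+1≤L : suc j ℕ.≤ L
        j+1≤L = ℕP.≤-trans (s≤s j≤M) (subst (suc M ℕ.≤_) (lem M) (ℕP.m≤m+n (suc M) (3 ℕ.* M ℕ.+ 7)))
          where lem : ∀ M → suc M ℕ.+ (3 ℕ.* M ℕ.+ 7) ≡ 4 ℕ.* M ℕ.+ 8
                lem = solveℕ

        2M+2+j≤L : 2 ℕ.* M ℕ.+ 2 ℕ.+ j ℕ.≤ L
        2M+2+j≤L = ℕP.≤-trans (ℕP.+-monoʳ-≤ (2 ℕ.* M ℕ.+ 2) j≤M) (subst (2 ℕ.* M ℕ.+ 2 ℕ.+ M ℕ.≤_) (lem M) (ℕP.m≤m+n (2 ℕ.* M ℕ.+ 2 ℕ.+ M) (M ℕ.+ 6)))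
          where lem : ∀ M → 2 ℕ.* M ℕ.+ 2 ℕ.+ M ℕ.+ (M ℕ.+ 6) ≡ 4 ℕ.* M ℕ.+ 8
                lem = solveℕ

        φ-at : ∀ x x' → x' ≡ x - 1ℤ → x ≤ + L → φ x' ≡ x * φ x
        φ-at x x' refl p = φ-rec x p

        fact-at : ∀ a b → b ≡ suc a → + (b !) ≡ + b * + (a !)
        fact-at a .(suc a) refl = ℤP.pos-* (suc a) (a !)

        φj : φ (+ j) ≡ + suc j * φ (+ suc j)
        φj = φ-at (+ suc j) (+ j) refl (+≤+ j+1≤L)

        φy : φ (+ (2 ℕ.* i ℕ.+ 1) - + j) ≡ y * φ y
        φy = φ-at y _ (lem (+ (2 ℕ.* i)) J) (sub-≤ (2 ℕ.* i ℕ.+ 2) j 2i+2≤L)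
          where lem : ∀ a b → a + 1ℤ - b ≡ a + + 2 - b - 1ℤ
                lem = solve-∀

        φy' : φ (+ (2 ℕ.* i) - + j) ≡ (y - 1ℤ) * (y * φ y)
        φy' = trans (φ-at (+ (2 ℕ.* i ℕ.+ 1) - + j) _ (lem (+ (2 ℕ.* i)) J) (sub-≤ (2 ℕ.* i ℕ.+ 1) j (ℕP.≤-trans (ℕP.+-monoʳ-≤ (2 ℕ.* i) (s≤s z≤n)) 2i+2≤L)))
            (cong₂ _*_ (lem' (+ (2 ℕ.* i)) J) φy)
          where
            lem : ∀ a b → a - b ≡ a + 1ℤ - b - 1ℤ
            lem = solve-∀
            lem' : ∀ a b → a + 1ℤ - b ≡ a + + 2 - b - 1ℤ
            lem' = solve-∀

        φz : φ (+ (2 ℕ.* j ℕ.+ 1) - + suc i) ≡ z * φ z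
        φz = φ-at z _ (lem (+ (2 ℕ.* j ℕ.+ 1)) I) (sub-≤ (2 ℕ.* j ℕ.+ 1) i 2j+1≤L)
          where lem : ∀ a b → a - (1ℤ + b) ≡ a - b - 1ℤ
                lem = solve-∀

        φz' : φ (+ (2 ℕ.* j) - 1ℤ - + i) ≡ (z - 1ℤ) * (z * φ z)
        φz' = trans (φ-at (z - 1ℤ) _ (lem (+ (2 ℕ.* j)) I) (ℤP.≤-trans (ℤP.i≤j⇒i-k≤j 1ℤ ℤP.≤-refl) (sub-≤ (2 ℕ.* j ℕ.+ 1) i 2j+1≤L)))
            (cong ((z - 1ℤ) *_) (φ-at z (z - 1ℤ) refl (sub-≤ (2 ℕ.* j ℕ.+ 1) i 2j+1≤L)))
          where lem : ∀ a b → a - 1ℤ - b ≡ a + 1ℤ - b - 1ℤ - 1ℤ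
                lem = solve-∀

        D≡ : + suc (2 ℕ.* M ℕ.+ 1 ℕ.∸ j) ≡ D
        D≡ = trans (lem (+ (2 ℕ.* M ℕ.+ 1 ℕ.∸ j)) J) (cong (λ k → 1ℤ + + k - J) (ℕP.m∸n+n≡m j≤2M+1) ⟨t⟩ lem' (+ (2 ℕ.* M)) J)
          where
            _⟨t⟩_ : ∀ {a b c : ℤ} → a ≡ b → b ≡ c → a ≡ c
            _⟨t⟩_ = trans
            j≤2M+1 : j ℕ.≤ 2 ℕ.* M ℕ.+ 1
            j≤2M+1 = ℕP.≤-trans j≤M (ℕP.≤-trans (ℕP.m≤n*m M 2) (ℕP.m≤m+n (2 ℕ.* M) 1))
            lem : ∀ d j → 1ℤ + d ≡ 1ℤ + (d + j) - j
            lem = solve-∀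
            lem' : ∀ a j → 1ℤ + (a + 1ℤ) - j ≡ a + + 2 - j
            lem' = solve-∀

        fD : + ((2 ℕ.* M ℕ.+ 2 ℕ.∸ j) !) ≡ D * + ((2 ℕ.* M ℕ.+ 1 ℕ.∸ j) !)
        fD = trans (fact-at (2 ℕ.* M ℕ.+ 1 ℕ.∸ j) _ e) (cong (_* + ((2 ℕ.* M ℕ.+ 1 ℕ.∸ j) !)) (trans (cong +_ e) D≡))
          where
            e : 2 ℕ.* M ℕ.+ 2 ℕ.∸ j ≡ suc (2 ℕ.* M ℕ.+ 1 ℕ.∸ j)
            e = trans (cong (ℕ._∸ j) (ℕP.+-suc (2 ℕ.* M) 1)) (ℕP.+-∸-assoc 1 (ℕP.≤-trans j≤M (ℕP.≤-trans (ℕP.m≤n*m M 2) (ℕP.m≤m+n (2 ℕ.* M) 1))))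

        fD' : + ((2 ℕ.* M ℕ.+ 2 ℕ.∸ suc j) !) ≡ + ((2 ℕ.* M ℕ.+ 1 ℕ.∸ j) !)
        fD' = cong (λ k → + ((k ℕ.∸ suc j) !)) (ℕP.+-suc (2 ℕ.* M) 1)

        φM : φ (+ M - + suc j) ≡ (m - J) * φ (m - J)
        φM = φ-at (m - J) _ (lem m J) (sub-≤ M j M≤L)
          where lem : ∀ a b → a - (1ℤ + b) ≡ a - b - 1ℤ
                lem = solve-∀

        φ2M : φ (+ (2 ℕ.* M ℕ.+ 1 ℕ.+ j)) ≡ + (2 ℕ.* M ℕ.+ 2 ℕ.+ j) * φ (+ (2 ℕ.* M ℕ.+ 2 ℕ.+ j))
        φ2M = φ-at (+ (2 ℕ.* M ℕ.+ 2 ℕ.+ j)) _ (lem (+ (2 ℕ.* M)) J) (+≤+ 2M+2+j≤L)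
          where lem : ∀ a b → a + 1ℤ + b ≡ a + + 2 + b - 1ℤ
                lem = solve-∀

        f2j : + ((2 ℕ.* suc j) !) ≡ + (2 ℕ.* j ℕ.+ 2) * (+ (2 ℕ.* j ℕ.+ 1) * + ((2 ℕ.* j) !))
        f2j = trans (cong (λ k → + (k !)) (lem j)) (trans (fact-at (2 ℕ.* j ℕ.+ 1) (2 ℕ.* j ℕ.+ 2) (ℕP.+-suc (2 ℕ.* j) 1)) (cong (+ (2 ℕ.* j ℕ.+ 2) *_) (fact-at (2 ℕ.* j) (2 ℕ.* j ℕ.+ 1) (ℕP.+-comm (2 ℕ.* j) 1))))
          where lem : ∀ j → 2 ℕ.* suc j ≡ 2 ℕ.* j ℕ.+ 2
                lem = solveℕ

        fM : + ((M ℕ.+ 1 ℕ.+ suc j) !) ≡ + (M ℕ.+ 1 ℕ.+ suc j) * + ((M ℕ.+ 1 ℕ.+ j) !)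
        fM = fact-at (M ℕ.+ 1 ℕ.+ j) _ (ℕP.+-suc (M ℕ.+ 1) j)

        fi : + ((suc i ℕ.+ j) !) ≡ + (suc i ℕ.+ j) * + ((i ℕ.+ j) !)
        fi = fact-at (i ℕ.+ j) _ refl

        fi' : + ((i ℕ.+ suc j) !) ≡ + (suc i ℕ.+ j) * + ((i ℕ.+ j) !)
        fi' = trans (cong (λ k → + (k !)) (ℕP.+-suc i j)) fi

        t₀ : κ j * weight i j ≡ + (3 ℕ.* j ℕ.+ 2) * + suc j * ((y - 1ℤ) * y) * base
        t₀ = trans (cong₂ (λ s t → sgn j * + ((2 ℕ.* j) !) * + (3 ℕ.* j ℕ.+ 2) * s * φ (+ suc j) * + ((M ℕ.+ 1 ℕ.+ j) !) * + ((2 ℕ.* M ℕ.+ 1 ℕ.∸ j) !) * φ (+ M - + j) * φ (+ (2 ℕ.* M ℕ.+ 2 ℕ.+ j)) * (+ ((i ℕ.+ j) !) * φ z * t)) φj φy')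
            (lem (sgn j) (+ ((2 ℕ.* j) !)) (+ (3 ℕ.* j ℕ.+ 2)) (+ suc j) (φ (+ suc j)) (+ ((M ℕ.+ 1 ℕ.+ j) !)) (+ ((2 ℕ.* M ℕ.+ 1 ℕ.∸ j) !)) (φ (+ M - + j)) (φ (+ (2 ℕ.* M ℕ.+ 2 ℕ.+ j))) (+ ((i ℕ.+ j) !)) (φ z) (y - 1ℤ) y (φ y))
          where lem : ∀ s f a b p g h q r e zz y1 y yy → s * f * a * (b * p) * p * g * h * q * r * (e * zz * (y1 * (y * yy))) ≡ a * b * (y1 * y) * (s * f * p * p * g * h * q * r * (e * zz * yy))
                lem = solve-∀

        t₁ : κ j * weight (suc i) j ≡ + (3 ℕ.* j ℕ.+ 2) * + suc j * (+ (suc i ℕ.+ j) * z) * base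
        t₁ = trans (cong₂ (λ s t → sgn j * + ((2 ℕ.* j) !) * + (3 ℕ.* j ℕ.+ 2) * s * φ (+ suc j) * + ((M ℕ.+ 1 ℕ.+ j) !) * + ((2 ℕ.* M ℕ.+ 1 ℕ.∸ j) !) * φ (+ M - + j) * φ (+ (2 ℕ.* M ℕ.+ 2 ℕ.+ j)) * t) φj
               (cong₂ _*_ (cong₂ _*_ fi φz) (cong φ (cong (λ k → + k - J) (e i)))))
            (lem (sgn j) (+ ((2 ℕ.* j) !)) (+ (3 ℕ.* j ℕ.+ 2)) (+ suc j) (φ (+ suc j)) (+ ((M ℕ.+ 1 ℕ.+ j) !)) (+ ((2 ℕ.* M ℕ.+ 1 ℕ.∸ j) !)) (φ (+ M - + j)) (φ (+ (2 ℕ.* M ℕ.+ 2 ℕ.+ j))) (+ (suc i ℕ.+ j)) (+ ((i ℕ.+ j) !)) z (φ z) (φ y))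
          where
            e : ∀ i → 2 ℕ.* suc i ≡ 2 ℕ.* i ℕ.+ 2
            e = solveℕ
            lem : ∀ s f a b p g h q r k e z zz yy → s * f * a * (b * p) * p * g * h * q * r * (k * e * (z * zz) * yy) ≡ a * b * (k * z) * (s * f * p * p * g * h * q * r * (e * zz * yy))
            lem = solve-∀

        g₀ : G i j ≡ + suc j * + suc j * D * + (2 ℕ.* M ℕ.+ 2 ℕ.+ j) * ((z - 1ℤ) * z) * base
        g₀ = trans (cong₂ (λ s t → s * φ (+ M - + j) * t * (+ ((i ℕ.+ j) !) * φ (+ (2 ℕ.* j) - 1ℤ - + i) * φ y)) (cong₂ (λ s t → sgn j * + ((2 ℕ.* j) !) * s * s * + ((M ℕ.+ 1 ℕ.+ j) !) * t) φj fD) φ2M)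
            (trans (cong (λ t → sgn j * + ((2 ℕ.* j) !) * (+ suc j * φ (+ suc j)) * (+ suc j * φ (+ suc j)) * + ((M ℕ.+ 1 ℕ.+ j) !) * (D * + ((2 ℕ.* M ℕ.+ 1 ℕ.∸ j) !)) * φ (+ M - + j) * (+ (2 ℕ.* M ℕ.+ 2 ℕ.+ j) * φ (+ (2 ℕ.* M ℕ.+ 2 ℕ.+ j))) * (+ ((i ℕ.+ j) !) * t * φ y)) φz')
            (lem (sgn j) (+ ((2 ℕ.* j) !)) (+ suc j) (φ (+ suc j)) (+ ((M ℕ.+ 1 ℕ.+ j) !)) D (+ ((2 ℕ.* M ℕ.+ 1 ℕ.∸ j) !)) (φ (+ M - + j)) (+ (2 ℕ.* M ℕ.+ 2 ℕ.+ j)) (φ (+ (2 ℕ.* M ℕ.+ 2 ℕ.+ j))) (+ ((i ℕ.+ j) !)) (z - 1ℤ) z (φ z) (φ y)))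
          where lem : ∀ s f b p g d h q x r e z1 z zz yy → s * f * (b * p) * (b * p) * g * (d * h) * q * (x * r) * (e * (z1 * (z * zz)) * yy) ≡ b * b * d * x * (z1 * z) * (s * f * p * p * g * h * q * r * (e * zz * yy))
                lem = solve-∀

        g₁ : G i (suc j) ≡ - (+ (2 ℕ.* j ℕ.+ 2) * + (2 ℕ.* j ℕ.+ 1) * + (M ℕ.+ 1 ℕ.+ suc j) * (m - J) * + (suc i ℕ.+ j) * y) * base
        g₁ = trans (cong₂ _*_ (cong₂ _*_ (cong₂ _*_ (cong₂ (λ s t → - sgn j * s * φ (+ suc j) * φ (+ suc j) * t * + ((2 ℕ.* M ℕ.+ 2 ℕ.∸ suc j) !)) f2j fM) φM) (cong φ (cong +_ e1)))
                (cong₂ _*_ (cong₂ _*_ fi' (cong φ e2)) (trans (cong φ e3) φy)))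
            (trans (cong (λ t → - sgn j * (+ (2 ℕ.* j ℕ.+ 2) * (+ (2 ℕ.* j ℕ.+ 1) * + ((2 ℕ.* j) !))) * φ (+ suc j) * φ (+ suc j) * (+ (M ℕ.+ 1 ℕ.+ suc j) * + ((M ℕ.+ 1 ℕ.+ j) !)) * t * ((m - J) * φ (m - J)) * φ (+ (2 ℕ.* M ℕ.+ 2 ℕ.+ j)) * (+ (suc i ℕ.+ j) * + ((i ℕ.+ j) !) * φ z * (y * φ y))) fD')
            (lem (sgn j) (+ (2 ℕ.* j ℕ.+ 2)) (+ (2 ℕ.* j ℕ.+ 1)) (+ ((2 ℕ.* j) !)) (φ (+ suc j)) (+ (M ℕ.+ 1 ℕ.+ suc j)) (+ ((M ℕ.+ 1 ℕ.+ j) !)) (+ ((2 ℕ.* M ℕ.+ 1 ℕ.∸ j) !)) (m - J) (φ (m - J)) (φ (+ (2 ℕ.* M ℕ.+ 2 ℕ.+ j))) (+ (suc i ℕ.+ j)) (+ ((i ℕ.+ j) !)) (φ z) y (φ y)))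
          where
            e1 : 2 ℕ.* M ℕ.+ 1 ℕ.+ suc j ≡ 2 ℕ.* M ℕ.+ 2 ℕ.+ j
            e1 = lem' M j
              where lem' : ∀ M j → 2 ℕ.* M ℕ.+ 1 ℕ.+ suc j ≡ 2 ℕ.* M ℕ.+ 2 ℕ.+ j
                    lem' = solveℕ
            e2 : + (2 ℕ.* suc j) - 1ℤ - + i ≡ z
            e2 = trans (cong (λ k → + k - 1ℤ - + i) (lem' j)) (lem'' (+ (2 ℕ.* j)) I)
              where
                lem' : ∀ j → 2 ℕ.* suc j ≡ 2 ℕ.* j ℕ.+ 2
                lem' = solveℕ
                lem'' : ∀ a i → a + + 2 - 1ℤ - i ≡ a + 1ℤ - i
                lem'' = solve-∀
            e3 : + (2 ℕ.* i ℕ.+ 2) - + suc j ≡ + (2 ℕ.* i ℕ.+ 1) - + j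
            e3 = lem'' (+ (2 ℕ.* i)) J
              where lem'' : ∀ a j → a + + 2 - (1ℤ + j) ≡ a + 1ℤ - j
                    lem'' = solve-∀
            lem : ∀ s a b f p c g h x q r k e zz y yy → - s * (a * (b * f)) * p * p * (c * g) * h * (x * q) * r * (k * e * zz * (y * yy)) ≡ - (a * b * c * x * k * y) * (s * f * p * p * g * h * q * r * (e * zz * yy))
            lem = solve-∀

      certificate : + 2 * + (2 ℕ.* i ℕ.+ 3) * (+ M - + i) * + (M ℕ.+ 2 ℕ.+ i) * (κ j * weight (suc i) j) + + i * (+ (2 ℕ.* M ℕ.+ 1) - + i) * + (2 ℕ.* M ℕ.+ 3 ℕ.+ i) * (κ j * weight i j)
        ≡ - + 3 * + suc i * (G i (suc j) - G i j)
      certificate = trans (cong₂ (λ s t → + 2 * + (2 ℕ.* i ℕ.+ 3) * (+ M - + i) * + (M ℕ.+ 2 ℕ.+ i) * s + + i * (+ (2 ℕ.* M ℕ.+ 1) - + i) * + (2 ℕ.* M ℕ.+ 3 ℕ.+ i) * t) t₁ t₀)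
        (trans (factor (+ 2 * + (2 ℕ.* i ℕ.+ 3) * (+ M - + i) * + (M ℕ.+ 2 ℕ.+ i)) (+ (3 ℕ.* j ℕ.+ 2) * + suc j * (+ (suc i ℕ.+ j) * z)) (+ i * (+ (2 ℕ.* M ℕ.+ 1) - + i) * + (2 ℕ.* M ℕ.+ 3 ℕ.+ i)) (+ (3 ℕ.* j ℕ.+ 2) * + suc j * ((y - 1ℤ) * y)) base)
        (trans (cong (_* base) (identity I J m)) (trans (factor' (- + 3 * + suc i) (- (+ (2 ℕ.* j ℕ.+ 2) * + (2 ℕ.* j ℕ.+ 1) * + (M ℕ.+ 1 ℕ.+ suc j) * (m - J) * + (suc i ℕ.+ j) * y)) (+ suc j * + suc j * D * + (2 ℕ.* M ℕ.+ 2 ℕ.+ j) * ((z - 1ℤ) * z)) base)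
          (cong₂ (λ s t → - + 3 * + suc i * (s - t)) (sym g₁) (sym g₀)))))
        where
          factor : ∀ a b c d e → a * (b * e) + c * (d * e) ≡ (a * b + c * d) * e
          factor = solve-∀
          factor' : ∀ a b c e → a * (b - c) * e ≡ a * (b * e - c * e)
          factor' = solve-∀
          identity : ∀ i j m →
            + 2 * (i + (i + 0ℤ) + + 3) * (m - i) * (m + + 2 + i) * ((j + (j + (j + 0ℤ)) + + 2) * (1ℤ + j) * ((1ℤ + i + j) * (j + (j + 0ℤ) + 1ℤ - i)))
            + i * (m + (m + 0ℤ) + 1ℤ - i) * (m + (m + 0ℤ) + + 3 + i) * ((j + (j + (j + 0ℤ)) + + 2) * (1ℤ + j) * ((i + (i + 0ℤ) + + 2 - j - 1ℤ) * (i + (i + 0ℤ) + + 2 - j)))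
            ≡ - + 3 * (1ℤ + i) * (- ((j + (j + 0ℤ) + + 2) * (j + (j + 0ℤ) + 1ℤ) * (m + 1ℤ + (1ℤ + j)) * (m - j) * (1ℤ + i + j) * (i + (i + 0ℤ) + + 2 - j))
              - (1ℤ + j) * (1ℤ + j) * (m + (m + 0ℤ) + + 2 - j) * (m + (m + 0ℤ) + + 2 + j) * ((j + (j + 0ℤ) + 1ℤ - i - 1ℤ) * (j + (j + 0ℤ) + 1ℤ - i)))
          identity = solve-∀

    S : ℕ → ℤ
    S i = sumN (suc M) (λ j → κ j * weight i j)

    S-rec : ∀ i → i ℕ.≤ 2 ℕ.* M ℕ.+ 1 →
      + 2 * + (2 ℕ.* i ℕ.+ 3) * (+ M - + i) * + (M ℕ.+ 2 ℕ.+ i) * S (suc i) + + i * (+ (2 ℕ.* M ℕ.+ 1) - + i) * + (2 ℕ.* M ℕ.+ 3 ℕ.+ i) * S i ≡ 0ℤ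
    S-rec i p = trans (cong₂ _+_ (sym (sumN-* (suc M) a₁ (λ j → κ j * weight (suc i) j))) (sym (sumN-* (suc M) a₀ (λ j → κ j * weight i j))))
      (trans (sym (sumN-+ (suc M) (λ j → a₁ * (κ j * weight (suc i) j)) (λ j → a₀ * (κ j * weight i j))))
      (trans (sumN-cong (suc M) (λ { j (s≤s j≤M) → certificate i j p j≤M }))
      (trans (sumN-* (suc M) (- + 3 * + suc i) (λ j → G i (suc j) - G i j)) (trans (cong (- + 3 * + suc i *_) (trans (telescope (suc M)) (cong₂ _-_ top bottom))) (ℤP.*-zeroʳ (- + 3 * + suc i))))))
      where
        a₁ a₀ : ℤ
        a₁ = + 2 * + (2 ℕ.* i ℕ.+ 3) * (+ M - + i) * + (M ℕ.+ 2 ℕ.+ i)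
        a₀ = + i * (+ (2 ℕ.* M ℕ.+ 1) - + i) * + (2 ℕ.* M ℕ.+ 3 ℕ.+ i)
        telescope : ∀ n → sumN n (λ j → G i (suc j) - G i j) ≡ G i n - G i 0
        telescope zero = sym (ℤP.+-inverseʳ (G i 0))
        telescope (suc n) = trans (cong (_+ (G i (suc n) - G i n)) (telescope n)) (lem (G i n) (G i 0) (G i (suc n)))
          where lem : ∀ a b c → a - b + (c - a) ≡ c - b
                lem = solve-∀
        zeroMid : ∀ a b c → a * 0ℤ * b * c ≡ 0ℤ
        zeroMid = solve-∀
        top : G i (suc M) ≡ 0ℤ
        top = trans (cong (λ t → sgn (suc M) * + ((2 ℕ.* suc M) !) * φ (+ suc M) * φ (+ suc M) * + ((M ℕ.+ 1 ℕ.+ suc M) !) * + ((2 ℕ.* M ℕ.+ 2 ℕ.∸ suc M) !) * t * φ (+ (2 ℕ.* M ℕ.+ 1 ℕ.+ suc M)) * (+ ((i ℕ.+ suc M) !) * φ (+ (2 ℕ.* suc M) - 1ℤ - + i) * φ (+ (2 ℕ.* i ℕ.+ 2) - + suc M)))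
                 (cong φ (lem (+ M))))
              (zeroMid (sgn (suc M) * + ((2 ℕ.* suc M) !) * φ (+ suc M) * φ (+ suc M) * + ((M ℕ.+ 1 ℕ.+ suc M) !) * + ((2 ℕ.* M ℕ.+ 2 ℕ.∸ suc M) !)) (φ (+ (2 ℕ.* M ℕ.+ 1 ℕ.+ suc M))) _)
          where lem : ∀ m → m - (1ℤ + m) ≡ -1ℤ
                lem = solve-∀
        bottom : G i 0 ≡ 0ℤ
        bottom = trans (cong (λ t → X * (+ ((i ℕ.+ 0) !) * φ t * φ (+ (2 ℕ.* i ℕ.+ 2) - 0ℤ))) (neg i)) (lem X (+ ((i ℕ.+ 0) !)) (φ (+ (2 ℕ.* i ℕ.+ 2) - 0ℤ)))
          where
            X = sgn 0 * + ((2 ℕ.* 0) !) * φ (+ 0) * φ (+ 0) * + ((M ℕ.+ 1 ℕ.+ 0) !) * + ((2 ℕ.* M ℕ.+ 2 ℕ.∸ 0) !) * φ (+ M - + 0) * φ (+ (2 ℕ.* M ℕ.+ 1 ℕ.+ 0))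
            neg : ∀ i → 0ℤ - 1ℤ - + i ≡ -[1+ i ]
            neg zero = refl
            neg (suc i) = refl
            lem : ∀ a b c → a * (b * 0ℤ * c) ≡ 0ℤ
            lem = solve-∀

    nz* : ∀ {a b} → a * b ≡ 0ℤ → a ≢ 0ℤ → b ≡ 0ℤ
    nz* {a} {b} e na = [ (λ a≡0 → contradiction a≡0 na) , id ]′ (ℤP.i*j≡0⇒i≡0∨j≡0 a e)

    pos≢0 : ∀ n → + suc n ≢ 0ℤ
    pos≢0 n ()

    -- the leading coefficient of S-rec vanishes only at i = M
    lead≢0 : ∀ i → i ≢ M → + 2 * + (2 ℕ.* i ℕ.+ 3) * (+ M - + i) * + (M ℕ.+ 2 ℕ.+ i) ≢ 0ℤ
    lead≢0 i ne e = ne (sym (ℤP.+-injective (ℤP.i-j≡0⇒i≡j (+ M) (+ i) (nz* {+ 2 * + (2 ℕ.* i ℕ.+ 3)} ([ id , (λ q → contradiction (trans (cong +_ (sym (cong (ℕ._+ i) (ℕP.+-suc M 1)))) q) (pos≢0 (M ℕ.+ 1 ℕ.+ i))) ]′ (ℤP.i*j≡0⇒i≡0∨j≡0 _ e)) nz₁))))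
      where
        nz₁ : + 2 * + (2 ℕ.* i ℕ.+ 3) ≢ 0ℤ
        nz₁ q with nz* {+ 2} q (λ ())
        ... | q' = contradiction (trans (cong +_ (sym (ℕP.+-suc (2 ℕ.* i) 2))) q') (pos≢0 (2 ℕ.* i ℕ.+ 2))

    S-zero : ∀ i → i ℕ.< M → S (suc i) ≡ 0ℤ
    S-zero i i<M = nz* (trans (sym (ℤP.+-identityʳ (c * S (suc i)))) (trans (cong (_+_ (c * S (suc i))) (sym (second i i<M))) (S-rec i (bound i<M)))) (lead≢0 i (ℕP.<⇒≢ i<M))
      where
        c = + 2 * + (2 ℕ.* i ℕ.+ 3) * (+ M - + i) * + (M ℕ.+ 2 ℕ.+ i)
        bound : ∀ {i} → i ℕ.< M → i ℕ.≤ 2 ℕ.* M ℕ.+ 1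
        bound p = ℕP.≤-trans (ℕP.<⇒≤ p) (ℕP.≤-trans (ℕP.m≤n*m M 2) (ℕP.m≤m+n (2 ℕ.* M) 1))
        second : ∀ i → i ℕ.< M → + i * (+ (2 ℕ.* M ℕ.+ 1) - + i) * + (2 ℕ.* M ℕ.+ 3 ℕ.+ i) * S i ≡ 0ℤ
        second zero p = refl
        second (suc i) p = trans (cong (+ suc i * (+ (2 ℕ.* M ℕ.+ 1) - + suc i) * + (2 ℕ.* M ℕ.+ 3 ℕ.+ suc i) *_) (S-zero i (ℕP.<⇒≤ p))) (ℤP.*-zeroʳ (+ suc i * (+ (2 ℕ.* M ℕ.+ 1) - + suc i) * + (2 ℕ.* M ℕ.+ 3 ℕ.+ suc i)))

    φ≢0 : ∀ n → n ℕ.≤ L → φ (+ n) ≢ 0ℤ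
    φ≢0 n p e = ℕ.≢-nonZero⁻¹ (L !) {{L ℕP.!≢0}} (ℤP.+-injective (trans (sym (φ-fact n p)) (cong (_* + (n !)) e)))

    fact≢0 : ∀ n → + (n !) ≢ 0ℤ
    fact≢0 n e = ℕ.≢-nonZero⁻¹ (n !) {{n ℕP.!≢0}} (ℤP.+-injective e)

    *≢0 : ∀ {a b} → a ≢ 0ℤ → b ≢ 0ℤ → a * b ≢ 0ℤ
    *≢0 na nb e = nb (nz* e na)

    sgn≢0 : ∀ n → sgn n ≢ 0ℤ
    sgn≢0 zero ()
    sgn≢0 (suc n) e = sgn≢0 n (trans (sym (ℤP.neg-involutive (sgn n))) (cong -_ e))

    ≤L : ∀ a b → a ℕ.≤ 4 → b ℕ.≤ 8 → a ℕ.* M ℕ.+ b ℕ.≤ L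
    ≤L a b p q = ℕP.+-mono-≤ (ℕP.*-monoˡ-≤ M p) q

    κ-0≢0 : κ 0 ≢ 0ℤ
    κ-0≢0 = *≢0 (*≢0 (*≢0 (*≢0 (*≢0 (*≢0 (*≢0 {1ℤ * 1ℤ} {+ 2} (λ ()) (λ ())) (φ≢0 0 z≤n)) (φ≢0 1 (≤L 0 1 z≤n (s≤s z≤n)))) (fact≢0 (M ℕ.+ 1 ℕ.+ 0))) (fact≢0 (2 ℕ.* M ℕ.+ 1)))
      (subst (λ z → φ z ≢ 0ℤ) (sym (ℤP.+-identityʳ (+ M))) (φ≢0 M (subst (ℕ._≤ L) (trans (ℕP.+-identityʳ (1 ℕ.* M)) (ℕP.*-identityˡ M)) (≤L 1 0 (s≤s z≤n) z≤n))))) (φ≢0 _ (subst (ℕ._≤ L) (sym (ℕP.+-identityʳ _)) (≤L 2 2 (s≤s (s≤s z≤n)) (s≤s (s≤s z≤n)))))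

    κ-M≢0 : κ M ≢ 0ℤ
    κ-M≢0 = *≢0 (*≢0 (*≢0 (*≢0 (*≢0 (*≢0 (*≢0 (*≢0 (sgn≢0 M) (fact≢0 (2 ℕ.* M))) (λ e → contradiction (trans (cong +_ (sym (ℕP.+-suc (3 ℕ.* M) 1))) e) (pos≢0 _)))
        (φ≢0 M (subst (ℕ._≤ L) (trans (ℕP.+-identityʳ (1 ℕ.* M)) (ℕP.*-identityˡ M)) (≤L 1 0 (s≤s z≤n) z≤n))))
        (φ≢0 (suc M) (subst (ℕ._≤ L) (lem1 M) (≤L 1 1 (s≤s z≤n) (s≤s z≤n))))) (fact≢0 (M ℕ.+ 1 ℕ.+ M))) (fact≢0 (2 ℕ.* M ℕ.+ 1 ℕ.∸ M)))
        (subst (λ z → φ z ≢ 0ℤ) (sym (ℤP.+-inverseʳ (+ M))) (φ≢0 0 z≤n))) (φ≢0 _ (subst (ℕ._≤ L) (lem M) (≤L 3 2 (s≤s (s≤s (s≤s z≤n))) (s≤s (s≤s z≤n)))))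
      where
        lem : ∀ M → 3 ℕ.* M ℕ.+ 2 ≡ 2 ℕ.* M ℕ.+ 2 ℕ.+ M
        lem = solveℕ
        lem1 : ∀ M → 1 ℕ.* M ℕ.+ 1 ≡ suc M
        lem1 = solveℕ

    S-last : S (2 ℕ.* M ℕ.+ 1) ≢ 0ℤ
    S-last e = *≢0 κ-M≢0 (*≢0 (*≢0 (fact≢0 (2 ℕ.* M ℕ.+ 1 ℕ.+ M)) (subst (λ z → φ z ≢ 0ℤ) (sym (ℤP.+-inverseʳ (+ (2 ℕ.* M ℕ.+ 1)))) (φ≢0 0 z≤n)))
        (subst (λ z → φ z ≢ 0ℤ) (sym (lem (+ M))) (φ≢0 (3 ℕ.* M ℕ.+ 2) (≤L 3 2 (s≤s (s≤s (s≤s z≤n))) (s≤s (s≤s z≤n))))))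
      (trans (sym (ℤP.+-identityˡ _)) (trans (cong (_+ κ M * weight (2 ℕ.* M ℕ.+ 1) M) (sym (sumN-0 M small))) e))
      where
        lem : ∀ m → m + (m + 0ℤ) + 1ℤ + (m + (m + 0ℤ) + 1ℤ + 0ℤ) - m ≡ m + (m + (m + 0ℤ)) + + 2
        lem = solve-∀
        small : ∀ j → j ℕ.< M → κ j * weight (2 ℕ.* M ℕ.+ 1) j ≡ 0ℤ
        small j p with ℕP.m≤n⇒∃[o]m+o≡n p
        ... | g , refl = trans (cong (λ z → κ j * (+ ((2 ℕ.* M ℕ.+ 1 ℕ.+ j) !) * φ z * φ (+ (2 ℕ.* (2 ℕ.* M ℕ.+ 1)) - + j))) (neg (+ j) (+ g)))
              (zero3 (κ j) (+ ((2 ℕ.* M ℕ.+ 1 ℕ.+ j) !)) (φ (+ (2 ℕ.* (2 ℕ.* M ℕ.+ 1)) - + j)))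
          where
            neg : ∀ j g → j + (j + 0ℤ) + 1ℤ - ((1ℤ + j + g) + ((1ℤ + j + g) + 0ℤ) + 1ℤ) ≡ - (1ℤ + (1ℤ + (g + g)))
            neg = solve-∀
            zero3 : ∀ a b c → a * (b * 0ℤ * c) ≡ 0ℤ
            zero3 = solve-∀

    S-M≢0 : S (suc M) ≢ 0ℤ
    S-M≢0 e = S-last (subst (λ k → S k ≡ 0ℤ) (lem M) (descend M ℕP.≤-refl))
      where
        lem : ∀ M → suc (M ℕ.+ M) ≡ 2 ℕ.* M ℕ.+ 1
        lem = solveℕ
        descend : ∀ d → d ℕ.≤ M → S (suc (M ℕ.+ d)) ≡ 0ℤ
        descend zero _ = trans (cong (λ k → S (suc k)) (ℕP.+-identityʳ M)) e
        descend (suc d) p = nz* (trans (sym (ℤP.+-identityʳ (c₁ * S (suc i)))) (trans (cong (_+_ (c₁ * S (suc i))) (sym (trans (cong (c₀ *_) (trans (cong S (ℕP.+-suc M d)) (descend d (ℕP.<⇒≤ p)))) (ℤP.*-zeroʳ c₀)))) (S-rec i bound)))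
            (lead≢0 i (λ q → ℕP.m≢1+m+n M (sym (trans (cong suc (sym refl)) (trans (sym (ℕP.+-suc M d)) q)))))
          where
            i = M ℕ.+ suc d
            c₁ = + 2 * + (2 ℕ.* i ℕ.+ 3) * (+ M - + i) * + (M ℕ.+ 2 ℕ.+ i)
            c₀ = + i * (+ (2 ℕ.* M ℕ.+ 1) - + i) * + (2 ℕ.* M ℕ.+ 3 ℕ.+ i)
            bound : i ℕ.≤ 2 ℕ.* M ℕ.+ 1
            bound = ℕP.≤-trans (ℕP.+-monoʳ-≤ M p) (subst (M ℕ.+ M ℕ.≤_) (lem M) (ℕP.n≤1+n (M ℕ.+ M)))

module Orthogonality where
  open Wedge
  open RowSums using (sumN; sumN-cong; sumN-head)
  open Polynomials using (sumN-+; sumN-*; sumN-0; sumN-swap)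
  open Contraction
  open RowFunctions
  open Hypergeometric
  open import Data.Nat.Base using (_!)
  open import Data.Integer.Base using (ℤ; +_; 0ℤ; 1ℤ; -1ℤ; _+_; _*_; _-_; -_; _≤_; +≤+; ≢-nonZero)
  open import Data.Vec.Base using (Vec; []; _∷_; _∷ʳ_)
  open import Data.Vec.Relation.Unary.All using (All; []; _∷_)

  *-zero : ∀ {a b} → a * b ≡ 0ℤ → a ≢ 0ℤ → b ≡ 0ℤ
  *-zero {a} e na = [ (λ a≡0 → contradiction a≡0 na) , id ]′ (ℤP.i*j≡0⇒i≡0∨j≡0 a e)

  cancel : ∀ a {b c} → a ≢ 0ℤ → a * b ≡ a * c → b ≡ c
  cancel a {b} {c} na e = ℤP.*-cancelˡ-≡ a b c {{≢-nonZero na}} e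

  tw : ℕ → ℤ
  tw zero = 1ℤ
  tw (suc j) = + 2 * tw j

  Ev-const : ∀ j c → Ev j (λ _ → c) ≡ tw j * c
  Ev-const zero c = sym (ℤP.*-identityˡ c)
  Ev-const (suc j) c = trans (Ev-const j (c + c)) (lem (tw j) c)
    where lem : ∀ t c → t * (c + c) ≡ + 2 * t * c
          lem = solve-∀

  Ps : ℕ → ∀ n → Vec (ℕ → ℤ) n
  Ps lo zero = []
  Ps lo (suc n) = P lo ∷ Ps (suc lo) n

  Ps-∷ʳ : ∀ lo n → Ps lo (suc n) ≡ Ps lo n ∷ʳ P (lo ℕ.+ n)
  Ps-∷ʳ lo zero = cong (λ k → P k ∷ []) (sym (ℕP.+-identityʳ lo))
  Ps-∷ʳ lo (suc n) = cong (P lo ∷_) (trans (Ps-∷ʳ (suc lo) n) (cong (λ k → Ps (suc lo) n ∷ʳ P k) (sym (ℕP.+-suc lo n))))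

  Ps-has : ∀ lo n j → j ℕ.< n → Has (P (lo ℕ.+ j)) (Ps lo n)
  Ps-has lo (suc n) zero _ = subst (λ k → Has (P k) (Ps lo (suc n))) (sym (ℕP.+-identityʳ lo)) here
  Ps-has lo (suc n) (suc j) (s≤s p) = subst (λ k → Has (P k) (Ps lo (suc n))) (sym (ℕP.+-suc lo j)) (there (Ps-has (suc lo) n j p))

  Ps-kills : ∀ lo c g b n → (∀ i → i ℕ.< n → sI lo c (λ a → g a * P (b ℕ.+ i) a) ≡ 0ℤ) → Kills lo c g (Ps b n)
  Ps-kills lo c g b zero h = []
  Ps-kills lo c g b (suc n) h = subst (λ k → sI lo c (λ a → g a * P k a) ≡ 0ℤ) (ℕP.+-identityʳ b) (h 0 (s≤s z≤n)) ∷
    Ps-kills lo c g (suc b) n (λ i p → subst (λ k → sI lo c (λ a → g a * P k a) ≡ 0ℤ) (ℕP.+-suc b i) (h (suc i) (s≤s p)))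

  Φ-sumN : ∀ n lo c k (κ : ℕ → ℤ) (F : ℕ → FN n) → Φ n lo c (λ v → sumN k (λ j → κ j * F j v)) ≡ sumN k (λ j → κ j * Φ n lo c (F j))
  Φ-sumN n lo c zero κ F = trans (Φ-* n lo c 0ℤ (λ _ → 0ℤ)) (ℤP.*-zeroˡ (Φ n lo c (λ _ → 0ℤ)))
  Φ-sumN n lo c (suc k) κ F = trans (Φ-+ n lo c (λ v → sumN k (λ j → κ j * F j v)) (λ v → κ k * F k v)) (cong₂ _+_ (Φ-sumN n lo c k κ F) (Φ-* n lo c (κ k) (F k)))

  Φ-0 : ∀ n lo c {F : FN n} → (∀ v → F v ≡ 0ℤ) → Φ n lo c F ≡ 0ℤ
  Φ-0 n lo c e = trans (Φ-cong n lo c e) (Φ-sumN n lo c 0 (λ _ → 0ℤ) (λ _ _ → 0ℤ))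

  Φ-cong-≥ : ∀ n lo c {F G : FN n} → (∀ v → All (lo ℕ.≤_) v → F v ≡ G v) → Φ n lo c F ≡ Φ n lo c G
  Φ-cong-≥ zero lo c e = e [] []
  Φ-cong-≥ (suc n) lo zero e = refl
  Φ-cong-≥ (suc n) lo (suc c) e = cong₂ _+_
    (Φ-cong-≥ n (suc lo) c (λ v a → e (lo ∷ v) (ℕP.≤-refl ∷ weaken a))) (Φ-cong-≥ (suc n) (suc lo) c (λ v a → e v (weaken a)))
    where
      weaken : ∀ {n lo} {v : Vec ℕ n} → All (suc lo ℕ.≤_) v → All (lo ℕ.≤_) v
      weaken [] = []
      weaken (p ∷ ps) = ℕP.<⇒≤ p ∷ weaken ps

  wl-at-0 : ∀ lo n v → wl (Ps (suc lo) (suc n)) (0 ∷ v) ≡ 0ℤ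
  wl-at-0 lo zero [] = cong (_* 1ℤ) (P-suc-0 lo)
  wl-at-0 lo (suc n) v = trans (cong₂ (λ s t → s * wl (Ps (suc (suc lo)) (suc n)) v - t) (P-suc-0 lo) (wd-0 (P (suc lo)) (wl-at-0 (suc lo) n) v)) refl

  wd-P0 : ∀ {n} (G : FN n) v → All (1 ℕ.≤_) v → wd (P 0) G v ≡ 0ℤ
  wd-P0 {zero} G (suc x ∷ []) (p ∷ []) = refl
  wd-P0 {suc n} G (suc x ∷ v) (p ∷ ps) = cong (λ z → 0ℤ * G v - z) (wd-P0 (λ u → G (suc x ∷ u)) v ps)

  Φ-P0 : ∀ n B → Φ (suc n) 0 (suc B) (wl (Ps 0 (suc n))) ≡ Φ n 0 (suc B) (wl (Ps 1 n))
  Φ-P0 n B = trans (cong₂ _+_ (Φ-cong-≥ n 1 B (λ v a → first n v a)) (trans (Φ-cong-≥ (suc n) 1 B (wd-P0 (wl (Ps 1 n)))) (Φ-0 (suc n) 1 B (λ _ → refl)))) (trans (ℤP.+-identityʳ _) (shrink n))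
    where
      first : ∀ n v → All (1 ℕ.≤_) v → wl (Ps 0 (suc n)) (0 ∷ v) ≡ wl (Ps 1 n) v
      first zero [] [] = refl
      first (suc n) v a = trans (cong₂ _-_ (ℤP.*-identityˡ (wl (Ps 1 (suc n)) v)) (wd-P0 (λ u → wl (Ps 1 (suc n)) (0 ∷ u)) v a)) (ℤP.+-identityʳ _)
      shrink : ∀ n → Φ n 1 B (wl (Ps 1 n)) ≡ Φ n 0 (suc B) (wl (Ps 1 n))
      shrink zero = refl
      shrink (suc n) = sym (trans (cong (_+ Φ (suc n) 1 B (wl (Ps 1 (suc n)))) (Φ-0 n 1 B (wl-at-0 0 n))) (ℤP.+-identityˡ _))

  module Orth (B : ℕ) (M : ℕ) (hB : 2 ℕ.* suc (suc M) ℕ.< B) where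
    open WZ M public

    q : ℕ → ℤ
    q x = sumN (suc M) (λ j → κ j * P j x)

    private
      small : ∀ {i} → i ℕ.≤ suc (suc M) → 2 ℕ.* i ℕ.< B
      small p = ℕP.≤-trans (s≤s (ℕP.*-monoʳ-≤ 2 p)) hB

    q-supp : ∀ x → B ℕ.≤ x → q x ≡ 0ℤ
    q-supp x p = sumN-0 (suc M) λ { j (s≤s j≤M) → trans (cong (κ j *_) (P-supp j x (ℕP.≤-trans (small (ℕP.≤-trans j≤M (ℕP.≤-trans (ℕP.n≤1+n M) (ℕP.n≤1+n (suc M))))) p))) (ℤP.*-zeroʳ (κ j)) }

    X : ℕ → ℤ
    X i = Br B q (P i)

    Qf : ℕ → ℤ
    Qf = QI 0 B q

    d : ℕ → ℤ
    d a = sumN (suc M) (λ j → κ j * Ch (suc j) (+ (2 ℕ.* j) - + a))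

    Q-diff : ∀ a → Qf (suc a) - Qf a ≡ d a
    Q-diff a = trans (QI-diff B q a q-supp) (trans (sym (sumN-+ (suc M) (λ j → κ j * P j a) (λ j → κ j * P j (suc a))))
      (sumN-cong (suc M) (λ j _ → trans (sym (ℤP.*-distribˡ-+ (κ j) (P j a) (P j (suc a)))) (cong (κ j *_) (P-adjacent j a)))))

    X-step : ∀ i → i ℕ.≤ M → φ 0ℤ * φ 0ℤ * (X (suc i) - + 2 * X i) ≡ + (3 ℕ.* i ℕ.+ 4) * S (suc i)
    X-step i p = trans (cong (φ 0ℤ * φ 0ℤ *_) (trans (cong₂ (λ s t → s - + 2 * t) (Br-P B q (suc i) (small (s≤s (ℕP.≤-trans p (ℕP.n≤1+n M))))) (Br-P B q i (small (ℕP.≤-trans p (ℕP.≤-trans (ℕP.n≤1+n M) (ℕP.n≤1+n (suc M)))))))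
        (trans (cong (_+_ (Ev (suc i) Qf)) (ℤP.neg-distribˡ-* (+ 2) (Ev i Qf))) (trans (sym (Ev-lin i (- + 2) (λ a → Qf (suc a) + Qf (suc (suc a))) Qf)) (trans (Ev-cong i regroup) (Ev-lin i (+ 2) (d ∘ suc) d))))))
      (trans (cong₂ (λ s t → φ 0ℤ * φ 0ℤ * (s + + 2 * t))
           (trans (Ev-sumN i (suc M) κ (λ j a → Ch (suc j) (+ (2 ℕ.* j) - + suc a))) (sumN-cong (suc M) (λ j _ → cong (κ j *_) (trans (Ev-cong i (λ a → cong (Ch (suc j)) (lem1 (+ (2 ℕ.* j)) (+ a)))) (Ev-Ch i (suc j) (+ (2 ℕ.* j) - 1ℤ))))))
           (trans (Ev-sumN i (suc M) κ (λ j a → Ch (suc j) (+ (2 ℕ.* j) - + a))) (sumN-cong (suc M) (λ j _ → cong (κ j *_) (Ev-Ch i (suc j) (+ (2 ℕ.* j)))))))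
      (trans (cong (φ 0ℤ * φ 0ℤ *_) (trans (cong (_+_ (sumN (suc M) (λ j → κ j * C₁ j))) (sym (sumN-* (suc M) (+ 2) (λ j → κ j * C₀ j)))) (sym (sumN-+ (suc M) (λ j → κ j * C₁ j) (λ j → + 2 * (κ j * C₀ j))))))
      (trans (sym (sumN-* (suc M) (φ 0ℤ * φ 0ℤ) (λ j → κ j * C₁ j + + 2 * (κ j * C₀ j)))) (trans (sumN-cong (suc M) (λ { j (s≤s j≤M) → term j j≤M })) (sumN-* (suc M) (+ (3 ℕ.* i ℕ.+ 4)) (λ j → κ j * weight (suc i) j))))))
      where
        C₁ C₀ : ℕ → ℤ
        C₁ j = Ch (suc j ℕ.+ i) (+ (2 ℕ.* j) - 1ℤ - + i)
        C₀ j = Ch (suc j ℕ.+ i) (+ (2 ℕ.* j) - + i)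
        regroup : ∀ a → (Qf (suc a) + Qf (suc (suc a))) + - + 2 * Qf a ≡ d (suc a) + + 2 * d a
        regroup a = trans (lem (Qf a) (Qf (suc a)) (Qf (suc (suc a)))) (cong₂ (λ s t → s + + 2 * t) (Q-diff (suc a)) (Q-diff a))
          where lem : ∀ x y z → (y + z) + - + 2 * x ≡ (z - y) + + 2 * (y - x)
                lem = solve-∀
        lem1 : ∀ a b → a - (1ℤ + b) ≡ a - 1ℤ - b
        lem1 = solve-∀
        term : ∀ j → j ℕ.≤ M → φ 0ℤ * φ 0ℤ * (κ j * C₁ j + + 2 * (κ j * C₀ j)) ≡ + (3 ℕ.* i ℕ.+ 4) * (κ j * weight (suc i) j)
        term j j≤M = trans (lem (φ 0ℤ * φ 0ℤ) (κ j) (C₁ j) (C₀ j)) (trans (cong (κ j *_) (trans (cong₂ (λ s t → s + + 2 * t) (Ch-φ n (+ (2 ℕ.* j) - 1ℤ - + i) n≤L) (Ch-φ n z n≤L))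
            (trans (cong₂ (λ s t → + (n !) * s * φ (+ n - (+ (2 ℕ.* j) - 1ℤ - + i)) + + 2 * (+ (n !) * φ z * t))
                (trans (cong φ (lem2 (+ (2 ℕ.* j)) (+ i))) (φ-rec z (ℤP.i≤j⇒i-k≤j (+ i) (+≤+ 2j≤L))))
                (trans (cong φ (lem3 (+ j) (+ i))) (φ-rec y (ℤP.i≤j⇒i-k≤j (+ j) (+≤+ 2i+2≤L)))))
            (trans (cong (λ s → + (n !) * (z * φ z) * φ s + + 2 * (+ (n !) * φ z * (y * φ y))) (lem4 (+ j) (+ i)))
            (trans (lem5 (+ (n !)) z (φ z) (φ y) y) (cong₂ _*_ (lem6 (+ j) (+ i)) (cong₂ _*_ (cong₂ _*_ (cong (λ k → + (k !)) (cong suc (ℕP.+-comm j i))) (cong φ (lem7 (+ (2 ℕ.* j)) (+ i)))) (cong (λ k → φ (+ k - + j)) (lem8 i))))))))) (lem9 (κ j) (+ (3 ℕ.* i ℕ.+ 4)) (weight (suc i) j)))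
          where
            n = suc j ℕ.+ i
            z y : ℤ
            z = + (2 ℕ.* j) - + i
            y = + (2 ℕ.* i ℕ.+ 2) - + j
            n≤L : n ℕ.≤ L
            n≤L = ℕP.≤-trans (s≤s (ℕP.+-mono-≤ j≤M p)) (subst (suc (M ℕ.+ M) ℕ.≤_) (l M) (ℕP.m≤m+n (suc (M ℕ.+ M)) (2 ℕ.* M ℕ.+ 7)))
              where l : ∀ M → suc (M ℕ.+ M) ℕ.+ (2 ℕ.* M ℕ.+ 7) ≡ 4 ℕ.* M ℕ.+ 8
                    l = solveℕ
            2j≤L : 2 ℕ.* j ℕ.≤ L
            2j≤L = ℕP.≤-trans (ℕP.*-mono-≤ {2} {4} (s≤s (s≤s z≤n)) j≤M) (ℕP.m≤m+n (4 ℕ.* M) 8)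
            2i+2≤L : 2 ℕ.* i ℕ.+ 2 ℕ.≤ L
            2i+2≤L = ℕP.+-mono-≤ (ℕP.*-mono-≤ {2} {4} (s≤s (s≤s z≤n)) p) (s≤s (s≤s z≤n))
            lem : ∀ c k a b → c * (k * a + + 2 * (k * b)) ≡ k * (a * c + + 2 * (b * c))
            lem = solve-∀
            lem2 : ∀ a b → a - 1ℤ - b ≡ a - b - 1ℤ
            lem2 = solve-∀
            lem3 : ∀ j i → (1ℤ + j + i) - (j + (j + 0ℤ) - i) ≡ i + (i + 0ℤ) + + 2 - j - 1ℤ
            lem3 = solve-∀
            lem4 : ∀ j i → (1ℤ + j + i) - (j + (j + 0ℤ) - 1ℤ - i) ≡ i + (i + 0ℤ) + + 2 - j
            lem4 = solve-∀
            lem5 : ∀ f z p q y → f * (z * p) * q + + 2 * (f * p * (y * q)) ≡ (z + + 2 * y) * (f * p * q)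
            lem5 = solve-∀
            lem6 : ∀ j i → (j + (j + 0ℤ) - i) + + 2 * (i + (i + 0ℤ) + + 2 - j) ≡ i + (i + (i + 0ℤ)) + + 4
            lem6 = solve-∀
            lem7 : ∀ a i → a - i ≡ a + 1ℤ - (1ℤ + i)
            lem7 = solve-∀
            lem8 : ∀ i → 2 ℕ.* i ℕ.+ 2 ≡ 2 ℕ.* suc i
            lem8 = solveℕ
            lem9 : ∀ k c w → k * (c * w) ≡ c * (k * w)
            lem9 = solve-∀

    y lam s : ℤ
    y = sumN (suc M) (λ j → κ j * tw j)
    lam = κ 0 - y
    s = X (suc M) - + 2 * X M

    c≢0 : φ 0ℤ * φ 0ℤ ≢ 0ℤ
    c≢0 = *≢0 (φ≢0 0 z≤n) (φ≢0 0 z≤n)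

    s≢0 : s ≢ 0ℤ
    s≢0 e = S-M≢0 (*-zero {+ (3 ℕ.* M ℕ.+ 4)} (trans (sym (X-step M ℕP.≤-refl)) (trans (cong (φ 0ℤ * φ 0ℤ *_) e) (ℤP.*-zeroʳ (φ 0ℤ * φ 0ℤ)))) λ e' → contradiction (trans (cong +_ (sym (ℕP.+-suc (3 ℕ.* M) 3))) e') (pos≢0 (3 ℕ.* M ℕ.+ 3)))

    X-0 : X 0 ≡ lam
    X-0 = trans (Br-P B q 0 (small z≤n)) (trans (sI-sumN 0 B (λ x → sg 0 x * q x)) (split B (ℕP.≤-trans (s≤s z≤n) hB) q ⟨t⟩ cong₂ _-_ q0 total))
      where
        _⟨t⟩_ : ∀ {a b c : ℤ} → a ≡ b → b ≡ c → a ≡ c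
        _⟨t⟩_ = trans
        split : ∀ B → 0 ℕ.< B → ∀ q → sumN B (λ x → sg 0 x * q x) ≡ q 0 - sumN B q
        split (suc B) _ q = trans (sumN-head B (λ x → sg 0 x * q x)) (trans (cong (_+_ (0ℤ * q 0)) (trans (sumN-cong B (λ _ _ → refl)) (sumN-* B -1ℤ (λ x → q (suc x)))))
            (trans (lem (q 0) (sumN B (λ x → q (suc x)))) (cong (λ z → q 0 - z) (sym (sumN-head B q)))))
          where lem : ∀ a b → 0ℤ * a + -1ℤ * b ≡ a - (a + b)
                lem = solve-∀
        q0 : q 0 ≡ κ 0
        q0 = trans (sumN-head M (λ j → κ j * P j 0)) (trans (cong₂ _+_ (ℤP.*-identityʳ (κ 0)) (sumN-0 M (λ j _ → trans (cong (κ (suc j) *_) (P-suc-0 j)) (ℤP.*-zeroʳ (κ (suc j)))))) (ℤP.+-identityʳ (κ 0)))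
        total : sumN B q ≡ y
        total = trans (sumN-swap B (suc M) (λ x j → κ j * P j x)) (sumN-cong (suc M) λ { j (s≤s p) → trans (sumN-* B (κ j) (P j)) (cong (κ j *_) (trans (sumN-cong B (λ a _ → sym (ℤP.*-identityʳ (P j a)))) (trans (pairing j B (λ _ → 1ℤ) (small (ℕP.≤-trans p (ℕP.≤-trans (ℕP.n≤1+n M) (ℕP.n≤1+n (suc M)))))) (trans (Ev-const j 1ℤ) (ℤP.*-identityʳ (tw j)))))) })

    X-tw : ∀ i → i ℕ.≤ M → X i ≡ tw i * lam
    X-tw zero p = trans X-0 (sym (ℤP.*-identityˡ lam))
    X-tw (suc i) p = trans (ℤP.i-j≡0⇒i≡j _ _ (*-zero {φ 0ℤ * φ 0ℤ} (trans (X-step i (ℕP.<⇒≤ p)) (trans (cong (+ (3 ℕ.* i ℕ.+ 4) *_) (S-zero i p)) (ℤP.*-zeroʳ (+ (3 ℕ.* i ℕ.+ 4))))) c≢0))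
      (trans (cong (+ 2 *_) (X-tw i (ℕP.<⇒≤ p))) (sym (ℤP.*-assoc (+ 2) (tw i) lam)))

    X-last : X (suc M) ≡ tw (suc M) * lam + s
    X-last = trans (lem (X (suc M)) (+ 2 * X M)) (cong (_+ s) (trans (cong (+ 2 *_) (X-tw M ℕP.≤-refl)) (sym (ℤP.*-assoc (+ 2) (tw M) lam))))
      where lem : ∀ a b → a ≡ b + (a - b)
            lem = solve-∀

    Br-low : ∀ n (κ' : ℕ → ℤ) → n ℕ.≤ M → Br B q (λ x → sumN (suc n) (λ j → κ' j * P j x)) ≡ sumN (suc n) (λ j → κ' j * tw j) * lam
    Br-low n κ' p = trans (Br-sum B q (suc n) κ') (trans (sumN-cong (suc n) (λ { j (s≤s j≤n) → trans (cong (κ' j *_) (X-tw j (ℕP.≤-trans j≤n p))) (lem (κ' j) (tw j) lam) }))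
        (trans (sumN-* (suc n) lam (λ j → κ' j * tw j)) (ℤP.*-comm lam _)))
      where lem : ∀ a b c → a * (b * c) ≡ c * (a * b)
            lem = solve-∀

    y-lam : y * lam ≡ 0ℤ
    y-lam = trans (sym (Br-low M κ ℕP.≤-refl)) (OperatorProducts.x≡-x⇒x≡0 _ (Br-anti B q q))

  module Consecutive (B : ℕ) (M : ℕ) (hB : 2 ℕ.* suc (suc (suc M)) ℕ.< B) where
    hB₀ : 2 ℕ.* suc (suc M) ℕ.< B
    hB₀ = ℕP.≤-trans (s≤s (ℕP.*-monoʳ-≤ 2 (ℕP.n≤1+n (suc (suc M))))) hB
    module O = Orth B M hB₀
    module O' = Orth B (suc M) hB

    K' : ℤ
    K' = O'.κ (suc M)

    relation : O.lam * O'.y + K' * O.s ≡ - (O.y * O'.lam)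
    relation = trans (lem O.lam (sumN (suc M) (λ j → O'.κ j * tw j)) K' (tw (suc M)) O.s) (trans (sym big) (trans (Br-anti B O.q O'.q) (cong -_ (O'.Br-low M O.κ (ℕP.n≤1+n M)))))
      where
        lem : ∀ l a k t s → l * (a + k * t) + k * s ≡ a * l + k * (t * l + s)
        lem = solve-∀
        big : Br B O.q O'.q ≡ sumN (suc M) (λ j → O'.κ j * tw j) * O.lam + K' * (tw (suc M) * O.lam + O.s)
        big = trans (Br-sum B O.q (suc (suc M)) O'.κ) (cong₂ _+_ (trans (sym (Br-sum B O.q (suc M) O'.κ)) (O.Br-low M O'.κ ℕP.≤-refl)) (cong (K' *_) O.X-last))

    Ks≢0 : K' * O.s ≢ 0ℤ
    Ks≢0 = O.*≢0 O'.κ-M≢0 O.s≢0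

    module EvenStep (e : O.y ≡ O.κ 0) where
      lam-0 : O.lam ≡ 0ℤ
      lam-0 = ℤP.i≡j⇒i-j≡0 (sym e)

      rel : K' * O.s ≡ - (O.κ 0 * O'.lam)
      rel = trans (sym (ℤP.+-identityˡ (K' * O.s))) (trans (cong (_+ K' * O.s) (sym (trans (cong (_* O'.y) lam-0) refl))) (trans relation (cong (λ z → - (z * O'.lam)) e)))

      y'-0 : O'.y ≡ 0ℤ
      y'-0 = *-zero {O'.lam} (trans (ℤP.*-comm O'.lam O'.y) O'.y-lam) (λ l → Ks≢0 (trans rel (cong -_ (trans (cong (O.κ 0 *_) l) (ℤP.*-zeroʳ (O.κ 0))))))

      Ks : K' * O.s ≡ - (O.κ 0 * O'.κ 0)
      Ks = trans rel (cong (λ z → - (O.κ 0 * z)) (trans (cong (λ z → O'.κ 0 - z) y'-0) (ℤP.+-identityʳ (O'.κ 0))))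

    odd-step : O.y ≡ 0ℤ → O'.y ≡ O'.κ 0
    odd-step e = sym (ℤP.i-j≡0⇒i≡j _ _ (*-zero {O'.y} O'.y-lam (λ y'0 → Ks≢0 (trans (sym (ℤP.+-identityˡ (K' * O.s))) (trans (cong (_+ K' * O.s) (sym (trans (cong (O.lam *_) y'0) (ℤP.*-zeroʳ O.lam)))) (trans relation (cong (λ z → - (z * O'.lam)) e)))))))

  y-even : ∀ B k (h : 2 ℕ.* suc (suc (k ℕ.+ k)) ℕ.< B) → Orth.y B (k ℕ.+ k) h ≡ Orth.κ B (k ℕ.+ k) h 0
  y-even B zero h = trans (ℤP.+-identityˡ _) (ℤP.*-identityʳ (Orth.κ B 0 h 0))
  y-even B (suc k) h = subst (λ M → ∀ (h : 2 ℕ.* suc (suc M) ℕ.< B) → Orth.y B M h ≡ Orth.κ B M h 0) (cong suc (sym (ℕP.+-suc k k))) (λ h → go h) h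
    where
      go : ∀ (h : 2 ℕ.* suc (suc (suc (suc (k ℕ.+ k)))) ℕ.< B) → Orth.y B (suc (suc (k ℕ.+ k))) h ≡ Orth.κ B (suc (suc (k ℕ.+ k))) h 0
      go h = C₂.odd-step (C₁.EvenStep.y'-0 (y-even B k C₁.hB₀))
        where
          module C₂ = Consecutive B (suc (k ℕ.+ k)) h
          module C₁ = Consecutive B (k ℕ.+ k) C₂.hB₀

module ArrayRatio where
  open Wedge
  open TriangleFunction using (sgn)
  open RowSums using (sumN; sumN-head)
  open Polynomials using (sumN-0; sgn-sq)
  open Contraction
  open RowFunctions
  open Hypergeometric
  open Orthogonality
  open import Data.Nat.Base using (_!)
  open import Data.Integer.Base using (ℤ; +_; 0ℤ; 1ℤ; -1ℤ; _+_; _*_; _-_; -_)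
  open import Data.Vec.Base using (Vec; _∷_; _∷ʳ_)

  sgn-even : ∀ k → sgn (k ℕ.+ k) ≡ 1ℤ
  sgn-even zero = refl
  sgn-even (suc k) = trans (cong (λ z → - sgn z) (ℕP.+-suc k k)) (trans (ℤP.neg-involutive (sgn (k ℕ.+ k))) (sgn-even k))

  ε-even : ∀ k → ε (k ℕ.+ k) ≡ 1ℤ
  ε-even zero = refl
  ε-even (suc k) = trans (cong (λ z → 1ℤ - ε z) (ℕP.+-suc k k)) (cong (λ z → 1ℤ - (1ℤ - z)) (ε-even k))

  parity : ∀ N → Σ ℕ λ k → N ≡ k ℕ.+ k ⊎ N ≡ suc (k ℕ.+ k)
  parity zero = 0 , inj₁ refl
  parity (suc N) with parity N
  ... | k , inj₁ refl = k , inj₂ refl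
  ... | k , inj₂ refl = suc k , inj₁ (cong suc (sym (ℕP.+-suc k k)))

  module PathCount (B' : ℕ) where
    B : ℕ
    B = suc B'

    T : ℕ → ℤ
    T n = Φ n 0 B (wl (Ps 0 n))

    Φ-q : ∀ M (κ : ℕ → ℤ) {n} (fs : Vec (ℕ → ℤ) n) → Φ (suc n) 0 B (wl ((λ x → sumN (suc M) (λ j → κ j * P j x)) ∷ fs)) ≡
      sumN (suc M) (λ j → κ j * Φ (suc n) 0 B (wl (P j ∷ fs)))
    Φ-q M κ fs = trans (Φ-cong _ 0 B (wd-sumN (suc M) κ P (wl fs))) (Φ-sumN _ 0 B (suc M) κ (λ j → wl (P j ∷ fs)))

    module Even (k : ℕ) (h : 2 ℕ.* suc (suc (k ℕ.+ k)) ℕ.< B) where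
      M : ℕ
      M = k ℕ.+ k
      open Orth B M h

      lam-0 : lam ≡ 0ℤ
      lam-0 = ℤP.i≡j⇒i-j≡0 (sym (y-even B k h))

      X-0' : ∀ i → i ℕ.≤ M → X i ≡ 0ℤ
      X-0' i p = trans (X-tw i p) (trans (cong (tw i *_) lam-0) (ℤP.*-zeroʳ (tw i)))

      -- evaluates Φ at q ∧ P (M+1) ∧ P 0 ∧ ⋯ ∧ P (M-1) in two ways
      two-up : κ M * T (suc (suc M)) ≡ s * T M
      two-up = trans (sym lhs) (trans (Φ-contract 0 B q (P (suc M)) (Ps 0 M) (ε-even k) (Ps-kills 0 B Qf 0 M (λ i p → X-0' i (ℕP.<⇒≤ p))))
          (cong (_* T M) (trans X-last (trans (cong (λ z → tw (suc M) * z + s) lam-0) (trans (cong (_+ s) (ℤP.*-zeroʳ (tw (suc M)))) (ℤP.+-identityˡ s))))))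
        where
          fs = P (suc M) ∷ Ps 0 M
          top : Φ (suc (suc M)) 0 B (wl (P M ∷ fs)) ≡ T (suc (suc M))
          top = Φ-cong (suc (suc M)) 0 B (λ v → trans (wd-swap M (P M) (P (suc M)) (wl (Ps 0 M)) v)
            (trans (cong -_ (trans (wd-congʳ (P (suc M)) (wl-move (P M) (Ps 0 M)) v) (trans (wd-* (P (suc M)) (sgn M) (wl (Ps 0 M ∷ʳ P M)) v)
               (cong (sgn M *_) (wl-move (P (suc M)) (Ps 0 M ∷ʳ P M) v)))))
            (trans (lem (sgn M) (wl ((Ps 0 M ∷ʳ P M) ∷ʳ P (suc M)) v)) (trans (cong (_* wl ((Ps 0 M ∷ʳ P M) ∷ʳ P (suc M)) v) (sgn-sq M)) (trans (ℤP.*-identityˡ _)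
              (cong (λ gs → wl gs v) (trans (cong (_∷ʳ P (suc M)) (sym (Ps-∷ʳ 0 M))) (sym (Ps-∷ʳ 0 (suc M))))))))))
            where lem : ∀ a b → - (a * (- a * b)) ≡ a * a * b
                  lem = solve-∀
          lhs : Φ (suc (suc M)) 0 B (wl (q ∷ fs)) ≡ κ M * T (suc (suc M))
          lhs = trans (Φ-q M κ fs) (trans (cong₂ _+_ (sumN-0 M (λ j p → trans (cong (κ j *_) (Φ-0 (suc (suc M)) 0 B (wl-has (there (Ps-has 0 M j p))))) (ℤP.*-zeroʳ (κ j)))) (cong (κ M *_) top)) (ℤP.+-identityˡ _))

    -- the case k > 0 evaluates Φ at q ∧ P 1 ∧ ⋯ ∧ P (M-1) in two ways, M = k + k
    one-up : ∀ k (h : 2 ℕ.* suc (suc (k ℕ.+ k)) ℕ.< B) → Orth.κ B (k ℕ.+ k) h (k ℕ.+ k) * T (suc (k ℕ.+ k)) ≡ Orth.κ B (k ℕ.+ k) h 0 * T (k ℕ.+ k)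
    one-up zero h = cong (Orth.κ B 0 h 0 *_) (Φ-P0 0 B')
    one-up (suc k) h = subst (λ M → ∀ (h : 2 ℕ.* suc (suc M) ℕ.< B) → Orth.y B M h ≡ Orth.κ B M h 0 → Orth.κ B M h M * T (suc M) ≡ Orth.κ B M h 0 * T M)
        (cong suc (sym (ℕP.+-suc k k))) go h (y-even B (suc k) h)
      where
        go : ∀ (h : 2 ℕ.* suc (suc (suc (suc (k ℕ.+ k)))) ℕ.< B) → Orth.y B (suc (suc (k ℕ.+ k))) h ≡ Orth.κ B (suc (suc (k ℕ.+ k))) h 0 →
          Orth.κ B (suc (suc (k ℕ.+ k))) h (suc (suc (k ℕ.+ k))) * T (suc (suc (suc (k ℕ.+ k)))) ≡ Orth.κ B (suc (suc (k ℕ.+ k))) h 0 * T (suc (suc (k ℕ.+ k)))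
        go h yk = lem (κ 0 * T M) (κ M * T (suc M)) (trans (cong (_+_ (κ 0 * T M)) neg) (trans (sym lhs) rhs)) 
          where
            open Orth B (suc (suc (k ℕ.+ k))) h
            M M₁ : ℕ
            M = suc (suc (k ℕ.+ k))
            M₁ = suc (k ℕ.+ k)
            fs = Ps 1 M₁
            lam-0 : lam ≡ 0ℤ
            lam-0 = ℤP.i≡j⇒i-j≡0 (sym yk)
            X-0' : ∀ i → i ℕ.≤ M → X i ≡ 0ℤ
            X-0' i p = trans (X-tw i p) (trans (cong (tw i *_) lam-0) (ℤP.*-zeroʳ (tw i)))
            rhs : Φ (suc (suc (k ℕ.+ k))) 0 B (wl (q ∷ fs)) ≡ 0ℤ
            rhs = trans (Φ-contract 0 B q (P 1) (Ps 2 (k ℕ.+ k)) (ε-even k) (Ps-kills 0 B Qf 2 (k ℕ.+ k) (λ i p → X-0' (2 ℕ.+ i) (s≤s (s≤s (ℕP.<⇒≤ p))))))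
              (cong (_* Φ (k ℕ.+ k) 0 B (wl (Ps 2 (k ℕ.+ k)))) (X-0' 1 (s≤s z≤n)))
            lhs : Φ (suc (suc (k ℕ.+ k))) 0 B (wl (q ∷ fs)) ≡ κ 0 * T M + κ M * (sgn M₁ * T (suc M))
            lhs = trans (Φ-q M κ fs) (cong₂ _+_ (trans (sumN-head M₁ (λ j → κ j * Φ M 0 B (wl (P j ∷ fs)))) (trans (cong (_+_ (κ 0 * T M)) (sumN-0 M₁ (λ j p → trans (cong (κ (suc j) *_) (Φ-0 M 0 B (wl-has (Ps-has 1 M₁ j p)))) (ℤP.*-zeroʳ (κ (suc j)))))) (ℤP.+-identityʳ (κ 0 * T M))))
              (cong (κ M *_) (trans (Φ-cong M 0 B (wl-move (P M) fs)) (trans (Φ-* M 0 B (sgn M₁) (wl (fs ∷ʳ P M))) (cong (sgn M₁ *_) (trans (cong (λ gs → Φ M 0 B (wl gs)) (sym (Ps-∷ʳ 1 M₁))) (sym (Φ-P0 M B'))))))))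
            neg : - (κ M * T (suc M)) ≡ κ M * (sgn M₁ * T (suc M))
            neg = trans (lem' (κ M) (T (suc M))) (cong (λ z → κ M * (- z * T (suc M))) (sym (sgn-even k)))
              where lem' : ∀ a b → - (a * b) ≡ a * (-1ℤ * b)
                    lem' = solve-∀
            lem : ∀ a b → a + - b ≡ 0ℤ → b ≡ a
            lem a b e = sym (ℤP.i-j≡0⇒i≡j a b e)

    ratio-κ : ∀ N (h : 2 ℕ.* suc (suc N) ℕ.< B) → Orth.κ B N h N * T (suc N) ≡ sgn N * (Orth.κ B N h 0 * T N)
    ratio-κ N h with parity N
    ... | k , inj₁ refl = trans (one-up k h) (trans (sym (ℤP.*-identityˡ _)) (cong (_* (Orth.κ B N h 0 * T N)) (sym (sgn-even k))))
    ... | k , inj₂ refl = cancel (O.κ 0 * O.κ M) (O.*≢0 O.κ-0≢0 O.κ-M≢0)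
          (trans (lem₁ (O.κ 0) (O.κ M) K' (T (suc (suc M)))) (trans (cong (O.κ 0 * K' *_) (Even.two-up k hB₀)) (trans (lem₂ (O.κ 0) K' O.s (T M)) (trans (cong (_* (O.κ 0 * T M)) (EvenStep.Ks (y-even B k hB₀)))
            (trans (cong (- (O.κ 0 * O'.κ 0) *_) (sym (one-up k hB₀))) (trans (lem₃ (O.κ 0) (O'.κ 0) (O.κ M) (T (suc M))) (cong (λ z → O.κ 0 * O.κ M * (- z * (O'.κ 0 * T (suc M)))) (sym (sgn-even k)))))))))
        where
          M = k ℕ.+ k
          open Consecutive B M h
          lem₁ : ∀ a b c t → a * b * (c * t) ≡ a * c * (b * t)
          lem₁ = solve-∀
          lem₂ : ∀ a c s t → a * c * (s * t) ≡ c * s * (a * t)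
          lem₂ = solve-∀
          lem₃ : ∀ a a' b t → - (a * a') * (b * t) ≡ a * b * (-1ℤ * (a' * t))
          lem₃ = solve-∀

    ratio : ∀ N → 2 ℕ.* suc (suc N) ℕ.< B → T (suc N) * + ((2 ℕ.* N ℕ.+ 1) !) * + ((2 ℕ.* N) !) ≡ T N * + ((3 ℕ.* N ℕ.+ 1) !) * + (N !)
    ratio N h = cancel (ℓ * ℓ * (c₃ * (+ 2 * n₁))) (*≢0 (*≢0 (fact≢0 L) (fact≢0 L)) (*≢0 c₃≢0 (*≢0 {+ 2} (λ ()) (pos≢0 N))))
      (trans (lem₁ ℓ c₃ n₁ (T (suc N)) (+ ((2 ℕ.* N ℕ.+ 1) !)) f₂)
      (trans (cong₂ (λ x y → f₂ * c₃ * x * y * T (suc N)) ℓℓ (sym e-2N+2))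
      (trans (lem₂ f₂ c₃ a₁ (+ (suc N !)) a₃ (+ ((3 ℕ.* N ℕ.+ 2) !)) (+ ((2 ℕ.* N ℕ.+ 2) !)) (T (suc N)))
      (trans (cong (_* (+ (suc N !) * + ((3 ℕ.* N ℕ.+ 2) !) * + ((2 ℕ.* N ℕ.+ 2) !))) core)
      (trans (lem₃ b₁ b₂ (T N) (+ (suc N !)) (+ ((3 ℕ.* N ℕ.+ 2) !)) (+ ((2 ℕ.* N ℕ.+ 2) !)))
      (trans (cong₂ (λ x y → + 2 * (x * y) * (+ (suc N !) * + ((3 ℕ.* N ℕ.+ 2) !) * T N)) fb₁ fb₂)
      (trans (cong₂ (λ x y → + 2 * (ℓ * ℓ) * (x * y * T N)) (ℤP.pos-* (suc N) (N !)) e-3N+2)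
        (lem₄ ℓ n₁ (+ (N !)) c₃ (+ ((3 ℕ.* N ℕ.+ 1) !)) (T N)))))))))
      where
        open Orth B N h
        ℓ c₃ n₁ f₂ a₁ a₃ b₁ b₂ Cc : ℤ
        ℓ = + (L !)
        c₃ = + (3 ℕ.* N ℕ.+ 2)
        n₁ = + suc N
        f₂ = + ((2 ℕ.* N) !)
        a₁ = φ (+ suc N)
        a₃ = φ (+ (2 ℕ.* N ℕ.+ 2 ℕ.+ N))
        b₁ = φ (+ 1)
        b₂ = φ (+ (2 ℕ.* N ℕ.+ 2 ℕ.+ 0))
        Cc = φ (+ N) * φ 0ℤ * + (suc N !) * + ((2 ℕ.* N ℕ.+ 1) !)
        n≤L : ∀ {n} r → n ℕ.+ r ≡ L → n ℕ.≤ L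
        n≤L {n} r e = subst (n ℕ.≤_) e (ℕP.m≤m+n n r)
        c₃≢0 : c₃ ≢ 0ℤ
        c₃≢0 e = pos≢0 (3 ℕ.* N ℕ.+ 1) (trans (cong +_ (sym (ℕP.+-suc (3 ℕ.* N) 1))) e)
        Cc≢0 : Cc ≢ 0ℤ
        Cc≢0 = *≢0 (*≢0 (*≢0 (φ≢0 N (n≤L (3 ℕ.* N ℕ.+ 8) (l N))) (φ≢0 0 z≤n)) (fact≢0 (suc N))) (fact≢0 (2 ℕ.* N ℕ.+ 1))
          where l : ∀ N → N ℕ.+ (3 ℕ.* N ℕ.+ 8) ≡ 4 ℕ.* N ℕ.+ 8
                l = solveℕ
        sgn≢0' : sgn N ≢ 0ℤ
        sgn≢0' = sgn≢0 N
        κN : κ N ≡ sgn N * Cc * (f₂ * c₃ * a₁ * a₃)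
        κN = trans (cong₂ (λ x y → sgn N * f₂ * c₃ * φ (+ N) * a₁ * + (x !) * + (y !) * φ (+ N - + N) * a₃) (l₁ N) (trans (cong (ℕ._∸ N) (l₂ N)) (ℕP.m+n∸n≡m (suc N) N)))
            (trans (cong (λ x → sgn N * f₂ * c₃ * φ (+ N) * a₁ * + ((2 ℕ.* N ℕ.+ 1) !) * + (suc N !) * φ x * a₃) (ℤP.+-inverseʳ (+ N)))
              (lem (sgn N) f₂ c₃ (φ (+ N)) a₁ (+ ((2 ℕ.* N ℕ.+ 1) !)) (+ (suc N !)) (φ 0ℤ) a₃))
          where
            l₁ : ∀ N → N ℕ.+ 1 ℕ.+ N ≡ 2 ℕ.* N ℕ.+ 1
            l₁ = solveℕ
            l₂ : ∀ N → 2 ℕ.* N ℕ.+ 1 ≡ suc N ℕ.+ N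
            l₂ = solveℕ
            lem : ∀ s f c p a g h o b → s * f * c * p * a * g * h * o * b ≡ s * (p * o * h * g) * (f * c * a * b)
            lem = solve-∀
        κ0 : κ 0 ≡ Cc * (+ 2 * b₁ * b₂)
        κ0 = trans (cong₂ (λ x y → 1ℤ * 1ℤ * + 2 * φ 0ℤ * b₁ * + (x !) * + ((2 ℕ.* N ℕ.+ 1) !) * φ y * b₂) (l N) (ℤP.+-identityʳ (+ N)))
            (lem (φ 0ℤ) b₁ (+ (suc N !)) (+ ((2 ℕ.* N ℕ.+ 1) !)) (φ (+ N)) b₂)
          where
            l : ∀ N → N ℕ.+ 1 ℕ.+ 0 ≡ suc N
            l = solveℕ
            lem : ∀ o b h g p b' → 1ℤ * 1ℤ * + 2 * o * b * h * g * p * b' ≡ (p * o * h * g) * (+ 2 * b * b')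
            lem = solve-∀
        core : f₂ * c₃ * a₁ * a₃ * T (suc N) ≡ + 2 * b₁ * b₂ * T N
        core = cancel (sgn N * Cc) (*≢0 sgn≢0' Cc≢0) (trans (sym (ℤP.*-assoc (sgn N * Cc) (f₂ * c₃ * a₁ * a₃) (T (suc N)))) (trans (cong (_* T (suc N)) (sym κN)) (trans (ratio-κ N h) (trans (cong (λ z → sgn N * (z * T N)) κ0) (lem (sgn N) Cc (+ 2 * b₁ * b₂) (T N))))))
          where lem : ∀ s c x t → s * (c * x * t) ≡ s * c * (x * t)
                lem = solve-∀
        fa₁ : a₁ * + (suc N !) ≡ ℓ
        fa₁ = φ-fact (suc N) (n≤L (3 ℕ.* N ℕ.+ 7) (l N))
          where l : ∀ N → suc N ℕ.+ (3 ℕ.* N ℕ.+ 7) ≡ 4 ℕ.* N ℕ.+ 8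
                l = solveℕ
        fa₃ : a₃ * + ((3 ℕ.* N ℕ.+ 2) !) ≡ ℓ
        fa₃ = trans (cong (λ z → a₃ * + (z !)) (l' N)) (φ-fact (2 ℕ.* N ℕ.+ 2 ℕ.+ N) (n≤L (N ℕ.+ 6) (l N)))
          where
            l' : ∀ N → 3 ℕ.* N ℕ.+ 2 ≡ 2 ℕ.* N ℕ.+ 2 ℕ.+ N
            l' = solveℕ
            l : ∀ N → 2 ℕ.* N ℕ.+ 2 ℕ.+ N ℕ.+ (N ℕ.+ 6) ≡ 4 ℕ.* N ℕ.+ 8
            l = solveℕ
        fb₁ : b₁ ≡ ℓ
        fb₁ = trans (sym (ℤP.*-identityʳ b₁)) (φ-fact 1 (n≤L (4 ℕ.* N ℕ.+ 7) (l N)))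
          where l : ∀ N → 1 ℕ.+ (4 ℕ.* N ℕ.+ 7) ≡ 4 ℕ.* N ℕ.+ 8
                l = solveℕ
        fb₂ : b₂ * + ((2 ℕ.* N ℕ.+ 2) !) ≡ ℓ
        fb₂ = trans (cong (λ z → b₂ * + (z !)) (sym (ℕP.+-identityʳ (2 ℕ.* N ℕ.+ 2)))) (φ-fact (2 ℕ.* N ℕ.+ 2 ℕ.+ 0) (n≤L (2 ℕ.* N ℕ.+ 6) (l N)))
          where l : ∀ N → 2 ℕ.* N ℕ.+ 2 ℕ.+ 0 ℕ.+ (2 ℕ.* N ℕ.+ 6) ≡ 4 ℕ.* N ℕ.+ 8
                l = solveℕ
        ℓℓ : ℓ * ℓ ≡ a₁ * + (suc N !) * (a₃ * + ((3 ℕ.* N ℕ.+ 2) !))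
        ℓℓ = sym (cong₂ _*_ fa₁ fa₃)
        e-2N+2 : + ((2 ℕ.* N ℕ.+ 2) !) ≡ + 2 * n₁ * + ((2 ℕ.* N ℕ.+ 1) !)
        e-2N+2 = trans (cong (λ z → + (z !)) (ℕP.+-suc (2 ℕ.* N) 1)) (trans (ℤP.pos-* (suc (2 ℕ.* N ℕ.+ 1)) ((2 ℕ.* N ℕ.+ 1) !)) (cong (_* + ((2 ℕ.* N ℕ.+ 1) !)) (trans (cong +_ (l N)) (ℤP.pos-* 2 (suc N)))))
          where l : ∀ N → suc (2 ℕ.* N ℕ.+ 1) ≡ 2 ℕ.* suc N
                l = solveℕ
        e-3N+2 : + ((3 ℕ.* N ℕ.+ 2) !) ≡ c₃ * + ((3 ℕ.* N ℕ.+ 1) !)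
        e-3N+2 = trans (cong (λ z → + (z !)) (ℕP.+-suc (3 ℕ.* N) 1)) (trans (ℤP.pos-* (suc (3 ℕ.* N ℕ.+ 1)) ((3 ℕ.* N ℕ.+ 1) !)) (cong (λ z → + z * + ((3 ℕ.* N ℕ.+ 1) !)) (sym (ℕP.+-suc (3 ℕ.* N) 1))))
        lem₁ : ∀ l c n t g f → l * l * (c * (+ 2 * n)) * (t * g * f) ≡ f * c * (l * l) * (+ 2 * n * g) * t
        lem₁ = solve-∀
        lem₂ : ∀ f c a x b y z t → f * c * (a * x * (b * y)) * z * t ≡ (f * c * a * b * t) * (x * y * z)
        lem₂ = solve-∀
        lem₃ : ∀ a b t x y z → (+ 2 * a * b * t) * (x * y * z) ≡ + 2 * (a * (b * z)) * (x * y * t)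
        lem₃ = solve-∀
        lem₄ : ∀ l n f c g t → + 2 * (l * l) * (n * f * (c * g) * t) ≡ l * l * (c * (+ 2 * n)) * (t * g * f)
        lem₄ = solve-∀

module Counting where
  open import Defs renaming (r to red; g to green; y to yellow; b to blue; o to orange; s to silver)
  open import Data.Bool.Base using (Bool; true; false; not; if_then_else_)
  import Data.Bool.Properties as BoolP
  open import Data.List.Base as L using (List; []; _∷_; length; concatMap; filterᵇ)
  import Data.List.Properties as LP
  open import Data.List.Relation.Unary.All as All using (All; []; _∷_)
  import Data.List.Relation.Unary.All.Properties as AllP
  open import Data.List.Relation.Unary.Any as Any using (Any; here; there)
  import Data.List.Relation.Unary.Any.Properties as AnyP
  open import Data.List.Relation.Unary.AllPairs as AllPairs using (AllPairs; []; _∷_)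
  import Data.List.Relation.Unary.AllPairs.Properties as APP
  open import Data.Nat.Base using (_≤_; _∸_)
  open import Relation.Binary.Structures using (IsEquivalence)
  open import Relation.Binary.Construct.Closure.ReflexiveTransitive using (ε; _◅_)

  private variable A B : Set

  Count : (A → A → Set) → (A → Set) → ℕ → Set
  Count {A} _~_ Q N = Σ (List A) λ L →
    (length L ≡ N) × All Q L × AllPairs (λ x y → ¬ (x ~ y)) L × (∀ x → Q x → Any (λ y → y ~ x) L)

  module _ {_~_ : A → A → Set} (eq : IsEquivalence _~_) where
    open IsEquivalence eq renaming (refl to ~refl; sym to ~sym; trans to ~trans)

    remove : ∀ {x} (L : List A) → Any (λ y → y ~ x) L → List A
    remove (y ∷ L) (here _) = L
    remove (y ∷ L) (there p) = y ∷ remove L p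

    length-remove : ∀ {x} (L : List A) (p : Any (λ y → y ~ x) L) → length L ≡ suc (length (remove L p))
    length-remove (y ∷ L) (here _) = refl
    length-remove (y ∷ L) (there p) = cong suc (length-remove L p)

    any-remove : ∀ {x z} (L : List A) (p : Any (λ y → y ~ x) L) → ¬ (x ~ z) → Any (λ y → y ~ z) L → Any (λ y → y ~ z) (remove L p)
    any-remove (y ∷ L) (here yx) n (here yz) = contradiction (~trans (~sym yx) yz) n
    any-remove (y ∷ L) (here _) n (there q) = q
    any-remove (y ∷ L) (there p) n (here yz) = here yz
    any-remove (y ∷ L) (there p) n (there q) = there (any-remove L p n q)

    pigeonhole : ∀ L L' → AllPairs (λ x y → ¬ (x ~ y)) L → All (λ x → Any (λ y → y ~ x) L') L → length L ≤ length L'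
    pigeonhole [] L' _ _ = z≤n
    pigeonhole (x ∷ L) L' (n ∷ ns) (p ∷ ps) = subst (suc (length L) ≤_) (sym (length-remove L' p))
      (s≤s (pigeonhole L (remove L' p) ns (All.zipWith (λ { (n , q) → any-remove L' p n q }) (n , ps))))

    count-unique : ∀ {Q : A → Set} {N N'} → Count _~_ Q N → Count _~_ Q N' → N ≡ N'
    count-unique (L , refl , q , d , c) (L' , refl , q' , d' , c') =
      ℕP.≤-antisym (pigeonhole L L' d (All.map (c' _) q)) (pigeonhole L' L d' (All.map (c _) q'))

  allPairs-map : ∀ {R : A → A → Set} {S : B → B → Set} {Q : A → Set} (f : A → B) → (∀ {x y} → Q x → Q y → R x y → S (f x) (f y)) →
    ∀ {L} → All Q L → AllPairs R L → AllPairs S (L.map f L)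
  allPairs-map f h [] [] = []
  allPairs-map f h (q ∷ qs) (r ∷ rs) = AllP.map⁺ (All.zipWith (λ { (q' , r) → h q q' r }) (qs , r)) ∷ allPairs-map f h qs rs

  count-map : ∀ {_~_ : A → A → Set} {_≋_ : B → B → Set} → (∀ {x y z} → x ≋ y → y ≋ z → x ≋ z) → {Q : A → Set} {Q' : B → Set} (f : A → B) →
    (∀ {x} → Q x → Q' (f x)) → (∀ {x y} → Q x → Q y → f x ≋ f y → x ~ y) → (∀ {x y} → x ~ y → f x ≋ f y) →
    (∀ {y} → Q' y → Σ A λ x → Q x × (f x ≋ y)) → ∀ {N} → Count _~_ Q N → Count _≋_ Q' N
  count-map tr f h inj resp surj (L , len , q , d , c) = L.map f L , trans (LP.length-map f L) len , AllP.map⁺ (All.map h q) ,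
    allPairs-map f (λ qx qy n e → n (inj qx qy e)) q d ,
    λ y q'y → let (x , qx , e) = surj q'y in AnyP.map⁺ (Any.map (λ x'~x → tr (resp x'~x) e) (c x qx))

  filter-count : ∀ {_~_ : A → A → Set} {Q : A → Set} (R : A → Bool) → (∀ {x y} → x ~ y → R x ≡ R y) → ∀ {N} (cnt : Count _~_ Q N) →
    Count _~_ (λ x → Q x × R x ≡ true) (length (filterᵇ R (proj₁ cnt)))
  filter-count {_~_ = _~_} {Q} R resp (L , len , q , d , c) = filterᵇ R L , refl , allQ L q , pairs L d , λ { x (qx , rx) → any L rx (c x qx) }
    where
      allQ : ∀ L → All Q L → All (λ x → Q x × R x ≡ true) (filterᵇ R L)
      allQ [] [] = []
      allQ (x ∷ L) (q ∷ qs) with R x in e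
      ... | true = (q , e) ∷ allQ L qs
      ... | false = allQ L qs
      all⁻ : ∀ {P : _ → Set} L → All P L → All P (filterᵇ R L)
      all⁻ [] [] = []
      all⁻ (x ∷ L) (q ∷ qs) with R x
      ... | true = q ∷ all⁻ L qs
      ... | false = all⁻ L qs
      pairs : ∀ {P : _ → _ → Set} L → AllPairs P L → AllPairs P (filterᵇ R L)
      pairs [] [] = []
      pairs (x ∷ L) (p ∷ ps) with R x
      ... | true = all⁻ L p ∷ pairs L ps
      ... | false = pairs L ps
      any : ∀ {x} L → R x ≡ true → Any (λ y → y ~ x) L → Any (λ y → y ~ x) (filterᵇ R L)
      any (y ∷ L) rx (here e) rewrite trans (resp e) rx = here e
      any (y ∷ L) rx (there p) with R y
      ... | true = there (any L rx p)
      ... | false = any L rx p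

  Enum : (A → Set) → List A → Set
  Enum {A} Q xs = All Q xs × AllPairs _≢_ xs × (∀ x → Q x → Any (λ y → y ≡ x) xs)

  enum-count : ∀ {Q : A → Set} {xs} → Enum Q xs → Count _≡_ Q (length xs)
  enum-count {xs = xs} (q , d , c) = xs , refl , q , d , c

  private variable C : Set

  enum-concat : ∀ {Q : A → Set} {R : A → B → Set} {P : C → Set} (c : A → B → C) (f : A → List B) →
    (∀ {a b a' b'} → c a b ≡ c a' b' → a ≡ a' × b ≡ b') → (∀ {a b} → Q a → R a b → P (c a b)) →
    (∀ {z} → P z → Σ A λ a → Σ B λ b → (z ≡ c a b) × Q a × R a b) → (∀ a → Q a → Enum (R a) (f a)) →
    ∀ {xs} → Enum Q xs → Enum P (concatMap (λ a → L.map (c a) (f a)) xs)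
  enum-concat {A = A} {B} {C} {Q} {R} {P} c f inj make split enum {xs} (q , d , comp) =
    AllP.concat⁺ (AllP.map⁺ (All.map (λ {a} qa → AllP.map⁺ (All.map (make qa) (proj₁ (enum a qa)))) q)) ,
    APP.concat⁺ (AllP.map⁺ (All.map (λ {a} qa → APP.map⁺ (AllPairs.map (λ n e → n (proj₂ (inj e))) (proj₁ (proj₂ (enum a qa))))) q))
      (APP.map⁺ (AllPairs.map (λ {a} {a'} n → AllP.map⁺ (All.universal (λ b → AllP.map⁺ (All.universal (λ b' e → n (proj₁ (inj e))) (f a'))) (f a))) d)) ,
    λ z pz → let (a , b , e , qa , rab) = split pz in
      AnyP.concatMap⁺ (λ a → L.map (c a) (f a)) (Any.map (λ { {a'} refl → AnyP.map⁺ (Any.map (λ { refl → sym e }) (proj₂ (proj₂ (enum a qa)) b rab)) }) (comp a qa))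

  module Points (n : ℕ) where
    equiv : IsEquivalence (SameSubset n)
    equiv = record { refl = λ p → refl ; sym = λ e p → sym (e p) ; trans = λ e e' p → trans (e p) (e' p) }

    same-trans : {I J K : SubsetT n} → SameSubset n I J → SameSubset n J K → SameSubset n I K
    same-trans e e' p = trans (e p) (e' p)

    pt-≡ : {p q : Pt n} → proj₁ p ≡ proj₁ q → p ≡ q
    pt-≡ {t , a} {.t , b} refl = cong (t ,_) (ℕP.≤-irrelevant a b)

    ideal-cover : ∀ {S} (I : SubsetT n) → (∀ p q → Cover n S p q → I q ≡ true → I p ≡ true) → IsIdeal n S I
    ideal-cover I h p .p ε i = i
    ideal-cover {S} I h p q (c ◅ cs) i = h p _ c (ideal-cover {S} I h _ q cs i)

    cover-ideal : ∀ {S} (I : SubsetT n) → IsIdeal n S I → ∀ p q → Cover n S p q → I q ≡ true → I p ≡ true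
    cover-ideal I id p q c i = id p q (c ◅ ε) i

    -- an involution of the set of points acts on the order ideals if it preserves the order,
    -- and on their complements if it reverses the order
    module Involution (φ : Pt n → Pt n) (inv : ∀ p → φ (φ p) ≡ p) {Q Q' : SubsetT n → Set} where
      preserve : (∀ I → Q I → Q' (I ∘ φ)) → (∀ I → Q' I → Q (I ∘ φ)) → ∀ {N} → Count (SameSubset n) Q N → Count (SameSubset n) Q' N
      preserve h h' = count-map {_~_ = SameSubset n} {SameSubset n} (λ {I} {J} {K} → same-trans {I} {J} {K}) (_∘ φ) (λ {I} → h I)
        (λ {I} {J} _ _ e p → trans (cong I (sym (inv p))) (trans (e (φ p)) (cong J (inv p)))) (λ e p → e (φ p))
        (λ {I} q' → I ∘ φ , h' I q' , λ p → cong I (inv p))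

      reverse : (∀ I → Q I → Q' (not ∘ I ∘ φ)) → (∀ I → Q' I → Q (not ∘ I ∘ φ)) → ∀ {N} → Count (SameSubset n) Q N → Count (SameSubset n) Q' N
      reverse h h' = count-map {_~_ = SameSubset n} {SameSubset n} (λ {I} {J} {K} → same-trans {I} {J} {K}) (λ I → not ∘ I ∘ φ) (λ {I} → h I)
        (λ {I} {J} _ _ e p → trans (cong I (sym (inv p))) (trans (BoolP.not-injective (e (φ p))) (cong J (inv p)))) (λ e p → cong not (e (φ p)))
        (λ {I} q' → not ∘ I ∘ φ , h' I q' , λ p → trans (cong (not ∘ not ∘ I) (inv p)) (BoolP.not-involutive (I p)))

    ideal-preserve : ∀ {S S'} (φ : Pt n → Pt n) → (∀ p q → Cover n S' p q → Cover n S (φ p) (φ q)) →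
      ∀ (I : SubsetT n) → IsIdeal n S I → IsIdeal n S' (I ∘ φ)
    ideal-preserve {S} {S'} φ h I id = ideal-cover {S'} (I ∘ φ) λ p q c i → cover-ideal {S} I id (φ p) (φ q) (h p q c) i

    ideal-reverse : ∀ {S S'} (φ : Pt n → Pt n) → (∀ p q → Cover n S' p q → Cover n S (φ q) (φ p)) →
      ∀ (I : SubsetT n) → IsIdeal n S I → IsIdeal n S' (not ∘ I ∘ φ)
    ideal-reverse {S} {S'} φ h I id = ideal-cover {S'} (not ∘ I ∘ φ) λ p q c i → anti (I (φ p)) (I (φ q)) (λ ip → cover-ideal {S} I id (φ q) (φ p) (h p q c) ip) i
      where
        anti : ∀ a b → (a ≡ true → b ≡ true) → not b ≡ true → not a ≡ true
        anti true false h _ = h refl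
        anti false b h _ = refl

    sum₃ : Pt n → ℕ
    sum₃ ((a , b , c) , _) = a ℕ.+ b ℕ.+ c

    c₀ : Pt n → ℕ
    c₀ p = n ∸ 2 ∸ sum₃ p

    total : ∀ p → sum₃ p ℕ.+ c₀ p ≡ n ∸ 2
    total (_ , h) = ℕP.m+[n∸m]≡n h

    point : ∀ a b c d → a ℕ.+ b ℕ.+ c ℕ.+ d ≡ n ∸ 2 → Pt n
    point a b c d e = (a , b , c) , subst (a ℕ.+ b ℕ.+ c ≤_) e (ℕP.m≤m+n _ d)

    c₀-point : ∀ a b c d (e : a ℕ.+ b ℕ.+ c ℕ.+ d ≡ n ∸ 2) → c₀ (point a b c d e) ≡ d
    c₀-point a b c d e = trans (cong (_∸ (a ℕ.+ b ℕ.+ c)) (sym e)) (ℕP.m+n∸m≡n (a ℕ.+ b ℕ.+ c) d)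

    c₀-suc : ∀ p q → sum₃ q ≡ suc (sum₃ p) → c₀ p ≡ suc (c₀ q)
    c₀-suc p q e = trans (ℕP.+-∸-assoc 1 (subst (_≤ n ∸ 2) e (proj₂ q))) (cong (λ k → suc (n ∸ 2 ∸ k)) (sym e))

    c₀-≡ : ∀ p q → sum₃ q ≡ sum₃ p → c₀ p ≡ c₀ q
    c₀-≡ p q e = cong (n ∸ 2 ∸_) (sym e)

module Symmetries where
  open import Defs renaming (r to red; g to green; y to yellow; b to blue; o to orange; s to silver)
  open Counting
  open import Data.Bool.Base using (Bool; true; false; not; if_then_else_)
  import Data.Bool.Properties as BoolP
  open import Data.Nat.Base using (_≤_; _∸_)

  gybo rgyb rgyo rgys rgbs gybs gbos : ColorSet
  gybo green = true
  gybo yellow = true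
  gybo blue = true
  gybo orange = true
  gybo _ = false
  rgyb red = true
  rgyb green = true
  rgyb yellow = true
  rgyb blue = true
  rgyb _ = false
  rgyo red = true
  rgyo green = true
  rgyo yellow = true
  rgyo orange = true
  rgyo _ = false
  rgys red = true
  rgys green = true
  rgys yellow = true
  rgys silver = true
  rgys _ = false
  rgbs red = true
  rgbs green = true
  rgbs blue = true
  rgbs silver = true
  rgbs _ = false
  gybs green = true
  gybs yellow = true
  gybs blue = true
  gybs silver = true
  gybs _ = false
  gbos green = true
  gbos blue = true
  gbos orange = true
  gbos silver = true
  gbos _ = false

  trues : ℕ → (ℕ → Bool) → ℕ
  trues zero f = 0
  trues (suc n) f = (if f n then 1 else 0) ℕ.+ trues n f

  trues-cong : ∀ n {f g : ℕ → Bool} → (∀ c → c ℕ.< n → f c ≡ g c) → trues n f ≡ trues n g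
  trues-cong zero e = refl
  trues-cong (suc n) e = cong₂ (λ x y → (if x then 1 else 0) ℕ.+ y) (e n ℕP.≤-refl) (trues-cong n (λ c p → e c (ℕP.m≤n⇒m≤1+n p)))

  trues-head : ∀ n f → trues (suc n) f ≡ (if f 0 then 1 else 0) ℕ.+ trues n (f ∘ suc)
  trues-head zero f = refl
  trues-head (suc n) f = trans (cong ((if f (suc n) then 1 else 0) ℕ.+_) (trues-head n f)) (lem (if f (suc n) then 1 else 0) (if f 0 then 1 else 0) (trues n (f ∘ suc)))
    where lem : ∀ a b c → a ℕ.+ (b ℕ.+ c) ≡ b ℕ.+ (a ℕ.+ c)
          lem = solveℕ

  trues-reverse : ∀ n f → trues (suc n) (λ c → f (n ∸ c)) ≡ trues (suc n) f
  trues-reverse zero f = refl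
  trues-reverse (suc n) f = trans (trues-head (suc n) (λ c → f (suc n ∸ c))) (cong ((if f (suc n) then 1 else 0) ℕ.+_) (trues-reverse n f))

  trues-not : ∀ n f → trues n (not ∘ f) ℕ.+ trues n f ≡ n
  trues-not zero f = refl
  trues-not (suc n) f with f n
  ... | true = trans (ℕP.+-suc _ _) (cong suc (trues-not n f))
  ... | false = cong suc (trues-not n f)

  trues-≤ : ∀ n f → trues n f ≤ n
  trues-≤ n f = ℕP.≤-trans (ℕP.m≤n+m _ (trues n (not ∘ f))) (ℕP.≤-reflexive (trues-not n f))

  module Maps (k : ℕ) where
    n : ℕ
    n = suc (suc k)
    open Points n public

    up : Triple → ℕ
    up (a , b , c) = a ℕ.+ b ℕ.+ c

    move-r : ∀ {p q} → Move red p q → up q ≡ suc (up p)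
    move-r {a , b , c} (refl , refl , refl) = refl

    move-g : ∀ {p q} → Move green p q → up q ≡ suc (up p)
    move-g {a , b , c} (refl , refl , refl) = cong (ℕ._+ c) (ℕP.+-suc a b)

    move-y : ∀ {p q} → Move yellow p q → up q ≡ suc (up p)
    move-y {a , b , c} (refl , refl , refl) = ℕP.+-suc (a ℕ.+ b) c

    move-b : ∀ {p q} → Move blue p q → up q ≡ up p
    move-b {_} {a , _ , c} (refl , refl , refl) = cong (ℕ._+ c) (ℕP.+-suc a _)

    move-o : ∀ {p q} → Move orange p q → up q ≡ up p
    move-o {_} {a , b , _} (refl , refl , refl) = ℕP.+-suc (a ℕ.+ b) _

    move-s : ∀ {p q} → Move silver p q → up q ≡ up p
    move-s {a , b , _} {_ , _ , c} (refl , refl , refl) = trans (cong (ℕ._+ c) (ℕP.+-suc a b)) (sym (ℕP.+-suc (a ℕ.+ b) c))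

    triple-≡ : ∀ {a b c a' b' c' : ℕ} → a ≡ a' → b ≡ b' → c ≡ c' → (a , b , c) ≡ (a' , b' , c')
    triple-≡ refl refl refl = refl

    perm₂₃ : ∀ a b c d → a ℕ.+ c ℕ.+ b ℕ.+ d ≡ a ℕ.+ b ℕ.+ c ℕ.+ d
    perm₂₃ = solveℕ
    perm₁₃ : ∀ a b c d → c ℕ.+ b ℕ.+ a ℕ.+ d ≡ a ℕ.+ b ℕ.+ c ℕ.+ d
    perm₁₃ = solveℕ
    perm₀₂ : ∀ a b c d → a ℕ.+ d ℕ.+ c ℕ.+ b ≡ a ℕ.+ b ℕ.+ c ℕ.+ d
    perm₀₂ = solveℕ
    perm₀₁ : ∀ a b c d → d ℕ.+ b ℕ.+ c ℕ.+ a ≡ a ℕ.+ b ℕ.+ c ℕ.+ d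
    perm₀₁ = solveℕ
    perm-flip : ∀ a b c d → b ℕ.+ a ℕ.+ d ℕ.+ c ≡ a ℕ.+ b ℕ.+ c ℕ.+ d
    perm-flip = solveℕ
    perm-turn : ∀ a b c d → c ℕ.+ d ℕ.+ a ℕ.+ b ≡ a ℕ.+ b ℕ.+ c ℕ.+ d
    perm-turn = solveℕ

    swap₂₃ swap₁₃ swap₀₂ swap₀₁ flip₁₂ turn : Pt n → Pt n
    swap₂₃ p@((a , b , c) , _) = point a c b (c₀ p) (trans (perm₂₃ a b c (c₀ p)) (total p))
    swap₁₃ p@((a , b , c) , _) = point c b a (c₀ p) (trans (perm₁₃ a b c (c₀ p)) (total p))
    swap₀₂ p@((a , b , c) , _) = point a (c₀ p) c b (trans (perm₀₂ a b c (c₀ p)) (total p))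
    swap₀₁ p@((a , b , c) , _) = point (c₀ p) b c a (trans (perm₀₁ a b c (c₀ p)) (total p))
    flip₁₂ p@((a , b , c) , _) = point b a (c₀ p) c (trans (perm-flip a b c (c₀ p)) (total p))
    turn p@((a , b , c) , _) = point c (c₀ p) a b (trans (perm-turn a b c (c₀ p)) (total p))

    inv₂₃ : ∀ p → swap₂₃ (swap₂₃ p) ≡ p
    inv₂₃ p = pt-≡ refl
    inv₁₃ : ∀ p → swap₁₃ (swap₁₃ p) ≡ p
    inv₁₃ p = pt-≡ refl
    inv₀₂ : ∀ p → swap₀₂ (swap₀₂ p) ≡ p
    inv₀₂ p@((a , b , c) , _) = pt-≡ (triple-≡ refl (c₀-point a (c₀ p) c b (trans (perm₀₂ a b c (c₀ p)) (total p))) refl)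
    inv₀₁ : ∀ p → swap₀₁ (swap₀₁ p) ≡ p
    inv₀₁ p@((a , b , c) , _) = pt-≡ (triple-≡ (c₀-point (c₀ p) b c a (trans (perm₀₁ a b c (c₀ p)) (total p))) refl refl)
    inv-flip : ∀ p → flip₁₂ (flip₁₂ p) ≡ p
    inv-flip p@((a , b , c) , _) = pt-≡ (triple-≡ refl refl (c₀-point b a (c₀ p) c (trans (perm-flip a b c (c₀ p)) (total p))))
    inv-turn : ∀ p → turn (turn p) ≡ p
    inv-turn p@((a , b , c) , _) = pt-≡ (triple-≡ refl (c₀-point c (c₀ p) a b (trans (perm-turn a b c (c₀ p)) (total p))) refl)

    rgyb-rgyo : ∀ p q → Cover n rgyo p q → Cover n rgyb (swap₂₃ p) (swap₂₃ q)
    rgyb-rgyo p q (red , _ , e₁ , e₂ , e₃) = red , refl , e₁ , e₃ , e₂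
    rgyb-rgyo p q (green , _ , e₁ , e₂ , e₃) = yellow , refl , e₁ , e₃ , e₂
    rgyb-rgyo p q (yellow , _ , e₁ , e₂ , e₃) = green , refl , e₁ , e₃ , e₂
    rgyb-rgyo p q (orange , _ , e₁ , e₂ , e₃) = blue , refl , e₁ , e₃ , e₂

    rgyo-rgyb : ∀ p q → Cover n rgyb p q → Cover n rgyo (swap₂₃ p) (swap₂₃ q)
    rgyo-rgyb p q (red , _ , e₁ , e₂ , e₃) = red , refl , e₁ , e₃ , e₂
    rgyo-rgyb p q (green , _ , e₁ , e₂ , e₃) = yellow , refl , e₁ , e₃ , e₂
    rgyo-rgyb p q (yellow , _ , e₁ , e₂ , e₃) = green , refl , e₁ , e₃ , e₂
    rgyo-rgyb p q (blue , _ , e₁ , e₂ , e₃) = orange , refl , e₁ , e₃ , e₂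

    rgyb-rgys : ∀ p q → Cover n rgys p q → Cover n rgyb (swap₁₃ p) (swap₁₃ q)
    rgyb-rgys p q (red , _ , e₁ , e₂ , e₃) = yellow , refl , e₃ , e₂ , e₁
    rgyb-rgys p q (green , _ , e₁ , e₂ , e₃) = green , refl , e₃ , e₂ , e₁
    rgyb-rgys p q (yellow , _ , e₁ , e₂ , e₃) = red , refl , e₃ , e₂ , e₁
    rgyb-rgys p q (silver , _ , e₁ , e₂ , e₃) = blue , refl , e₃ , e₂ , e₁

    rgys-rgyb : ∀ p q → Cover n rgyb p q → Cover n rgys (swap₁₃ p) (swap₁₃ q)
    rgys-rgyb p q (red , _ , e₁ , e₂ , e₃) = yellow , refl , e₃ , e₂ , e₁
    rgys-rgyb p q (green , _ , e₁ , e₂ , e₃) = green , refl , e₃ , e₂ , e₁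
    rgys-rgyb p q (yellow , _ , e₁ , e₂ , e₃) = red , refl , e₃ , e₂ , e₁
    rgys-rgyb p q (blue , _ , e₁ , e₂ , e₃) = silver , refl , e₃ , e₂ , e₁

    rgbs-gybs : ∀ p q → Cover n gybs p q → Cover n rgbs (swap₁₃ p) (swap₁₃ q)
    rgbs-gybs p q (yellow , _ , e₁ , e₂ , e₃) = red , refl , e₃ , e₂ , e₁
    rgbs-gybs p q (green , _ , e₁ , e₂ , e₃) = green , refl , e₃ , e₂ , e₁
    rgbs-gybs p q (blue , _ , e₁ , e₂ , e₃) = silver , refl , e₃ , e₂ , e₁
    rgbs-gybs p q (silver , _ , e₁ , e₂ , e₃) = blue , refl , e₃ , e₂ , e₁

    gybs-rgbs : ∀ p q → Cover n rgbs p q → Cover n gybs (swap₁₃ p) (swap₁₃ q)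
    gybs-rgbs p q (red , _ , e₁ , e₂ , e₃) = yellow , refl , e₃ , e₂ , e₁
    gybs-rgbs p q (green , _ , e₁ , e₂ , e₃) = green , refl , e₃ , e₂ , e₁
    gybs-rgbs p q (blue , _ , e₁ , e₂ , e₃) = silver , refl , e₃ , e₂ , e₁
    gybs-rgbs p q (silver , _ , e₁ , e₂ , e₃) = blue , refl , e₃ , e₂ , e₁

    rgyb-rgbs : ∀ p q → Cover n rgbs p q → Cover n rgyb (swap₀₂ q) (swap₀₂ p)
    rgyb-rgbs p q (red , _ , e@(e₁ , e₂ , e₃)) = blue , refl , e₁ , c₀-suc p q (move-r e) , sym e₃
    rgyb-rgbs p q (green , _ , e@(e₁ , e₂ , e₃)) = green , refl , sym e₁ , c₀-suc p q (move-g e) , sym e₃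
    rgyb-rgbs p q (blue , _ , e@(e₁ , e₂ , e₃)) = red , refl , e₁ , c₀-≡ p q (move-b e) , sym e₃
    rgyb-rgbs p q (silver , _ , e@(e₁ , e₂ , e₃)) = yellow , refl , sym e₁ , c₀-≡ p q (move-s e) , e₃

    rgbs-rgyb : ∀ p q → Cover n rgyb p q → Cover n rgbs (swap₀₂ q) (swap₀₂ p)
    rgbs-rgyb p q (red , _ , e@(e₁ , e₂ , e₃)) = blue , refl , e₁ , c₀-suc p q (move-r e) , sym e₃
    rgbs-rgyb p q (green , _ , e@(e₁ , e₂ , e₃)) = green , refl , sym e₁ , c₀-suc p q (move-g e) , sym e₃
    rgbs-rgyb p q (yellow , _ , e@(e₁ , e₂ , e₃)) = silver , refl , sym e₁ , c₀-suc p q (move-y e) , e₃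
    rgbs-rgyb p q (blue , _ , e@(e₁ , e₂ , e₃)) = red , refl , e₁ , c₀-≡ p q (move-b e) , sym e₃

    gybs-gbos : ∀ p q → Cover n gbos p q → Cover n gybs (swap₀₁ p) (swap₀₁ q)
    gybs-gbos p q (green , _ , e@(e₁ , e₂ , e₃)) = blue , refl , c₀-suc p q (move-g e) , e₂ , e₃
    gybs-gbos p q (blue , _ , e@(e₁ , e₂ , e₃)) = green , refl , sym (c₀-≡ p q (move-b e)) , e₂ , e₃
    gybs-gbos p q (orange , _ , e@(e₁ , e₂ , e₃)) = yellow , refl , sym (c₀-≡ p q (move-o e)) , e₂ , e₃
    gybs-gbos p q (silver , _ , e@(e₁ , e₂ , e₃)) = silver , refl , sym (c₀-≡ p q (move-s e)) , e₂ , e₃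

    gbos-gybs : ∀ p q → Cover n gybs p q → Cover n gbos (swap₀₁ p) (swap₀₁ q)
    gbos-gybs p q (green , _ , e@(e₁ , e₂ , e₃)) = blue , refl , c₀-suc p q (move-g e) , e₂ , e₃
    gbos-gybs p q (yellow , _ , e@(e₁ , e₂ , e₃)) = orange , refl , c₀-suc p q (move-y e) , e₂ , e₃
    gbos-gybs p q (blue , _ , e@(e₁ , e₂ , e₃)) = green , refl , sym (c₀-≡ p q (move-b e)) , e₂ , e₃
    gbos-gybs p q (silver , _ , e@(e₁ , e₂ , e₃)) = silver , refl , sym (c₀-≡ p q (move-s e)) , e₂ , e₃

    gybo-flip : ∀ p q → Cover n gybo p q → Cover n gybo (flip₁₂ q) (flip₁₂ p)
    gybo-flip p q (green , _ , e@(e₁ , e₂ , e₃)) = orange , refl , e₂ , sym e₁ , c₀-suc p q (move-g e)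
    gybo-flip p q (yellow , _ , e@(e₁ , e₂ , e₃)) = yellow , refl , sym e₂ , sym e₁ , c₀-suc p q (move-y e)
    gybo-flip p q (blue , _ , e@(e₁ , e₂ , e₃)) = blue , refl , e₂ , e₁ , c₀-≡ p q (move-b e)
    gybo-flip p q (orange , _ , e@(e₁ , e₂ , e₃)) = green , refl , sym e₂ , e₁ , c₀-≡ p q (move-o e)

    gybo-turn : ∀ p q → Cover n gybo p q → Cover n gybo (turn q) (turn p)
    gybo-turn p q (green , _ , e@(e₁ , e₂ , e₃)) = green , refl , sym e₃ , c₀-suc p q (move-g e) , sym e₁
    gybo-turn p q (yellow , _ , e@(e₁ , e₂ , e₃)) = blue , refl , e₃ , c₀-suc p q (move-y e) , sym e₁
    gybo-turn p q (blue , _ , e@(e₁ , e₂ , e₃)) = yellow , refl , sym e₃ , c₀-≡ p q (move-b e) , e₁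
    gybo-turn p q (orange , _ , e@(e₁ , e₂ , e₃)) = orange , refl , e₃ , c₀-≡ p q (move-o e) , e₁

    to-rgyo : ∀ {N} → NumIdeals n rgyb N → NumIdeals n rgyo N
    to-rgyo = Involution.preserve swap₂₃ inv₂₃ (ideal-preserve {rgyb} {rgyo} swap₂₃ rgyb-rgyo) (ideal-preserve {rgyo} {rgyb} swap₂₃ rgyo-rgyb)

    to-rgys : ∀ {N} → NumIdeals n rgyb N → NumIdeals n rgys N
    to-rgys = Involution.preserve swap₁₃ inv₁₃ (ideal-preserve {rgyb} {rgys} swap₁₃ rgyb-rgys) (ideal-preserve {rgys} {rgyb} swap₁₃ rgys-rgyb)

    to-rgbs : ∀ {N} → NumIdeals n rgyb N → NumIdeals n rgbs N
    to-rgbs = Involution.reverse swap₀₂ inv₀₂ (ideal-reverse {rgyb} {rgbs} swap₀₂ rgyb-rgbs) (ideal-reverse {rgbs} {rgyb} swap₀₂ rgbs-rgyb)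

    to-gybs : ∀ {N} → NumIdeals n rgbs N → NumIdeals n gybs N
    to-gybs = Involution.preserve swap₁₃ inv₁₃ (ideal-preserve {rgbs} {gybs} swap₁₃ rgbs-gybs) (ideal-preserve {gybs} {rgbs} swap₁₃ gybs-rgbs)

    to-gbos : ∀ {N} → NumIdeals n gybs N → NumIdeals n gbos N
    to-gbos = Involution.preserve swap₀₁ inv₀₁ (ideal-preserve {gybs} {gbos} swap₀₁ gybs-gbos) (ideal-preserve {gbos} {gybs} swap₀₁ gbos-gybs)

    same-colors : ∀ {S S'} → (∀ x → S x ≡ S' x) → ∀ {N} → NumIdeals n S N → NumIdeals n S' N
    same-colors {S} {S'} e = Involution.preserve id (λ _ → refl)
      (ideal-preserve {S} {S'} id (λ { p q (x , m , mv) → x , trans (e x) m , mv }))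
      (ideal-preserve {S'} {S} id (λ { p q (x , m , mv) → x , trans (sym (e x)) m , mv }))

    mem : SubsetT n → ℕ → ℕ → ℕ → Bool
    mem I a b c with a ℕ.+ b ℕ.+ c ℕP.≤? k
    ... | yes h = I ((a , b , c) , h)
    ... | no _ = false

    mem-in : ∀ I a b c h → mem I a b c ≡ I ((a , b , c) , h)
    mem-in I a b c h with a ℕ.+ b ℕ.+ c ℕP.≤? k
    ... | yes h' = cong I (pt-≡ refl)
    ... | no nh = contradiction h nh

    mem-true : ∀ I a b c → mem I a b c ≡ true → Σ (a ℕ.+ b ℕ.+ c ≤ k) λ h → I ((a , b , c) , h) ≡ true
    mem-true I a b c e with a ℕ.+ b ℕ.+ c ℕP.≤? k
    ... | yes h = h , e

    mem-cong : ∀ {I J} → SameSubset n I J → ∀ a b c → mem I a b c ≡ mem J a b c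
    mem-cong e a b c with a ℕ.+ b ℕ.+ c ℕP.≤? k
    ... | yes h = e _
    ... | no _ = refl

    -- the elements on the edge c₀ = c₃ = 0, and the elements missing on the edge c₁ = c₂ = 0
    edge₁₂ edge₀₃ : SubsetT n → ℕ
    edge₁₂ I = trues (suc k) (λ c → mem I c (k ∸ c) 0)
    edge₀₃ I = trues (suc k) (λ c → not (mem I 0 0 c))

    edge₁₂-in : ∀ c → c ≤ k → c ℕ.+ (k ∸ c) ℕ.+ 0 ≤ k
    edge₁₂-in c p = ℕP.≤-reflexive (trans (ℕP.+-identityʳ _) (ℕP.m+[n∸m]≡n p))

    edge-flip : ∀ I → edge₁₂ (not ∘ I ∘ flip₁₂) ≡ suc k ∸ edge₁₂ I
    edge-flip I = trans (trues-cong (suc k) (λ { c (s≤s p) → point-wise c p })) (trans (trues-reverse k (λ c → not (mem I c (k ∸ c) 0)))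
      (trans (sym (ℕP.m+n∸n≡m _ (edge₁₂ I))) (cong (_∸ edge₁₂ I) (trues-not (suc k) (λ c → mem I c (k ∸ c) 0)))))
      where
        point-wise : ∀ c → c ≤ k → mem (not ∘ I ∘ flip₁₂) c (k ∸ c) 0 ≡ not (mem I (k ∸ c) (k ∸ (k ∸ c)) 0)
        point-wise c p = trans (mem-in (not ∘ I ∘ flip₁₂) c (k ∸ c) 0 (edge₁₂-in c p)) (cong not (trans (cong I (pt-≡ (triple-≡ refl (sym (ℕP.m∸[m∸n]≡n p)) z)))
            (sym (mem-in I (k ∸ c) (k ∸ (k ∸ c)) 0 (edge₁₂-in (k ∸ c) (ℕP.m∸n≤m k c))))))
          where z : k ∸ (c ℕ.+ (k ∸ c) ℕ.+ 0) ≡ 0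
                z = trans (cong (k ∸_) (trans (ℕP.+-identityʳ _) (ℕP.m+[n∸m]≡n p))) (ℕP.n∸n≡0 k)

    edge-turn : ∀ I → edge₁₂ (not ∘ I ∘ turn) ≡ edge₀₃ I
    edge-turn I = trues-cong (suc k) (λ { c (s≤s p) → point-wise c p })
      where
        point-wise : ∀ c → c ≤ k → mem (not ∘ I ∘ turn) c (k ∸ c) 0 ≡ not (mem I 0 0 c)
        point-wise c p = trans (mem-in (not ∘ I ∘ turn) c (k ∸ c) 0 (edge₁₂-in c p)) (cong not (trans (cong I (pt-≡ (triple-≡ refl z refl))) (sym (mem-in I 0 0 c p))))
          where z : k ∸ (c ℕ.+ (k ∸ c) ℕ.+ 0) ≡ 0
                z = trans (cong (k ∸_) (trans (ℕP.+-identityʳ _) (ℕP.m+[n∸m]≡n p))) (ℕP.n∸n≡0 k)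

    edge-turn' : ∀ I → edge₀₃ (not ∘ I ∘ turn) ≡ edge₁₂ I
    edge-turn' I = trans (sym (edge-turn (not ∘ I ∘ turn))) (trues-cong (suc k) (λ c _ → mem-cong (λ p → trans (BoolP.not-involutive _) (cong I (inv-turn p))) c (k ∸ c) 0))

    flip-count : ∀ e → e ≤ suc k → ∀ {N} → Count (SameSubset n) (λ I → IsIdeal n gybo I × edge₁₂ I ≡ e) N → Count (SameSubset n) (λ I → IsIdeal n gybo I × edge₁₂ I ≡ suc k ∸ e) N
    flip-count e p = Involution.reverse flip₁₂ inv-flip
      (λ { I (id , refl) → ideal-reverse {gybo} {gybo} flip₁₂ gybo-flip I id , edge-flip I })
      (λ { I (id , q) → ideal-reverse {gybo} {gybo} flip₁₂ gybo-flip I id , trans (edge-flip I) (trans (cong (suc k ∸_) q) (ℕP.m∸[m∸n]≡n p)) })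

    turn-count : ∀ e {N} → Count (SameSubset n) (λ I → IsIdeal n gybo I × edge₀₃ I ≡ e) N → Count (SameSubset n) (λ I → IsIdeal n gybo I × edge₁₂ I ≡ e) N
    turn-count e = Involution.reverse turn inv-turn
      (λ { I (id , refl) → ideal-reverse {gybo} {gybo} turn gybo-turn I id , edge-turn I })
      (λ { I (id , refl) → ideal-reverse {gybo} {gybo} turn gybo-turn I id , edge-turn' I })

module HeightFunctions where
  open import Defs renaming (r to red; g to green; y to yellow; b to blue; o to orange; s to silver)
  open Counting
  open Symmetries
  open import Data.Bool.Base using (Bool; true; false)
  open import Data.Bool.Properties using (T-≡)
  open import Data.Nat.Base using (_≤_; _<_; _∸_; _<ᵇ_)
  open import Function.Bundles using (Equivalence)

  <ᵇ-true : ∀ {m n} → m < n → (m <ᵇ n) ≡ true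
  <ᵇ-true p = Equivalence.to T-≡ (ℕP.<⇒<ᵇ p)

  true-< : ∀ {m n} → (m <ᵇ n) ≡ true → m < n
  true-< {m} e = ℕP.<ᵇ⇒< m _ (Equivalence.from T-≡ e)

  <ᵇ-false : ∀ {m n} → n ≤ m → (m <ᵇ n) ≡ false
  <ᵇ-false {m} {n} p with m <ᵇ n in e
  ... | true = contradiction (true-< e) (ℕP.≤⇒≯ p)
  ... | false = refl

  bool-ext : ∀ {x y : Bool} → (x ≡ true → y ≡ true) → (y ≡ true → x ≡ true) → x ≡ y
  bool-ext {true} {y} h _ = sym (h refl)
  bool-ext {false} {true} _ h = h refl
  bool-ext {false} {false} _ _ = refl

  ≤-by-< : ∀ {m n} → (∀ b → b < m → b < n) → m ≤ n
  ≤-by-< {zero} h = z≤n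
  ≤-by-< {suc m} h = h m ℕP.≤-refl

  trues-0 : ∀ n f → (∀ c → c < n → f c ≡ false) → trues n f ≡ 0
  trues-0 zero f h = refl
  trues-0 (suc n) f h rewrite h n ℕP.≤-refl = trues-0 n f (λ c p → h c (ℕP.m≤n⇒m≤1+n p))

  trues-all : ∀ n f → (∀ c → c < n → f c ≡ true) → trues n f ≡ n
  trues-all zero f h = refl
  trues-all (suc n) f h rewrite h n ℕP.≤-refl = cong suc (trues-all n f (λ c p → h c (ℕP.m≤n⇒m≤1+n p)))

  down : ∀ (f : ℕ → Bool) → (∀ c → f (suc c) ≡ true → f c ≡ true) → ∀ {c d} → c ≤ d → f d ≡ true → f c ≡ true
  down f h {d = zero} z≤n e = e
  down f h {d = suc d} p e with ℕP.m≤n⇒m<n∨m≡n p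
  ... | inj₁ (s≤s q) = down f h q (h d e)
  ... | inj₂ refl = e

  trues-initial : ∀ n (f : ℕ → Bool) → (∀ c → f (suc c) ≡ true → f c ≡ true) → (∀ c → f c ≡ true → c < n) → ∀ c → f c ≡ (c <ᵇ trues n f)
  trues-initial zero f h b c = bool-ext (λ e → contradiction (b c e) λ ()) λ ()
  trues-initial (suc n) f h b c with f n in e
  ... | true = trans (bool-ext (λ p → <ᵇ-true (b c p)) (λ p → down f h (ℕP.≤-pred (true-< {c} {suc n} p)) e))
     (cong (λ z → c <ᵇ suc z) (sym (trues-all n f (λ c p → down f h (ℕP.<⇒≤ p) e))))
  ... | false = trues-initial n f h (λ c p → ℕP.≤∧≢⇒< (ℕP.≤-pred (b c p)) (λ { refl → contradiction (trans (sym p) e) λ () })) c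

  module Heights (k : ℕ) where
    open Maps k

    Height : Set
    Height = ℕ → ℕ → ℕ

    _≈ₕ_ : Height → Height → Set
    Y ≈ₕ Z = ∀ a c → a ℕ.+ c ≤ k → Y a c ≡ Z a c

    Bounded : Height → Set
    Bounded Y = ∀ a c → a ℕ.+ c ≤ k → Y a c ≤ suc k ∸ (a ℕ.+ c)

    Closed : Color → Height → Set
    Closed red Y = ∀ a c → a ℕ.+ c < k → Y (suc a) c ≤ Y a c
    Closed green Y = ⊤
    Closed yellow Y = ∀ a c → a ℕ.+ c < k → Y a (suc c) ≤ Y a c
    Closed blue Y = ∀ a c → a ℕ.+ c < k → Y a c ≤ suc (Y (suc a) c)
    Closed orange Y = ∀ a c → a ℕ.+ c < k → Y a (suc c) ≤ Y (suc a) c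
    Closed silver Y = ∀ a c → a ℕ.+ c < k → Y a c ≤ suc (Y a (suc c))

    IsHeight : ColorSet → Height → Set
    IsHeight S Y = Bounded Y × (∀ x → S x ≡ true → Closed x Y)

    ideal : Height → SubsetT n
    ideal Y ((a , b , c) , _) = b <ᵇ Y a c

    base-≤ : ∀ {a b c} → a ℕ.+ b ℕ.+ c ≤ k → a ℕ.+ c ≤ k
    base-≤ {a} {b} {c} p = ℕP.≤-trans (ℕP.+-monoˡ-≤ c (ℕP.m≤m+n a b)) p

    room : ∀ {Y a b c} → Bounded Y → a ℕ.+ c ≤ k → b < Y a c → a ℕ.+ b ℕ.+ c ≤ k
    room {Y} {a} {b} {c} bd p q = ℕP.≤-trans (ℕP.≤-reflexive e) (ℕP.≤-trans (ℕP.+-monoʳ-≤ (a ℕ.+ c) b≤) (ℕP.≤-reflexive (ℕP.m+[n∸m]≡n p)))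
      where
        b≤ : b ≤ k ∸ (a ℕ.+ c)
        b≤ = ℕP.≤-pred (ℕP.≤-trans q (subst (Y a c ≤_) (ℕP.+-∸-assoc 1 p) (bd a c p)))
        e : a ℕ.+ b ℕ.+ c ≡ a ℕ.+ c ℕ.+ b
        e = trans (ℕP.+-assoc a b c) (trans (cong (a ℕ.+_) (ℕP.+-comm b c)) (sym (ℕP.+-assoc a c b)))

    ideal-isIdeal : ∀ S Y → IsHeight S Y → IsIdeal n S (ideal Y)
    ideal-isIdeal S Y (bd , cl) = ideal-cover {S} (ideal Y) step
      where
        <-base : ∀ {a b c} → a ℕ.+ suc b ℕ.+ c ≤ k → a ℕ.+ c < k
        <-base {a} {b} {c} p = ℕP.≤-trans (s≤s (ℕP.+-monoˡ-≤ c (ℕP.m≤m+n a b))) (subst (_≤ k) (cong (ℕ._+ c) (ℕP.+-suc a b)) p)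
        step : ∀ p q → Cover n S p q → ideal Y q ≡ true → ideal Y p ≡ true
        step ((a , b , c) , _) (_ , h) (red , m , refl , refl , refl) e = <ᵇ-true (ℕP.≤-trans (true-< e) (cl red m a c (base-≤ {suc a} {b} {c} h)))
        step ((a , b , c) , _) _ (green , m , refl , refl , refl) e = <ᵇ-true (ℕP.<⇒≤ (true-< {suc b} {Y a c} e))
        step ((a , b , c) , _) (_ , h) (yellow , m , refl , refl , refl) e = <ᵇ-true (ℕP.≤-trans (true-< e) (cl yellow m a c (subst (_≤ k) (ℕP.+-suc a c) (base-≤ {a} {b} {suc c} h))))
        step ((_ , b , c) , h) ((a , _) , _) (blue , m , refl , refl , refl) e = <ᵇ-true (ℕP.≤-pred (ℕP.≤-trans (true-< {suc b} e) (cl blue m a c (base-≤ {suc a} {b} {c} h))))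
        step ((_ , b , c) , h) ((a , _) , _) (orange , m , refl , refl , refl) e = <ᵇ-true (ℕP.≤-trans (true-< e) (cl orange m a c (base-≤ {suc a} {b} {c} h)))
        step ((a , b , _) , h) ((_ , _ , c) , _) (silver , m , refl , refl , refl) e = <ᵇ-true (ℕP.≤-pred (ℕP.≤-trans (true-< {suc b} e) (cl silver m a c (subst (_≤ k) (ℕP.+-suc a c) (base-≤ {a} {b} {suc c} h)))))

    mem-ideal : ∀ {Y} → Bounded Y → ∀ a b c → a ℕ.+ c ≤ k → mem (ideal Y) a b c ≡ (b <ᵇ Y a c)
    mem-ideal {Y} bd a b c p with a ℕ.+ b ℕ.+ c ℕP.≤? k
    ... | yes _ = refl
    ... | no nh = sym (<ᵇ-false (ℕP.≮⇒≥ (λ q → nh (room {Y} bd p q))))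

    ideal-injective : ∀ {Y Z} → Bounded Y → Bounded Z → SameSubset n (ideal Y) (ideal Z) → Y ≈ₕ Z
    ideal-injective {Y} {Z} bY bZ e a c p = ℕP.≤-antisym (half {Y} {Z} bY bZ e) (half {Z} {Y} bZ bY (λ q → sym (e q)))
      where
        half : ∀ {Y Z} → Bounded Y → Bounded Z → SameSubset n (ideal Y) (ideal Z) → Y a c ≤ Z a c
        half {Y} {Z} bY bZ e = ≤-by-< λ b q → true-< (trans (sym (e ((a , b , c) , room {Y} bY p q))) (<ᵇ-true q))

    heightOf : SubsetT n → Height
    heightOf I a c = trues (suc k ∸ (a ℕ.+ c)) (λ b → mem I a b c)

    module _ {S : ColorSet} (green∈S : S green ≡ true) (I : SubsetT n) (id : IsIdeal n S I) where
      mem-cover : ∀ a b c a' b' c' → (x : Color) → S x ≡ true → Move x (a , b , c) (a' , b' , c') → a ℕ.+ b ℕ.+ c ≤ k → mem I a' b' c' ≡ true → mem I a b c ≡ true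
      mem-cover a b c a' b' c' x m mv h e = let (h' , e') = mem-true I a' b' c' e in
        trans (mem-in I a b c h) (cover-ideal {S} I id ((a , b , c) , h) ((a' , b' , c') , h') (x , m , mv) e')

      mem-down : ∀ a c b → mem I a (suc b) c ≡ true → mem I a b c ≡ true
      mem-down a c b e = mem-cover a b c a (suc b) c green green∈S (refl , refl , refl)
        (ℕP.≤-trans (ℕP.+-monoˡ-≤ c (ℕP.+-monoʳ-≤ a (ℕP.n≤1+n b))) (proj₁ (mem-true I a (suc b) c e))) e

      heightOf-mem : ∀ a b c → mem I a b c ≡ (b <ᵇ heightOf I a c)
      heightOf-mem a b c = trues-initial (suc k ∸ (a ℕ.+ c)) (λ b → mem I a b c) (mem-down a c) bound b
        where
          bound : ∀ b → mem I a b c ≡ true → b < suc k ∸ (a ℕ.+ c)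
          bound b e = ℕP.m+n≤o⇒m≤o∸n (suc b) (s≤s (subst (_≤ k) (trans (cong (ℕ._+ c) (ℕP.+-comm a b)) (ℕP.+-assoc b a c)) (proj₁ (mem-true I a b c e))))

      ideal-heightOf : SameSubset n (ideal (heightOf I)) I
      ideal-heightOf ((a , b , c) , h) = trans (sym (heightOf-mem a b c)) (mem-in I a b c h)

      mem-< : ∀ a b c → b < heightOf I a c → mem I a b c ≡ true
      mem-< a b c p = trans (heightOf-mem a b c) (<ᵇ-true p)

      <-mem : ∀ a b c → mem I a b c ≡ true → b < heightOf I a c
      <-mem a b c e = true-< (trans (sym (heightOf-mem a b c)) e)

      closed : ∀ x → S x ≡ true → Closed x (heightOf I)
      closed red m a c p = ≤-by-< λ b q → let e = mem-< (suc a) b c q in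
        <-mem a b c (mem-cover a b c (suc a) b c red m (refl , refl , refl) (ℕP.<⇒≤ (proj₁ (mem-true I (suc a) b c e))) e)
      closed green m = tt
      closed yellow m a c p = ≤-by-< λ b q → let e = mem-< a b (suc c) q in
        <-mem a b c (mem-cover a b c a b (suc c) yellow m (refl , refl , refl) (ℕP.<⇒≤ (subst (_≤ k) (ℕP.+-suc (a ℕ.+ b) c) (proj₁ (mem-true I a b (suc c) e)))) e)
      closed blue m a c p = ≤-by-< λ { zero q → s≤s z≤n ; (suc b) q → let e = mem-< a (suc b) c q in
        s≤s (<-mem (suc a) b c (mem-cover (suc a) b c a (suc b) c blue m (refl , refl , refl) (subst (_≤ k) (cong (ℕ._+ c) (ℕP.+-suc a b)) (proj₁ (mem-true I a (suc b) c e))) e)) }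
      closed orange m a c p = ≤-by-< λ b q → let e = mem-< a b (suc c) q in
        <-mem (suc a) b c (mem-cover (suc a) b c a b (suc c) orange m (refl , refl , refl) (subst (_≤ k) (ℕP.+-suc (a ℕ.+ b) c) (proj₁ (mem-true I a b (suc c) e))) e)
      closed silver m a c p = ≤-by-< λ { zero q → s≤s z≤n ; (suc b) q → let e = mem-< a (suc b) c q in
        s≤s (<-mem a b (suc c) (mem-cover a b (suc c) a (suc b) c silver m (refl , refl , refl) (subst (_≤ k) (trans (cong (ℕ._+ c) (ℕP.+-suc a b)) (sym (ℕP.+-suc (a ℕ.+ b) c))) (proj₁ (mem-true I a (suc b) c e))) e)) }

      heightOf-isHeight : IsHeight S (heightOf I)
      heightOf-isHeight = (λ a c _ → trues-≤ (suc k ∸ (a ℕ.+ c)) (λ b → mem I a b c)) , closed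

    height-count : ∀ {S} → S green ≡ true → ∀ {N} → Count _≈ₕ_ (IsHeight S) N → NumIdeals n S N
    height-count {S} gr = count-map {_~_ = _≈ₕ_} {SameSubset n} (λ {I} {J} {K} → same-trans {I} {J} {K}) ideal (λ {Y} → ideal-isIdeal S Y)
      (λ { (bY , _) (bZ , _) → ideal-injective bY bZ })
      (λ { e ((a , b , c) , h) → cong (b <ᵇ_) (e a c (base-≤ {a} {b} {c} h)) })
      (λ {I} id → heightOf I , heightOf-isHeight gr I id , ideal-heightOf gr I id)

module TriangularArrays where
  open MonotoneTriangles using (Rows)
  open Counting
  open import Data.Bool.Base using (Bool; true; if_then_else_)
  open import Data.List.Base as L using ([]; _∷_; filterᵇ)
  open import Data.List.Relation.Unary.All using ([]; _∷_)
  open import Data.List.Relation.Unary.AllPairs using ([]; _∷_)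
  open import Data.Nat.Base using (_<_)
  open import Data.Vec.Base using (Vec; []; _∷_)

  private variable
    X : Set
    n m : ℕ

  entry : X → Vec X n → ℕ → X
  entry d [] i = d
  entry d (x ∷ v) zero = x
  entry d (x ∷ v) (suc i) = entry d v i

  table : ∀ n → (ℕ → X) → Vec X n
  table zero f = []
  table (suc n) f = f 0 ∷ table n (f ∘ suc)

  entry-table : ∀ (d : X) n f i → i < n → entry d (table n f) i ≡ f i
  entry-table d (suc n) f zero _ = refl
  entry-table d (suc n) f (suc i) (s≤s p) = entry-table d n (f ∘ suc) i p

  entry-ext : ∀ (d : X) (v w : Vec X n) → (∀ i → i < n → entry d v i ≡ entry d w i) → v ≡ w
  entry-ext d [] [] e = refl
  entry-ext d (x ∷ v) (y ∷ w) e = cong₂ _∷_ (e 0 (s≤s z≤n)) (entry-ext d v w (λ i p → e (suc i) (s≤s p)))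

  at₂ : X → ∀ m → Rows X m → ℕ → ℕ → X
  at₂ d zero t j i = d
  at₂ d (suc m) (l , t) zero i = entry d l i
  at₂ d (suc m) (l , t) (suc j) i = at₂ d m t j i

  table₂ : ∀ m → (ℕ → ℕ → X) → Rows X m
  table₂ zero f = tt
  table₂ (suc m) f = table (suc m) (f 0) , table₂ m (f ∘ suc)

  at-table : ∀ (d : X) m f j i → j ℕ.+ i < m → at₂ d m (table₂ m f) j i ≡ f j i
  at-table d (suc m) f zero i p = entry-table d (suc m) (f 0) i p
  at-table d (suc m) f (suc j) i (s≤s p) = at-table d m (f ∘ suc) j i p

  at-ext : ∀ (d : X) m (t u : Rows X m) → (∀ j i → j ℕ.+ i < m → at₂ d m t j i ≡ at₂ d m u j i) → t ≡ u
  at-ext d zero t u e = refl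
  at-ext d (suc m) (l , t) (l' , u) e = cong₂ _,_ (entry-ext d l l' (e 0)) (at-ext d m t u (λ j i p → e (suc j) i (s≤s p)))

  lead : (ℕ → Bool) → ℕ → ℕ
  lead f zero = 0
  lead f (suc n) = if f 0 then suc (lead (f ∘ suc) n) else 0

  lead-cong : ∀ n {f g : ℕ → Bool} → (∀ j → j < n → f j ≡ g j) → lead f n ≡ lead g n
  lead-cong zero e = refl
  lead-cong (suc n) {f} {g} e rewrite e 0 (s≤s z≤n) = cong (λ x → if g 0 then suc x else 0) (lead-cong n (λ j p → e (suc j) (s≤s p)))

  enum-filter : ∀ {Q : X → Set} (R : X → Bool) {xs} → Enum Q xs → Enum (λ x → Q x × R x ≡ true) (filterᵇ R xs)
  enum-filter R {xs} (q , d , c) = let (_ , _ , q' , d' , c') = filter-count {_~_ = _≡_} R (λ { refl → refl }) {L.length xs} (xs , refl , q , d , c) in q' , d' , c'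

module TriangleIdeals where
  open import Defs renaming (r to red; g to green; y to yellow; b to blue; o to orange; s to silver)
  open RowSums
  open MonotoneTriangles
  open TriangleRatio using (iota; iota-strict)
  open Counting
  open Symmetries
  open HeightFunctions
  open TriangularArrays
  open import Data.Bool.Base using (true)
  open import Data.List.Base as L using ([]; _∷_)
  open import Data.List.Relation.Unary.All using ([]; _∷_)
  open import Data.List.Relation.Unary.Any using (here)
  import Data.List.Relation.Unary.All.Properties as AllP
  import Data.List.Relation.Unary.Any.Properties as AnyP
  open import Data.List.Relation.Unary.AllPairs using ([]; _∷_)
  import Data.List.Relation.Unary.AllPairs.Properties as APP
  open import Data.Nat.Base using (_∸_)
  open import Data.Integer.Base using (ℤ; +_; 0ℤ; 1ℤ; _+_; _-_; ∣_∣)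
  open import Data.Vec.Base using (Vec; []; _∷_)

  private variable n : ℕ

  Between : ℤ → Vec ℤ n → Vec ℤ n → Set
  Between lo [] [] = ⊤
  Between lo (k ∷ ks) (l ∷ v) = (lo ≼ l) × (l ≼ k) × Between (next l k) ks v

  Monotone : ∀ m → Vec ℤ (suc m) → Tri m → Set
  Monotone zero ks t = ⊤
  Monotone (suc m) (k ∷ ks) (l , t) = Between k ks l × Monotone m l t

  +-cancel : ∀ lo {c d} → lo + + c ≡ lo + + d → c ≡ d
  +-cancel lo {c} {d} e = trans (sym (∣lo+c-lo∣ lo c)) (trans (cong (λ z → ∣ z - lo ∣) e) (∣lo+c-lo∣ lo d))

  rng-enum : ∀ {lo k} → lo ≼ k → Enum (λ l → (lo ≼ l) × (l ≼ k)) (rng lo ∣ k - lo ∣)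
  rng-enum {lo} (c , refl) = subst (λ z → Enum (λ l → (lo ≼ l) × (l ≼ lo + + c)) (rng lo z)) (sym (∣lo+c-lo∣ lo c))
    (AllP.applyUpTo⁺₁ (λ i → lo + + i) (suc c) (λ {i} i<c → (i , refl) , within i i<c) ,
     APP.applyUpTo⁺₁ (λ i → lo + + i) (suc c) (λ i<j _ e → ℕP.<⇒≢ i<j (+-cancel lo e)) ,
     λ { l ((i , refl) , (d , e)) → AnyP.applyUpTo⁺ (λ i → lo + + i) refl (s≤s (subst (i ℕ.≤_) (sym (+-cancel lo (trans e (ℤP.+-assoc lo (+ i) (+ d))))) (ℕP.m≤m+n i d))) })
    where
      within : ∀ i → i ℕ.< suc c → lo + + i ≼ lo + + c
      within i (s≤s p) with ℕP.m≤n⇒∃[o]m+o≡n p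
      ... | d , refl = d , sym (ℤP.+-assoc lo (+ i) (+ d))

  rows-enum : ∀ lo (ks : Vec ℤ n) → Weak lo ks → Enum (Between lo ks) (rows lo ks)
  rows-enum lo [] w = tt ∷ [] , [] ∷ [] , λ { [] _ → here refl }
  rows-enum lo (k ∷ ks) (p , s) = enum-concat {Q = λ l → (lo ≼ l) × (l ≼ k)} {R = λ l → Between (next l k) ks} {P = Between lo (k ∷ ks)} _∷_ (λ l → rows (next l k) ks)
    (λ { refl → refl , refl }) (λ { (q , q') r → q , q' , r }) (λ { {l ∷ v} (q , q' , r) → l , v , refl , (q , q') , r })
    (λ l _ → rows-enum (next l k) ks (Strict⇒Weak-next l k ks s)) (rng-enum p)

  ≼-next' : ∀ {l k} → l ≼ k → l + 1ℤ ≼ next l k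
  ≼-next' {l} {k} (c , e) = subst (λ z → z + 1ℤ ≼ next z k) (ℤP.+-identityʳ l) (≼-next {l} {c} {k} {0} e (s≤s z≤n))

  next-≽ : ∀ l k → k ≼ next l k
  next-≽ l k with l ℤP.≟ k
  ... | yes _ = ≼-suc k
  ... | no _ = ≼-refl

  between-weak : ∀ lo (ks v : Vec ℤ n) → Weak lo ks → Between lo ks v → Weak lo v
  between-weak lo [] [] w h = tt
  between-weak lo (k ∷ ks) (l ∷ v) (_ , s) (p , q , h) = p , Weak⇒Strict v (≼-next' q) (between-weak (next l k) ks v (Strict⇒Weak-next l k ks s) h)

  between-strict : ∀ k (ks v : Vec ℤ (suc n)) → Strict k ks → Between k ks v → StrictV v
  between-strict k ks (l ∷ v) s h = proj₂ (between-weak k ks (l ∷ v) (Strict⇒Weak ks s) h)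

  tris-enum : ∀ m ks → StrictV ks → Enum (Monotone m ks) (tris m ks)
  tris-enum zero ks s = tt ∷ [] , [] ∷ [] , λ { tt _ → here refl }
  tris-enum (suc m) (k ∷ ks) s = enum-concat {Q = Between k ks} {R = Monotone m} {P = Monotone (suc m) (k ∷ ks)} _,_ (tris m)
    (λ { refl → refl , refl }) _,_ (λ { {l , t} (p , q) → l , t , refl , p , q })
    (λ l b → tris-enum m l (between-strict k ks l s b)) (rows-enum k ks (Strict⇒Weak ks s))

  between-lower : ∀ {lo lo'} (ks v : Vec ℤ n) → lo' ≼ lo → Between lo ks v → Between lo' ks v
  between-lower [] [] p h = tt
  between-lower (k ∷ ks) (l ∷ v) p (q , h) = ≼-trans p q , h

  between-entry : ∀ lo (ks v : Vec ℤ n) → Between lo ks v → ∀ i → i ℕ.< n →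
    (entry 0ℤ (lo ∷ ks) i ≼ entry 0ℤ v i) × (entry 0ℤ v i ≼ entry 0ℤ (lo ∷ ks) (suc i))
  between-entry lo (k ∷ ks) (l ∷ v) (p , q , h) zero _ = p , q
  between-entry lo (k ∷ ks) (l ∷ v) (p , q , h) (suc i) (s≤s r) = between-entry k ks v (between-lower ks v (next-≽ l k) h) i r

  strict-entry : ∀ x (v : Vec ℤ n) → Strict x v → ∀ i → i ℕ.< n → entry 0ℤ (x ∷ v) i + 1ℤ ≼ entry 0ℤ (x ∷ v) (suc i)
  strict-entry x (y ∷ v) (p , s) zero _ = p
  strict-entry x (y ∷ v) (p , s) (suc i) (s≤s r) = strict-entry y v s i r

  between-intro : ∀ n (e e' : ℕ → ℤ) lo → (0 ℕ.< n → lo ≼ e' 0) → (∀ i → i ℕ.< n → e' i ≼ e i) → (∀ i → suc i ℕ.< n → e i ≼ e' (suc i)) →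
    (∀ i → suc i ℕ.< n → e' i + 1ℤ ≼ e' (suc i)) → Between lo (table n e) (table n e')
  between-intro zero e e' lo h₁ h₂ h₃ h₄ = tt
  between-intro (suc n) e e' lo h₁ h₂ h₃ h₄ = h₁ (s≤s z≤n) , h₂ 0 (s≤s z≤n) ,
    between-intro n (e ∘ suc) (e' ∘ suc) (next (e' 0) (e 0)) step (λ i p → h₂ (suc i) (s≤s p)) (λ i p → h₃ (suc i) (s≤s p)) (λ i p → h₄ (suc i) (s≤s p))
    where
      step : 0 ℕ.< n → next (e' 0) (e 0) ≼ e' 1
      step p with e' 0 ℤP.≟ e 0
      ... | yes q = subst (λ z → z + 1ℤ ≼ e' 1) q (h₄ 0 (s≤s p))
      ... | no _ = h₃ 0 (s≤s p)

  monotone-at : ∀ m l t → StrictV l → Monotone m l t → let z = at₂ 0ℤ (suc m) (l , t) in ∀ j i → j ℕ.+ i ℕ.< m →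
    (z j i ≼ z (suc j) i) × (z (suc j) i ≼ z j (suc i)) × (z j i + 1ℤ ≼ z j (suc i))
  monotone-at (suc m) (k ∷ ks) (l , t) s (b , h) zero i p = let (q , q') = between-entry k ks l b i p in q , q' , strict-entry k ks s i p
  monotone-at (suc m) (k ∷ ks) (l , t) s (b , h) (suc j) i (s≤s p) = monotone-at m l t (between-strict k ks l s b) h j i p

  monotone-intro : ∀ m (z : ℕ → ℕ → ℤ) → (∀ j i → j ℕ.+ i ℕ.< m → (z j i ≼ z (suc j) i) × (z (suc j) i ≼ z j (suc i))) →
    (∀ j i → suc (j ℕ.+ i) ℕ.< m → z (suc j) i + 1ℤ ≼ z (suc j) (suc i)) → Monotone m (table (suc m) (z 0)) (table₂ m (z ∘ suc))
  monotone-intro zero z h h' = tt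
  monotone-intro (suc m) z h h' =
    between-intro (suc m) (z 0 ∘ suc) (z 1) (z 0 0) (λ _ → proj₁ (h 0 0 (s≤s z≤n))) (λ i p → proj₂ (h 0 i p)) (λ i p → proj₁ (h 0 (suc i) p)) (λ i p → h' 0 i p) ,
    monotone-intro m (z ∘ suc) (λ j i p → h (suc j) i (s≤s p)) (λ j i p → h' (suc j) i (s≤s p))

  iota-table : ∀ k n → table n (λ i → k + + i) ≡ iota k n
  iota-table k zero = refl
  iota-table k (suc n) = cong₂ _∷_ (ℤP.+-identityʳ k) (trans (table-cong n (λ i → sym (ℤP.+-assoc k 1ℤ (+ i)))) (iota-table (k + 1ℤ) n))
    where
      table-cong : ∀ n {f g : ℕ → ℤ} → (∀ i → f i ≡ g i) → table n f ≡ table n g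
      table-cong zero e = refl
      table-cong (suc n) e = cong₂ _∷_ (e 0) (table-cong n (e ∘ suc))

  pos-≼ : ∀ {x y} → x ℕ.≤ y → + x ≼ + y
  pos-≼ {x} p with ℕP.m≤n⇒∃[o]m+o≡n p
  ... | d , refl = d , refl

  ≼-pos : ∀ {x z} → + x ≼ z → (z ≡ + ∣ z ∣) × (x ℕ.≤ ∣ z ∣)
  ≼-pos {x} (c , refl) = refl , ℕP.m≤m+n x c

  abs-≼ : ∀ {x y z} → + x ≼ y → y ≼ z → ∣ y ∣ ℕ.≤ ∣ z ∣
  abs-≼ {x} (c , refl) (d , refl) = ℕP.m≤m+n (x ℕ.+ c) d

  ∸-suc' : ∀ {k x} → x ℕ.< k → k ∸ x ≡ suc (k ∸ suc x)
  ∸-suc' {suc k} {x} (s≤s p) = ℕP.+-∸-assoc 1 p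

  module ASM (k : ℕ) where
    open Maps k renaming (n to ord)
    open Heights k

    m : ℕ
    m = suc k

    base : Vec ℤ (suc m)
    base = iota 0ℤ (suc m)

    base-strict : StrictV base
    base-strict = iota-strict 0ℤ m

    z : Tri m → ℕ → ℕ → ℤ
    z t = at₂ 0ℤ (suc m) (base , t)

    N : Tri m → ℕ → ℕ → ℕ
    N t j i = ∣ z t j i ∣

    -- with rows numbered from below, entry a of row j + 1, a + c + j = k, exceeds the height over (a, c) by a
    height : Tri m → Height
    height t a c = N t (suc (k ∸ (a ℕ.+ c))) a ∸ a

    row-ok : ∀ {a c} → a ℕ.+ c ℕ.≤ k → suc (k ∸ (a ℕ.+ c)) ℕ.+ a ℕ.≤ m
    row-ok {a} {c} p = s≤s (ℕP.≤-trans (ℕP.+-monoʳ-≤ (k ∸ (a ℕ.+ c)) (ℕP.m≤m+n a c)) (ℕP.≤-reflexive (ℕP.m∸n+n≡m p)))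

    drop-y : ∀ {a c} → a ℕ.+ c ℕ.< k → k ∸ (a ℕ.+ c) ≡ suc (k ∸ (a ℕ.+ suc c))
    drop-y {a} {c} p = trans (∸-suc' p) (cong (λ x → suc (k ∸ x)) (sym (ℕP.+-suc a c)))

    third : ∀ {j i} → j ℕ.+ i ℕ.≤ k → i ℕ.+ (k ∸ (j ℕ.+ i)) ≡ k ∸ j
    third {j} {i} p = sym (trans (cong (_∸ j) (trans (sym (ℕP.m+[n∸m]≡n p)) (ℕP.+-assoc j i _))) (ℕP.m+n∸m≡n j _))

    row-of : ∀ {j i} → j ℕ.+ i ℕ.≤ k → k ∸ (i ℕ.+ (k ∸ (j ℕ.+ i))) ≡ j
    row-of {j} {i} p = trans (cong (k ∸_) (third {j} {i} p)) (ℕP.m∸[m∸n]≡n (ℕP.m+n≤o⇒m≤o j p))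

    module _ (t : Tri m) (h : Monotone m base t) where
      at-rel : ∀ j i → j ℕ.+ i ℕ.< m → (z t j i ≼ z t (suc j) i) × (z t (suc j) i ≼ z t j (suc i)) × (z t j i + 1ℤ ≼ z t j (suc i))
      at-rel = monotone-at m base t base-strict h

      base-at : ∀ i → i ℕ.≤ m → z t 0 i ≡ + i
      base-at i p = trans (cong (λ v → entry 0ℤ v i) (sym (iota-table 0ℤ (suc m)))) (entry-table 0ℤ (suc m) (λ i → + i) i (s≤s p))

      lower : ∀ j i → j ℕ.+ i ℕ.≤ m → + i ≼ z t j i
      lower zero i p = subst (+ i ≼_) (sym (base-at i p)) ≼-refl
      lower (suc j) i p = ≼-trans (lower j i (ℕP.<⇒≤ p)) (proj₁ (at-rel j i p))

      z-N : ∀ j i → j ℕ.+ i ℕ.≤ m → z t j i ≡ + N t j i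
      z-N j i p = proj₁ (≼-pos (lower j i p))

      N-≥ : ∀ j i → j ℕ.+ i ℕ.≤ m → i ℕ.≤ N t j i
      N-≥ j i p = proj₂ (≼-pos (lower j i p))

      N-up : ∀ j i → j ℕ.+ i ℕ.< m → N t j i ℕ.≤ N t (suc j) i
      N-up j i p = abs-≼ (lower j i (ℕP.<⇒≤ p)) (proj₁ (at-rel j i p))

      N-diag : ∀ j i → j ℕ.+ i ℕ.< m → N t (suc j) i ℕ.≤ N t j (suc i)
      N-diag j i p = abs-≼ (lower (suc j) i p) (proj₁ (proj₂ (at-rel j i p)))

      N-row : ∀ j i → j ℕ.+ i ℕ.< m → N t j i ℕ.< N t j (suc i)
      N-row j i p = subst (ℕ._≤ N t j (suc i)) (trans (cong (λ x → ∣ x + 1ℤ ∣) (z-N j i (ℕP.<⇒≤ p))) (ℕP.+-comm (N t j i) 1))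
        (abs-≼ (subst (λ x → + (i ℕ.+ 1) ≼ x + 1ℤ) (sym (z-N j i (ℕP.<⇒≤ p))) (pos-≼ (ℕP.+-monoˡ-≤ 1 (N-≥ j i (ℕP.<⇒≤ p))))) (proj₂ (proj₂ (at-rel j i p))))

      N-≤ : ∀ j i → j ℕ.+ i ℕ.≤ m → N t j i ℕ.≤ j ℕ.+ i
      N-≤ zero i p = ℕP.≤-reflexive (cong ∣_∣ (base-at i p))
      N-≤ (suc j) i p = ℕP.≤-trans (N-diag j i p) (subst (N t j (suc i) ℕ.≤_) (ℕP.+-suc j i) (N-≤ j (suc i) (subst (ℕ._≤ m) (sym (ℕP.+-suc j i)) p)))

      height-bounded : Bounded (height t)
      height-bounded a c p = ℕP.≤-trans (ℕP.∸-monoˡ-≤ a (N-≤ (suc (k ∸ (a ℕ.+ c))) a (row-ok {a} {c} p))) (ℕP.≤-reflexive (trans (ℕP.m+n∸n≡m (suc (k ∸ (a ℕ.+ c))) a) (sym (ℕP.+-∸-assoc 1 p))))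

      height-isHeight : IsHeight gybo (height t)
      height-isHeight = height-bounded , closed'
        where
          in-row : ∀ {a c} → a ℕ.+ c ℕ.< k → suc (k ∸ (a ℕ.+ suc c)) ℕ.+ a ℕ.< m
          in-row {a} {c} p = subst (λ x → x ℕ.+ a ℕ.< m) (drop-y {a} {c} p) (row-ok {a} {c} (ℕP.<⇒≤ p))
          in-row' : ∀ {a c} → a ℕ.+ c ℕ.< k → suc (k ∸ suc (a ℕ.+ c)) ℕ.+ a ℕ.< m
          in-row' {a} {c} p = subst (λ x → x ℕ.+ a ℕ.< m) (∸-suc' p) (row-ok {a} {c} (ℕP.<⇒≤ p))
          closed' : ∀ x → gybo x ≡ true → Closed x (height t)
          closed' green _ = tt
          closed' yellow _ a c p rewrite drop-y {a} {c} p = ℕP.∸-monoˡ-≤ a (N-up (suc (k ∸ (a ℕ.+ suc c))) a (in-row {a} {c} p))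
          closed' blue _ a c p rewrite ∸-suc' p = ℕP.≤-trans (ℕP.∸-monoˡ-≤ a (N-diag j a (in-row' {a} {c} p)))
              (ℕP.≤-reflexive (∸-suc' (N-≥ j (suc a) (subst (ℕ._≤ m) (sym (ℕP.+-suc j a)) (in-row' {a} {c} p)))))
            where j = suc (k ∸ suc (a ℕ.+ c))
          closed' orange _ a c p = subst (λ x → N t (suc (k ∸ x)) a ∸ a ℕ.≤ height t (suc a) c) (sym (ℕP.+-suc a c)) (ℕP.∸-monoˡ-≤ (suc a) (N-row (suc (k ∸ suc (a ℕ.+ c))) a (in-row' {a} {c} p)))

      z-height : ∀ j i → j ℕ.+ i ℕ.≤ k → z t (suc j) i ≡ + (i ℕ.+ height t i (k ∸ (j ℕ.+ i)))
      z-height j i p rewrite row-of {j} {i} p = trans (z-N (suc j) i (s≤s p)) (cong +_ (sym (ℕP.m+[n∸m]≡n (N-≥ (suc j) i (s≤s p)))))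

    height-injective : ∀ t u → Monotone m base t → Monotone m base u → height t ≈ₕ height u → t ≡ u
    height-injective t u ht hu e = at-ext 0ℤ m t u λ { j i (s≤s p) → trans (z-height t ht j i p)
      (trans (cong (λ x → + (i ℕ.+ x)) (e i (k ∸ (j ℕ.+ i)) (subst (ℕ._≤ k) (sym (third {j} {i} p)) (ℕP.m∸n≤m k j)))) (sym (z-height u hu j i p))) }

    module _ (Y : Height) (isH : IsHeight gybo Y) where
      array : ℕ → ℕ → ℤ
      array zero i = + i
      array (suc j) i = + (i ℕ.+ Y i (k ∸ (j ℕ.+ i)))

      triangle : Tri m
      triangle = table₂ m (array ∘ suc)

      triangle-monotone : Monotone m base triangle
      triangle-monotone = subst (λ v → Monotone m v triangle) (iota-table 0ℤ (suc m)) (monotone-intro m array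
        (λ { zero i (s≤s p) → pos-≼ (ℕP.m≤m+n i _) , pos-≼ (ℕP.≤-trans (ℕP.+-monoʳ-≤ i (top i p)) (ℕP.≤-reflexive (ℕP.+-comm i 1)))
           ; (suc j) i (s≤s p) → pos-≼ (ℕP.+-monoʳ-≤ i (subst (λ x → Y i x ℕ.≤ Y i (k ∸ suc (j ℕ.+ i))) (sym (∸-suc' p)) (proj₂ isH yellow refl i _ (small j i p)))) ,
               pos-≼ (ℕP.≤-trans (ℕP.+-monoʳ-≤ i (proj₂ isH blue refl i _ (small j i p))) (ℕP.≤-reflexive (trans (ℕP.+-suc i _) (cong (λ x → suc (i ℕ.+ Y (suc i) (k ∸ x))) (sym (ℕP.+-suc j i)))))) })
        (λ { j i (s≤s p) → subst (_≼ array (suc j) (suc i)) (cong +_ (ℕP.+-comm 1 _)) (pos-≼ (s≤s (ℕP.+-monoʳ-≤ i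
               (subst₂ (λ x y → Y i x ℕ.≤ Y (suc i) (k ∸ y)) (sym (∸-suc' p)) (sym (ℕP.+-suc j i)) (proj₂ isH orange refl i _ (small j i p)))))) }))
        where
          top : ∀ i → i ℕ.≤ k → Y i (k ∸ i) ℕ.≤ 1
          top i p = subst (Y i (k ∸ i) ℕ.≤_) (trans (cong (suc k ∸_) (ℕP.m+[n∸m]≡n p)) (ℕP.m+n∸n≡m 1 k)) (proj₁ isH i (k ∸ i) (ℕP.≤-reflexive (ℕP.m+[n∸m]≡n p)))
          small : ∀ j i → j ℕ.+ i ℕ.< k → i ℕ.+ (k ∸ suc (j ℕ.+ i)) ℕ.< k
          small j i p = ℕP.≤-trans (ℕP.≤-reflexive (trans (sym (ℕP.+-suc i _)) (cong (i ℕ.+_) (sym (∸-suc' p))))) (ℕP.≤-trans (ℕP.≤-reflexive (third {j} {i} (ℕP.<⇒≤ p))) (ℕP.m∸n≤m k j))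

      height-triangle : height triangle ≈ₕ Y
      height-triangle a c p = trans (cong (λ x → ∣ x ∣ ∸ a) (at-table 0ℤ m (array ∘ suc) (k ∸ (a ℕ.+ c)) a (row-ok {a} {c} p)))
        (trans (ℕP.m+n∸m≡n a _) (cong (Y a) (trans (cong (k ∸_) (trans (ℕP.+-comm (k ∸ (a ℕ.+ c)) a) (trans (cong (λ x → a ℕ.+ (k ∸ x)) (ℕP.+-comm a c)) (third {c} {a} (subst (ℕ._≤ k) (ℕP.+-comm a c) p)))))
          (ℕP.m∸[m∸n]≡n (ℕP.m+n≤o⇒n≤o a p)))))

    monotone-count : Count _≡_ (Monotone m base) (L.length (tris m base))
    monotone-count = enum-count (tris-enum m base base-strict)

    height-map : Count _≈ₕ_ (IsHeight gybo) (L.length (tris m base))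
    height-map = count-map {_~_ = _≡_} {_≈ₕ_} (λ e e' a c p → trans (e a c p) (e' a c p)) height (λ {t} → height-isHeight t)
      (λ {t} {u} → height-injective t u) (λ { refl a c p → refl }) (λ {Y} isH → triangle Y isH , triangle-monotone Y isH , height-triangle Y isH) monotone-count

    ideals : NumIdeals ord gybo (L.length (tris m base))
    ideals = height-count {gybo} refl height-map

module RefinedCounts where
  open import Defs renaming (r to red; g to green; y to yellow; b to blue; o to orange; s to silver)
  open RowSums using (sumL)
  open MonotoneTriangles using (Tri; tris; statF; statL; lst)
  open TriangleRatio using (ind; distribution; a-ratio; NL; NF; triangles; iota)
  open Counting
  open Symmetries
  open HeightFunctions
  open TriangularArrays
  open TriangleIdeals
  open import Data.Bool.Base using (true; false; not; if_then_else_)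
  open import Data.Bool.Properties using (T-≡)
  open import Data.List.Base as L using (List; []; _∷_; filterᵇ; length)
  import Data.List.Properties as LP
  open import Data.List.Relation.Unary.All as All using (All; []; _∷_)
  open import Data.Nat.Base using (_∸_; _<ᵇ_; _≡ᵇ_; _!)
  open import Data.Integer.Base using (ℤ; +_; 0ℤ; 1ℤ; _+_; _*_; ∣_∣)
  open import Data.Vec.Base using (Vec; []; _∷_)
  open import Function.Bundles using (Equivalence)

  private variable A B : Set

  trues-lead : ∀ n f → (∀ c → suc c ℕ.< n → f c ≡ true → f (suc c) ≡ true) → trues n f ≡ lead (λ j → f (n ∸ suc j)) n
  trues-lead zero f h = refl
  trues-lead (suc n) f h with f n in e
  ... | true = cong suc (trues-lead n f (λ c p → h c (ℕP.m≤n⇒m≤1+n p)))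
  ... | false = trues-0 n f all-false
    where
      up : ∀ d c → suc (c ℕ.+ d) ≡ n → f c ≡ true → f n ≡ true
      up zero c refl q = subst (λ x → f (suc x) ≡ true) (sym (ℕP.+-identityʳ c)) (h c (s≤s (s≤s (ℕP.≤-reflexive (sym (ℕP.+-identityʳ c))))) q)
      up (suc d) c refl q = up d (suc c) (cong suc (sym (ℕP.+-suc c d))) (h c (s≤s (s≤s (ℕP.m≤m+n c (suc d)))) q)
      all-false : ∀ c → c ℕ.< n → f c ≡ false
      all-false c p with f c in q
      ... | false = refl
      ... | true = let (d , e') = ℕP.m≤n⇒∃[o]m+o≡n p in contradiction (trans (sym (up d c e' q)) e) λ ()

  statF-lead : ∀ m K (t : Tri m) → statF {m} K t ≡ lead (λ j → does (at₂ 0ℤ m t j 0 ℤP.≟ K)) m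
  statF-lead zero K t = refl
  statF-lead (suc m) K ((l ∷ ls) , t) = cong (λ x → if does (l ℤP.≟ K) then suc x else 0) (statF-lead m K t)

  lst-entry : ∀ {n} (v : Vec ℤ (suc n)) → lst v ≡ entry 0ℤ v n
  lst-entry {zero} (x ∷ []) = refl
  lst-entry {suc n} (x ∷ y ∷ v) = lst-entry (y ∷ v)

  statL-lead : ∀ m K (t : Tri m) → statL {m} K t ≡ lead (λ j → does (at₂ 0ℤ m t j (m ∸ suc j) ℤP.≟ K)) m
  statL-lead zero K t = refl
  statL-lead (suc m) K (l , t) = cong₂ (λ x y → if does (y ℤP.≟ K) then suc x else 0) (statL-lead m K t) (lst-entry l)

  ind-≡ᵇ : ∀ x i → ind x i ≡ (if x ≡ᵇ i then 1ℤ else 0ℤ)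
  ind-≡ᵇ zero zero = refl
  ind-≡ᵇ zero (suc i) = refl
  ind-≡ᵇ (suc x) zero = refl
  ind-≡ᵇ (suc x) (suc i) = ind-≡ᵇ x i

  distribution-filter : ∀ (stat : A → ℕ) (f : A → B) (g : B → ℕ) i xs → All (λ x → g (f x) ≡ stat x) xs →
    distribution stat xs i ≡ + length (filterᵇ (λ b → g b ≡ᵇ i) (L.map f xs))
  distribution-filter stat f g i [] [] = refl
  distribution-filter stat f g i (x ∷ xs) (e ∷ es) rewrite ind-≡ᵇ (stat x) i | e with stat x ≡ᵇ i
  ... | true = cong (_+_ 1ℤ) (distribution-filter stat f g i xs es)
  ... | false = trans (ℤP.+-identityˡ (distribution stat xs i)) (distribution-filter stat f g i xs es)

  sumL-length : ∀ (xs : List A) → sumL (λ _ → 1ℤ) xs ≡ + length xs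
  sumL-length [] = refl
  sumL-length (x ∷ xs) = cong (_+_ 1ℤ) (sumL-length xs)

  count-iff : ∀ {_~_ : A → A → Set} {Q R : A → Set} → (∀ {x} → Q x → R x) → (∀ {x} → R x → Q x) → ∀ {N} → Count _~_ Q N → Count _~_ R N
  count-iff h h' (L , len , q , d , c) = L , len , All.map h q , d , λ x r → c x (h' r)

  module Refined (k : ℕ) where
    open Maps k renaming (n to ord)
    open Heights k
    open ASM k

    encode : Tri m → SubsetT ord
    encode t = ideal (height t)

    module _ (t : Tri m) (h : Monotone m base t) where
      private
        is-ideal : IsIdeal ord gybo (encode t)
        is-ideal = ideal-isIdeal gybo (height t) (height-isHeight t h)

      edge-statL : edge₁₂ (encode t) ≡ statL {m} (+ m) t
      edge-statL = trans (trues-lead (suc k) (λ c → mem (encode t) c (k ∸ c) 0) mono) (trans (lead-cong (suc k) row) (sym (statL-lead m (+ m) t)))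
        where
          mono : ∀ c → suc c ℕ.< suc k → mem (encode t) c (k ∸ c) 0 ≡ true → mem (encode t) (suc c) (k ∸ suc c) 0 ≡ true
          mono c (s≤s p) e = mem-cover {gybo} refl (encode t) is-ideal (suc c) (k ∸ suc c) 0 c (k ∸ c) 0 blue refl (refl , ∸-suc' p , refl) (edge₁₂-in (suc c) p) e
          row : ∀ j → j ℕ.< suc k → mem (encode t) (k ∸ j) (k ∸ (k ∸ j)) 0 ≡ does (z t (suc j) (k ∸ j) ℤP.≟ + m)
          row j (s≤s p) = trans (mem-ideal {height t} (height-bounded t h) (k ∸ j) (k ∸ (k ∸ j)) 0 (ℕP.≤-trans (ℕP.≤-reflexive (ℕP.+-identityʳ (k ∸ j))) (ℕP.m∸n≤m k j)))
            (trans (cong₂ _<ᵇ_ j≡ (cong (λ x → N t (suc x) (k ∸ j) ∸ (k ∸ j)) (trans (cong (k ∸_) (ℕP.+-identityʳ (k ∸ j))) j≡))) test)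
            where
              j≡ : k ∸ (k ∸ j) ≡ j
              j≡ = ℕP.m∸[m∸n]≡n p
              sum≡ : suc j ℕ.+ (k ∸ j) ≡ m
              sum≡ = cong suc (ℕP.m+[n∸m]≡n p)
              row-in : suc j ℕ.+ (k ∸ j) ℕ.≤ m
              row-in = ℕP.≤-reflexive sum≡
              test : (j <ᵇ N t (suc j) (k ∸ j) ∸ (k ∸ j)) ≡ does (z t (suc j) (k ∸ j) ℤP.≟ + m)
              test with z t (suc j) (k ∸ j) ℤP.≟ + m
              ... | yes e = <ᵇ-true (ℕP.≤-reflexive (sym (trans (cong (λ x → ∣ x ∣ ∸ (k ∸ j)) e) (trans (cong (_∸ (k ∸ j)) (sym sum≡)) (ℕP.m+n∸n≡m (suc j) (k ∸ j))))))
              ... | no ne = <ᵇ-false (ℕP.≮⇒≥ λ q → ne (trans (z-N t h (suc j) (k ∸ j) row-in) (cong +_ (ℕP.≤-antisym (subst (N t (suc j) (k ∸ j) ℕ.≤_) sum≡ (N-≤ t h (suc j) (k ∸ j) row-in))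
                   (subst (ℕ._≤ N t (suc j) (k ∸ j)) sum≡ (ℕP.≤-trans (ℕP.+-monoˡ-≤ (k ∸ j) q) (ℕP.≤-reflexive (ℕP.m∸n+n≡m (N-≥ t h (suc j) (k ∸ j) row-in)))))))))

      edge-statF : edge₀₃ (encode t) ≡ statF {m} 0ℤ t
      edge-statF = trans (trues-lead (suc k) (λ c → not (mem (encode t) 0 0 c)) mono) (trans (lead-cong (suc k) row) (sym (statF-lead m 0ℤ t)))
        where
          mono : ∀ c → suc c ℕ.< suc k → not (mem (encode t) 0 0 c) ≡ true → not (mem (encode t) 0 0 (suc c)) ≡ true
          mono c (s≤s p) e = anti (mem (encode t) 0 0 (suc c)) (mem (encode t) 0 0 c)
              (mem-cover {gybo} refl (encode t) is-ideal 0 0 c 0 0 (suc c) yellow refl (refl , refl , refl) (ℕP.<⇒≤ p)) e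
            where
              anti : ∀ x y → (x ≡ true → y ≡ true) → not y ≡ true → not x ≡ true
              anti false y _ _ = refl
              anti true true _ ()
              anti true false h' _ = contradiction (h' refl) λ ()
          row : ∀ j → j ℕ.< suc k → not (mem (encode t) 0 0 (k ∸ j)) ≡ does (z t (suc j) 0 ℤP.≟ 0ℤ)
          row j (s≤s p) = trans (cong not (trans (mem-ideal {height t} (height-bounded t h) 0 0 (k ∸ j) (ℕP.m∸n≤m k j)) (cong (λ x → 0 <ᵇ N t (suc x) 0) (ℕP.m∸[m∸n]≡n p)))) test
            where
              test : not (0 <ᵇ N t (suc j) 0) ≡ does (z t (suc j) 0 ℤP.≟ 0ℤ)
              test with z t (suc j) 0 ℤP.≟ 0ℤ
              ... | yes e = cong (λ x → not (0 <ᵇ ∣ x ∣)) e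
              ... | no ne with N t (suc j) 0 in q
              ...   | zero = contradiction (ℤP.∣i∣≡0⇒i≡0 q) ne
              ...   | suc _ = refl

    edge₁₂-cong : ∀ {I J} → SameSubset ord I J → edge₁₂ I ≡ edge₁₂ J
    edge₁₂-cong e = trues-cong (suc k) (λ c _ → mem-cong e c (k ∸ c) 0)

    edge₀₃-cong : ∀ {I J} → SameSubset ord I J → edge₀₃ I ≡ edge₀₃ J
    edge₀₃-cong e = trues-cong (suc k) (λ c _ → cong not (mem-cong e 0 0 c))

    ≡ᵇ-true : ∀ {x i} → (x ≡ᵇ i) ≡ true → x ≡ i
    ≡ᵇ-true {x} {i} e = ℕP.≡ᵇ⇒≡ x i (Equivalence.from T-≡ e)

    true-≡ᵇ : ∀ {x i} → x ≡ i → (x ≡ᵇ i) ≡ true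
    true-≡ᵇ {x} {i} e = Equivalence.to T-≡ (ℕP.≡⇒≡ᵇ x i e)

    refined : (edge : SubsetT ord → ℕ) → (∀ {I J} → SameSubset ord I J → edge I ≡ edge J) → ∀ i →
      Count (SameSubset ord) (λ I → IsIdeal ord gybo I × edge I ≡ i) (length (filterᵇ (λ I → edge I ≡ᵇ i) (proj₁ ideals)))
    refined edge resp i = count-iff {_~_ = SameSubset ord} (λ (q , e) → q , ≡ᵇ-true e) (λ (q , e) → q , true-≡ᵇ e)
      (filter-count {_~_ = SameSubset ord} (λ I → edge I ≡ᵇ i) (λ {I} {J} e → cong (_≡ᵇ i) (resp {I} {J} e)) ideals)

    distribution-ideals : ∀ (stat : Tri m → ℕ) (edge : SubsetT ord → ℕ) → (∀ t → Monotone m base t → edge (encode t) ≡ stat t) → ∀ i →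
      distribution stat (triangles k) i ≡ + length (filterᵇ (λ I → edge I ≡ᵇ i) (proj₁ ideals))
    distribution-ideals stat edge h i = trans (distribution-filter stat encode edge i (triangles k) (All.map (λ {t} → h t) (proj₁ (tris-enum m base base-strict))))
      (cong (λ xs → + length (filterᵇ (λ I → edge I ≡ᵇ i) xs)) (LP.map-∘ (triangles k)))

    NL-palindromic : ∀ i → i ℕ.≤ m → NL k (m ∸ i) ≡ NL k i
    NL-palindromic i p = trans (distribution-ideals (statL {m} (+ m)) edge₁₂ edge-statL (m ∸ i))
      (trans (cong +_ (count-unique equiv (refined edge₁₂ (λ {I} {J} → edge₁₂-cong {I} {J}) (m ∸ i)) (flip-count i p (refined edge₁₂ (λ {I} {J} → edge₁₂-cong {I} {J}) i))))
        (sym (distribution-ideals (statL {m} (+ m)) edge₁₂ edge-statL i)))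

    NF≡NL : ∀ i → i ℕ.≤ m → NF k i ≡ NL k i
    NF≡NL i p = trans (distribution-ideals (statF {m} 0ℤ) edge₀₃ edge-statF i)
      (trans (cong +_ (count-unique equiv (turn-count i (refined edge₀₃ (λ {I} {J} → edge₀₃-cong {I} {J}) i)) (refined edge₁₂ (λ {I} {J} → edge₁₂-cong {I} {J}) i)))
        (sym (distribution-ideals (statL {m} (+ m)) edge₁₂ edge-statL i)))

  pos-*-* : ∀ x y z → + (x ℕ.* y ℕ.* z) ≡ + x * + y * + z
  pos-*-* x y z = trans (ℤP.pos-* (x ℕ.* y) z) (cong (_* + z) (ℤP.pos-* x y))

  asm : ℕ → ℕ
  asm m = length (tris m (iota 0ℤ (suc m)))

  asm-ratio : ∀ k → let m = suc k in asm m ℕ.* (2 ℕ.* m ℕ.+ 1) ! ℕ.* (2 ℕ.* m) ! ≡ asm k ℕ.* (3 ℕ.* m ℕ.+ 1) ! ℕ.* m !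
  asm-ratio k = ℤP.+-injective (trans (pos-*-* (asm m) ((2 ℕ.* m ℕ.+ 1) !) ((2 ℕ.* m) !)) (trans (cong (λ x → x * + ((2 ℕ.* m ℕ.+ 1) !) * + ((2 ℕ.* m) !)) (sym (sumL-length (triangles k))))
    (trans (a-ratio k (Refined.NL-palindromic k) (Refined.NF≡NL k))
    (trans (cong (λ x → x * + ((3 ℕ.* m ℕ.+ 1) !) * + (m !)) (sumL-length (tris k (iota 0ℤ m)))) (sym (pos-*-* (asm k) ((3 ℕ.* m ℕ.+ 1) !) (m !)))))))
    where m = suc k

module ArrayIdeals where
  open import Defs renaming (r to red; g to green; y to yellow; b to blue; o to orange; s to silver)
  open Wedge using (wd; wd-cong; wd-+; wd-0; AltF; AltF-tail)
  open RowSums using (sumL; sumL-map; sumL-concatMap; sumL-cong; sumL-++)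
  open MonotoneTriangles using (Rows; sumL-+; sumL-cong-All)
  open Contraction
  open RowFunctions using (P; P-suc-0; P-suc-1; P-suc-suc)
  open Orthogonality using (Ps; wl-at-0; wd-P0; Φ-P0)
  open ArrayRatio using (module PathCount)
  open Counting
  open Symmetries
  open HeightFunctions
  open TriangularArrays
  open TriangleIdeals using (∸-suc'; module ASM)
  open RefinedCounts using (sumL-length)
  open import Data.Bool.Base using (Bool; true; false; _∧_)
  open import Data.Fin.Base using (zero; suc)
  open import Data.List.Base as L using (List; []; _∷_; _++_; filterᵇ; length; concatMap)
  open import Data.List.Relation.Unary.All as All using (All; []; _∷_)
  import Data.List.Relation.Unary.All.Properties as AllP
  open import Data.List.Relation.Unary.Any as Any using (Any; here; there)
  import Data.List.Relation.Unary.Any.Properties as AnyP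
  open import Data.List.Relation.Unary.AllPairs as AllPairs using (AllPairs; []; _∷_)
  import Data.List.Relation.Unary.AllPairs.Properties as APP
  open import Data.Nat.Base using (_∸_; _<ᵇ_)
  open import Data.Integer.Base using (ℤ; +_; 0ℤ; 1ℤ; -1ℤ; _+_; _*_; _-_; -_)
  open import Data.Vec.Base using (Vec; []; _∷_)
  import Data.Vec.Relation.Unary.All as VAll
  open VAll using ([]; _∷_)

  private variable
    d : ℕ
    A A' : Set

  enum-++ : ∀ {Q R S : A → Set} → (∀ {x} → Q x → S x) → (∀ {x} → R x → S x) → (∀ x → S x → Q x ⊎ R x) → (∀ {x} → Q x → ¬ R x) →
    ∀ {xs ys} → Enum Q xs → Enum R ys → Enum S (xs ++ ys)
  enum-++ qs rs split disj {xs} {ys} (q , dq , cq) (r , dr , cr) = AllP.++⁺ (All.map qs q) (All.map rs r) ,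
    APP.++⁺ dq dr (All.map (λ qx → All.map (λ { ry refl → disj qx ry }) r) q) ,
    λ x s → cover x (split x s)
    where
      cover : ∀ x → _ ⊎ _ → Any (_≡ x) (xs ++ ys)
      cover x (inj₁ h) = AnyP.++⁺ˡ (cq x h)
      cover x (inj₂ h) = AnyP.++⁺ʳ xs (cr x h)

  enum-map : ∀ {Q : A → Set} {S : A' → Set} (f : A → A') → (∀ {x y} → f x ≡ f y → x ≡ y) → (∀ {x} → Q x → S (f x)) → (∀ z → S z → Σ A λ x → (f x ≡ z) × Q x) →
    ∀ {xs} → Enum Q xs → Enum S (L.map f xs)
  enum-map f inj h split (q , dq , c) = AllP.map⁺ (All.map h q) , APP.map⁺ (AllPairs.map (λ n e → n (inj e)) dq) ,
    λ z s → let (x , e , qx) = split z s in AnyP.map⁺ (Any.map (λ { refl → e }) (c x qx))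

  Inc : ℕ → Vec ℕ d → Set
  Inc lo [] = ⊤
  Inc lo (x ∷ v) = (lo ℕ.≤ x) × Inc (suc x) v

  inc : ℕ → Vec ℕ d → Bool
  inc lo [] = true
  inc lo (x ∷ v) = (lo ℕ.≤ᵇ x) ∧ inc (suc x) v

  inc-Inc : ∀ lo (v : Vec ℕ d) → inc lo v ≡ true → Inc lo v
  inc-Inc lo [] e = tt
  inc-Inc zero (x ∷ v) e = z≤n , inc-Inc (suc x) v e
  inc-Inc (suc lo) (x ∷ v) e with lo <ᵇ x in q
  ... | true = true-< {lo} q , inc-Inc (suc x) v e

  Inc-inc : ∀ lo (v : Vec ℕ d) → Inc lo v → inc lo v ≡ true
  Inc-inc lo [] _ = refl
  Inc-inc zero (x ∷ v) (_ , h) = Inc-inc (suc x) v h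
  Inc-inc (suc lo) (x ∷ v) (p , h) rewrite <ᵇ-true p = Inc-inc (suc x) v h

  Inc-lower : ∀ {lo lo'} → lo' ℕ.≤ lo → (v : Vec ℕ d) → Inc lo v → Inc lo' v
  Inc-lower p [] h = tt
  Inc-lower p (x ∷ v) (q , h) = ℕP.≤-trans p q , h

  Inc-entry : ∀ {lo} (v : Vec ℕ d) → Inc lo v → ∀ i → suc i ℕ.< d → entry 0 v i ℕ.< entry 0 v (suc i)
  Inc-entry (x ∷ []) _ i (s≤s ())
  Inc-entry (x ∷ y ∷ v) (_ , p , h) zero _ = p
  Inc-entry (x ∷ y ∷ v) (_ , h) (suc i) (s≤s q) = Inc-entry (y ∷ v) h i q

  Inc-table : ∀ n lo (f : ℕ → ℕ) → (0 ℕ.< n → lo ℕ.≤ f 0) → (∀ i → suc i ℕ.< n → f i ℕ.< f (suc i)) → Inc lo (table n f)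
  Inc-table zero lo f h h' = tt
  Inc-table (suc n) lo f h h' = h (s≤s z≤n) , Inc-table n (suc (f 0)) (f ∘ suc) (λ p → h' 0 (s≤s p)) (λ i p → h' (suc i) (s≤s p))

  All-table : ∀ {R : ℕ → Set} n (f : ℕ → ℕ) → (∀ i → i ℕ.< n → R (f i)) → VAll.All R (table n f)
  All-table zero f h = []
  All-table (suc n) f h = h 0 (s≤s z≤n) ∷ All-table n (f ∘ suc) (λ i p → h (suc i) (s≤s p))

  incs : ∀ n → ℕ → ℕ → List (Vec ℕ n)
  incs zero lo c = [] ∷ []
  incs (suc n) lo zero = []
  incs (suc n) lo (suc c) = L.map (lo ∷_) (incs n (suc lo) c) ++ incs (suc n) (suc lo) c

  Φ-incs : ∀ n lo c F → Φ n lo c F ≡ sumL F (incs n lo c)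
  Φ-incs zero lo c F = sym (ℤP.+-identityʳ (F []))
  Φ-incs (suc n) lo zero F = refl
  Φ-incs (suc n) lo (suc c) F = trans (cong₂ _+_ (trans (Φ-incs n (suc lo) c (λ v → F (lo ∷ v))) (sym (sumL-map F (lo ∷_) (incs n (suc lo) c)))) (Φ-incs (suc n) (suc lo) c F))
    (sym (sumL-++ F (L.map (lo ∷_) (incs n (suc lo) c)) (incs (suc n) (suc lo) c)))

  incs-enum : ∀ n lo c → Enum (λ v → Inc lo v × VAll.All (ℕ._< lo ℕ.+ c) v) (incs n lo c)
  incs-enum zero lo c = (tt , []) ∷ [] , [] ∷ [] , λ { [] _ → here refl }
  incs-enum (suc n) lo zero = [] , [] , λ { (x ∷ v) ((p , _) , (q ∷ _)) → contradiction (ℕP.≤-trans q (subst (ℕ._≤ x) (sym (ℕP.+-identityʳ lo)) p)) (ℕP.<-irrefl refl) }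
  incs-enum (suc n) lo (suc c) rewrite ℕP.+-suc lo c = enum-++
    {Q = λ w → Σ (Vec ℕ n) λ v → (lo ∷ v ≡ w) × Inc (suc lo) v × VAll.All (ℕ._< suc lo ℕ.+ c) v} {R = λ w → Inc (suc lo) w × VAll.All (ℕ._< suc lo ℕ.+ c) w}
    (λ { (v , refl , h , h') → (ℕP.≤-refl , h) , s≤s (ℕP.m≤m+n lo c) ∷ h' }) (λ { {x ∷ v} ((p , h) , h') → (ℕP.<⇒≤ p , h) , h' })
    split (λ { (v , refl , _) ((p , _) , _) → ℕP.<-irrefl refl p })
    (enum-map (lo ∷_) (λ { refl → refl }) (λ {v} h → v , refl , h) (λ { _ (v , e , h) → v , e , h }) (incs-enum n (suc lo) c)) (incs-enum (suc n) (suc lo) c)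
    where
      split : ∀ w → Inc lo w × VAll.All (ℕ._< suc lo ℕ.+ c) w → _ ⊎ _
      split (x ∷ v) ((p , h) , (q ∷ h')) with ℕP.m≤n⇒m<n∨m≡n p
      ... | inj₁ lo<x = inj₂ ((lo<x , h) , q ∷ h')
      ... | inj₂ refl = inj₁ (v , refl , h , h')

  Step : ℕ → ℕ → Set
  Step x y = (x ≡ suc y) ⊎ (x ≡ suc (suc y))

  steps : ℕ → List ℕ
  steps zero = []
  steps (suc zero) = 0 ∷ []
  steps (suc (suc a)) = suc a ∷ a ∷ []

  steps-enum : ∀ x → Enum (Step x) (steps x)
  steps-enum zero = [] , [] , λ { y (inj₁ ()) ; y (inj₂ ()) }
  steps-enum (suc zero) = inj₁ refl ∷ [] , [] ∷ [] , λ { y (inj₁ refl) → here refl ; y (inj₂ ()) }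
  steps-enum (suc (suc a)) = inj₁ refl ∷ inj₂ refl ∷ [] , ((λ e → ℕP.1+n≢n e) ∷ []) ∷ [] ∷ [] , λ { y (inj₁ refl) → here refl ; y (inj₂ refl) → there (here refl) }

  Steps : Vec ℕ d → Vec ℕ d → Set
  Steps [] [] = ⊤
  Steps (x ∷ e) (y ∷ v) = Step x y × Steps e v

  stepsV : Vec ℕ d → List (Vec ℕ d)
  stepsV [] = [] ∷ []
  stepsV (x ∷ e) = concatMap (λ y → L.map (y ∷_) (stepsV e)) (steps x)

  stepsV-enum : ∀ (e : Vec ℕ d) → Enum (Steps e) (stepsV e)
  stepsV-enum [] = tt ∷ [] , [] ∷ [] , λ { [] _ → here refl }
  stepsV-enum (x ∷ e) = enum-concat {Q = Step x} {R = λ _ → Steps e} {P = Steps (x ∷ e)} _∷_ (λ _ → stepsV e) (λ { refl → refl , refl }) _,_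
    (λ { {y ∷ v} (p , q) → y , v , refl , p , q }) (λ _ _ → stepsV-enum e) (steps-enum x)

  pick : ℕ → List A → List A
  pick zero xs = []
  pick (suc zero) xs = xs
  pick (suc (suc zero)) xs = xs
  pick (suc (suc (suc _))) xs = []

  pick-enum : ∀ x {Q : A → Set} {xs} → Enum Q xs → Enum (λ z → Step x 0 × Q z) (pick x xs)
  pick-enum zero _ = [] , [] , λ { z (inj₁ () , _) ; z (inj₂ () , _) }
  pick-enum (suc zero) (q , dq , c) = All.map (inj₁ refl ,_) q , dq , λ z (_ , h) → c z h
  pick-enum (suc (suc zero)) (q , dq , c) = All.map (inj₂ refl ,_) q , dq , λ z (_ , h) → c z h
  pick-enum (suc (suc (suc x))) _ = [] , [] , λ { z (inj₁ () , _) ; z (inj₂ () , _) }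

  Chain : ∀ m → Vec ℕ (suc m) → Rows ℕ m → Set
  Chain zero (x ∷ e) t = Step x 0 × ⊤
  Chain (suc m) (x ∷ e) (v , t) = Step x 0 × (Steps e v × Inc 1 v) × Chain m v t

  preds : Vec ℕ d → List (Vec ℕ d)
  preds e = filterᵇ (inc 1) (stepsV e)

  preds-enum : ∀ (e : Vec ℕ d) → Enum (λ v → Steps e v × Inc 1 v) (preds e)
  preds-enum e = let (q , dq , c) = enum-filter (inc 1) (stepsV-enum e) in
    All.map (λ {v} (h , i) → h , inc-Inc 1 v i) q , dq , λ v (h , i) → c v (h , Inc-inc 1 v i)

  chains : ∀ m → Vec ℕ (suc m) → List (Rows ℕ m)
  chains zero (x ∷ e) = pick x (tt ∷ [])
  chains (suc m) (x ∷ e) = pick x (concatMap (λ v → L.map (v ,_) (chains m v)) (preds e))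

  chains-enum : ∀ m e → Enum (Chain m e) (chains m e)
  chains-enum zero (x ∷ e) = pick-enum x (tt ∷ [] , [] ∷ [] , λ { tt _ → here refl })
  chains-enum (suc m) (x ∷ e) = pick-enum x (enum-concat {Q = λ v → Steps e v × Inc 1 v} {R = Chain m} {P = λ { (v , t) → (Steps e v × Inc 1 v) × Chain m v t }}
    _,_ (chains m) (λ { refl → refl , refl }) _,_ (λ { {v , t} (p , q) → v , t , refl , p , q }) (λ v _ → chains-enum m v) (preds-enum e))

  sumL-*ˡ : ∀ c (f : A → ℤ) xs → sumL (λ x → c * f x) xs ≡ c * sumL f xs
  sumL-*ˡ c f [] = sym (ℤP.*-zeroʳ c)
  sumL-*ˡ c f (x ∷ xs) = trans (cong (_+_ (c * f x)) (sumL-*ˡ c f xs)) (sym (ℤP.*-distribˡ-+ c (f x) (sumL f xs)))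

  sumL-minus : ∀ (f g : A → ℤ) xs → sumL (λ x → f x - g x) xs ≡ sumL f xs - sumL g xs
  sumL-minus f g xs = trans (sumL-+ f (λ x → - g x) xs) (cong (_+_ (sumL f xs)) (trans (sumL-cong (λ x → sym (ℤP.-1*i≡-i (g x))) xs) (trans (sumL-*ˡ -1ℤ g xs) (ℤP.-1*i≡-i (sumL g xs)))))

  -- the transpose of multiplication by u (1 + u) in every variable
  mulV : FN d → FN d
  mulV G e = sumL G (stepsV e)

  mulV-∷ : ∀ (G : FN (suc d)) x e → mulV G (x ∷ e) ≡ sumL (λ y → mulV (λ v → G (y ∷ v)) e) (steps x)
  mulV-∷ G x e = trans (sumL-concatMap G (λ y → L.map (y ∷_) (stepsV e)) (steps x)) (sumL-cong (λ y → sumL-map G (y ∷_) (stepsV e)) (steps x))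

  wd-sumL : ∀ {X : Set} (f : ℕ → ℤ) (G : X → FN d) xs e → wd f (λ u → sumL (λ y → G y u) xs) e ≡ sumL (λ y → wd f (G y) e) xs
  wd-sumL f G [] e = wd-0 f (λ _ → refl) e
  wd-sumL f G (x ∷ xs) e = trans (wd-+ f (G x) (λ u → sumL (λ y → G y u) xs) e) (cong (_+_ (wd f (G x) e)) (wd-sumL f G xs e))

  wd-mulV : ∀ d (f : ℕ → ℤ) (G : FN d) e → wd (λ x → sumL f (steps x)) (mulV G) e ≡ mulV (wd f G) e
  wd-mulV zero f G (x ∷ []) = sym (trans (mulV-∷ (wd f G) x []) (trans (sumL-cong (λ y → lem (f y) (G [])) (steps x)) (trans (sumL-*ˡ (mulV G []) f (steps x)) (ℤP.*-comm (mulV G []) (sumL f (steps x))))))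
    where lem : ∀ a b → a * b + 0ℤ ≡ (b + 0ℤ) * a
          lem = solve-∀
  wd-mulV (suc d) f G (x ∷ e) = trans (cong (_-_ (sumL f (steps x) * mulV G e)) left)
    (sym (trans (mulV-∷ (wd f G) x e) (trans (sumL-cong (λ y → trans (sumL-minus (λ v → f y * G v) (wd f (λ u → G (y ∷ u))) (stepsV e))
        (cong (_- mulV (wd f (λ u → G (y ∷ u))) e) (trans (sumL-*ˡ (f y) G (stepsV e)) (ℤP.*-comm (f y) (mulV G e))))) (steps x))
      (trans (sumL-minus (λ y → mulV G e * f y) (λ y → mulV (wd f (λ u → G (y ∷ u))) e) (steps x))
        (cong (_- sumL (λ y → mulV (wd f (λ u → G (y ∷ u))) e) (steps x)) (trans (sumL-*ˡ (mulV G e) f (steps x)) (ℤP.*-comm (mulV G e) (sumL f (steps x)))))))))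
    where
      left : wd (λ x → sumL f (steps x)) (λ u → mulV G (x ∷ u)) e ≡ sumL (λ y → mulV (wd f (λ u → G (y ∷ u))) e) (steps x)
      left = trans (wd-cong (λ _ → refl) (mulV-∷ G x) e) (trans (wd-sumL (λ x → sumL f (steps x)) (λ y → mulV (λ v → G (y ∷ v))) (steps x) e)
        (sumL-cong (λ y → wd-mulV d f (λ v → G (y ∷ v)) e) (steps x)))

  P-steps : ∀ j x → P (suc j) x ≡ sumL (P j) (steps x)
  P-steps j zero = P-suc-0 j
  P-steps j (suc zero) = trans (P-suc-1 j) (sym (ℤP.+-identityʳ (P j 0)))
  P-steps j (suc (suc a)) = trans (P-suc-suc j a) (cong (_+_ (P j (suc a))) (sym (ℤP.+-identityʳ (P j a))))

  wl-mulV : ∀ lo d e → wl (Ps (suc lo) d) e ≡ mulV (wl (Ps lo d)) e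
  wl-mulV lo zero [] = refl
  wl-mulV lo (suc d) e = trans (wd-cong (P-steps lo) (wl-mulV (suc lo) d) e) (wd-mulV d (P lo) (wl (Ps (suc lo) d)) e)

  data Ascending : ℕ → ∀ {d} → Vec ℕ d → Set where
    [] : ∀ {lo} → Ascending lo []
    _∷_ : ∀ {lo d x} {v : Vec ℕ d} → lo ℕ.≤ x → Ascending x v → Ascending lo (x ∷ v)

  ascending-tie : ∀ d (G : FN (suc d)) → AltF (suc d) G → ∀ x v → Ascending x v → inc (suc x) v ≡ false → G (x ∷ v) ≡ 0ℤ
  ascending-tie (suc d) G alt x (y ∷ v) (p ∷ h) e with ℕP.m≤n⇒m<n∨m≡n p
  ... | inj₂ refl = alt-tie d G alt x v
  ... | inj₁ q = ascending-tie d (λ u → G (x ∷ u)) (AltF-tail (suc d) G alt x) y v h (trans (cong (_∧ inc (suc y) v) (sym (<ᵇ-true q))) e)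

  Steps-ascending : ∀ x (e v : Vec ℕ d) → Inc (suc (suc x)) e → Steps e v → Ascending x v
  Steps-ascending x [] [] i s = []
  Steps-ascending x (z ∷ e) (y ∷ v) (p , i) (inj₁ refl , s) = ℕP.≤-trans (ℕP.n≤1+n x) (ℕP.≤-pred p) ∷ Steps-ascending y e v i s
  Steps-ascending x (z ∷ e) (y ∷ v) (p , i) (inj₂ refl , s) = ℕP.≤-pred (ℕP.≤-pred p) ∷ Steps-ascending y e v (Inc-lower (ℕP.n≤1+n _) e i) s

  Steps-≥ : ∀ (e v : Vec ℕ d) {lo} → Inc (suc (suc lo)) e → Steps e v → VAll.All (lo ℕ.≤_) v
  Steps-≥ e v {lo} i s = go v (Steps-ascending lo e v i s)
    where
      go : ∀ {d lo} (v : Vec ℕ d) → Ascending lo v → VAll.All (lo ℕ.≤_) v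
      go [] _ = []
      go (x ∷ v) (p ∷ h) = p ∷ VAll.map (ℕP.≤-trans p) (go v h)

  number : ∀ m → Vec ℕ (suc m) → ℤ
  number m e = sumL (λ _ → 1ℤ) (chains m e)

  sumL-filter : ∀ (R : A → Bool) (f : A → ℤ) xs → All (λ x → R x ≡ false → f x ≡ 0ℤ) xs → sumL f (filterᵇ R xs) ≡ sumL f xs
  sumL-filter R f [] [] = refl
  sumL-filter R f (x ∷ xs) (h ∷ hs) with R x
  ... | true = cong (_+_ (f x)) (sumL-filter R f xs hs)
  ... | false = trans (sumL-filter R f xs hs) (trans (sym (ℤP.+-identityˡ (sumL f xs))) (cong (_+ sumL f xs) (sym (h refl))))

  sumL-pick : ∀ x (xs : List A) (f : A → ℤ) → 1 ℕ.≤ x → sumL f (pick x xs) ≡ sumL (P 0) (steps x) * sumL f xs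
  sumL-pick (suc zero) xs f _ = sym (ℤP.*-identityˡ (sumL f xs))
  sumL-pick (suc (suc zero)) xs f _ = sym (ℤP.*-identityˡ (sumL f xs))
  sumL-pick (suc (suc (suc x))) xs f _ = refl

  wl-∷ : ∀ m x (e : Vec ℕ m) → Inc (suc x) e → wl (Ps 1 (suc m)) (x ∷ e) ≡ sumL (P 0) (steps x) * mulV (wl (Ps 1 m)) e
  wl-∷ m x e i = trans (wl-mulV 0 (suc m) (x ∷ e)) (trans (mulV-∷ (wl (Ps 0 (suc m))) x e)
    (trans (sumL-cong-All (steps x) (proj₁ (steps-enum x)) (λ y s → trans (first m y e (above s)) (ℤP.*-comm (P 0 y) (mulV (wl (Ps 1 m)) e))))
      (trans (sumL-*ˡ (mulV (wl (Ps 1 m)) e) (P 0) (steps x)) (ℤP.*-comm (mulV (wl (Ps 1 m)) e) (sumL (P 0) (steps x))))))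
    where
      above : ∀ {y} → Step x y → Inc (suc (suc y)) e
      above (inj₁ refl) = i
      above (inj₂ refl) = Inc-lower (ℕP.n≤1+n _) e i
      rest : ∀ m y v → (∀ z → y ≡ suc z → VAll.All (1 ℕ.≤_) v) → wd (P 0) (λ u → wl (Ps 1 (suc m)) (y ∷ u)) v ≡ 0ℤ
      rest m zero v h = wd-0 (P 0) (wl-at-0 0 m) v
      rest m (suc y) v h = wd-P0 (λ u → wl (Ps 1 (suc m)) (suc y ∷ u)) v (h y refl)
      first : ∀ m y (e : Vec ℕ m) → Inc (suc (suc y)) e → mulV (λ v → wl (Ps 0 (suc m)) (y ∷ v)) e ≡ P 0 y * mulV (wl (Ps 1 m)) e
      first zero y [] i = trans (ℤP.+-identityʳ (P 0 y * 1ℤ)) (cong (P 0 y *_) (sym (ℤP.+-identityʳ 1ℤ)))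
      first (suc m) y e i = trans (sumL-cong-All (stepsV e) (proj₁ (stepsV-enum e)) (λ v s →
          trans (cong (_-_ (P 0 y * wl (Ps 1 (suc m)) v)) (rest m y v (λ { z refl → VAll.map (ℕP.≤-trans (s≤s z≤n)) (Steps-≥ e v i s) }))) (ℤP.+-identityʳ (P 0 y * wl (Ps 1 (suc m)) v))))
          (sumL-*ˡ (P 0 y) (wl (Ps 1 (suc m))) (stepsV e))

  number-wl : ∀ m e → Inc 0 e → number m e ≡ wl (Ps 1 (suc m)) e
  number-wl zero (zero ∷ e) _ = sym (wl-at-0 0 0 e)
  number-wl zero (suc x ∷ []) _ = trans (sumL-pick (suc x) (tt ∷ []) (λ _ → 1ℤ) (s≤s z≤n)) (sym (wl-∷ 0 (suc x) [] tt))
  number-wl (suc m) (zero ∷ e) _ = sym (wl-at-0 0 (suc m) e)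
  number-wl (suc m) (suc x ∷ e) (_ , i) = trans (sumL-pick (suc x) (concatMap (λ v → L.map (v ,_) (chains m v)) (preds e)) (λ _ → 1ℤ) (s≤s z≤n))
    (trans (cong (sumL (P 0) (steps (suc x)) *_) (trans (sumL-concatMap (λ _ → 1ℤ) (λ v → L.map (v ,_) (chains m v)) (preds e))
       (trans (sumL-cong (λ v → sumL-map (λ _ → 1ℤ) (v ,_) (chains m v)) (preds e))
       (trans (sumL-cong-All (preds e) (proj₁ (preds-enum e)) (λ v (_ , h) → number-wl m v (Inc-lower z≤n v h)))
         (sumL-filter (inc 1) (wl (Ps 1 (suc m))) (stepsV e) (All.map (λ {v} s → vanish v s) (proj₁ (stepsV-enum e))))))))
      (sym (wl-∷ (suc m) (suc x) e i)))
    where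
      vanish : ∀ v → Steps e v → inc 1 v ≡ false → wl (Ps 1 (suc m)) v ≡ 0ℤ
      vanish (zero ∷ v) s _ = wl-at-0 0 m v
      vanish (suc y ∷ v) s q with Steps-ascending 0 e (suc y ∷ v) (Inc-lower (s≤s (s≤s z≤n)) e i) s
      ... | _ ∷ h = ascending-tie m (wl (Ps 1 (suc m))) (wl-alt (suc m) (Ps 1 (suc m))) (suc y) v h q

  module TSSCPP (k : ℕ) (B' : ℕ) where
    open Maps k renaming (n to ord)
    open Heights k

    B : ℕ
    B = suc B'

    arrays : List (Rows ℕ (suc k))
    arrays = concatMap (λ e → L.map (e ,_) (chains k e)) (incs (suc k) 0 B)

    Array : Rows ℕ (suc k) → Set
    Array (e , t) = (Inc 0 e × VAll.All (ℕ._< B) e) × Chain k e t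

    arrays-enum : Enum Array arrays
    arrays-enum = enum-concat {Q = λ e → Inc 0 e × VAll.All (ℕ._< B) e} {R = Chain k} {P = Array} _,_ (chains k) (λ { refl → refl , refl }) _,_
      (λ { {e , t} (p , q) → e , t , refl , p , q }) (λ e _ → chains-enum k e) (incs-enum (suc k) 0 B)

    arrays-length : + length arrays ≡ PathCount.T B' (suc (suc k))
    arrays-length = trans (sym (sumL-length arrays)) (trans (sumL-concatMap (λ _ → 1ℤ) (λ e → L.map (e ,_) (chains k e)) (incs (suc k) 0 B))
      (trans (sumL-cong (λ e → sumL-map (λ _ → 1ℤ) (e ,_) (chains k e)) (incs (suc k) 0 B))
      (trans (sumL-cong-All (incs (suc k) 0 B) (proj₁ (incs-enum (suc k) 0 B)) (λ e (i , _) → number-wl k e i))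
      (trans (sym (Φ-incs (suc k) 0 B (wl (Ps 1 (suc k))))) (sym (Φ-P0 (suc k) B'))))))

    chain-head : ∀ m e t → Chain m e t → ∀ j → j ℕ.≤ m → Step (at₂ 0 (suc m) (e , t) j 0) 0
    chain-head zero (x ∷ e) t (s , _) zero _ = s
    chain-head (suc m) (x ∷ e) t (s , _) zero _ = s
    chain-head (suc m) (x ∷ e) (v , t) (_ , _ , h) (suc j) (s≤s p) = chain-head m v t h j p

    Steps-entry : ∀ {d} (e v : Vec ℕ d) → Steps e v → ∀ i → i ℕ.< d → Step (entry 0 e i) (entry 0 v i)
    Steps-entry (x ∷ e) (y ∷ v) (p , s) zero _ = p
    Steps-entry (x ∷ e) (y ∷ v) (p , s) (suc i) (s≤s q) = Steps-entry e v s i q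

    chain-at : ∀ m e t → Inc 0 e → Chain m e t → let z = at₂ 0 (suc m) (e , t) in ∀ j i → j ℕ.+ i ℕ.< m → Step (z j (suc i)) (z (suc j) i) × (z j i ℕ.< z j (suc i))
    chain-at (suc m) (x ∷ e) (v , t) i₀ (_ , (s , _) , _) zero i p = Steps-entry e v s i p , Inc-entry (x ∷ e) i₀ i (s≤s p)
    chain-at (suc m) (x ∷ e) (v , t) _ (_ , (_ , i₁) , h) (suc j) i (s≤s p) = chain-at m v t (Inc-lower z≤n v i₁) h j i p

    Steps-table : ∀ n (f g : ℕ → ℕ) → (∀ i → i ℕ.< n → Step (f i) (g i)) → Steps (table n f) (table n g)
    Steps-table zero f g h = tt
    Steps-table (suc n) f g h = h 0 (s≤s z≤n) , Steps-table n (f ∘ suc) (g ∘ suc) (λ i p → h (suc i) (s≤s p))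

    chain-intro : ∀ m (f : ℕ → ℕ → ℕ) → (∀ j → j ℕ.≤ m → Step (f j 0) 0) → (∀ j i → j ℕ.+ i ℕ.< m → Step (f j (suc i)) (f (suc j) i)) →
      (∀ j i → j ℕ.+ i ℕ.< m → f j i ℕ.< f j (suc i)) → Chain m (table (suc m) (f 0)) (table₂ m (f ∘ suc))
    chain-intro zero f h h' h'' = h 0 z≤n , tt
    chain-intro (suc m) f h h' h'' = h 0 z≤n ,
      (Steps-table (suc m) (f 0 ∘ suc) (f 1) (λ i p → h' 0 i p) , Inc-table (suc m) 1 (f 1) (λ _ → pos (h 1 (s≤s z≤n))) (λ i p → h'' 1 i p)) ,
      chain-intro m (f ∘ suc) (λ j p → h (suc j) (s≤s p)) (λ j i p → h' (suc j) i (s≤s p)) (λ j i p → h'' (suc j) i (s≤s p))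
      where
        pos : ∀ {x} → Step x 0 → 1 ℕ.≤ x
        pos (inj₁ refl) = s≤s z≤n
        pos (inj₂ refl) = s≤s z≤n

    Step-≥ : ∀ {x y} → Step x y → suc y ℕ.≤ x
    Step-≥ (inj₁ refl) = ℕP.≤-refl
    Step-≥ (inj₂ refl) = ℕP.n≤1+n _

    Step-≤ : ∀ {x y} → Step x y → x ℕ.≤ suc (suc y)
    Step-≤ (inj₁ refl) = ℕP.n≤1+n _
    Step-≤ (inj₂ refl) = ℕP.≤-refl

    z : Rows ℕ (suc k) → ℕ → ℕ → ℕ
    z t = at₂ 0 (suc k) t

    -- entry i of row a, a + c + i = k, exceeds the height over (a, c) by i + 1
    height : Rows ℕ (suc k) → Height
    height t a c = z t a (k ∸ (a ℕ.+ c)) ∸ suc (k ∸ (a ℕ.+ c))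

    open ASM k using (third)

    in-row : ∀ {a c} → a ℕ.+ c ℕ.≤ k → a ℕ.+ (k ∸ (a ℕ.+ c)) ℕ.≤ k
    in-row {a} {c} p = subst (ℕ._≤ k) (sym (third {c} {a} (subst (ℕ._≤ k) (ℕP.+-comm a c) p) ∙ cong (λ x → a ℕ.+ (k ∸ x)) (ℕP.+-comm a c))) (ℕP.m∸n≤m k c)
      where
        _∙_ : ∀ {x y w : ℕ} → x ≡ y → w ≡ x → w ≡ y
        e ∙ e' = trans e' e

    module _ (t : Rows ℕ (suc k)) (h : Array t) where
      head : ∀ j → j ℕ.≤ k → Step (z t j 0) 0
      head = chain-head k (proj₁ t) (proj₂ t) (proj₂ h)

      at-rel : ∀ j i → j ℕ.+ i ℕ.< k → Step (z t j (suc i)) (z t (suc j) i) × (z t j i ℕ.< z t j (suc i))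
      at-rel = chain-at k (proj₁ t) (proj₂ t) (proj₁ (proj₁ h)) (proj₂ h)

      z-≥ : ∀ j i → j ℕ.+ i ℕ.≤ k → suc i ℕ.≤ z t j i
      z-≥ j zero p = Step-≥ (head j (subst (ℕ._≤ k) (ℕP.+-identityʳ j) p))
      z-≥ j (suc i) p = let p' = subst (ℕ._≤ k) (ℕP.+-suc j i) p in ℕP.≤-trans (s≤s (z-≥ j i (ℕP.<⇒≤ p'))) (proj₂ (at-rel j i p'))

      z-≤ : ∀ i j → j ℕ.+ i ℕ.≤ k → z t j i ℕ.≤ suc i ℕ.+ suc i
      z-≤ zero j p = Step-≤ (head j (subst (ℕ._≤ k) (ℕP.+-identityʳ j) p))
      z-≤ (suc i) j p = let p' = subst (ℕ._≤ k) (ℕP.+-suc j i) p in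
        ℕP.≤-trans (Step-≤ (proj₁ (at-rel j i p'))) (ℕP.≤-trans (s≤s (s≤s (z-≤ i (suc j) p'))) (ℕP.≤-reflexive (cong (λ x → suc (suc x)) (sym (ℕP.+-suc i (suc i))))))

      height-bounded : Bounded (height t)
      height-bounded a c p = ℕP.≤-trans (ℕP.∸-monoˡ-≤ (suc i) (z-≤ i a (in-row {a} {c} p))) (ℕP.≤-reflexive (trans (ℕP.m+n∸n≡m (suc i) (suc i)) (sym (ℕP.+-∸-assoc 1 p))))
        where i = k ∸ (a ℕ.+ c)

      height-isHeight : IsHeight rgyb (height t)
      height-isHeight = height-bounded , closed'
        where
          in-row' : ∀ {a c} → a ℕ.+ c ℕ.< k → a ℕ.+ (k ∸ suc (a ℕ.+ c)) ℕ.< k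
          in-row' {a} {c} p = subst (ℕ._≤ k) (trans (cong (a ℕ.+_) (∸-suc' p)) (ℕP.+-suc a _)) (in-row {a} {c} (ℕP.<⇒≤ p))
          closed' : ∀ x → rgyb x ≡ true → Closed x (height t)
          closed' green _ = tt
          closed' red _ a c p rewrite ∸-suc' p = ℕP.∸-monoˡ-≤ (suc (suc (k ∸ suc (a ℕ.+ c)))) (Step-≥ (proj₁ (at-rel a (k ∸ suc (a ℕ.+ c)) (in-row' {a} {c} p))))
          closed' blue _ a c p rewrite ∸-suc' p = ℕP.≤-trans (ℕP.∸-monoˡ-≤ (suc (suc i)) (Step-≤ (proj₁ (at-rel a i (in-row' {a} {c} p)))))
              (ℕP.≤-reflexive (∸-suc' (z-≥ (suc a) i (in-row' {a} {c} p))))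
            where i = k ∸ suc (a ℕ.+ c)
          closed' yellow _ a c p rewrite ∸-suc' p | ℕP.+-suc a c = ℕP.∸-monoˡ-≤ (suc (suc (k ∸ suc (a ℕ.+ c)))) (proj₂ (at-rel a (k ∸ suc (a ℕ.+ c)) (in-row' {a} {c} p)))

      z-height : ∀ j i → j ℕ.+ i ℕ.≤ k → z t j i ≡ suc i ℕ.+ height t j (k ∸ (j ℕ.+ i))
      z-height j i p rewrite trans (cong (k ∸_) (trans (cong (λ x → j ℕ.+ (k ∸ x)) (ℕP.+-comm j i)) (third {i} {j} (subst (ℕ._≤ k) (ℕP.+-comm j i) p)))) (ℕP.m∸[m∸n]≡n (ℕP.m+n≤o⇒n≤o j p)) =
        sym (ℕP.m+[n∸m]≡n (z-≥ j i p))

    height-injective : ∀ t u → Array t → Array u → height t ≈ₕ height u → t ≡ u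
    height-injective t u ht hu e = at-ext 0 (suc k) t u λ { j i (s≤s p) → trans (z-height t ht j i p)
      (trans (cong (suc i ℕ.+_) (e j (k ∸ (j ℕ.+ i)) (in-row {j} {i} p))) (sym (z-height u hu j i p))) }

    module _ (Y : Height) (isH : IsHeight rgyb Y) where
      array : ℕ → ℕ → ℕ
      array j i = suc i ℕ.+ Y j (k ∸ (j ℕ.+ i))

      private
        small : ∀ j i → j ℕ.+ i ℕ.< k → j ℕ.+ (k ∸ suc (j ℕ.+ i)) ℕ.< k
        small j i p = subst (ℕ._≤ k) (trans (cong (j ℕ.+_) (∸-suc' p)) (ℕP.+-suc j _)) (in-row {j} {i} (ℕP.<⇒≤ p))

        array-≤ : ∀ j i → j ℕ.+ i ℕ.≤ k → Y j (k ∸ (j ℕ.+ i)) ℕ.≤ suc i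
        array-≤ j i p = ℕP.≤-trans (proj₁ isH j (k ∸ (j ℕ.+ i)) (in-row {j} {i} p))
          (ℕP.≤-reflexive (trans (cong (suc k ∸_) (trans (cong (λ x → j ℕ.+ (k ∸ x)) (ℕP.+-comm j i)) (third {i} {j} (subst (ℕ._≤ k) (ℕP.+-comm j i) p))))
            (trans (ℕP.+-∸-assoc 1 (ℕP.m∸n≤m k i)) (cong suc (ℕP.m∸[m∸n]≡n (ℕP.m+n≤o⇒n≤o j p))))))

        array-row : ∀ j i → j ℕ.+ i ℕ.< k → array j i ℕ.< array j (suc i)
        array-row j i p = s≤s (s≤s (ℕP.+-monoʳ-≤ i (subst₂ (λ x y → Y j x ℕ.≤ Y j (k ∸ y)) (sym (∸-suc' p)) (sym (ℕP.+-suc j i)) (proj₂ isH yellow refl j _ (small j i p)))))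

        near : ∀ {x y} → x ℕ.≤ y → y ℕ.≤ suc x → (y ≡ x) ⊎ (y ≡ suc x)
        near p q with ℕP.m≤n⇒m<n∨m≡n p
        ... | inj₁ x<y = inj₂ (ℕP.≤-antisym q x<y)
        ... | inj₂ refl = inj₁ refl

        array-head : ∀ j → j ℕ.≤ k → Step (array j 0) 0
        array-head j p with near {0} z≤n (array-≤ j 0 (subst (ℕ._≤ k) (sym (ℕP.+-identityʳ j)) p))
        ... | inj₁ e = inj₁ (cong suc e)
        ... | inj₂ e = inj₂ (cong suc e)

        array-step : ∀ j i → j ℕ.+ i ℕ.< k → Step (array j (suc i)) (array (suc j) i)
        array-step j i p rewrite ℕP.+-suc j i with near (proj₂ isH red refl j _ (small j i p)) (proj₂ isH blue refl j _ (small j i p))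
        ... | inj₁ e = inj₁ (cong (λ x → suc (suc (i ℕ.+ x))) e)
        ... | inj₂ e = inj₂ (cong (λ x → suc (suc x)) (trans (cong (i ℕ.+_) e) (ℕP.+-suc i _)))

      rows-of : Rows ℕ (suc k)
      rows-of = table₂ (suc k) array

      rows-array : 2 ℕ.* suc k ℕ.< B → Array rows-of
      rows-array hB = (Inc-table (suc k) 0 (array 0) (λ _ → z≤n) (λ { i (s≤s p) → array-row 0 i p }) ,
          All-table (suc k) (array 0) (λ { i (s≤s p) → ℕP.≤-trans (s≤s (ℕP.+-mono-≤ (s≤s p) (ℕP.≤-trans (array-≤ 0 i p) (s≤s p))))
            (ℕP.≤-trans (ℕP.≤-reflexive (cong (λ x → suc (suc k ℕ.+ x)) (sym (ℕP.+-identityʳ (suc k))))) hB) })) ,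
        chain-intro k array array-head array-step array-row

      height-rows : height rows-of ≈ₕ Y
      height-rows a c p = trans (cong (_∸ suc (k ∸ (a ℕ.+ c))) (at-table 0 (suc k) array a (k ∸ (a ℕ.+ c)) (s≤s (in-row {a} {c} p))))
        (trans (ℕP.m+n∸m≡n (suc (k ∸ (a ℕ.+ c))) _) (cong (Y a) (trans (cong (k ∸_) (trans (cong (λ x → a ℕ.+ (k ∸ x)) (ℕP.+-comm a c)) (third {c} {a} (subst (ℕ._≤ k) (ℕP.+-comm a c) p)))) (ℕP.m∸[m∸n]≡n (ℕP.m+n≤o⇒n≤o a p)))))

    ideals : 2 ℕ.* suc k ℕ.< B → NumIdeals ord rgyb (length arrays)
    ideals hB = height-count {rgyb} refl (count-map {_~_ = _≡_} {_≈ₕ_} (λ e e' a c p → trans (e a c p) (e' a c p)) height (λ {t} → height-isHeight t)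
      (λ {t} {u} → height-injective t u) (λ { refl a c p → refl }) (λ {Y} isH → rows-of Y isH , rows-array Y isH hB , height-rows Y isH) (enum-count arrays-enum))

module Products where
  open import Defs using (prodFT; numA; denA; numB; denB)
  open import Data.List.Base using (map; applyUpTo)
  import Data.List.Properties as LP
  open import Data.Nat.ListAction using (product)
  open import Data.Nat.Base using (_∸_; _!; _+_; _*_; _≤_; _<_)

  ∏ : ℕ → (ℕ → ℕ) → ℕ
  ∏ zero f = 1
  ∏ (suc n) f = ∏ n f * f n

  ∏-cong : ∀ n {f g : ℕ → ℕ} → (∀ i → i < n → f i ≡ g i) → ∏ n f ≡ ∏ n g
  ∏-cong zero e = refl
  ∏-cong (suc n) e = cong₂ _*_ (∏-cong n (λ i p → e i (ℕP.m≤n⇒m≤1+n p))) (e n ℕP.≤-refl)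

  ∏-head : ∀ n f → ∏ (suc n) f ≡ f 0 * ∏ n (f ∘ suc)
  ∏-head zero f = ℕP.*-comm 1 (f 0)
  ∏-head (suc n) f = trans (cong (_* f (suc n)) (∏-head n f)) (ℕP.*-assoc (f 0) (∏ n (f ∘ suc)) (f (suc n)))

  interchange : ∀ a b c d → a * b * (c * d) ≡ a * c * (b * d)
  interchange = solveℕ

  ∏-* : ∀ n f g → ∏ n (λ i → f i * g i) ≡ ∏ n f * ∏ n g
  ∏-* zero f g = refl
  ∏-* (suc n) f g = trans (cong (_* (f n * g n)) (∏-* n f g)) (interchange (∏ n f) (∏ n g) (f n) (g n))

  ∏-product : ∀ n f → product (applyUpTo f n) ≡ ∏ n f
  ∏-product zero f = refl
  ∏-product (suc n) f = trans (cong (f 0 *_) (∏-product n (f ∘ suc))) (sym (∏-head n f))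

  ∏[_,_] : ℕ → ℕ → (ℕ → ℕ) → ℕ
  ∏[ lo , hi ] f = ∏ (suc hi ∸ lo) (λ i → f (lo + i))

  prodFT-∏ : ∀ lo hi f → prodFT lo hi f ≡ ∏[ lo , hi ] f
  prodFT-∏ lo hi f = trans (cong product (trans (cong (map f) (LP.map-upTo (lo +_) (suc hi ∸ lo))) (LP.map-applyUpTo (lo +_) f (suc hi ∸ lo)))) (∏-product (suc hi ∸ lo) (λ i → f (lo + i)))

  ∏[]-snoc : ∀ lo hi f → lo ≤ suc hi → ∏[ lo , suc hi ] f ≡ ∏[ lo , hi ] f * f (suc hi)
  ∏[]-snoc lo hi f p rewrite ℕP.+-∸-assoc 1 p = cong (λ x → ∏[ lo , hi ] f * f x) (ℕP.m+[n∸m]≡n p)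

  ∏[]-empty : ∀ hi f → ∏[ suc hi , hi ] f ≡ 1
  ∏[]-empty hi f = cong (λ x → ∏ x (λ i → f (suc hi + i))) (ℕP.n∸n≡0 hi)

  ∏[]-cong : ∀ lo hi {f g : ℕ → ℕ} → (∀ i → lo ≤ i → i ≤ hi → f i ≡ g i) → ∏[ lo , hi ] f ≡ ∏[ lo , hi ] g
  ∏[]-cong lo hi e = ∏-cong (suc hi ∸ lo) λ i p → e (lo + i) (ℕP.m≤m+n lo i)
    (ℕP.≤-pred (ℕP.≤-trans (ℕP.≤-reflexive (sym (ℕP.+-suc lo i))) (ℕP.≤-trans (ℕP.+-monoʳ-≤ lo p) (ℕP.≤-reflexive (ℕP.m+[n∸m]≡n {lo} (ℕP.<⇒≤ (ℕP.m∸n≢0⇒n<m (λ z → ℕP.n≮0 (subst (i <_) z p)))))))))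

  ∏[]-* : ∀ lo hi f g → ∏[ lo , hi ] (λ i → f i * g i) ≡ ∏[ lo , hi ] f * ∏[ lo , hi ] g
  ∏[]-* lo hi f g = ∏-* (suc hi ∸ lo) (λ i → f (lo + i)) (λ i → g (lo + i))

  ∏³ : ℕ → (ℕ → ℕ) → ℕ
  ∏³ m f = ∏[ 1 , m ] λ i → ∏[ i , m ] λ j → ∏[ j , m ] λ k → f (i + j + k)

  layer : ℕ → (ℕ → ℕ) → ℕ
  layer m f = ∏[ 1 , m ] λ i → ∏[ i , m ] λ j → f (i + j + m)

  ∏³-suc : ∀ m f → ∏³ (suc m) f ≡ ∏³ m f * layer (suc m) f
  ∏³-suc m f = trans (∏[]-cong 1 (suc m) (λ i _ i≤ → trans (∏[]-cong i (suc m) (λ j _ j≤ → ∏[]-snoc j m (λ k → f (i + j + k)) j≤))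
      (∏[]-* i (suc m) (λ j → ∏[ j , m ] λ k → f (i + j + k)) (λ j → f (i + j + suc m)))))
    (trans (∏[]-* 1 (suc m) (λ i → ∏[ i , suc m ] λ j → ∏[ j , m ] λ k → f (i + j + k)) (λ i → ∏[ i , suc m ] λ j → f (i + j + suc m)))
      (cong (_* layer (suc m) f) (trans (∏[]-cong 1 (suc m) (λ i _ i≤ → drop i i≤)) last)))
    where
      inner : ℕ → ℕ
      inner i = ∏[ i , m ] λ j → ∏[ j , m ] λ k → f (i + j + k)
      drop : ∀ i → i ≤ suc m → (∏[ i , suc m ] λ j → ∏[ j , m ] λ k → f (i + j + k)) ≡ inner i
      drop i p = trans (∏[]-snoc i m (λ j → ∏[ j , m ] λ k → f (i + j + k)) p) (trans (cong (inner i *_) (∏[]-empty m (λ k → f (i + suc m + k)))) (ℕP.*-identityʳ (inner i)))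
      last : ∏[ 1 , suc m ] inner ≡ ∏[ 1 , m ] inner
      last = trans (∏[]-snoc 1 m inner (s≤s z≤n)) (trans (cong (∏[ 1 , m ] inner *_) (∏[]-empty m (λ j → ∏[ j , m ] λ k → f (suc m + j + k)))) (ℕP.*-identityʳ (∏[ 1 , m ] inner)))

  telescope : ∀ t (g : ℕ → ℕ) → ∏ t (λ b → g (suc (suc b))) * (g 0 * g 1) ≡ ∏ t g * (g t * g (suc t))
  telescope zero g = refl
  telescope (suc t) g = trans (lem₁ (∏ t (λ b → g (suc (suc b)))) (g (suc (suc t))) (g 0 * g 1))
    (trans (cong (_* g (suc (suc t))) (telescope t g)) (lem₂ (∏ t g) (g t) (g (suc t)) (g (suc (suc t)))))
    where
      lem₁ : ∀ a b c → a * b * c ≡ a * c * b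
      lem₁ = solveℕ
      lem₂ : ∀ p a b c → p * (a * b) * c ≡ p * a * (b * c)
      lem₂ = solveℕ

  rising : ∀ t x → ∏ t (λ a → suc (x + a)) * x ! ≡ (x + t) !
  rising zero x = trans (ℕP.*-identityˡ (x !)) (cong _! (sym (ℕP.+-identityʳ x)))
  rising (suc t) x = trans (lem (∏ t (λ a → suc (x + a))) (suc (x + t)) (x !)) (trans (cong (suc (x + t) *_) (rising t x)) (cong _! (sym (ℕP.+-suc x t))))
    where lem : ∀ a b c → a * b * c ≡ b * (a * c)
          lem = solveℕ

  rising₂ : ∀ t x → ∏ t (λ a → suc (x + 2 * a) * suc (suc (x + 2 * a))) * x ! ≡ (x + 2 * t) !
  rising₂ zero x = trans (ℕP.*-identityˡ (x !)) (cong _! (sym (ℕP.+-identityʳ x)))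
  rising₂ (suc t) x = trans (lem (∏ t (λ a → suc (x + 2 * a) * suc (suc (x + 2 * a)))) (suc (x + 2 * t)) (suc (suc (x + 2 * t))) (x !))
      (trans (cong (λ y → suc (suc (x + 2 * t)) * (suc (x + 2 * t) * y)) (rising₂ t x)) (cong _! (lem' x t)))
    where
      lem : ∀ a b c d → a * (b * c) * d ≡ c * (b * (a * d))
      lem = solveℕ
      lem' : ∀ x t → suc (suc (x + 2 * t)) ≡ x + 2 * suc t
      lem' = solveℕ

  layer-ratio : ∀ m → layer m (_+ 1) * ((2 * m + 1) ! * (2 * m) !) ≡ layer m (_∸ 1) * ((3 * m + 1) ! * m !)
  layer-ratio m = ℕP.*-cancelʳ-≡ _ _ ((m + 2 * m) !) {{ℕP._!≢0 (m + 2 * m)}}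
    (trans (cong (λ x → L₊ * ((2 * m + 1) ! * (2 * m) !) * x) (sym (rising₂ m m)))
    (trans (lem₁ L₊ ((2 * m + 1) !) ((2 * m) !) U (m !))
    (trans (cong (λ x → x * ((2 * m + 1) ! * ((2 * m) ! * m !))) (trans main (cong (L₋ *_) (∏-* m (λ a → suc (2 * m + a)) (λ a → suc (2 * m + 1 + a))))))
    (trans (lem₂ L₋ V W ((2 * m + 1) !) ((2 * m) !) (m !))
    (trans (cong₂ (λ x y → L₋ * (x * m !) * y) (rising m (2 * m + 1)) (rising m (2 * m)))
      (cong₂ (λ x y → L₋ * (x ! * m !) * y !) (lem₃ m) (lem₄ m)))))))
    where
      L₊ L₋ U V W : ℕ
      L₊ = layer m (_+ 1)
      L₋ = layer m (_∸ 1)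
      U = ∏ m (λ a → suc (m + 2 * a) * suc (suc (m + 2 * a)))
      V = ∏ m (λ a → suc (2 * m + a))
      W = ∏ m (λ a → suc (2 * m + 1 + a))
      lem₁ : ∀ l a b u c → l * (a * b) * (u * c) ≡ l * u * (a * (b * c))
      lem₁ = solveℕ
      lem₂ : ∀ l v w a b c → l * (v * w) * (a * (b * c)) ≡ l * (w * a * c) * (v * b)
      lem₂ = solveℕ
      lem₃ : ∀ m → 2 * m + 1 + m ≡ 3 * m + 1
      lem₃ = solveℕ
      lem₄ : ∀ m → 2 * m + m ≡ m + 2 * m
      lem₄ = solveℕ
      row : ∀ a → a < m → (∏[ suc a , m ] λ j → suc a + j + m + 1) * (suc (m + 2 * a) * suc (suc (m + 2 * a))) ≡
        (∏[ suc a , m ] λ j → suc a + j + m ∸ 1) * (suc (2 * m + a) * suc (2 * m + 1 + a))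
      row a p = trans (cong₂ _*_ (∏-cong t (λ b _ → l₁ a b m)) (cong₂ _*_ (l₂ a m) (l₃ a m)))
        (trans (telescope t g) (cong (∏ t g *_) (cong₂ _*_ (trans (l₄ a t m) (trans (cong (λ x → suc (a + x + m)) at) (l₅ a m))) (trans (l₆ a t m) (trans (cong (λ x → suc (suc (a + x + m))) at) (l₇ a m))))))
        where
          t = m ∸ a
          at : a + t ≡ m
          at = ℕP.m+[n∸m]≡n (ℕP.<⇒≤ p)
          g : ℕ → ℕ
          g b = a + (suc a + b) + m
          l₁ : ∀ a b m → suc a + (suc a + b) + m + 1 ≡ a + (suc a + suc (suc b)) + m
          l₁ = solveℕ
          l₂ : ∀ a m → suc (m + 2 * a) ≡ a + (suc a + 0) + m
          l₂ = solveℕ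
          l₃ : ∀ a m → suc (suc (m + 2 * a)) ≡ a + (suc a + 1) + m
          l₃ = solveℕ
          l₄ : ∀ a t m → a + (suc a + t) + m ≡ suc (a + (a + t) + m)
          l₄ = solveℕ
          l₅ : ∀ a m → suc (a + m + m) ≡ suc (2 * m + a)
          l₅ = solveℕ
          l₆ : ∀ a t m → a + (suc a + suc t) + m ≡ suc (suc (a + (a + t) + m))
          l₆ = solveℕ
          l₇ : ∀ a m → suc (suc (a + m + m)) ≡ suc (2 * m + 1 + a)
          l₇ = solveℕ
      main : L₊ * U ≡ L₋ * ∏ m (λ a → suc (2 * m + a) * suc (2 * m + 1 + a))
      main = trans (sym (∏-* m _ _)) (trans (∏-cong m row) (∏-* m _ _))

  module Closed (X : ℕ → ℕ) (K : ℕ) (X-0 : X 0 ≡ 1)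
    (X-suc : ∀ k → k < K → X (suc k) * (2 * suc k + 1) ! * (2 * suc k) ! ≡ X k * (3 * suc k + 1) ! * (suc k) !) where

    nums dens : ℕ → ℕ
    nums m = ∏ m (λ j → (3 * j + 1) !)
    dens m = ∏ m (λ j → (m + j) !)

    dens-suc : ∀ m → dens (suc m) * m ! ≡ dens m * (2 * m) ! * (2 * m + 1) !
    dens-suc m = trans (ℕP.*-comm (dens (suc m)) (m !)) (trans (cong₂ _*_ (cong _! (sym (ℕP.+-identityʳ m))) (∏-cong (suc m) (λ j _ → cong _! (sym (ℕP.+-suc m j)))))
      (trans (sym (∏-head (suc m) (λ j → (m + j) !))) (cong₂ (λ x y → dens m * x ! * y !) (l₁ m) (l₂ m))))
      where
        l₁ : ∀ m → m + m ≡ 2 * m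
        l₁ = solveℕ
        l₂ : ∀ m → m + suc m ≡ 2 * m + 1
        l₂ = solveℕ

    X-nums : ∀ m → m ≤ K → X m * dens (suc m) ≡ nums (suc m)
    X-nums zero _ = cong (_* 1) X-0
    X-nums (suc k) p = ℕP.*-cancelʳ-≡ _ _ (m !) {{ℕP._!≢0 m}}
      (trans (ℕP.*-assoc (X m) (dens (suc m)) (m !)) (trans (cong (X m *_) (dens-suc m))
      (trans (l₁ (X m) (dens m) ((2 * m) !) ((2 * m + 1) !)) (trans (cong (_* dens m) (X-suc k p))
      (trans (l₂ (X k) ((3 * m + 1) !) (m !) (dens m)) (cong (λ x → x * (3 * m + 1) ! * m !) (X-nums k (ℕP.<⇒≤ p))))))))
      where
        m = suc k
        l₁ : ∀ x d a b → x * (d * a * b) ≡ x * b * a * d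
        l₁ = solveℕ
        l₂ : ∀ x a b d → x * a * b * d ≡ x * d * a * b
        l₂ = solveℕ

    X-∏³ : ∀ m → m ≤ K → X m * ∏³ m (_∸ 1) ≡ ∏³ m (_+ 1)
    X-∏³ zero _ = cong (_* 1) X-0
    X-∏³ (suc k) p = ℕP.*-cancelʳ-≡ _ _ ((2 * m + 1) ! * (2 * m) !) {{ℕP.m*n≢0 _ _ {{ℕP._!≢0 (2 * m + 1)}} {{ℕP._!≢0 (2 * m)}}}}
      (trans (cong (λ x → X m * x * ((2 * m + 1) ! * (2 * m) !)) (∏³-suc k (_∸ 1)))
      (trans (l₁ (X m) (∏³ k (_∸ 1)) (layer m (_∸ 1)) ((2 * m + 1) !) ((2 * m) !)) (trans (cong (_* (∏³ k (_∸ 1) * layer m (_∸ 1))) (X-suc k p))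
      (trans (l₂ (X k) ((3 * m + 1) !) (m !) (∏³ k (_∸ 1)) (layer m (_∸ 1))) (trans (cong₂ _*_ (X-∏³ k (ℕP.<⇒≤ p)) (sym (layer-ratio m)))
      (trans (l₃ (∏³ k (_+ 1)) (layer m (_+ 1)) ((2 * m + 1) ! * (2 * m) !)) (cong (_* ((2 * m + 1) ! * (2 * m) !)) (sym (∏³-suc k (_+ 1))))))))))
      where
        m = suc k
        l₁ : ∀ x p l a b → x * (p * l) * (a * b) ≡ x * a * b * (p * l)
        l₁ = solveℕ
        l₂ : ∀ x a b p l → x * a * b * (p * l) ≡ (x * p) * (l * (a * b))
        l₂ = solveℕ
        l₃ : ∀ p l a → p * (l * a) ≡ p * l * a
        l₃ = solveℕ

    ∏³-prodFT : ∀ m f → (prodFT 1 m λ i → prodFT i m λ j → prodFT j m λ k → f (i + j + k)) ≡ ∏³ m f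
    ∏³-prodFT m f = trans (prodFT-∏ 1 m (λ i → prodFT i m λ j → prodFT j m λ k → f (i + j + k)))
      (∏[]-cong 1 m {g = λ i → ∏[ i , m ] λ j → ∏[ j , m ] λ k → f (i + j + k)} (λ i _ _ → trans (prodFT-∏ i m (λ j → prodFT j m λ k → f (i + j + k)))
        (∏[]-cong i m {g = λ j → ∏[ j , m ] λ k → f (i + j + k)} (λ j _ _ → prodFT-∏ j m (λ k → f (i + j + k))))))

    X-numA : ∀ m → m ≤ K → X m * denA (suc m) ≡ numA (suc m)
    X-numA m p = trans (cong (X m *_) (prodFT-∏ 0 m (λ j → (suc m + j) !))) (trans (X-nums m p) (sym (prodFT-∏ 0 m (λ j → (3 * j + 1) !))))

    X-numB : ∀ m → m ≤ K → X m * denB (suc m) ≡ numB (suc m)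
    X-numB m p = trans (cong (X m *_) (∏³-prodFT m (_∸ 1))) (trans (X-∏³ m p) (sym (∏³-prodFT m (_+ 1))))

module Formula where
  open import Defs renaming (r to red; g to green; y to yellow; b to blue; o to orange; s to silver)
  open ArrayRatio using (module PathCount)
  open Orthogonality using (Φ-P0)
  open Symmetries
  open TriangleIdeals using (module ASM)
  open RefinedCounts using (asm; asm-ratio; pos-*-*)
  open ArrayIdeals using (module TSSCPP)
  open Products using (module Closed)
  open import Data.Bool.Base using (Bool; true; false; if_then_else_)
  open import Data.List.Base using (List; []; _∷_; length; map)
  open import Data.Nat.ListAction using (sum)
  open import Data.Integer.Base as ℤ using (ℤ; +_)
  open import Data.Nat.Base using (_!)

  tsscpp : ℕ → ℕ → ℕ
  tsscpp B' zero = 1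
  tsscpp B' (suc k) = length (TSSCPP.arrays k B')

  tsscpp-T : ∀ B' m → + tsscpp B' m ≡ PathCount.T B' (suc m)
  tsscpp-T B' zero = sym (Φ-P0 0 B')
  tsscpp-T B' (suc k) = TSSCPP.arrays-length k B'

  tsscpp-ratio : ∀ B' k → let m = suc k in 2 ℕ.* suc (suc m) ℕ.< suc B' → tsscpp B' m ℕ.* (2 ℕ.* m ℕ.+ 1) ! ℕ.* (2 ℕ.* m) ! ≡ tsscpp B' k ℕ.* (3 ℕ.* m ℕ.+ 1) ! ℕ.* m !
  tsscpp-ratio B' k h = ℤP.+-injective (trans (pos-*-* (tsscpp B' m) ((2 ℕ.* m ℕ.+ 1) !) ((2 ℕ.* m) !))
    (trans (cong (λ x → x ℤ.* + ((2 ℕ.* m ℕ.+ 1) !) ℤ.* + ((2 ℕ.* m) !)) (tsscpp-T B' m))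
    (trans (PathCount.ratio B' m h)
    (trans (cong (λ x → x ℤ.* + ((3 ℕ.* m ℕ.+ 1) !) ℤ.* + (m !)) (sym (tsscpp-T B' k))) (sym (pos-*-* (tsscpp B' k) ((3 ℕ.* m ℕ.+ 1) !) (m !)))))))
    where m = suc k

  module Admissibles (k : ℕ) where
    open Maps k using (n; to-rgyo; to-rgys; to-rgbs; to-gybs; to-gbos; same-colors)

    Formula : ColorSet → Set
    Formula S = Σ ℕ λ N → NumIdeals n S N × (N ℕ.* denA n ≡ numA n) × (N ℕ.* denB n ≡ numB n)

    formula-map : ∀ S S' → (∀ {N} → NumIdeals n S N → NumIdeals n S' N) → Formula S → Formula S'
    formula-map S S' f (N , c , e) = N , f c , e

    formula-gybo : Formula gybo
    formula-gybo = asm (suc k) , ASM.ideals k , X-numA (suc k) ℕP.≤-refl , X-numB (suc k) ℕP.≤-refl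
      where open Closed asm (suc k) refl (λ j _ → asm-ratio j)

    formula-rgyb : Formula rgyb
    formula-rgyb = tsscpp B' (suc k) , TSSCPP.ideals k B' large , X-numA (suc k) ℕP.≤-refl , X-numB (suc k) ℕP.≤-refl
      where
        B' : ℕ
        B' = 2 ℕ.* suc (suc (suc k))
        large : 2 ℕ.* suc k ℕ.< suc B'
        large = s≤s (ℕP.*-monoʳ-≤ 2 (s≤s (ℕP.≤-trans (ℕP.n≤1+n k) (ℕP.n≤1+n (suc k)))))
        open Closed (tsscpp B') (suc k) refl (λ j p → tsscpp-ratio B' j (s≤s (ℕP.*-monoʳ-≤ 2 (s≤s (s≤s p)))))

    formula-rgbs : Formula rgbs
    formula-rgbs = formula-map rgyb rgbs to-rgbs formula-rgyb

    formula-gybs : Formula gybs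
    formula-gybs = formula-map rgbs gybs to-gybs formula-rgbs

    colors : Bool → Bool → Bool → Bool → Bool → Bool → ColorSet
    colors r g y b o s red = r
    colors r g y b o s green = g
    colors r g y b o s yellow = y
    colors r g y b o s blue = b
    colors r g y b o s orange = o
    colors r g y b o s silver = s

    few : ∀ (bs : List Bool) {n} → length bs ℕ.< n → sum (map (λ x → if x then 1 else 0) bs) ≢ n
    few bs p refl = ℕP.<⇒≱ p (bound bs)
      where
        bound : ∀ bs → sum (map (λ x → if x then 1 else 0) bs) ℕ.≤ length bs
        bound [] = z≤n
        bound (true ∷ bs) = s≤s (bound bs)
        bound (false ∷ bs) = ℕP.m≤n⇒m≤1+n (bound bs)

    via : ∀ {S} S' → S red ≡ S' red → S green ≡ S' green → S yellow ≡ S' yellow → S blue ≡ S' blue → S orange ≡ S' orange → S silver ≡ S' silver → Formula S → Formula S'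
    via {S} S' e₁ e₂ e₃ e₄ e₅ e₆ = formula-map S S' (same-colors {S} {S'} λ { red → e₁ ; green → e₂ ; yellow → e₃ ; blue → e₄ ; orange → e₅ ; silver → e₆ })

    formula : ∀ r g y b o s → Admissible (colors r g y b o s) → size (colors r g y b o s) ≡ 4 → Formula (colors r g y b o s)
    formula true true true true false false _ refl = via _ refl refl refl refl refl refl formula-rgyb
    formula true true true false true false _ refl = via _ refl refl refl refl refl refl (formula-map rgyb rgyo to-rgyo formula-rgyb)
    formula true true true false false true _ refl = via _ refl refl refl refl refl refl (formula-map rgyb rgys to-rgys formula-rgyb)
    formula true true false true false true _ refl = via _ refl refl refl refl refl refl formula-rgbs
    formula false true true true true false _ refl = via _ refl refl refl refl refl refl formula-gybo
    formula false true true true false true _ refl = via _ refl refl refl refl refl refl formula-gybs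
    formula false true false true true true _ refl = via _ refl refl refl refl refl refl (formula-map gybs gbos to-gbos formula-gybs)
    formula true true false true true false (_ , _ , _ , h) refl = contradiction (h refl refl) λ ()
    formula true true false false true true (_ , _ , _ , h) refl = contradiction (h refl refl) λ ()
    formula false true true false true true (_ , h , _) refl = contradiction (h refl refl) λ ()
    formula true false true true true false (h , _) refl = contradiction (h refl refl) λ ()
    formula true false true true false true (h , _) refl = contradiction (h refl refl) λ ()
    formula true false true false true true (_ , h , _) refl = contradiction (h refl refl) λ ()
    formula true false false true true true (h , _) refl = contradiction (h refl refl) λ ()
    formula false false true true true true (_ , _ , h , _) refl = contradiction (h refl refl) λ ()
    formula false false false b o s _ e = contradiction e (few (b ∷ o ∷ s ∷ []) (s≤s (s≤s (s≤s (s≤s z≤n)))))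
    formula false false true false o s _ e = contradiction (ℕP.suc-injective e) (few (o ∷ s ∷ []) (s≤s (s≤s (s≤s z≤n))))
    formula false false true true false s _ e = contradiction (ℕP.suc-injective (ℕP.suc-injective e)) (few (s ∷ []) (s≤s (s≤s z≤n)))
    formula false true false false o s _ e = contradiction (ℕP.suc-injective e) (few (o ∷ s ∷ []) (s≤s (s≤s (s≤s z≤n))))
    formula false true false true false s _ e = contradiction (ℕP.suc-injective (ℕP.suc-injective e)) (few (s ∷ []) (s≤s (s≤s z≤n)))
    formula false true true false false s _ e = contradiction (ℕP.suc-injective (ℕP.suc-injective e)) (few (s ∷ []) (s≤s (s≤s z≤n)))
    formula true false false false o s _ e = contradiction (ℕP.suc-injective e) (few (o ∷ s ∷ []) (s≤s (s≤s (s≤s z≤n))))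
    formula true false false true false s _ e = contradiction (ℕP.suc-injective (ℕP.suc-injective e)) (few (s ∷ []) (s≤s (s≤s z≤n)))
    formula true false true false false s _ e = contradiction (ℕP.suc-injective (ℕP.suc-injective e)) (few (s ∷ []) (s≤s (s≤s z≤n)))
    formula true true false false false s _ e = contradiction (ℕP.suc-injective (ℕP.suc-injective e)) (few (s ∷ []) (s≤s (s≤s z≤n)))

    formula-admissible : ∀ S → Admissible S → size S ≡ 4 → Formula S
    formula-admissible S adm sz = via S refl refl refl refl refl refl (formula (S red) (S green) (S yellow) (S blue) (S orange) (S silver) adm sz)

open import Defs
open import Data.Nat using (_≤_; _*_)

theorem13 : (n : ℕ) → 2 ≤ n → (S : ColorSet) → Admissible S → size S ≡ 4 →
    Σ ℕ (λ N → NumIdeals n S N × (N * denA n ≡ numA n) × (N * denB n ≡ numB n))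
theorem13 (suc (suc k)) (s≤s (s≤s z≤n)) = Formula.Admissibles.formula-admissible k
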